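{- Let $n,r\ge1$ and $0\le k\le n$ be integers. There is an isomorphism of $(\mathbb{Z}_r\wr\mathfrak{S}_n)$-modules $$(SR_{n,r})_{*,n-k}\cong\mathbb{C}[\widetilde{\mathcal{OP}}^{(k)}_{n,r}]\otimes\det ,$$ where $(SR_{n,r})_{*,n-k}=\bigoplus_{i\ge0}(SR_{n,r})_{i,n-k}$ is the fermionic-degree $n-k$ part of $SR_{n,r}$ and $\widetilde{\mathcal{OP}}^{(k)}_{n,r}$ is the set of $r$-ified ordered set partitions of $[n]$ with exactly $k$ nonzero blocks.
   Context: Write $[n]=\{1,\dots,n\}$ and $\zeta=\exp(2\pi i/r)$. $\mathbb{Z}_r\wr\mathfrak{S}_n\subseteq GL_n(\mathbb{C})$ is the group of $n\times n$ monomial matrices (exactly one nonzero entry in each row and column) whose nonzero entries are $r$-th roots of unity; $\det$ is the one-dimensional module given by the determinant of matrices. $\Omega=\mathbb{C}[x_1,\dots,x_n]\otimes\wedge\{\theta_1,\dots,\theta_n\}$ is the unital associative $\mathbb{C}$-algebra generated by $x_i,\theta_i$ with relations $x_ix_j=x_jx_i$, $x_i\theta_j=\theta_jx_i$, $\theta_i\theta_j=-\theta_j\theta_i$, bigraded with $x_i$ in degree $(1,0)$ and $\theta_i$ in degree $(0,1)$ (the second is the fermionic degree). The group acts on $\Omega$ by algebra automorphisms: $\mathrm{diag}(\zeta^{c_1},\dots,\zeta^{c_n})$ sends $x_i\mapsto\zeta^{ -c_i}x_i$, $\theta_i\mapsto\zeta^{ -c_i}\theta_i$, and a permutation matrix $w$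 sends $x_i\mapsto x_{w(i)}$, $\theta_i\mapsto\theta_{w(i)}$. $SI_{n,r}\subseteq\Omega$ is the two-sided ideal generated by all invariants with vanishing constant term, and $SR_{n,r}:=\Omega/SI_{n,r}$, a bigraded module. An $r$-ified ordered set partition of $[n]$ is a pair $\sigma=(Z,\mathcal{B})$ where $Z\subseteq[n]$ (the zero block, possibly empty) has each element decorated by a color in $\{0,\dots,r-2\}$, and $\mathcal{B}=(B_1\mid\cdots\mid B_k)$ is an ordered set partition of $[n]-Z$ into nonempty blocks (the nonzero blocks), each element of which is decorated by a color in $\{0,\dots,r-1\}$. (For $r=1$ the zero block must be empty.) The vector space $\mathbb{C}[\widetilde{\mathcal{OP}}^{(k)}_{n,r}]$ with basis $\widetilde{\mathcal{OP}}^{(k)}_{n,r}$ carries the following $(\mathbb{Z}_r\wr\mathfrak{S}_n)$-action. A permutation $w\in\mathfrak{S}_n$ replaces each number $a$ by $w(a)$ while keeping colors (and blocks) in place. A diagonal element $g=\mathrm{diag}(\zeta^{c_1},\dots,\zeta^{c_n})$ acts on $\sigma$ by changing the color $\kappa$ of each $i$ in a nonzero block to $\kappa+c_i\pmod r$, leaving the colors of zero block elements unchanged, and multiplying the result by the scalar $\prod_{i\in Z}\zeta^{\kappa_ic_i}$, where $\kappa_i$ is the color of $i\in Z$. -}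

module Defs where

open import Algebra.Apartness using (HeytingField; HeytingCommutativeRing)
open import Algebra.Bundles using (CommutativeRing; Ring)
open import Algebra.Module.Bundles using (LeftModule)
open import Algebra.Module.Morphism.Structures using (module LeftModuleMorphisms)
import Algebra.Module.Construct.TensorUnit as TensorUnit
import Algebra.Module.Morphism.Construct.Composition as Composition
import Algebra.Definitions.RawMonoid as RawMonoidDefinitions
import Algebra.Properties.Ring as RingProperties
import Algebra.Properties.Semiring.Exp as Exp
open import Data.Fin.Base using (Fin; zero; suc; toℕ; punchIn)
open import Data.Fin.Permutation using (Permutation′; _⟨$⟩ʳ_; _⟨$⟩ˡ_; inverseˡ)
open import Data.Fin.Properties using (_≟_)
open import Data.Nat.Base as ℕ using (ℕ; zero; suc; NonZero)
open import Data.Nat.DivMod using (_mod_)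
open import Data.Product.Base using (Σ; ∃₂; _×_; _,_; proj₁)
open import Function.Base using (_∘_)
open import Level using (Level; _⊔_; 0ℓ) renaming (suc to lsuc)
open import Relation.Binary.Bundles using (Setoid)
open import Relation.Binary.Core using (Rel)
open import Relation.Binary.PropositionalEquality as ≡ using (_≡_; _≗_)
import Relation.Binary.Reasoning.Setoid as SetoidReasoning
open import Relation.Nullary.Decidable.Core using (does)
open import Data.Bool.Base using (if_then_else_)

-- There is no library type of complex numbers.  The ground field is an
-- arbitrary field of characteristic zero containing a primitive r-th
-- root of unity ζ; ℂ with ζ = exp(2πi/r) is an instance.

module _ {c ℓ₁ ℓ₂ : Level} (K : HeytingField c ℓ₁ ℓ₂) where

  open HeytingField K

  commutativeRing : CommutativeRing c ℓ₁
  commutativeRing = HeytingCommutativeRing.commutativeRing heytingCommutativeRing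

  private module R = CommutativeRing commutativeRing

  open Exp R.semiring using (_^_)

  CharacteristicZero : Set ℓ₂
  CharacteristicZero = ∀ m → (suc m · 1#) # 0#
    where open RawMonoidDefinitions R.+-rawMonoid using () renaming (_×_ to _·_)

  record IsPrimitiveRoot (r : ℕ) (ζ : Carrier) : Set (ℓ₁ ⊔ ℓ₂) where
    field
      ζ^r≈1 : ζ ^ r ≈ 1#
      ζ^j#1 : ∀ j → 0 ℕ.< j → j ℕ.< r → (ζ ^ j) # 1#

module Presentations {c ℓ : Level} (R : Ring c ℓ) where

  open Ring R using (Carrier; _≈_; 0#; 1#; -_)
    renaming (_+_ to _+ᴷ_; _*_ to _*ᴷ_; -‿inverseʳ to -ᴷ‿inverseʳ; refl to reflᴷ)

  infixl 6 _⊕_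
  infixr 7 _•_

  data Combination {a : Level} (A : Set a) : Set (c ⊔ a) where
    gen : A → Combination A
    𝟘   : Combination A
    _⊕_ : Combination A → Combination A → Combination A
    _•_ : Carrier → Combination A → Combination A

  -- The least R-linear congruence containing _~_.
  data Congruence {a ρ : Level} {A : Set a} (_~_ : Rel (Combination A) ρ)
       : Rel (Combination A) (c ⊔ ℓ ⊔ a ⊔ ρ) where
    relation    : ∀ {s t} → s ~ t → Congruence _~_ s t
    refl        : ∀ {s} → Congruence _~_ s s
    sym         : ∀ {s t} → Congruence _~_ s t → Congruence _~_ t s
    trans       : ∀ {s t u} → Congruence _~_ s t → Congruence _~_ t u → Congruence _~_ s u
    ⊕-cong      : ∀ {s s′ t t′} → Congruence _~_ s s′ → Congruence _~_ t t′ →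
                  Congruence _~_ (s ⊕ t) (s′ ⊕ t′)
    •-cong      : ∀ {k k′ s s′} → k ≈ k′ → Congruence _~_ s s′ →
                  Congruence _~_ (k • s) (k′ • s′)
    ⊕-assoc     : ∀ s t u → Congruence _~_ ((s ⊕ t) ⊕ u) (s ⊕ (t ⊕ u))
    ⊕-comm      : ∀ s t → Congruence _~_ (s ⊕ t) (t ⊕ s)
    ⊕-identityˡ : ∀ s → Congruence _~_ (𝟘 ⊕ s) s
    •-zeroˡ     : ∀ s → Congruence _~_ (0# • s) 𝟘
    •-zeroʳ     : ∀ k → Congruence _~_ (k • 𝟘) 𝟘
    •-distribʳ  : ∀ s k l → Congruence _~_ ((k +ᴷ l) • s) ((k • s) ⊕ (l • s))
    •-distribˡ  : ∀ k s t → Congruence _~_ (k • (s ⊕ t)) ((k • s) ⊕ (k • t))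
    •-assoc     : ∀ k l s → Congruence _~_ ((k *ᴷ l) • s) (k • (l • s))
    •-identityˡ : ∀ s → Congruence _~_ (1# • s) s

  module _ {a ρ : Level} (A : Set a) (_~_ : Rel (Combination A) ρ) where

    private
      inverseʳ : ∀ s → Congruence _~_ (s ⊕ ((- 1#) • s)) 𝟘
      inverseʳ s =
        trans (⊕-cong (sym (•-identityˡ s)) refl)
        (trans (sym (•-distribʳ s 1# (- 1#)))
        (trans (•-cong (-ᴷ‿inverseʳ 1#) refl) (•-zeroˡ s)))

      inverseˡ′ : ∀ s → Congruence _~_ (((- 1#) • s) ⊕ s) 𝟘
      inverseˡ′ s = trans (⊕-comm _ s) (inverseʳ s)

    presented : LeftModule R (c ⊔ a) (c ⊔ ℓ ⊔ a ⊔ ρ)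
    presented = record
      { Carrierᴹ = Combination A
      ; _≈ᴹ_ = Congruence _~_
      ; _+ᴹ_ = _⊕_
      ; _*ₗ_ = _•_
      ; 0ᴹ = 𝟘
      ; -ᴹ_ = (- 1#) •_
      ; isLeftModule = record
        { isLeftSemimodule = record
          { +ᴹ-isCommutativeMonoid = record
            { isMonoid = record
              { isSemigroup = record
                { isMagma = record
                  { isEquivalence = record { refl = refl ; sym = sym ; trans = trans }
                  ; ∙-cong = ⊕-cong }
                ; assoc = ⊕-assoc }
              ; identity = ⊕-identityˡ , λ s → trans (⊕-comm s 𝟘) (⊕-identityˡ s) }
            ; comm = ⊕-comm }
          ; isPreleftSemimodule = record
            { *ₗ-cong = •-cong
            ; *ₗ-zeroˡ = •-zeroˡ
            ; *ₗ-distribʳ = •-distribʳ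
            ; *ₗ-identityˡ = •-identityˡ
            ; *ₗ-assoc = •-assoc
            ; *ₗ-zeroʳ = •-zeroʳ
            ; *ₗ-distribˡ = •-distribˡ } }
        ; -ᴹ‿cong = •-cong reflᴷ
        ; -ᴹ‿inverse = inverseˡ′ , inverseʳ } }

  extend : ∀ {a b} {A : Set a} {B : Set b} →
           (A → Combination B) → Combination A → Combination B
  extend f (gen x) = f x
  extend f 𝟘       = 𝟘
  extend f (s ⊕ t) = extend f s ⊕ extend f t
  extend f (k • s) = k • extend f s

  module _ {a b ρ σ : Level} {A : Set a} {B : Set b}
           {_~_ : Rel (Combination A) ρ} {_≋_ : Rel (Combination B) σ}
           (f : A → Combination B)
           (f-cong : ∀ {s t} → s ~ t → Congruence _≋_ (extend f s) (extend f t))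
           where

    extend-cong : ∀ {s t} → Congruence _~_ s t → Congruence _≋_ (extend f s) (extend f t)
    extend-cong (relation p)       = f-cong p
    extend-cong refl               = refl
    extend-cong (sym p)            = sym (extend-cong p)
    extend-cong (trans p q)        = trans (extend-cong p) (extend-cong q)
    extend-cong (⊕-cong p q)       = ⊕-cong (extend-cong p) (extend-cong q)
    extend-cong (•-cong e p)       = •-cong e (extend-cong p)
    extend-cong (⊕-assoc s t u)    = ⊕-assoc _ _ _
    extend-cong (⊕-comm s t)       = ⊕-comm _ _
    extend-cong (⊕-identityˡ s)    = ⊕-identityˡ _
    extend-cong (•-zeroˡ s)        = •-zeroˡ _
    extend-cong (•-zeroʳ k)        = •-zeroʳ k
    extend-cong (•-distribʳ s k l) = •-distribʳ _ k l
    extend-cong (•-distribˡ k s t) = •-distribˡ k _ _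
    extend-cong (•-assoc k l s)    = •-assoc k l _
    extend-cong (•-identityˡ s)    = •-identityˡ _

    open LeftModuleMorphisms
      (LeftModule.rawLeftModule (presented A _~_))
      (LeftModule.rawLeftModule (presented B _≋_))

    extend-isLinear : IsLeftModuleHomomorphism (extend f)
    extend-isLinear = record
      { +ᴹ-isGroupHomomorphism = record
        { isMonoidHomomorphism = record
          { isMagmaHomomorphism = record
            { isRelHomomorphism = record { cong = extend-cong }
            ; homo = λ _ _ → refl }
          ; ε-homo = refl }
        ; ⁻¹-homo = λ _ → refl }
      ; *ₗ-homo = λ _ _ → refl }

  -- The free module on a setoid: its only relations identify equal
  -- generators.
  module _ {a e : Level} (X : Setoid a e) where

    open Setoid X using () renaming (Carrier to |X|; _≈_ to _≈ˣ_)

    data FreeRelation : Rel (Combination |X|) (c ⊔ a ⊔ e) where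
      gen-cong : ∀ {x y} → x ≈ˣ y → FreeRelation (gen x) (gen y)

    free : LeftModule R (c ⊔ a) (c ⊔ ℓ ⊔ a ⊔ e)
    free = presented |X| FreeRelation

  module _ {m n ℓm ℓn : Level}
           (M : LeftModule R m ℓm) (N : LeftModule R n ℓn) where

    private
      module M = LeftModule M
      module N = LeftModule N

    data TensorRelation
         : Rel (Combination (M.Carrierᴹ × N.Carrierᴹ)) (c ⊔ m ⊔ n ⊔ ℓm ⊔ ℓn) where
      ⊗-cong : ∀ {u u′ v v′} → u M.≈ᴹ u′ → v N.≈ᴹ v′ →
               TensorRelation (gen (u , v)) (gen (u′ , v′))
      ⊗-+ˡ   : ∀ u u′ v →
               TensorRelation (gen (u M.+ᴹ u′ , v)) (gen (u , v) ⊕ gen (u′ , v))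
      ⊗-+ʳ   : ∀ u v v′ →
               TensorRelation (gen (u , v N.+ᴹ v′)) (gen (u , v) ⊕ gen (u , v′))
      ⊗-*ˡ   : ∀ k u v → TensorRelation (gen (k M.*ₗ u , v)) (k • gen (u , v))
      ⊗-*ʳ   : ∀ k u v → TensorRelation (gen (u , k N.*ₗ v)) (k • gen (u , v))

    tensor : LeftModule R (c ⊔ m ⊔ n) (c ⊔ ℓ ⊔ m ⊔ n ⊔ ℓm ⊔ ℓn)
    tensor = presented (M.Carrierᴹ × N.Carrierᴹ) TensorRelation

module Actions {c ℓ g : Level} (R : Ring c ℓ) (G : Set g) where

  open Presentations R

  -- An equivariant isomorphism does not refer to the multiplication of G, so
  -- G is only a set of operators here.
  record Action (m ℓm : Level) : Set (c ⊔ ℓ ⊔ g ⊔ lsuc (m ⊔ ℓm)) where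
    field
      space : LeftModule R m ℓm

    open LeftModule space public using (Carrierᴹ; _≈ᴹ_; rawLeftModule)
    open LeftModuleMorphisms rawLeftModule rawLeftModule

    field
      act        : G → Carrierᴹ → Carrierᴹ
      act-linear : ∀ h → IsLeftModuleHomomorphism (act h)

  record _≅_ {m ℓm n ℓn : Level} (V : Action m ℓm) (W : Action n ℓn)
         : Set (c ⊔ g ⊔ m ⊔ ℓm ⊔ n ⊔ ℓn) where
    private
      module V = Action V
      module W = Action W
    open LeftModuleMorphisms V.rawLeftModule W.rawLeftModule
    field
      to            : V.Carrierᴹ → W.Carrierᴹ
      isIsomorphism : IsLeftModuleIsomorphism to
      equivariant   : ∀ h v → to (V.act h v) W.≈ᴹ W.act h (to v)

  infix  4 _≅_
  infixl 7 _⊗_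

  _⊗_ : ∀ {m ℓm n ℓn} → Action m ℓm → Action n ℓn →
        Action (c ⊔ m ⊔ n) (c ⊔ ℓ ⊔ m ⊔ n ⊔ ℓm ⊔ ℓn)
  V ⊗ W = record
    { space      = tensor V.space W.space
    ; act        = λ h → extend (diagonal h)
    ; act-linear = λ h → extend-isLinear (diagonal h) (respects h)
    }
    where
    module V = Action V
    module W = Action W
    module VL h = LeftModuleMorphisms.IsLeftModuleHomomorphism (V.act-linear h)
    module WL h = LeftModuleMorphisms.IsLeftModuleHomomorphism (W.act-linear h)

    diagonal : G → V.Carrierᴹ × W.Carrierᴹ → Combination (V.Carrierᴹ × W.Carrierᴹ)
    diagonal h (v , w) = gen (V.act h v , W.act h w)

    respects : ∀ h {s t} → TensorRelation V.space W.space s t →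
               Congruence (TensorRelation V.space W.space)
                 (extend (diagonal h) s) (extend (diagonal h) t)
    respects h (⊗-cong p q)   = relation (⊗-cong (VL.⟦⟧-cong h p) (WL.⟦⟧-cong h q))
    respects h (⊗-+ˡ u u′ v)  =
      trans (relation (⊗-cong (VL.+ᴹ-homo h u u′) (LeftModule.≈ᴹ-refl W.space)))
            (relation (⊗-+ˡ _ _ _))
    respects h (⊗-+ʳ u v v′)  =
      trans (relation (⊗-cong (LeftModule.≈ᴹ-refl V.space) (WL.+ᴹ-homo h v v′)))
            (relation (⊗-+ʳ _ _ _))
    respects h (⊗-*ˡ k u v)   =
      trans (relation (⊗-cong (VL.*ₗ-homo h k u) (LeftModule.≈ᴹ-refl W.space)))
            (relation (⊗-*ˡ _ _ _))
    respects h (⊗-*ʳ k u v)   =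
      trans (relation (⊗-cong (LeftModule.≈ᴹ-refl V.space) (WL.*ₗ-homo h k v)))
            (relation (⊗-*ʳ _ _ _))

-- Expansion along the first row.
module Determinant {c ℓ : Level} (R : Ring c ℓ) where

  open Ring R hiding (zero)
  open Exp semiring using (_^_)
  open RawMonoidDefinitions +-rawMonoid using (sum)

  determinant : ∀ {m} → (Fin m → Fin m → Carrier) → Carrier
  determinant {zero}  M = 1#
  determinant {suc m} M = sum λ j →
    (- 1#) ^ toℕ j * M zero j * determinant (λ a b → M (suc a) (punchIn j b))

module Monomial {c ℓ : Level} (K : CommutativeRing c ℓ)
                (n r : ℕ) (ζ : CommutativeRing.Carrier K) where

  open CommutativeRing K
  open Exp semiring using (_^_)
  open Determinant ring using (determinant)

  -- (colour , w) is the matrix diag(ζ^colour₁ , … , ζ^colourₙ) · w.  When ζ is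
  -- a primitive r-th root of unity in a field, its powers are all the r-th
  -- roots of unity, so these are exactly the monomial matrices whose nonzero
  -- entries are r-th roots of unity, each obtained from one pair.
  Monomial : Set
  Monomial = (Fin n → Fin r) × Permutation′ n

  matrix : Monomial → Fin n → Fin n → Carrier
  matrix (colour , w) i j = if does (i ≟ w ⟨$⟩ʳ j) then ζ ^ toℕ (colour i) else 0#

  open Actions ring Monomial

  det : Action c ℓ
  det = record
    { space      = TensorUnit.leftModule
    ; act        = λ g a → determinant (matrix g) * a
    ; act-linear = λ g → record
      { +ᴹ-isGroupHomomorphism = record
        { isMonoidHomomorphism = record
          { isMagmaHomomorphism = record
            { isRelHomomorphism = record { cong = *-congˡ }
            ; homo = distribˡ _ }
          ; ε-homo = zeroʳ _ }
        ; ⁻¹-homo = λ a → sym (-‿distribʳ-* _ a) }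
      ; *ₗ-homo = λ k a →
          trans (sym (*-assoc _ k a)) (trans (*-congʳ (*-comm _ k)) (*-assoc k _ a)) }
    }
    where open RingProperties ring using (-‿distribʳ-*)

module Superspace {c ℓ : Level} (K : CommutativeRing c ℓ)
                  (n r : ℕ) (ζ : CommutativeRing.Carrier K) where

  open CommutativeRing K using (Carrier; _≈_; 0#; 1#; ring; semiring)
  private module K = CommutativeRing K
  open Exp semiring using (_^_)
  open Monomial K n r ζ using (Monomial)
  open Actions ring Monomial using (Action)

  infixl 6 _+_ _-_
  infixl 7 _*_
  infix  4 _≈Ω_ _≈SR_

  data Ω : Set c where
    scalar  : Carrier → Ω
    x θ     : Fin n → Ω
    _+_ _*_ : Ω → Ω → Ω

  -- The least congruence making Ω an associative unital K-algebra in which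
  -- the relations between the generators hold.
  data _≈Ω_ : Rel Ω (c ⊔ ℓ) where
    refl       : ∀ {f} → f ≈Ω f
    sym        : ∀ {f g} → f ≈Ω g → g ≈Ω f
    trans      : ∀ {f g h} → f ≈Ω g → g ≈Ω h → f ≈Ω h
    +-cong     : ∀ {f f′ g g′} → f ≈Ω f′ → g ≈Ω g′ → f + g ≈Ω f′ + g′
    *-cong     : ∀ {f f′ g g′} → f ≈Ω f′ → g ≈Ω g′ → f * g ≈Ω f′ * g′
    +-assoc    : ∀ f g h → (f + g) + h ≈Ω f + (g + h)
    +-comm     : ∀ f g → f + g ≈Ω g + f
    +-zero     : ∀ f → scalar 0# + f ≈Ω f
    *-assoc    : ∀ f g h → (f * g) * h ≈Ω f * (g * h)
    *-one      : ∀ f → scalar 1# * f ≈Ω f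
    *-zero     : ∀ f → scalar 0# * f ≈Ω scalar 0#
    distribˡ   : ∀ f g h → f * (g + h) ≈Ω f * g + f * h
    distribʳ   : ∀ f g h → (g + h) * f ≈Ω g * f + h * f
    scalar-≈   : ∀ {a b} → a ≈ b → scalar a ≈Ω scalar b
    scalar-+   : ∀ a b → scalar (a K.+ b) ≈Ω scalar a + scalar b
    scalar-*   : ∀ a b → scalar (a K.* b) ≈Ω scalar a * scalar b
    central    : ∀ a f → scalar a * f ≈Ω f * scalar a
    x-x        : ∀ i j → x i * x j ≈Ω x j * x i
    x-θ        : ∀ i j → x i * θ j ≈Ω θ j * x i
    θ-θ        : ∀ i j → θ i * θ j ≈Ω scalar (K.- 1#) * (θ j * θ i)

  _-_ : Ω → Ω → Ω
  f - g = f + scalar (K.- 1#) * g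

  -- The homogeneous components of the bigrading with each xᵢ in degree (1,0)
  -- and each θᵢ in degree (0,1).
  data HasBidegree : ℕ → ℕ → Ω → Set (c ⊔ ℓ) where
    scalar : ∀ a → HasBidegree 0 0 (scalar a)
    x      : ∀ i → HasBidegree 1 0 (x i)
    θ      : ∀ i → HasBidegree 0 1 (θ i)
    zero   : ∀ {p q} → HasBidegree p q (scalar 0#)
    _+_    : ∀ {p q f g} → HasBidegree p q f → HasBidegree p q g → HasBidegree p q (f + g)
    _*_    : ∀ {p q p′ q′ f g} → HasBidegree p q f → HasBidegree p′ q′ g →
             HasBidegree (p ℕ.+ p′) (q ℕ.+ q′) (f * g)
    resp   : ∀ {p q f g} → f ≈Ω g → HasBidegree p q f → HasBidegree p q g

  -- The sum over all p of the components of bidegree (p , q).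
  data HasFermionicDegree (q : ℕ) : Ω → Set (c ⊔ ℓ) where
    homogeneous : ∀ {p f} → HasBidegree p q f → HasFermionicDegree q f
    _+_         : ∀ {f g} → HasFermionicDegree q f → HasFermionicDegree q g →
                  HasFermionicDegree q (f + g)
    resp        : ∀ {f g} → f ≈Ω g → HasFermionicDegree q f → HasFermionicDegree q g

  substitute : (Fin n → Ω) → (Fin n → Ω) → Ω → Ω
  substitute X Θ (scalar a) = scalar a
  substitute X Θ (x i)      = X i
  substitute X Θ (θ i)      = Θ i
  substitute X Θ (f + g)    = substitute X Θ f + substitute X Θ g
  substitute X Θ (f * g)    = substitute X Θ f * substitute X Θ g

  -- As ζ ^ r = 1, the scalar ζ ^ (r ∸ colourᵢ) is ζ ^ (- colourᵢ).
  diagonalΩ : (Fin n → Fin r) → Ω → Ω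
  diagonalΩ colour = substitute (λ i → coefficient i * x i) (λ i → coefficient i * θ i)
    where
    coefficient : Fin n → Ω
    coefficient i = scalar (ζ ^ (r ℕ.∸ toℕ (colour i)))

  permuteΩ : Permutation′ n → Ω → Ω
  permuteΩ w = substitute (λ i → x (w ⟨$⟩ʳ i)) (λ i → θ (w ⟨$⟩ʳ i))

  actΩ : Monomial → Ω → Ω
  actΩ (colour , w) = diagonalΩ colour ∘ permuteΩ w

  Invariant : Ω → Set (c ⊔ ℓ)
  Invariant f = ∀ g → actΩ g f ≈Ω f

  constantTerm : Ω → Carrier
  constantTerm (scalar a) = a
  constantTerm (x i)      = 0#
  constantTerm (θ i)      = 0#
  constantTerm (f + g)    = constantTerm f K.+ constantTerm g
  constantTerm (f * g)    = constantTerm f K.* constantTerm g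

  -- The two-sided ideal generated by the invariants without constant term.
  data SI : Ω → Set (c ⊔ ℓ) where
    invariant : ∀ {f} → Invariant f → constantTerm f ≈ 0# → SI f
    _+_       : ∀ {f g} → SI f → SI g → SI (f + g)
    _*ˡ_      : ∀ h {f} → SI f → SI (h * f)
    _*ʳ_      : ∀ {f} → SI f → ∀ h → SI (f * h)
    resp      : ∀ {f g} → f ≈Ω g → SI f → SI g

  _≈SR_ : Rel Ω (c ⊔ ℓ)
  f ≈SR g = SI (f - g)

  Ω-setoid : Setoid c (c ⊔ ℓ)
  Ω-setoid = record
    { Carrier       = Ω
    ; _≈_           = _≈Ω_
    ; isEquivalence = record { refl = refl ; sym = sym ; trans = trans } }

  open SetoidReasoning Ω-setoid

  -1Ω 0Ω : Ω
  -1Ω = scalar (K.- 1#)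
  0Ω  = scalar 0#

  +-zeroʳ : ∀ f → f + 0Ω ≈Ω f
  +-zeroʳ f = trans (+-comm f 0Ω) (+-zero f)

  minus-self : ∀ f → f - f ≈Ω 0Ω
  minus-self f = begin
    f + -1Ω * f                ≈⟨ +-cong (sym (*-one f)) refl ⟩
    scalar 1# * f + -1Ω * f    ≈⟨ sym (distribʳ f (scalar 1#) -1Ω) ⟩
    (scalar 1# + -1Ω) * f      ≈⟨ *-cong (sym (scalar-+ 1# (K.- 1#))) refl ⟩
    scalar (1# K.+ K.- 1#) * f ≈⟨ *-cong (scalar-≈ (K.-‿inverseʳ 1#)) refl ⟩
    0Ω * f                     ≈⟨ *-zero f ⟩
    0Ω                         ∎

  -1²≈1 : ∀ f → -1Ω * (-1Ω * f) ≈Ω f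
  -1²≈1 f = begin
    -1Ω * (-1Ω * f)                ≈⟨ sym (*-assoc -1Ω -1Ω f) ⟩
    (-1Ω * -1Ω) * f                ≈⟨ *-cong (sym (scalar-* (K.- 1#) (K.- 1#))) refl ⟩
    scalar (K.- 1# K.* K.- 1#) * f ≈⟨ *-cong (scalar-≈ square) refl ⟩
    scalar 1# * f                  ≈⟨ *-one f ⟩
    f                              ∎
    where
    open RingProperties ring using (-1*x≈-x; -‿involutive)
    square : K.- 1# K.* K.- 1# ≈ 1#
    square = K.trans (-1*x≈-x (K.- 1#)) (-‿involutive 1#)

  interchange : ∀ f g h k → (f + g) + (h + k) ≈Ω (f + h) + (g + k)
  interchange f g h k = begin
    (f + g) + (h + k) ≈⟨ +-assoc f g (h + k) ⟩
    f + (g + (h + k)) ≈⟨ +-cong refl (sym (+-assoc g h k)) ⟩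
    f + ((g + h) + k) ≈⟨ +-cong refl (+-cong (+-comm g h) refl) ⟩
    f + ((h + g) + k) ≈⟨ +-cong refl (+-assoc h g k) ⟩
    f + (h + (g + k)) ≈⟨ sym (+-assoc f h (g + k)) ⟩
    (f + h) + (g + k) ∎

  scalars-out : ∀ a b f g →
                (scalar a * f) * (scalar b * g) ≈Ω (scalar a * scalar b) * (f * g)
  scalars-out a b f g = begin
    (scalar a * f) * (scalar b * g) ≈⟨ *-assoc (scalar a) f (scalar b * g) ⟩
    scalar a * (f * (scalar b * g)) ≈⟨ *-cong refl (sym (*-assoc f (scalar b) g)) ⟩
    scalar a * ((f * scalar b) * g) ≈⟨ *-cong refl (*-cong (sym (central b f)) refl) ⟩
    scalar a * ((scalar b * f) * g) ≈⟨ *-cong refl (*-assoc (scalar b) f g) ⟩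
    scalar a * (scalar b * (f * g)) ≈⟨ sym (*-assoc (scalar a) (scalar b) (f * g)) ⟩
    (scalar a * scalar b) * (f * g) ∎

  scale-commute : ∀ a b f g → f * g ≈Ω g * f →
                  (scalar a * f) * (scalar b * g) ≈Ω (scalar b * g) * (scalar a * f)
  scale-commute a b f g fg≈gf = begin
    (scalar a * f) * (scalar b * g) ≈⟨ scalars-out a b f g ⟩
    (scalar a * scalar b) * (f * g) ≈⟨ *-cong (central a (scalar b)) fg≈gf ⟩
    (scalar b * scalar a) * (g * f) ≈⟨ sym (scalars-out b a g f) ⟩
    (scalar b * g) * (scalar a * f) ∎

  scale-anticommute : ∀ a b f g → f * g ≈Ω -1Ω * (g * f) →
                      (scalar a * f) * (scalar b * g) ≈Ω
                      -1Ω * ((scalar b * g) * (scalar a * f))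
  scale-anticommute a b f g fg≈-gf = begin
    (scalar a * f) * (scalar b * g)         ≈⟨ scalars-out a b f g ⟩
    (scalar a * scalar b) * (f * g)         ≈⟨ *-cong (central a (scalar b)) fg≈-gf ⟩
    (scalar b * scalar a) * (-1Ω * (g * f)) ≈⟨ sym (*-assoc _ -1Ω (g * f)) ⟩
    ((scalar b * scalar a) * -1Ω) * (g * f) ≈⟨ *-cong (sym (central _ _)) refl ⟩
    (-1Ω * (scalar b * scalar a)) * (g * f) ≈⟨ *-assoc -1Ω _ (g * f) ⟩
    -1Ω * ((scalar b * scalar a) * (g * f)) ≈⟨ *-cong refl (sym (scalars-out b a g f)) ⟩
    -1Ω * ((scalar b * g) * (scalar a * f)) ∎

  module Substitute
    (X Θ : Fin n → Ω)
    (X-X : ∀ i j → X i * X j ≈Ω X j * X i)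
    (X-Θ : ∀ i j → X i * Θ j ≈Ω Θ j * X i)
    (Θ-Θ : ∀ i j → Θ i * Θ j ≈Ω -1Ω * (Θ j * Θ i))
    where

    substitute-cong : ∀ {f g} → f ≈Ω g → substitute X Θ f ≈Ω substitute X Θ g
    substitute-cong refl             = refl
    substitute-cong (sym p)          = sym (substitute-cong p)
    substitute-cong (trans p q)      = trans (substitute-cong p) (substitute-cong q)
    substitute-cong (+-cong p q)     = +-cong (substitute-cong p) (substitute-cong q)
    substitute-cong (*-cong p q)     = *-cong (substitute-cong p) (substitute-cong q)
    substitute-cong (+-assoc _ _ _)  = +-assoc _ _ _
    substitute-cong (+-comm _ _)     = +-comm _ _
    substitute-cong (+-zero _)       = +-zero _
    substitute-cong (*-assoc _ _ _)  = *-assoc _ _ _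
    substitute-cong (*-one _)        = *-one _
    substitute-cong (*-zero _)       = *-zero _
    substitute-cong (distribˡ _ _ _) = distribˡ _ _ _
    substitute-cong (distribʳ _ _ _) = distribʳ _ _ _
    substitute-cong (scalar-≈ e)     = scalar-≈ e
    substitute-cong (scalar-+ a b)   = scalar-+ a b
    substitute-cong (scalar-* a b)   = scalar-* a b
    substitute-cong (central a _)    = central a _
    substitute-cong (x-x i j)        = X-X i j
    substitute-cong (x-θ i j)        = X-Θ i j
    substitute-cong (θ-θ i j)        = Θ-Θ i j

    module _ (X-degree : ∀ i → HasBidegree 1 0 (X i))
             (Θ-degree : ∀ i → HasBidegree 0 1 (Θ i)) where

      substitute-bidegree : ∀ {p q f} → HasBidegree p q f →
                            HasBidegree p q (substitute X Θ f)
      substitute-bidegree (scalar a) = scalar a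
      substitute-bidegree (x i)      = X-degree i
      substitute-bidegree (θ i)      = Θ-degree i
      substitute-bidegree zero       = zero
      substitute-bidegree (s + t)    = substitute-bidegree s + substitute-bidegree t
      substitute-bidegree (s * t)    = substitute-bidegree s * substitute-bidegree t
      substitute-bidegree (resp p s) = resp (substitute-cong p) (substitute-bidegree s)

  module Diagonal (colour : Fin n → Fin r) = Substitute _ _
    (λ i j → scale-commute _ (ζ ^ (r ℕ.∸ toℕ (colour j))) _ (x j) (x-x i j))
    (λ i j → scale-commute _ (ζ ^ (r ℕ.∸ toℕ (colour j))) _ (θ j) (x-θ i j))
    (λ i j → scale-anticommute (ζ ^ (r ℕ.∸ toℕ (colour i))) (ζ ^ (r ℕ.∸ toℕ (colour j)))
                               (θ i) (θ j) (θ-θ i j))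

  module Permute (w : Permutation′ n) = Substitute _ _
    (λ i j → x-x (w ⟨$⟩ʳ i) (w ⟨$⟩ʳ j))
    (λ i j → x-θ (w ⟨$⟩ʳ i) (w ⟨$⟩ʳ j))
    (λ i j → θ-θ (w ⟨$⟩ʳ i) (w ⟨$⟩ʳ j))

  actΩ-cong : ∀ g {f h} → f ≈Ω h → actΩ g f ≈Ω actΩ g h
  actΩ-cong (colour , w) p =
    Diagonal.substitute-cong colour (Permute.substitute-cong w p)

  actΩ-bidegree : ∀ g {p q f} → HasBidegree p q f → HasBidegree p q (actΩ g f)
  actΩ-bidegree (colour , w) d =
    Diagonal.substitute-bidegree colour
      (λ i → scalar _ * x i) (λ i → scalar _ * θ i)
      (Permute.substitute-bidegree w (λ i → x (w ⟨$⟩ʳ i)) (λ i → θ (w ⟨$⟩ʳ i)) d)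

  actΩ-fermionicDegree : ∀ g {q f} → HasFermionicDegree q f →
                         HasFermionicDegree q (actΩ g f)
  actΩ-fermionicDegree g (homogeneous d) = homogeneous (actΩ-bidegree g d)
  actΩ-fermionicDegree g (d + e)         =
    actΩ-fermionicDegree g d + actΩ-fermionicDegree g e
  actΩ-fermionicDegree g (resp p d)      =
    resp (actΩ-cong g p) (actΩ-fermionicDegree g d)

  actΩ-SI : ∀ g {f} → SI f → SI (actΩ g f)
  actΩ-SI g (invariant inv ε) = resp (sym (inv g)) (invariant inv ε)
  actΩ-SI g (s + t)           = actΩ-SI g s + actΩ-SI g t
  actΩ-SI g (h *ˡ s)          = actΩ g h *ˡ actΩ-SI g s
  actΩ-SI g (s *ʳ h)          = actΩ-SI g s *ʳ actΩ g h
  actΩ-SI g (resp p s)        = resp (actΩ-cong g p) (actΩ-SI g s)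

  scale-fermionicDegree : ∀ a {q f} → HasFermionicDegree q f →
                          HasFermionicDegree q (scalar a * f)
  scale-fermionicDegree a (homogeneous d) = homogeneous (scalar a * d)
  scale-fermionicDegree a (d + e)         =
    resp (sym (distribˡ _ _ _)) (scale-fermionicDegree a d + scale-fermionicDegree a e)
  scale-fermionicDegree a (resp p d)      =
    resp (*-cong refl p) (scale-fermionicDegree a d)

  ≈⇒≈SR : ∀ {f g} → f ≈Ω g → f ≈SR g
  ≈⇒≈SR {f} {g} p =
    resp (sym (trans (+-cong p refl) (minus-self g)))
         (invariant (λ _ → refl) K.refl)

  ≈SR-sym : ∀ {f g} → f ≈SR g → g ≈SR f
  ≈SR-sym {f} {g} s = resp negated (-1Ω *ˡ s)
    where
    negated : -1Ω * (f - g) ≈Ω g - f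
    negated = begin
      -1Ω * (f + -1Ω * g)       ≈⟨ distribˡ -1Ω f (-1Ω * g) ⟩
      -1Ω * f + -1Ω * (-1Ω * g) ≈⟨ +-cong refl (-1²≈1 g) ⟩
      -1Ω * f + g               ≈⟨ +-comm (-1Ω * f) g ⟩
      g + -1Ω * f               ∎

  ≈SR-+-cong : ∀ {f f′ g g′} → f ≈SR f′ → g ≈SR g′ → f + g ≈SR f′ + g′
  ≈SR-+-cong {f} {f′} {g} {g′} s t = resp regroup (s + t)
    where
    regroup : (f - f′) + (g - g′) ≈Ω (f + g) - (f′ + g′)
    regroup = trans (interchange f (-1Ω * f′) g (-1Ω * g′))
                    (+-cong refl (sym (distribˡ -1Ω f′ g′)))

  ≈SR-trans : ∀ {f g h} → f ≈SR g → g ≈SR h → f ≈SR h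
  ≈SR-trans {f} {g} {h} s t = resp telescope (s + t)
    where
    telescope : (f - g) + (g - h) ≈Ω f - h
    telescope = begin
      (f + -1Ω * g) + (g + -1Ω * h) ≈⟨ +-assoc f (-1Ω * g) _ ⟩
      f + (-1Ω * g + (g + -1Ω * h)) ≈⟨ +-cong refl (sym (+-assoc (-1Ω * g) g _)) ⟩
      f + ((-1Ω * g + g) + -1Ω * h) ≈⟨ +-cong refl (+-cong (+-comm _ g) refl) ⟩
      f + ((g - g) + -1Ω * h)       ≈⟨ +-cong refl (+-cong (minus-self g) refl) ⟩
      f + (0Ω + -1Ω * h)            ≈⟨ +-cong refl (+-zero _) ⟩
      f - h                         ∎

  ≈SR-scale : ∀ {a b f g} → a ≈ b → f ≈SR g → scalar a * f ≈SR scalar b * g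
  ≈SR-scale {a} {b} {f} {g} e s = ≈SR-trans (resp regroup (scalar a *ˡ s))
    (≈⇒≈SR (*-cong (scalar-≈ e) refl))
    where
    regroup : scalar a * (f - g) ≈Ω scalar a * f - scalar a * g
    regroup = begin
      scalar a * (f + -1Ω * g)            ≈⟨ distribˡ (scalar a) f (-1Ω * g) ⟩
      scalar a * f + scalar a * (-1Ω * g) ≈⟨ +-cong refl (sym (*-assoc _ -1Ω g)) ⟩
      scalar a * f + (scalar a * -1Ω) * g ≈⟨ +-cong refl (*-cong (central a -1Ω) refl) ⟩
      scalar a * f + (-1Ω * scalar a) * g ≈⟨ +-cong refl (*-assoc -1Ω _ g) ⟩
      scalar a * f - scalar a * g         ∎

  minus-selfˡ : ∀ f → -1Ω * f + f ≈Ω 0Ω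
  minus-selfˡ f = trans (+-comm _ f) (minus-self f)

  -- The image in Ω/SI of the fermionic degree q part of Ω.
  SRspace : ℕ → LeftModule ring (c ⊔ ℓ) (c ⊔ ℓ)
  SRspace q = record
    { Carrierᴹ = Σ Ω (HasFermionicDegree q)
    ; _≈ᴹ_ = λ f g → proj₁ f ≈SR proj₁ g
    ; _+ᴹ_ = λ (f , d) (g , e) → f + g , d + e
    ; _*ₗ_ = λ a (f , d) → scalar a * f , scale-fermionicDegree a d
    ; 0ᴹ = scalar 0# , homogeneous {p = 0} zero
    ; -ᴹ_ = λ (f , d) → scalar (K.- 1#) * f , scale-fermionicDegree (K.- 1#) d
    ; isLeftModule = record
      { isLeftSemimodule = record
        { +ᴹ-isCommutativeMonoid = record
          { isMonoid = record
            { isSemigroup = record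
              { isMagma = record
                { isEquivalence = record
                  { refl = ≈⇒≈SR refl ; sym = ≈SR-sym ; trans = ≈SR-trans }
                ; ∙-cong = ≈SR-+-cong }
              ; assoc = λ _ _ _ → ≈⇒≈SR (+-assoc _ _ _) }
            ; identity = (λ _ → ≈⇒≈SR (+-zero _)) , λ _ → ≈⇒≈SR (+-zeroʳ _) }
          ; comm = λ _ _ → ≈⇒≈SR (+-comm _ _) }
        ; isPreleftSemimodule = record
          { *ₗ-cong = ≈SR-scale
          ; *ₗ-zeroˡ = λ _ → ≈⇒≈SR (*-zero _)
          ; *ₗ-distribʳ = λ _ a b →
              ≈⇒≈SR (trans (*-cong (scalar-+ a b) refl) (distribʳ _ _ _))
          ; *ₗ-identityˡ = λ _ → ≈⇒≈SR (*-one _)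
          ; *ₗ-assoc = λ a b _ →
              ≈⇒≈SR (trans (*-cong (scalar-* a b) refl) (*-assoc _ _ _))
          ; *ₗ-zeroʳ = λ a → ≈⇒≈SR (trans (central a 0Ω) (*-zero _))
          ; *ₗ-distribˡ = λ _ _ _ → ≈⇒≈SR (distribˡ _ _ _) } }
      ; -ᴹ‿cong = ≈SR-scale K.refl
      ; -ᴹ‿inverse = (λ _ → ≈⇒≈SR (minus-selfˡ _)) , λ _ → ≈⇒≈SR (minus-self _) } }

  SR⟨*,_⟩ : ℕ → Action (c ⊔ ℓ) (c ⊔ ℓ)
  SR⟨*, q ⟩ = record
    { space      = SRspace q
    ; act        = λ g (f , d) → actΩ g f , actΩ-fermionicDegree g d
    ; act-linear = λ g → record
      { +ᴹ-isGroupHomomorphism = record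
        { isMonoidHomomorphism = record
          { isMagmaHomomorphism = record
            { isRelHomomorphism = record { cong = actΩ-SI g }
            ; homo = λ _ _ → ≈⇒≈SR refl }
          ; ε-homo = ≈⇒≈SR refl }
        ; ⁻¹-homo = λ _ → ≈⇒≈SR refl }
      ; *ₗ-homo = λ _ _ → ≈⇒≈SR refl }
    }

module OrderedSetPartitions {c ℓ : Level} (K : CommutativeRing c ℓ)
                            (n r : ℕ) .{{_ : NonZero r}}
                            (ζ : CommutativeRing.Carrier K) where

  open CommutativeRing K using (Carrier; _≈_; 1#; ring; semiring; *-rawMonoid; reflexive)
  open Exp semiring using (_^_)
  open RawMonoidDefinitions *-rawMonoid using () renaming (sum to product)
  open Monomial K n r ζ using (Monomial)
  open Presentations ring
  open Actions ring Monomial using (Action)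

  -- The block containing a given number, together with the number's colour,
  -- which lies in {0,…,r-2} in the zero block and in {0,…,r-1} elsewhere.
  data Place (k : ℕ) : Set where
    inZero  : (κ : Fin (r ℕ.∸ 1)) → Place k
    inBlock : (b : Fin k) (κ : Fin r) → Place k

  -- The partition (Z , B₁ | ⋯ | Bₖ) is recorded by the place of each number;
  -- every Bⱼ must be hit, while Z may be empty.  For r = 1 there are no zero
  -- block colours, so Z is empty.
  record OP (k : ℕ) : Set where
    field
      place    : Fin n → Place k
      nonempty : ∀ b → ∃₂ λ i κ → place i ≡ inBlock b κ

  open OP

  OP-setoid : ℕ → Setoid 0ℓ 0ℓ
  OP-setoid k = record
    { Carrier       = OP k
    ; _≈_           = λ σ τ → place σ ≗ place τ
    ; isEquivalence = record
      { refl  = λ _ → ≡.refl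
      ; sym   = λ p i → ≡.sym (p i)
      ; trans = λ p q i → ≡.trans (p i) (q i) } }

  permuteOP : ∀ {k} → Permutation′ n → OP k → OP k
  permuteOP w σ = record
    { place    = λ a → place σ (w ⟨$⟩ˡ a)
    ; nonempty = λ b → let i , κ , p = nonempty σ b in
        w ⟨$⟩ʳ i , κ , ≡.trans (≡.cong (place σ) (inverseˡ w)) p }

  shift : ∀ {k} → Fin r → Place k → Place k
  shift d (inZero κ)    = inZero κ
  shift d (inBlock b κ) = inBlock b ((toℕ κ ℕ.+ toℕ d) mod r)

  recolour : ∀ {k} → (Fin n → Fin r) → OP k → OP k
  recolour colour σ = record
    { place    = λ i → shift (colour i) (place σ i)
    ; nonempty = λ b → let i , κ , p = nonempty σ b in
        i , _ , ≡.cong (shift (colour i)) p }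

  factor : ∀ {k} → Fin r → Place k → Carrier
  factor d (inZero κ)    = ζ ^ (toℕ κ ℕ.* toℕ d)
  factor d (inBlock b κ) = 1#

  weight : ∀ {k} → (Fin n → Fin r) → OP k → Carrier
  weight colour σ = product λ i → factor (colour i) (place σ i)

  product-cong : ∀ {m} {f g : Fin m → Carrier} → f ≗ g → product f ≡ product g
  product-cong {zero}  p = ≡.refl
  product-cong {suc m} p =
    ≡.cong₂ (CommutativeRing._*_ K) (p zero) (product-cong (λ i → p (suc i)))

  permuteBasis : ∀ {k} → Permutation′ n → OP k → Combination (OP k)
  permuteBasis w σ = gen (permuteOP w σ)

  diagonalBasis : ∀ {k} → (Fin n → Fin r) → OP k → Combination (OP k)
  diagonalBasis colour σ = weight colour σ • gen (recolour colour σ)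

  K[OP_] : ℕ → Action c (c ⊔ ℓ)
  K[OP k ] = record
    { space      = free (OP-setoid k)
    ; act        = λ (colour , w) → extend (diagonalBasis colour) ∘ extend (permuteBasis w)
    ; act-linear = λ (colour , w) →
        Composition.isLeftModuleHomomorphism (LeftModule.≈ᴹ-trans (free (OP-setoid k)))
          (extend-isLinear (permuteBasis w) (permute-cong w))
          (extend-isLinear (diagonalBasis colour) (diagonal-cong colour))
    }
    where
    permute-cong : ∀ w {s t} → FreeRelation (OP-setoid k) s t →
                   Congruence (FreeRelation (OP-setoid k))
                     (extend (permuteBasis w) s) (extend (permuteBasis w) t)
    permute-cong w (gen-cong p) = relation (gen-cong λ a → p (w ⟨$⟩ˡ a))

    diagonal-cong : ∀ colour {s t} → FreeRelation (OP-setoid k) s t →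
                    Congruence (FreeRelation (OP-setoid k))
                      (extend (diagonalBasis colour) s) (extend (diagonalBasis colour) t)
    diagonal-cong colour (gen-cong p) = •-cong
      (reflexive (product-cong λ i → ≡.cong (factor (colour i)) (p i)))
      (relation (gen-cong λ i → ≡.cong (shift (colour i)) (p i)))

-- Both modules end towers of quotients of one G-module with isomorphic layers: cancel, counting dimensions
-- by a spanning family and evaluations at flats.
module Submission where
open import Agda.Primitive using (Setω)
open import Data.Nat.Base using () renaming (ℕ to O)
open import Data.Nat.Properties using () renaming (≤-reflexive to e1; ≤-trans to e2; ≤-refl to e3; <-≤-trans to e4; +-identityʳ to e5; +-comm to e6; +-assoc to e7; +-suc to e8; m≤m+n to e9; m≤n+m to e0)
open import Defs
open import Algebra.Apartness using (HeytingField)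
open import Data.Nat.Base using (ℕ; NonZero; _≤_; _∸_)
open import Algebra.Bundles using (CommutativeRing)
open import Level using (Level)
open import Algebra.Apartness using (HeytingField)
open import Algebra.Bundles using (CommutativeRing; RawRing; CommutativeMonoid; Ring)
import Algebra.Definitions.RawMonoid as RawMonoidDefinitions
open import Algebra.Module.Bundles using () renaming (LeftModule to i9; module LeftModule to i9)
import Algebra.Module.Construct.TensorUnit as TensorUnit
open import Algebra.Module.Morphism.Structures using (module LeftModuleMorphisms)
import Algebra.Module.Properties.LeftModule as LeftModuleProperties
import Algebra.Properties.AbelianGroup as AbelianGroupProperties
import Algebra.Properties.CommutativeSemigroup as CommutativeSemigroup
import Algebra.Properties.CommutativeSemigroup as CommutativeSemigroupProperties
import Algebra.Properties.CommutativeSemiring.Exp as CommutativeExp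
import Algebra.Properties.Group as GroupProperties
import Algebra.Properties.Monoid.Mult as Mult
import Algebra.Properties.Ring as RingProperties
import Algebra.Properties.Semiring.Exp as Exp
import Algebra.Properties.Semiring.Mult as SemiringMult
import Algebra.Solver.Ring as RingSolver
open import Algebra.Solver.Ring.AlmostCommutativeRing using (AlmostCommutativeRing; fromCommutativeRing; _-Raw-AlmostCommutative⟶_)
import Data.Bool
open import Data.Bool.Base using (if_then_else_; Bool; not; _∧_) renaming (true to b2; false to b1)
import Data.Bool.Properties as Bool
open import Data.Empty using (⊥-elim; ⊥)
open import Data.Fin.Base using (Fin; zero; suc; punchIn; punchOut; toℕ; splitAt; _↑ʳ_; remQuot; fromℕ; fromℕ<; opposite)
import Data.Fin.Base as Fin
open import Data.Fin.Permutation using (_⟨$⟩ʳ_; _⟨$⟩ˡ_; inverseˡ; inverseʳ; Permutation′; permutation)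
open import Data.Fin.Permutation as Permutation using (Permutation′; _⟨$⟩ʳ_; _⟨$⟩ˡ_; _∘ₚ_; transpose; inverseˡ)
open import Data.Fin.Properties using (_≟_; punchInᵢ≢i; punchIn-punchOut; toℕ-injective; combine-injectiveˡ; splitAt-↑ʳ; toℕ<n; splitAt-↑ˡ; splitAt-<; combine-remQuot; splitAt⁻¹-↑ˡ; splitAt⁻¹-↑ʳ; toℕ-fromℕ; toℕ-fromℕ<; toℕ-↑ˡ; opposite-prop; opposite-involutive; ¬∀⟶∃¬)
open import Data.List.Base using (List; []; _∷_; _++_; length; map; allFin)
open import Data.List.Base as List using (List; []; _∷_; length; _++_; map; concatMap; allFin)
open import Data.List.Membership.DecPropositional using (_∈?_)
open import Data.List.Membership.Propositional using (_∈_)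
open import Data.List.Membership.Propositional.Properties using (∈-map⁺; ∈-++⁺ˡ; ∈-++⁺ʳ; ∈-map⁻; ∈-++⁻; ∈-lookup; ∈-concatMap⁺; ∈-concatMap⁻; ∈-∃++; ∈-allFin)
open import Data.List.Properties using (length-++; length-tabulate; length-map; map-++; map-id; ∷-injective)
open import Data.List.Relation.Binary.Permutation.Propositional using (_↭_; prep; ↭-refl; ↭-sym; ↭-trans)
open import Data.List.Relation.Binary.Permutation.Propositional.Properties using ()
import Data.List.Relation.Unary.All as All
import Data.List.Relation.Unary.All.Properties as All
open import Data.List.Relation.Unary.AllPairs using ([]; _∷_)
open import Data.List.Relation.Unary.AllPairs as AllPairs using ([]; _∷_)
open import Data.List.Relation.Unary.Any using (here; there; any?)
open import Data.List.Relation.Unary.Any as Any using (here; there)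
import Data.List.Relation.Unary.Any.Properties as Any
open import Data.List.Relation.Unary.Unique.Propositional using (Unique)
open import Data.List.Relation.Unary.Unique.Propositional.Properties using (map⁺; ++⁺; allFin⁺)
open import Data.Maybe.Base using (Maybe; just; nothing)
open import Data.Nat.Base using (ℕ)
open import Data.Nat.Base as Q using (ℕ; zero; suc; NonZero; _≤_; _<_; z≤n; s≤s; _∸_)
open import Data.Nat.DivMod using (_%_; _/_; m≡m%n+[m/n]*n; [m+kn]%n≡m%n; m<n⇒m%n≡m; _mod_; m%n<n)
open import Data.Nat.Divisibility using (_∣_; _∣?_; divides; m%n≡0⇒n∣m)
open import Data.Nat.Induction using (<-rec)
open import Data.Nat.ListAction using (sum)
import Data.Nat.Properties as Q
open import Data.Nat.Solver using (module +-*-Solver)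
open import Data.Product.Base using (_×_; _,_; ∃; Σ) renaming (proj₁ to p1; proj₂ to p2)
open import Data.Sum.Base using (_⊎_; [_,_]′) renaming (inj₁ to i1; inj₂ to i2)
open import Data.Unit.Base using (⊤; tt)
open import Data.Vec.Base using (Vec; []; _∷_; lookup; replicate; _[_]≔_)
open import Data.Vec.Base as Vec using (Vec; []; _∷_; lookup; _[_]≔_)
import Data.Vec.Functional as Vector
open import Data.Vec.Properties using (lookup∘update; lookup∘update′; []≔-idempotent; []≔-lookup; lookup-replicate; ∷-injectiveʳ; lookup∘tabulate; tabulate∘lookup)
import Data.Vec.Properties as Vec
open import Function.Base using (_∘_; id)
open import Level using (_⊔_; Level; Lift) renaming (suc to lsuc)
open import Relation.Binary.Core using (Rel)
open import Relation.Binary.Definitions using (tri<; tri≈; tri>)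
open import Relation.Binary.PropositionalEquality as U using (_≡_; _≢_; _≗_)
import Relation.Binary.Reasoning.Setoid as SetoidReasoning
open import Relation.Nullary using (yes; no; does; Dec; ¬_)
open import Relation.Nullary.Decidable using (dec-true; dec-false; map′; _×-dec_)
private
 module Int {c ℓ} (K : CommutativeRing c ℓ) where
  open CommutativeRing K
  open SemiringMult semiring using (×-homo-+; ×1-homo-*) renaming (_×_ to _·_)
  open RingProperties ring using (-‿+-comm; -‿distribˡ-*; -‿distribʳ-*; -‿involutive; -0#≈0#)
  open CommutativeSemigroup +-commutativeSemigroup using (interchange)
  open import Relation.Binary.Reasoning.Setoid setoid
  coe : RawRing _ _
  coe = record { Carrier = O × O ; _≈_ = _≡_ ; _+_ = \ (a , b) (c , d) -> a Q.+ c , b Q.+ d ; _*_ = \ (a , b) (c , d) -> a Q.* c Q.+ b Q.* d , a Q.* d Q.+ b Q.* c ; -_ = \ (a , b) -> b , a ; 0# = 0 , 0 ; 1# = 1 , 0 }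
  va : O × O -> Carrier
  va (a , b) = a · 1# - b · 1#
  vf : ∀ A B C D -> (A + C) - (B + D) ≈ (A - B) + (C - D)
  vf A B C D = trans (+-congˡ (sym (-‿+-comm B D))) (interchange A C (- B) (- D))
  vi : ∀ A B C D -> (A * C + B * D) - (A * D + B * C) ≈ (A - B) * (C - D)
  vi A B C D = begin (A * C + B * D) - (A * D + B * C) ≈⟨ +-congˡ (trans (-‿cong (+-comm _ _)) (sym (-‿+-comm _ _))) ⟩ (A * C + B * D) + (- (B * C) + - (A * D)) ≈⟨ +-cong refl (+-comm _ _) ⟩ (A * C + B * D) + (- (A * D) + - (B * C)) ≈⟨ interchange _ _ _ _ ⟩ (A * C + - (A * D)) + (B * D + - (B * C)) ≈⟨ +-congˡ (+-comm _ _) ⟩ (A * C + - (A * D)) + (- (B * C) + B * D) ≈⟨ +-cong (+-congˡ (-‿distribʳ-* A D)) (+-cong (-‿distribˡ-* B C) bD) ⟩ (A * C + A * - D) + (- B * C + - B * - D) ≈⟨ sym (+-cong (distribˡ A C (- D)) (distribˡ (- B) C (- D))) ⟩ A * (C - D) + - B * (C - D) ≈⟨ sym (distribʳ (C - D) A (- B)) ⟩ (A - B) * (C - D) ∎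
   where
   bD : B * D ≈ - B * - D
   bD = trans (sym (-‿involutive _)) (trans (-‿cong (-‿distribʳ-* B D)) (-‿distribˡ-* B (- D)))
  mor : coe -Raw-AlmostCommutative⟶ fromCommutativeRing K
  mor = record { ⟦_⟧ = va ; +-homo = \ (a , b) (c , d) -> trans (+-cong (×-homo-+ 1# a c) (-‿cong (×-homo-+ 1# b d))) (vf _ _ _ _) ; *-homo = \ (a , b) (c , d) -> trans (+-cong (trans (×-homo-+ 1# (a Q.* c) (b Q.* d)) (+-cong (×1-homo-* a c) (×1-homo-* b d))) (-‿cong (trans (×-homo-+ 1# (a Q.* d) (b Q.* c)) (+-cong (×1-homo-* a d) (×1-homo-* b c))))) (vi _ _ _ _) ; -‿homo = \ (a , b) -> trans (+-comm _ _) (trans (+-congˡ (sym (-‿involutive _))) (-‿+-comm _ _)) ; 0-homo = trans (+-identityˡ _) -0#≈0# ; 1-homo = trans (+-congˡ -0#≈0#) (trans (+-identityʳ _) (+-identityʳ _)) }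
  c6 : ∀ p q -> Maybe (va p ≈ va q)
  c6 (a , b) (c , d) with a Q.+ d Q.≟ c Q.+ b
  ... | no _ = nothing
  ... | yes e = just (begin va (a , b) ≈⟨ sym (+-identityʳ _) ⟩ va (a , b) + 0# ≈⟨ +-congˡ (sym (-‿inverseʳ (d · 1#))) ⟩ va (a , b) + va (d , d) ≈⟨ sym (vf _ _ _ _) ⟩ (a · 1# + d · 1#) - (b · 1# + d · 1#) ≈⟨ +-cong (trans (sym (×-homo-+ 1# a d)) (trans (reflexive (U.cong (_· 1#) e)) (×-homo-+ 1# c b))) (-‿cong (+-comm _ _)) ⟩ (c · 1# + b · 1#) - (d · 1# + b · 1#) ≈⟨ vf _ _ _ _ ⟩ va (c , d) + va (b , b) ≈⟨ +-congˡ (-‿inverseʳ _) ⟩ va (c , d) + 0# ≈⟨ +-identityʳ _ ⟩ va (c , d) ∎)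
  open RingSolver coe (fromCommutativeRing K) mor c6 public using (solve; _:=_; _:+_; _:*_; _:-_; :-_)
 module S8 where
  open import Algebra.Bundles using (CommutativeMonoid; CommutativeRing)
  open import Data.Bool.Base using (if_then_else_)
  open import Data.Fin.Base using (Fin; zero; suc; punchIn; splitAt; remQuot)
  open import Data.Fin.Permutation using (Permutation; _⟨$⟩ʳ_)
  open import Data.Fin.Properties using (_≟_; punchInᵢ≢i)
  open import Data.Nat.Base using (ℕ; zero; suc)
  open import Relation.Binary.PropositionalEquality as U using (_≡_; _≢_)
  open import Data.Product.Base using (_×_; _,_; proj₁; proj₂)
  open import Data.Sum.Base using (inj₁; inj₂; [_,_]′; map₁)
  open import Relation.Nullary using (does)
  open import Relation.Nullary.Decidable using (dec-true; dec-false)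
  import Algebra.Properties.CommutativeMonoid.Sum as MonoidSum
  import Algebra.Properties.Ring as RingProperties
  -- The library's sum unfolds, which defeats unification; this one does not.
  module Sn {c ℓ} (M : CommutativeMonoid c ℓ) where
   open CommutativeMonoid M
   private module S = MonoidSum M
   opaque
    ∑ : ∀ {m} -> (Fin m -> Carrier) -> Carrier
    ∑ = S.sum
    ur : ∀ {m} (f : Fin m -> Carrier) -> ∑ f ≡ S.sum f
    ur f = U.refl
    cg : ∀ {q m} (Q : Carrier -> Set q) -> Q ε -> (∀ {a b} -> Q a -> Q b -> Q (a ∙ b)) -> {f : Fin m -> Carrier} -> (∀ i -> Q (f i)) -> Q (∑ f)
    cg {m = zero} Q z s h = z
    cg {m = suc m} Q z s h = s (h zero) (cg Q z s \ i -> h (suc i))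
    ue : (f : Fin 0 -> Carrier) -> ∑ f ≈ ε
    ue f = refl
    sf : ∀ {m} (f : Fin (suc m) -> Carrier) -> ∑ f ≈ f zero ∙ ∑ (\ i -> f (suc i))
    sf f = refl
    cb : ∀ {m} {f g : Fin m -> Carrier} -> (∀ i -> f i ≈ g i) -> ∑ f ≈ ∑ g
    cb = S.sum-cong-≋
    uj : ∀ {m} {f : Fin m -> Carrier} -> (∀ i -> f i ≈ ε) -> ∑ f ≈ ε
    uj {m} e = trans (cb e) (S.sum-replicate-zero m)
    uh : ∀ {m} (f g : Fin m -> Carrier) -> ∑ (\ i -> f i ∙ g i) ≈ ∑ f ∙ ∑ g
    uh = S.∑-distrib-+
    ss : ∀ {m p} (f : Fin m -> Fin p -> Carrier) -> ∑ (\ i -> ∑ (f i)) ≈ ∑ (\ j -> ∑ (\ i -> f i j))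
    ss = S.∑-comm
    rc : ∀ {m} i (f : Fin (suc m) -> Carrier) -> ∑ f ≈ f i ∙ ∑ (\ j -> f (punchIn i j))
    rc i f = S.sum-remove {i = i} f
    pc : ∀ {m p} (f : Fin m -> Carrier) (π : Permutation p m) -> ∑ f ≈ ∑ (\ i -> f (π ⟨$⟩ʳ i))
    pc f π = S.sum-permute f π
   sj : ∀ {m} (f : Fin m -> Carrier) i -> (∀ j -> j ≢ i -> f j ≈ ε) -> ∑ f ≈ f i
   sj {suc m} f i z = trans (rc i f) (trans (∙-congˡ (uj \ j -> z (punchIn i j) (punchInᵢ≢i i j))) (identityʳ _))
   uq : ∀ a {b} (f : Fin a -> Carrier) (g : Fin b -> Carrier) -> ∑ (\ i -> [ f , g ]′ (splitAt a i)) ≈ ∑ f ∙ ∑ g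
   uq zero f g = sym (trans (∙-congʳ (ue f)) (identityˡ _))
   uq (suc a) f g = trans (sf _) (trans (∙-congˡ (trans (cb \ i -> reflexive (shift i)) (uq a (\ i -> f (suc i)) g))) (trans (sym (assoc _ _ _)) (∙-congʳ (sym (sf f)))))
    where
    shift : ∀ i -> [ f , g ]′ (Data.Sum.Base.map₁ suc (splitAt a i)) ≡ [ (\ j -> f (suc j)) , g ]′ (splitAt a i)
    shift i with splitAt a i
    ... | i1 _ = U.refl
    ... | i2 _ = U.refl
   rd : ∀ m {k} (f : Fin m × Fin k -> Carrier) -> ∑ (\ i -> f (remQuot {m} k i)) ≈ ∑ (\ a -> ∑ (\ l -> f (a , l)))
   rd zero f = trans (ue _) (sym (ue _))
   rd (suc m) {k} f = trans (cb \ i -> reflexive (head i)) (trans (uq k (\ l -> f (zero , l)) (\ i -> f (suc (p1 (remQuot {m} k i)) , p2 (remQuot {m} k i)))) (trans (∙-congˡ (rd m \ (a , l) -> f (suc a , l))) (sym (sf _))))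
    where
    head : ∀ i -> f (remQuot {suc m} k i) ≡ [ (\ l -> f (zero , l)) , (\ i -> f (suc (p1 (remQuot {m} k i)) , p2 (remQuot {m} k i))) ]′ (splitAt k i)
    head i with splitAt k i
    ... | i1 _ = U.refl
    ... | i2 _ = U.refl
  module Ho {c ℓ c' ℓ'} (M : CommutativeMonoid c ℓ) (N : CommutativeMonoid c' ℓ') where
   private
    module M = CommutativeMonoid M
    module N = CommutativeMonoid N
    module SM = Sn M
    module SN = Sn N
   ha : (h : M.Carrier -> N.Carrier) -> (∀ {x y} -> x M.≈ y -> h x N.≈ h y) -> h M.ε N.≈ N.ε -> (∀ x y -> h (x M.∙ y) N.≈ h x N.∙ h y) -> ∀ {m} (f : Fin m -> M.Carrier) -> h (SM.∑ f) N.≈ SN.∑ (\ i -> h (f i))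
   ha h cong z add {zero} f = N.trans (cong (SM.ue f)) (N.trans z (N.sym (SN.ue _)))
   ha h cong z add {suc m} f = N.trans (cong (SM.sf f)) (N.trans (add _ _) (N.trans (N.∙-congˡ (ha h cong z add (\ i -> f (suc i)))) (N.sym (SN.sf _))))
  module Ri {c ℓ} (K : CommutativeRing c ℓ) where
   open CommutativeRing K hiding (zero)
   open RingProperties ring using (-‿+-comm; -0#≈0#)
   open Sn +-commutativeMonoid public renaming (uh to ∑-+; uj to ∑-zero)
   open Ho +-commutativeMonoid +-commutativeMonoid
   ui : ∀ {m} a (f : Fin m -> Carrier) -> a * ∑ f ≈ ∑ (\ i -> a * f i)
   ui a = ha (a *_) *-congˡ (zeroʳ a) (distribˡ a)
   uv : ∀ {m} a (f : Fin m -> Carrier) -> ∑ f * a ≈ ∑ (\ i -> f i * a)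
   uv a = ha (_* a) *-congʳ (zeroˡ a) (distribʳ a)
   δ : ∀ {m} -> Fin m -> Fin m -> Carrier
   δ i j = if does (i ≟ j) then 1# else 0#
   s0 : ∀ {m} (i : Fin m) -> δ i i ≡ 1#
   s0 i rewrite dec-true (i ≟ i) U.refl = U.refl
   dc : ∀ {m} {i j : Fin m} -> i ≢ j -> δ i j ≡ 0#
   dc {i = i} {j} p rewrite dec-false (i ≟ j) p = U.refl
   u6 : ∀ {m} (f : Fin m -> Carrier) i -> ∑ (\ j -> δ i j * f j) ≈ f i
   u6 f i = trans (sj _ i (\ j p -> trans (*-congʳ (reflexive (dc (\ e -> p (U.sym e))))) (zeroˡ _))) (trans (*-congʳ (reflexive (s0 i))) (*-identityˡ _))
   ux : ∀ {m} (f : Fin m -> Carrier) i -> ∑ (\ j -> f j * δ j i) ≈ f i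
   ux f i = trans (sj _ i (\ j p -> trans (*-congˡ (reflexive (dc p))) (zeroʳ _))) (trans (*-congˡ (reflexive (s0 i))) (*-identityʳ _))
 open S8
 module In {c ℓ} (K : CommutativeRing c ℓ) where
  open CommutativeRing K hiding (zero)
  open Int K using (solve; _:=_; _:+_; _:*_; _:-_; :-_)
  Inv : Carrier -> Set (c ⊔ ℓ)
  Inv x = ∃ \ y -> x * y ≈ 1#
  Ia : ∀ {x y} -> x ≈ y -> Inv x -> Inv y
  Ia e (z , p) = z , trans (*-congʳ (sym e)) p
  Ih : Inv 1#
  Ih = 1# , *-identityˡ 1#
  Ie : ∀ {x y} -> Inv x -> Inv y -> Inv (x * y)
  Ie {x} {y} (x' , p) (y' , q) = x' * y' , trans (swap x y x' y') (trans (*-cong p q) (*-identityˡ 1#))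
   where
   swap : ∀ a b c d -> (a * b) * (c * d) ≈ (a * c) * (b * d)
   swap = solve 4 (\ a b c d -> (a :* b) :* (c :* d) := (a :* c) :* (b :* d)) refl
  Ij : ∀ {x y} -> Inv (x * y) -> Inv x
  Ij {x} {y} (z , p) = y * z , trans (sym (*-assoc x y z)) p
  Is : ∀ {x y} -> Inv (x * y) -> Inv y
  Is i = Ij (Ia (*-comm _ _) i)
  Il : ∀ {x} -> Inv x -> Inv (- x)
  Il {x} (y , p) = - y , trans (neg x y) p
   where
   neg : ∀ a b -> (- a) * (- b) ≈ a * b
   neg = solve 2 (\ a b -> (:- a) :* (:- b) := a :* b) refl
  can : ∀ {x a} -> Inv x -> x * a ≈ 0# -> a ≈ 0#
  can {x} {a} (y , p) e = trans (sym (*-identityˡ a)) (trans (*-congʳ (trans (sym p) (*-comm x y))) (trans (*-assoc y x a) (trans (*-congˡ e) (zeroʳ y))))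
  mc : ∀ {a b} -> a ≈ b -> a - b ≈ 0#
  mc {a} {b} e = trans (+-congʳ e) (-‿inverseʳ b)
  za : ∀ {a b} -> a - b ≈ 0# -> a ≈ b
  za {a} {b} e = trans (spl a b) (trans (+-congʳ e) (+-identityˡ b))
   where
   spl : ∀ u v -> u ≈ (u - v) + v
   spl = solve 2 (\ u v -> u := (u :- v) :+ v) refl
 module Lk {c ℓ} (K : CommutativeRing c ℓ) (local : ∀ {a b} -> In.Inv K (CommutativeRing._+_ K a b) -> In.Inv K a ⊎ In.Inv K b) (nontrivial : {a : Set (c ⊔ ℓ)} -> In.Inv K (CommutativeRing.0# K) -> a) where
  open CommutativeRing K hiding (zero)
  open In K
  open Ri K
  open Int K using (solve; _:=_; _:+_; _:*_; _:-_; :-_)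
  open import Relation.Binary.Reasoning.Setoid setoid
  bz : ∀ {m} (f : Fin m -> Carrier) -> Inv (∑ f) -> ∃ \ i -> Inv (f i)
  bz {zero} f i = nontrivial (Ia (ue f) i)
  bz {suc m} f i with local (Ia (sf f) i)
  ... | i1 p = zero , p
  ... | i2 p with j , q <- bz (\ j -> f (suc j)) p = suc j , q
  combine : ∀ {m p} -> (Fin m -> Carrier) -> (Fin m -> Fin p -> Carrier) -> Fin p -> Carrier
  combine c v j = ∑ \ i -> c i * v i j
  S1 : ∀ {m p} -> (Fin m -> Fin p -> Carrier) -> Set (c ⊔ ℓ)
  S1 {m} {p} v = (u : Fin p -> Carrier) -> Σ (Fin m -> Carrier) \ c -> ∀ j -> combine c v j ≈ u j
  Ix : ∀ {m p} -> (Fin m -> Fin p -> Carrier) -> Set (c ⊔ ℓ)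
  Ix {m} v = (c : Fin m -> Carrier) -> (∀ j -> combine c v j ≈ 0#) -> ∀ i -> c i ≈ 0#
  -- Gaussian elimination: spanning supplies the pivot, which cannot be found by
  -- testing entries for zero.
  sy : ∀ {m} (v : Fin m -> Fin m -> Carrier) -> S1 v -> Ix v
  sy {zero} v span c e ()
  sy {suc m} v span c e = c8
   where
   uJ : Fin (suc m) -> Carrier
   uJ = δ zero
   p6 : ∃ \ p -> Inv (v p zero)
   p6 with c₀ , s <- span uJ with p , i <- bz (\ i -> c₀ i * v i zero) (Ia (sym (s zero)) Ih) = p , Is i
   p = p1 p6
   w = p1 (p2 p6)
   vp : Fin (suc m) -> Carrier
   vp = v p
   pw : vp zero * w ≈ 1#
   pw = p2 (p2 p6)
   v′ : Fin m -> Fin m -> Carrier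
   v′ i j = v (punchIn p i) (suc j) - v (punchIn p i) zero * (w * vp (suc j))
   rb : ∀ {q} -> (Fin (suc m) -> Carrier) -> (Fin (suc m) -> Fin q -> Carrier) -> Fin q -> Carrier
   rb c v j = ∑ \ i -> c (punchIn p i) * v (punchIn p i) j
   eli : ∀ c j -> combine (\ i -> c (punchIn p i)) v′ j ≈ rb c v (suc j) - rb c v zero * (w * vp (suc j))
   eli c j = begin ∑ (\ i -> c (punchIn p i) * v′ i j) ≈⟨ cb (\ i -> ed (c (punchIn p i)) (v (punchIn p i) (suc j)) (v (punchIn p i) zero) _) ⟩ ∑ (\ i -> c (punchIn p i) * v (punchIn p i) (suc j) + (c (punchIn p i) * v (punchIn p i) zero) * - (w * vp (suc j))) ≈⟨ ∑-+ (\ i -> c (punchIn p i) * v (punchIn p i) (suc j)) _ ⟩ rb c v (suc j) + ∑ (\ i -> (c (punchIn p i) * v (punchIn p i) zero) * - (w * vp (suc j))) ≈⟨ +-congˡ (sym (uv (- (w * vp (suc j))) (\ i -> c (punchIn p i) * v (punchIn p i) zero))) ⟩ rb c v (suc j) + rb c v zero * - (w * vp (suc j)) ≈⟨ pB _ _ _ ⟩ rb c v (suc j) - rb c v zero * (w * vp (suc j)) ∎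
    where
    ed : ∀ a b d e -> a * (b - d * e) ≈ a * b + (a * d) * (- e)
    ed = solve 4 (\ a b d e -> a :* (b :- d :* e) := a :* b :+ (a :* d) :* (:- e)) refl
    pB : ∀ a b d -> a + b * - d ≈ a - b * d
    pB = solve 3 (\ a b d -> a :+ b :* :- d := a :- b :* d) refl
   spl : ∀ c j -> combine c v j ≈ c p * vp j + rb c v j
   spl c j = rc p (\ i -> c i * v i j)
   b4 : ∀ a b x y -> a * b + x ≈ y -> x ≈ y - a * b
   b4 a b x y e = trans (lem a b x) (+-congʳ e)
    where
    lem : ∀ a b x -> x ≈ (a * b + x) - a * b
    lem = solve 3 (\ a b x -> x := (a :* b :+ x) :- a :* b) refl
   cX : ∀ a b s t y -> b * w ≈ 1# -> s ≈ y - a * t -> ∀ z -> z ≈ 0# - a * b -> s - z * (w * t) ≈ y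
   cX a b s t y bw es z ez = begin s - z * (w * t) ≈⟨ +-cong es (-‿cong (*-congʳ (trans ez (+-identityˡ _)))) ⟩ (y - a * t) - - (a * b) * (w * t) ≈⟨ regroup y a b w t ⟩ y + ((b * w) * (a * t) - a * t) ≈⟨ +-congˡ (mc (trans (*-congʳ bw) (*-identityˡ _))) ⟩ y + 0# ≈⟨ +-identityʳ y ⟩ y ∎
    where
    regroup : ∀ y a b w t -> (y - a * t) - - (a * b) * (w * t) ≈ y + ((b * w) * (a * t) - a * t)
    regroup = solve 5 (\ y a b w t -> (y :- a :* t) :- (:- (a :* b)) :* (w :* t) := y :+ ((b :* w) :* (a :* t) :- a :* t)) refl
   er : (Fin m -> Carrier) -> Fin (suc m) -> Carrier
   er u zero = 0#
   er u (suc j) = u j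
   et : ∀ c (u : Fin (suc m) -> Carrier) -> u zero ≈ 0# -> (∀ j -> combine c v j ≈ u j) -> ∀ j -> combine (\ i -> c (punchIn p i)) v′ j ≈ u (suc j)
   et c u u0 e j = trans (eli c j) (cX (c p) (vp zero) _ (vp (suc j)) _ pw (b4 _ _ _ _ (trans (sym (spl c (suc j))) (e (suc j)))) _ (b4 _ _ _ _ (trans (sym (spl c zero)) (trans (e zero) u0))))
   gx : S1 v′
   gx u with d , s <- span (er u) = (\ i -> d (punchIn p i)) , et d (er u) refl s
   ot : ∀ i -> c (punchIn p i) ≈ 0#
   ot = sy v′ gx (\ i -> c (punchIn p i)) (et c (\ _ -> 0#) refl e)
   cp : c p ≈ 0#
   cp = can (p2 p6) (trans (*-comm _ _) (trans (sym (+-identityʳ _)) (trans (+-congˡ (sym (∑-zero \ i -> trans (*-congʳ (ot i)) (zeroˡ _)))) (trans (sym (spl c zero)) (e zero)))))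
   c8 : ∀ i -> c i ≈ 0#
   c8 i with p ≟ i
   ... | yes U.refl = cp
   ... | no p≢i = trans (reflexive (U.cong c (U.sym (punchIn-punchOut p≢i)))) (ot (punchOut p≢i))
  -- Forward substitution, iterated: after t rounds the entries of rank below t are final.
  module Tri {m} (A : Fin m -> Fin m -> Carrier) (rf : Fin m -> O) (diagonal : ∀ i -> Inv (A i i)) (lo : ∀ i j -> i ≢ j -> rf i Q.≤ rf j -> A i j ≈ 0#) (F : Fin m -> Carrier) where
   off : (Fin m -> Carrier) -> Fin m -> Carrier
   off H i = ∑ \ j -> if does (i ≟ j) then 0# else A i j * H j
   sg : (Fin m -> Carrier) -> Fin m -> Carrier
   sg H i = p1 (diagonal i) * (F i - off H i)
   ite : O -> Fin m -> Carrier
   ite zero = \ _ -> 0#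
   ite (suc t) = sg (ite t)
   oz : ∀ {H H'} i -> (∀ j -> rf j Q.< rf i -> H j ≈ H' j) -> off H i ≈ off H' i
   oz {H} {H'} i e = cb en
    where
    en : ∀ j -> (if does (i ≟ j) then 0# else A i j * H j) ≈ (if does (i ≟ j) then 0# else A i j * H' j)
    en j with i ≟ j
    ... | yes _ = refl
    ... | no p with rf i Q.≤? rf j
    ... | yes q = trans (trans (*-congʳ (lo i j p q)) (zeroˡ _)) (sym (trans (*-congʳ (lo i j p q)) (zeroˡ _)))
    ... | no q = *-congˡ (e j (Q.≰⇒> q))
   g3 : ∀ t i -> rf i Q.< t -> ite t i ≈ ite (suc t) i
   g3 (suc t) i (Q.s≤s q) = *-congˡ (+-congˡ (-‿cong (oz i \ j p -> g3 t j (e4 p q))))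
   bel : ∀ {m} (f : Fin m -> O) -> O
   bel {zero} f = 0
   bel {suc m} f = suc (f zero) Q.+ bel (\ i -> f (suc i))
   bj : ∀ {m} (f : Fin m -> O) i -> f i Q.< bel f
   bj f zero = e9 _ _
   bj f (suc i) = e4 (bj (\ i -> f (suc i)) i) (e0 _ _)
   sol : Fin m -> Carrier
   sol = ite (bel rf)
   dx : ∀ i -> ∑ (\ j -> A i j * sol j) ≈ F i
   dx i = begin ∑ (\ j -> A i j * H j) ≈⟨ cb sep ⟩ ∑ (\ j -> δ i j * (A i j * H j) + (if does (i ≟ j) then 0# else A i j * H j)) ≈⟨ ∑-+ (\ j -> δ i j * (A i j * H j)) _ ⟩ ∑ (\ j -> δ i j * (A i j * H j)) + off H i ≈⟨ +-congʳ (trans (u6 (\ j -> A i j * H j) i) (*-congˡ (g3 _ i (bj rf i)))) ⟩ A i i * (w * (F i - off H i)) + off H i ≈⟨ +-congʳ (trans (sym (*-assoc _ _ _)) (trans (*-congʳ (p2 (diagonal i))) (*-identityˡ _))) ⟩ (F i - off H i) + off H i ≈⟨ sym (res (F i) (off H i)) ⟩ F i ∎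
    where
    H = sol
    w = p1 (diagonal i)
    res : ∀ a b -> a ≈ (a - b) + b
    res = solve 2 (\ a b -> a := (a :- b) :+ b) refl
    sep : ∀ j -> A i j * H j ≈ δ i j * (A i j * H j) + (if does (i ≟ j) then 0# else A i j * H j)
    sep j with i ≟ j
    ... | yes _ = sym (trans (+-identityʳ _) (*-identityˡ _))
    ... | no _ = sym (trans (+-congʳ (zeroˡ _)) (+-identityˡ _))
 module Pe {c ℓ} (K : CommutativeRing c ℓ) (local : ∀ {a b} -> In.Inv K (CommutativeRing._+_ K a b) -> In.Inv K a ⊎ In.Inv K b) (char0 : ∀ m -> In.Inv K (RawMonoidDefinitions._×_ (CommutativeRing.+-rawMonoid K) (suc m) (CommutativeRing.1# K)))
  where
  open CommutativeRing K hiding (zero)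
  open In K
  open Ri K
  open Int K using (solve; _:=_; _:+_; _:*_; _:-_; :-_)
  open Mult +-monoid using (×-homo-+)
  open import Relation.Binary.Reasoning.Setoid setoid
  nat : O -> Carrier
  nat m = RawMonoidDefinitions._×_ +-rawMonoid m 1#
  -- Polynomial functions of degree less than e, and monic ones of degree e.
  data Low : O -> (Carrier -> Carrier) -> Set (c ⊔ ℓ) where
   ll : ∀ {f} -> (∀ x -> f x ≈ 0#) -> Low 0 f
   lf : ∀ {e f} a g -> Low e g -> (∀ x -> f x ≈ a + x * g x) -> Low (suc e) f
  data Mo : O -> (Carrier -> Carrier) -> Set (c ⊔ ℓ) where
   mj : ∀ {f} -> (∀ x -> f x ≈ 1#) -> Mo 0 f
   mh : ∀ {e f} a g -> Mo e g -> (∀ x -> f x ≈ a + x * g x) -> Mo (suc e) f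
  private
   aW : ∀ a b x u v -> (a + x * u) + (b + x * v) ≈ (a + b) + x * (u + v)
   aW = solve 5 (\ a b x u v -> (a :+ x :* u) :+ (b :+ x :* v) := (a :+ b) :+ x :* (u :+ v)) refl
   m0 : ∀ a x u v -> (a + x * u) * v ≈ x * (u * v) + a * v
   m0 = solve 4 (\ a x u v -> (a :+ x :* u) :* v := x :* (u :* v) :+ a :* v) refl
   gu : ∀ b a x u -> b * (a + x * u) ≈ b * a + x * (b * u)
   gu = solve 4 (\ b a x u -> b :* (a :+ x :* u) := b :* a :+ x :* (b :* u)) refl
  Le : ∀ {e f g} -> (∀ x -> g x ≈ f x) -> Low e f -> Low e g
  Le e (ll p) = ll \ x -> trans (e x) (p x)
  Le e (lf a h l p) = lf a h l \ x -> trans (e x) (p x)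
  Mb : ∀ {e f g} -> (∀ x -> g x ≈ f x) -> Mo e f -> Mo e g
  Mb e (mj p) = mj \ x -> trans (e x) (p x)
  Mb e (mh a h l p) = mh a h l \ x -> trans (e x) (p x)
  Lg : ∀ e {f} -> (∀ x -> f x ≈ 0#) -> Low e f
  Lg zero p = ll p
  Lg (suc e) p = lf 0# (\ _ -> 0#) (Lg e \ _ -> refl) \ x -> trans (p x) (sym (trans (+-identityˡ _) (zeroʳ x)))
  Lf : ∀ {e f g} -> Low e f -> Low e g -> Low e (\ x -> f x + g x)
  Lf (ll p) (ll q) = ll \ x -> trans (+-cong (p x) (q x)) (+-identityˡ _)
  Lf (lf a f′ l p) (lf b g′ k q) = lf (a + b) _ (Lf l k) \ x -> trans (+-cong (p x) (q x)) (aW _ _ _ _ _)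
  Lb : ∀ {e f} b -> Low e f -> Low e (\ x -> b * f x)
  Lb b (ll p) = ll \ x -> trans (*-congˡ (p x)) (zeroʳ b)
  Lb b (lf a f′ l p) = lf (b * a) _ (Lb b l) \ x -> trans (*-congˡ (p x)) (gu _ _ _ _)
  Lh : ∀ {e f} -> Low e f -> Low e (\ x -> - f x)
  Lh l = Le (\ x -> sym (minus-one _)) (Lb (- 1#) l)
   where open import Algebra.Properties.Ring ring renaming (-1*x≈-x to minus-one)
  Lc : ∀ {e e' f} -> e Q.≤ e' -> Low e f -> Low e' f
  Lc _ (ll p) = Lg _ p
  Lc (Q.s≤s q) (lf a g l p) = lf a g (Lc q l) p
  Lj : ∀ {e f} -> Low e f -> Low (suc e) (\ x -> x * f x)
  Lj l = lf 0# _ l \ x -> sym (+-identityˡ _)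
  Ld : ∀ {a b f g} -> Low (suc a) f -> Low b g -> Low (a Q.+ b) (\ x -> f x * g x)
  Ld {zero} (lf a f′ (ll z) p) k = Le (\ x -> trans (*-congʳ (trans (p x) (trans (+-congˡ (trans (*-congˡ (z x)) (zeroʳ x))) (+-identityʳ a)))) refl) (Lb a k)
  Ld {suc n} {b} (lf a f′ l p) k = Le (\ x -> trans (*-congʳ (p x)) (m0 _ _ _ _)) (Lf (Lj (Ld l k)) (Lc (e0 b (suc n)) (Lb a k)))
  Mon : ∀ {e f} -> Mo e f -> Low (suc e) f
  Mon (mj p) = lf 1# (\ _ -> 0#) (ll \ _ -> refl) \ x -> trans (p x) (sym (trans (+-congˡ (zeroʳ x)) (+-identityʳ _)))
  Mon (mh a g l p) = lf a g (Mon l) p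
  Mc : ∀ {e f g} -> Mo e f -> Low e g -> Mo e (\ x -> f x + g x)
  Mc (mj p) (ll q) = mj \ x -> trans (+-cong (p x) (q x)) (+-identityʳ _)
  Mc (mh a f′ l p) (lf b g′ k q) = mh (a + b) _ (Mc l k) \ x -> trans (+-cong (p x) (q x)) (aW _ _ _ _ _)
  Md : ∀ {a b f g} -> Mo a f -> Mo b g -> Mo (a Q.+ b) (\ x -> f x * g x)
  Md (mj p) k = Mb (\ x -> trans (*-congʳ (p x)) (*-identityˡ _)) k
  Md {suc n} {b} (mh a f′ l p) k = Mb (\ x -> trans (*-congʳ (p x)) (m0 _ _ _ _)) (Mc (mh 0# _ (Md l k) (\ x -> sym (+-identityˡ _))) (Lc (Q.s≤s (e0 b n)) (Lb a (Mon k))))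
  dj : ∀ {e f} -> Mo (suc e) f -> ∀ y -> Σ (Carrier -> Carrier) \ g -> Mo e g × (∀ x -> f x - f y ≈ (x - y) * g x)
  dj (mh a f₁ (mj q) p) y = f₁ , mj q , \ x -> trans (+-cong (p x) (-‿cong (p y))) (trans (+-cong (+-congˡ (*-congˡ (q x))) (-‿cong (+-congˡ (*-congˡ (q y))))) (trans (di a x y 1#) (*-congˡ (sym (q x)))))
   where
   di : ∀ a x y o -> (a + x * o) - (a + y * o) ≈ (x - y) * o
   di = solve 4 (\ a x y o -> (a :+ x :* o) :- (a :+ y :* o) := (x :- y) :* o) refl
  dj (mh a f₁ m@(mh _ _ _ _) p) y with g , mg , d <- dj m y = (\ x -> f₁ x + y * g x) , Mc m (Lb y (Mon mg)) , \ x -> trans (+-cong (p x) (-‿cong (p y))) (trans (di a x y (f₁ x) (f₁ y)) (trans (+-congˡ (*-congˡ (d x))) (factor x y (f₁ x) (g x))))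
   where
   di : ∀ a x y u v -> (a + x * u) - (a + y * v) ≈ (x - y) * u + y * (u - v)
   di = solve 5 (\ a x y u v -> (a :+ x :* u) :- (a :+ y :* v) := (x :- y) :* u :+ y :* (u :- v)) refl
   factor : ∀ x y u g -> (x - y) * u + y * ((x - y) * g) ≈ (x - y) * (u + y * g)
   factor = solve 4 (\ x y u g -> (x :- y) :* u :+ y :* ((x :- y) :* g) := (x :- y) :* (u :+ y :* g)) refl
  Al : ∀ {m} -> (Fin m -> Carrier) -> Set (c ⊔ ℓ)
  Al p = ∀ i j -> i ≢ j -> Inv (p i - p j)
  non : ∀ {e f} -> Mo e f -> (p : Fin (suc e) -> Carrier) -> Al p -> ∃ \ i -> Inv (f (p i))
  non (mj q) p apart = zero , Ia (sym (q _)) Ih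
  non m@(mh _ _ _ _) p apart with g , mg , d <- dj m (p zero) with i , v <- non mg (\ i -> p (suc i)) (\ i j i≢j -> apart (suc i) (suc j) (\ e -> i≢j (Data.Fin.Properties.suc-injective e))) with local (Ia (sym (d (p (suc i)))) (Ie (apart (suc i) zero (\ ())) v))
  ... | i1 w = suc i , w
  ... | i2 w = zero , Ia (-‿involutive _) (Il w)
   where open import Algebra.Properties.Ring ring using (-‿involutive)
  So : ∀ {m} -> (Fin m -> Fin m -> Carrier) -> Set (c ⊔ ℓ)
  So {m} A = (F : Fin m -> Carrier) -> Σ (Fin m -> Carrier) \ H -> ∀ i -> ∑ (\ j -> A i j * H j) ≈ F i
  -- Fraction-free elimination keeps the matrix monic on the diagonal, so no pivot search is needed.
  ga : ∀ {m} e (L : Carrier -> Fin m -> Fin m -> Carrier) -> (∀ i -> Mo e (\ x -> L x i i)) -> (∀ i j -> i ≢ j -> Low e (\ x -> L x i j)) -> ∃ \ d -> Σ (Carrier -> Carrier) \ f -> Mo d f × (∀ x -> Inv (f x) -> So (L x))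
  ga {zero} e L diag off = 0 , (\ _ -> 1#) , mj (\ _ -> refl) , \ x _ F -> (\ ()) , \ ()
  ga {suc m} e L diag off with d , f , mf , s <- ga {m} (e Q.+ e) (\ x i j -> L x zero zero * L x (suc i) (suc j) - L x (suc i) zero * L x zero (suc j)) (\ i -> Mc (Md (diag zero) (diag (suc i))) (Lh (Ld (Lc (Q.n≤1+n e) (off (suc i) zero (\ ()))) (off zero (suc i) (\ ()))))) (\ i j i≢j -> Lf (Ld (Mon (diag zero)) (off (suc i) (suc j) (\ eq -> i≢j (Data.Fin.Properties.suc-injective eq)))) (Lh (Ld (Lc (Q.n≤1+n e) (off (suc i) zero (\ ()))) (off zero (suc j) (\ ()))))) = e Q.+ d , (\ x -> L x zero zero * f x) , Md (diag zero) mf , b4 s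
   where
   b4 : {f : Carrier -> Carrier} -> (∀ x -> Inv (f x) -> So (\ i j -> L x zero zero * L x (suc i) (suc j) - L x (suc i) zero * L x zero (suc j))) -> ∀ x -> Inv (L x zero zero * f x) -> So (L x)
   b4 s x v F = H , rh
    where
    A = L x
    a = A zero zero
    aA : Inv a
    aA = Ij v
    b = p1 aA
    red = s x (Is v) (\ i -> a * F (suc i) - A (suc i) zero * F zero)
    H' = p1 red
    top = ∑ (\ j -> A zero (suc j) * H' j)
    H : Fin (suc m) -> Carrier
    H zero = b * (F zero - top)
    H (suc j) = H' j
    aH : a * H zero ≈ F zero - top
    aH = trans (sym (*-assoc _ _ _)) (trans (*-congʳ (p2 aA)) (*-identityˡ _))
    rh : ∀ i -> ∑ (\ j -> A i j * H j) ≈ F i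
    rh zero = trans (sf _) (trans (+-congʳ aH) (res (F zero) top))
     where
     res : ∀ u v -> (u - v) + v ≈ u
     res = solve 2 (\ u v -> (u :- v) :+ v := u) refl
    rh (suc i) = za (can aA (begin a * (∑ (\ j -> A (suc i) j * H j) - F (suc i)) ≈⟨ *-congˡ (+-congʳ (sf _)) ⟩ a * ((p * H zero + ∑ (\ j -> A (suc i) (suc j) * H' j)) - F (suc i)) ≈⟨ ed a p (H zero) _ (F (suc i)) ⟩ p * (a * H zero) + (a * ∑ (\ j -> A (suc i) (suc j) * H' j) - a * F (suc i)) ≈⟨ +-cong (*-congˡ aH) (+-congʳ (ui a _)) ⟩ p * (F zero - top) + (∑ (\ j -> a * (A (suc i) (suc j) * H' j)) - a * F (suc i)) ≈⟨ col p (F zero) top _ (a * F (suc i)) ⟩ (∑ (\ j -> a * (A (suc i) (suc j) * H' j)) + - p * top) - (a * F (suc i) - p * F zero) ≈⟨ +-congʳ (+-congˡ (ui (- p) _)) ⟩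
     (∑ (\ j -> a * (A (suc i) (suc j) * H' j)) + ∑ (\ j -> - p * (A zero (suc j) * H' j))) - (a * F (suc i) - p * F zero) ≈⟨ +-congʳ (trans (sym (∑-+ _ _)) (cb \ j -> mer a (A (suc i) (suc j)) (H' j) p (A zero (suc j)))) ⟩
     ∑ (\ j -> (a * A (suc i) (suc j) - p * A zero (suc j)) * H' j) - (a * F (suc i) - p * F zero) ≈⟨ mc (p2 red i) ⟩
     0# ∎))
     where
     p = A (suc i) zero
     ed : ∀ a p h s f -> a * ((p * h + s) - f) ≈ p * (a * h) + (a * s - a * f)
     ed = solve 5 (\ a p h s f -> a :* ((p :* h :+ s) :- f) := p :* (a :* h) :+ (a :* s :- a :* f)) refl
     col : ∀ p f t s g -> p * (f - t) + (s - g) ≈ (s + - p * t) - (g - p * f)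
     col = solve 5 (\ p f t s g -> p :* (f :- t) :+ (s :- g) := (s :+ (:- p) :* t) :- (g :- p :* f)) refl
     mer : ∀ a b h p d -> a * (b * h) + - p * (d * h) ≈ (a * b - p * d) * h
     mer = solve 5 (\ a b h p d -> a :* (b :* h) :+ (:- p) :* (d :* h) := (a :* b :- p :* d) :* h) refl
  nm : ∀ b a -> b Q.< a -> Inv (nat a - nat b)
  nm b a p with Q.m≤n⇒∃[o]m+o≡n p
  ... | (d , U.refl) = Ia (trans (ca (nat (suc d)) (nat b)) (+-congʳ (trans (+-comm _ _) (trans (sym (×-homo-+ 1# b (suc d))) (reflexive (U.cong nat (e8 b d))))))) (char0 d)
   where
   ca : ∀ u v -> u ≈ (u + v) - v
   ca = solve 2 (\ u v -> u := (u :+ v) :- v) refl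
  nh : ∀ a b -> a ≢ b -> Inv (nat a - nat b)
  nh a b a≢b with Q.<-cmp a b
  ... | tri≈ _ e _ = ⊥-elim (a≢b e)
  ... | tri> _ _ b<a = nm b a b<a
  ... | tri< a<b _ _ = Ia (flip (nat b) (nat a)) (Il (nm a b a<b))
   where
   flip : ∀ u v -> - (u - v) ≈ v - u
   flip = solve 2 (\ u v -> :- (u :- v) := v :- u) refl
  sh : ∀ {m} -> (Fin m -> Fin m -> Carrier) -> Carrier -> Fin m -> Fin m -> Carrier
  sh B x i j = x * δ i j + B i j
  dt : ∀ {m} (B : Fin m -> Fin m -> Carrier) -> ∃ \ d -> Σ (Carrier -> Carrier) \ f -> Mo d f × (∀ x -> Inv (f x) -> So (sh B x))
  dt B = ga 1 (sh B) (\ i -> mh (B i i) (\ _ -> 1#) (mj \ _ -> refl) \ x -> trans (+-congʳ (*-congˡ (reflexive (s0 i)))) (+-comm _ _)) (\ i j i≢j -> lf (B i j) (\ _ -> 0#) (ll \ _ -> refl) \ x -> trans (+-congʳ (*-congˡ (reflexive (dc i≢j)))) (+-comm _ _))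
  -- The first condition is posed for 1/λ, where it becomes monic.
  gb : ∀ {m} (A B : Fin m -> Fin m -> Carrier) -> Σ Carrier \ x -> So (\ i j -> δ i j + x * A i j) × So (sh B x)
  gb A B with d₁ , f₁ , m₁ , s₁ <- dt B with d₂ , f₂ , m₂ , s₂ <- dt A = c8 (non m₂ (\ t -> p1 (pg t)) rG)
   where
   index : Fin (suc d₂) -> Fin (suc d₁) -> O
   index t i = toℕ (Fin.combine t i)
   cho : ∀ t -> ∃ \ i -> Inv (f₁ (nat (suc (index t i))))
   cho t = non m₁ (\ i -> nat (suc (index t i))) \ i j i≢j -> nh _ _ \ e -> i≢j (inj t i j (toℕ-injective (Q.suc-injective e)))
    where
    open import Data.Fin.Properties using (combine-injectiveʳ)
    inj : ∀ t i j -> Fin.combine t i ≡ Fin.combine t j -> i ≡ j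
    inj t i j = combine-injectiveʳ t i t j
   va : Fin (suc d₂) -> O
   va t = suc (index t (p1 (cho t)))
   poi : Fin (suc d₂) -> Carrier
   poi t = nat (va t)
   pg : ∀ t -> Inv (poi t)
   pg t = char0 (index t (p1 (cho t)))
   rG : Al (\ t -> p1 (pg t))
   rG s t s≢t = Is {x = poi s * poi t} (Ia (sym (trans (di (poi s) (poi t) _ _) (+-cong (trans (*-congʳ (p2 (pg s))) (*-identityˡ _)) (-‿cong (trans (*-congʳ (p2 (pg t))) (*-identityˡ _)))))) (nh (va t) (va s) \ e -> s≢t (U.sym (combine-injectiveˡ t _ s _ (toℕ-injective (Q.suc-injective e))))))
    where
    di : ∀ a b u v -> (a * b) * (u - v) ≈ (a * u) * b - (b * v) * a
    di = solve 4 (\ a b u v -> (a :* b) :* (u :- v) := (a :* u) :* b :- (b :* v) :* a) refl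
   c8 : (∃ \ t -> Inv (f₂ (p1 (pg t)))) -> Σ Carrier \ x -> So (\ i j -> δ i j + x * A i j) × So (sh B x)
   c8 (t , v) = x , one , s₁ x (p2 (cho t))
    where
    x = poi t
    y = p1 (pg t)
    one : So (\ i j -> δ i j + x * A i j)
    one F with H , r <- s₂ y v (\ i -> y * F i) = H , \ i -> begin ∑ (\ j -> (δ i j + x * A i j) * H j) ≈⟨ cb (\ j -> trans (*-congʳ (+-congʳ (trans (sym (*-identityˡ _)) (*-congʳ (sym (p2 (pg t))))))) (factor x y (δ i j) (A i j) (H j))) ⟩ ∑ (\ j -> x * (sh A y i j * H j)) ≈⟨ sym (ui x _) ⟩ x * ∑ (\ j -> sh A y i j * H j) ≈⟨ *-congˡ (r i) ⟩ x * (y * F i) ≈⟨ sym (*-assoc _ _ _) ⟩ x * y * F i ≈⟨ *-congʳ (p2 (pg t)) ⟩ 1# * F i ≈⟨ *-identityˡ _ ⟩ F i ∎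
     where
     factor : ∀ x y d a h -> (x * y * d + x * a) * h ≈ x * ((y * d + a) * h)
     factor = solve 5 (\ x y d a h -> (x :* y :* d :+ x :* a) :* h := x :* ((y :* d :+ a) :* h)) refl
 module Lin {c ℓ} (K : CommutativeRing c ℓ) where
  open CommutativeRing K using (Carrier; _≈_; _+_; _*_; -_; 0#; 1#; ring)
  private module K = CommutativeRing K
  module La {m ℓm} (V : i9 ring m ℓm) where
   open i9 V public using (*ₗ-assoc; *ₗ-cong; *ₗ-congʳ; *ₗ-congˡ; *ₗ-distribʳ; *ₗ-distribˡ; *ₗ-identityˡ; *ₗ-zeroʳ; *ₗ-zeroˡ; +ᴹ-abelianGroup; +ᴹ-assoc; +ᴹ-comm; +ᴹ-commutativeMonoid; +ᴹ-cong; +ᴹ-congʳ; +ᴹ-congˡ; +ᴹ-group; +ᴹ-identityʳ; +ᴹ-identityˡ; +ᴹ-isCommutativeMonoid; -ᴹ_; -ᴹ‿cong; -ᴹ‿inverse; -ᴹ‿inverseʳ; -ᴹ‿inverseˡ; 0ᴹ; Carrierᴹ; _*ₗ_; _+ᴹ_; _≈ᴹ_; isLeftModule; isLeftSemimodule; isPreleftSemimodule; rawLeftModule; ≈ᴹ-refl; ≈ᴹ-reflexive; ≈ᴹ-setoid; ≈ᴹ-sym; ≈ᴹ-trans)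
   open GroupProperties +ᴹ-group public using (identityˡ-unique) renaming (ε⁻¹≈ε to -0ᴹ)
   open AbelianGroupProperties +ᴹ-abelianGroup public using (⁻¹-∙-comm)
   open CommutativeSemigroupProperties (CommutativeMonoid.commutativeSemigroup +ᴹ-commutativeMonoid) public using () renaming (interchange to +ᴹ-interchange)
   open Sn +ᴹ-commutativeMonoid public using () renaming (∑ to ∑ᴹ; ue to ∑ᴹ-0; sf to ∑ᴹ-suc; cb to ∑ᴹ-cong; uj to ∑ᴹ-zero; uh to ∑ᴹ-+; ss to ∑ᴹ-swap; pc to ∑ᴹ-permute; sj to ∑ᴹ-single)
   infixl 6 _−_
   _−_ : Carrierᴹ -> Carrierᴹ -> Carrierᴹ
   u − v = u +ᴹ -ᴹ v
   cf : ∀ {u u′ v v′} -> u ≈ᴹ u′ -> v ≈ᴹ v′ -> u − v ≈ᴹ u′ − v′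
   cf p q = +ᴹ-cong p (-ᴹ‿cong q)
   mc : ∀ {u v} -> u ≈ᴹ v -> u − v ≈ᴹ 0ᴹ
   mc {u} {v} p = ≈ᴹ-trans (+ᴹ-congʳ p) (-ᴹ‿inverseʳ v)
   za : ∀ {u v} -> u − v ≈ᴹ 0ᴹ -> u ≈ᴹ v
   za {u} {v} p = begin u ≈⟨ ≈ᴹ-sym (+ᴹ-identityʳ u) ⟩ u +ᴹ 0ᴹ ≈⟨ +ᴹ-congˡ (≈ᴹ-sym (-ᴹ‿inverseˡ v)) ⟩ u +ᴹ (-ᴹ v +ᴹ v) ≈⟨ ≈ᴹ-sym (+ᴹ-assoc u _ v) ⟩ u − v +ᴹ v ≈⟨ +ᴹ-congʳ p ⟩ 0ᴹ +ᴹ v ≈⟨ +ᴹ-identityˡ v ⟩ v ∎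
    where open SetoidReasoning ≈ᴹ-setoid
   ig : ∀ u -> u − 0ᴹ ≈ᴹ u
   ig u = ≈ᴹ-trans (+ᴹ-congˡ -0ᴹ) (+ᴹ-identityʳ u)
   ih : ∀ a b u v -> (a +ᴹ b) − (u +ᴹ v) ≈ᴹ (a − u) +ᴹ (b − v)
   ih a b u v = ≈ᴹ-trans (+ᴹ-congˡ (≈ᴹ-sym (⁻¹-∙-comm u v))) (+ᴹ-interchange a b _ _)
   na : ∀ v -> (- 1#) *ₗ v ≈ᴹ -ᴹ v
   na v = LeftModuleProperties.inverseˡ-uniqueᴹ V _ v (begin (- 1#) *ₗ v +ᴹ v ≈⟨ +ᴹ-congˡ (≈ᴹ-sym (*ₗ-identityˡ v)) ⟩ (- 1#) *ₗ v +ᴹ 1# *ₗ v ≈⟨ ≈ᴹ-sym (*ₗ-distribʳ v (- 1#) 1#) ⟩ (- 1# + 1#) *ₗ v ≈⟨ *ₗ-congʳ (K.-‿inverseˡ 1#) ⟩ 0# *ₗ v ≈⟨ *ₗ-zeroˡ v ⟩ 0ᴹ ∎)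
    where open SetoidReasoning ≈ᴹ-setoid
   sl : ∀ a b v -> a *ₗ (b *ₗ v) ≈ᴹ b *ₗ (a *ₗ v)
   sl a b v = ≈ᴹ-trans (≈ᴹ-sym (*ₗ-assoc a b v)) (≈ᴹ-trans (*ₗ-congʳ (K.*-comm a b)) (*ₗ-assoc b a v))
   nb : ∀ a v -> a *ₗ (-ᴹ v) ≈ᴹ -ᴹ (a *ₗ v)
   nb a v = ≈ᴹ-trans (*ₗ-congˡ (≈ᴹ-sym (na v))) (≈ᴹ-trans (sl a (- 1#) v) (na _))
   uf : ∀ {p} a (f : Fin p -> Carrierᴹ) -> a *ₗ ∑ᴹ f ≈ᴹ ∑ᴹ (\ i -> a *ₗ f i)
   uf a = Ho.ha +ᴹ-commutativeMonoid +ᴹ-commutativeMonoid (a *ₗ_) *ₗ-congˡ (*ₗ-zeroʳ a) (*ₗ-distribˡ a)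
   ut : ∀ {p} (f : Fin p -> Carrier) v -> Ri.∑ K f *ₗ v ≈ᴹ ∑ᴹ (\ i -> f i *ₗ v)
   ut f v = Ho.ha K.+-commutativeMonoid +ᴹ-commutativeMonoid (_*ₗ v) *ₗ-congʳ (*ₗ-zeroˡ v) (*ₗ-distribʳ v) f
   co : ∀ {p} -> (Fin p -> Carrier) -> (Fin p -> Carrierᴹ) -> Carrierᴹ
   co a v = ∑ᴹ \ i -> a i *ₗ v i
   cC : ∀ {p} (a b : Fin p -> Carrier) v -> co (\ i -> a i + b i) v ≈ᴹ co a v +ᴹ co b v
   cC a b v = ≈ᴹ-trans (∑ᴹ-cong \ i -> *ₗ-distribʳ (v i) (a i) (b i)) (∑ᴹ-+ _ _)
   cB : ∀ {p} s (a : Fin p -> Carrier) v -> co (\ i -> s * a i) v ≈ᴹ s *ₗ co a v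
   cB s a v = ≈ᴹ-trans (∑ᴹ-cong \ i -> *ₗ-assoc s (a i) (v i)) (≈ᴹ-sym (uf s _))
   cL : ∀ {p} (a : Fin p -> Carrier) v -> co (\ i -> - a i) v ≈ᴹ -ᴹ co a v
   cL a v = ≈ᴹ-trans (∑ᴹ-cong \ i -> *ₗ-congʳ (K.sym (-1*x≈-x (a i)))) (≈ᴹ-trans (cB (- 1#) a v) (na _))
    where open RingProperties ring using (-1*x≈-x)
   c1 : ∀ {p} i (v : Fin p -> Carrierᴹ) -> co (\ j -> Ri.δ K j i) v ≈ᴹ v i
   c1 i v = ≈ᴹ-trans (∑ᴹ-single _ i (\ j j≢i -> ≈ᴹ-trans (*ₗ-congʳ (K.reflexive (Ri.dc K j≢i))) (*ₗ-zeroˡ _))) (≈ᴹ-trans (*ₗ-congʳ (K.reflexive (Ri.s0 K i))) (*ₗ-identityˡ _))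
   c4 : ∀ {p q} (a : Fin p -> Carrier) (b : Fin p -> Fin q -> Carrier) (v : Fin q -> Carrierᴹ) -> co a (\ i -> co (b i) v) ≈ᴹ co (\ j -> Ri.∑ K (\ i -> a i * b i j)) v
   c4 a b v = ≈ᴹ-trans (∑ᴹ-cong \ i -> ≈ᴹ-trans (uf (a i) _) (∑ᴹ-cong \ j -> ≈ᴹ-sym (*ₗ-assoc (a i) (b i j) (v j)))) (≈ᴹ-trans (∑ᴹ-swap _) (∑ᴹ-cong \ j -> ≈ᴹ-sym (ut (\ i -> a i * b i j) (v j))))
  record Li {m ℓm m' ℓm'} (V : i9 ring m ℓm) (W : i9 ring m' ℓm') : Set (c ⊔ m ⊔ ℓm ⊔ m' ⊔ ℓm') where
   private
    module V = i9 V
    module W = i9 W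
   field
    fun : V.Carrierᴹ -> W.Carrierᴹ
    f-cong : ∀ {u v} -> u V.≈ᴹ v -> fun u W.≈ᴹ fun v
    f-+ : ∀ u v -> fun (u V.+ᴹ v) W.≈ᴹ fun u W.+ᴹ fun v
    f-* : ∀ a v -> fun (a V.*ₗ v) W.≈ᴹ a W.*ₗ fun v
   f-0 : fun V.0ᴹ W.≈ᴹ W.0ᴹ
   f-0 = W.≈ᴹ-trans (f-cong (V.≈ᴹ-sym (V.*ₗ-zeroˡ V.0ᴹ))) (W.≈ᴹ-trans (f-* 0# V.0ᴹ) (W.*ₗ-zeroˡ _))
   fs : ∀ v -> fun (V.-ᴹ v) W.≈ᴹ W.-ᴹ fun v
   fs v = W.≈ᴹ-trans (f-cong (V.≈ᴹ-sym (La.na V v))) (W.≈ᴹ-trans (f-* (- 1#) v) (La.na W _))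
   fv : ∀ u v -> fun (La._−_ V u v) W.≈ᴹ La._−_ W (fun u) (fun v)
   fv u v = W.≈ᴹ-trans (f-+ u _) (W.+ᴹ-congˡ (fs v))
   fj : ∀ {p} (g : Fin p -> V.Carrierᴹ) -> fun (La.∑ᴹ V g) W.≈ᴹ La.∑ᴹ W (\ i -> fun (g i))
   fj = Ho.ha V.+ᴹ-commutativeMonoid W.+ᴹ-commutativeMonoid fun f-cong f-0 f-+
   fg : ∀ {p} a (v : Fin p -> V.Carrierᴹ) -> fun (La.co V a v) W.≈ᴹ La.co W a (\ i -> fun (v i))
   fg a v = W.≈ᴹ-trans (fj _) (La.∑ᴹ-cong W \ i -> f-* (a i) (v i))
   isH : LeftModuleMorphisms.IsLeftModuleHomomorphism V.rawLeftModule W.rawLeftModule fun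
   isH = record { +ᴹ-isGroupHomomorphism = record { isMonoidHomomorphism = record { isMagmaHomomorphism = record { isRelHomomorphism = record { cong = f-cong } ; homo = f-+ } ; ε-homo = f-0 } ; ⁻¹-homo = fs } ; *ₗ-homo = f-* }
  open Li public
  cq : ∀ {m₁ l₁ m₂ l₂ m₃ l₃} {U : i9 ring m₁ l₁} {V : i9 ring m₂ l₂} {W : i9 ring m₃ l₃} -> Li V W -> Li U V -> Li U W
  cq {W = W} g f = record { fun = \ u -> fun g (fun f u) ; f-cong = \ e -> f-cong g (f-cong f e) ; f-+ = \ u v -> i9.≈ᴹ-trans W (f-cong g (f-+ f u v)) (f-+ g _ _) ; f-* = \ a v -> i9.≈ᴹ-trans W (f-cong g (f-* f a v)) (f-* g a _) }
  record Ba {m ℓm} (V : i9 ring m ℓm) (p : O) : Set (c ⊔ ℓ ⊔ m ⊔ ℓm) where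
   open La V
   field
    vec : Fin p -> Carrierᴹ
    coo : Carrierᴹ -> Fin p -> Carrier
    spa : ∀ v -> v ≈ᴹ co (coo v) vec
    ind : ∀ a -> co a vec ≈ᴹ 0ᴹ -> ∀ i -> a i ≈ 0#
   cn : ∀ a v -> v ≈ᴹ co a vec -> ∀ i -> coo v i ≈ a i
   cn a v e i = In.za K (ind (\ j -> coo v j + - a j) (≈ᴹ-trans (cC _ _ vec) (≈ᴹ-trans (+ᴹ-cong (≈ᴹ-sym (spa v)) (cL a vec)) (mc e))) i)
   cr : ∀ {u v} -> u ≈ᴹ v -> ∀ i -> coo u i ≈ coo v i
   cr {u} {v} e = cn (coo v) u (≈ᴹ-trans e (spa v))
   cR : ∀ u v i -> coo (u +ᴹ v) i ≈ coo u i + coo v i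
   cR u v = cn _ _ (≈ᴹ-trans (+ᴹ-cong (spa u) (spa v)) (≈ᴹ-sym (cC _ _ vec)))
   cQ : ∀ a v i -> coo (a *ₗ v) i ≈ a * coo v i
   cQ a v = cn _ _ (≈ᴹ-trans (*ₗ-congˡ (spa v)) (≈ᴹ-sym (cB a _ vec)))
   c9 : ∀ a i -> coo (co a vec) i ≈ a i
   c9 a = cn a _ ≈ᴹ-refl
  -- The linear map with prescribed values on a basis.
  eJ : ∀ {m ℓm m' ℓm' p} {V : i9 ring m ℓm} (B : Ba V p) (W : i9 ring m' ℓm') -> (Fin p -> i9.Carrierᴹ W) -> Li V W
  eJ B W w = record { fun = \ v -> co (coo v) w ; f-cong = \ e -> ∑ᴹ-cong \ i -> *ₗ-congʳ (cr e i) ; f-+ = \ u v -> ≈ᴹ-trans (∑ᴹ-cong \ i -> *ₗ-congʳ (cR u v i)) (cC _ _ w) ; f-* = \ a v -> ≈ᴹ-trans (∑ᴹ-cong \ i -> *ₗ-congʳ (cQ a v i)) (cB a _ w) }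
   where
   open Ba B
   open La W
 module Mg where
  open import Data.Fin.Base using (Fin; toℕ; combine; remQuot; finToFun; funToFin)
  open import Data.Fin.Permutation using (Permutation; Permutation′; permutation; _⟨$⟩ʳ_; _⟨$⟩ˡ_; _∘ₚ_; inverseˡ; inverseʳ)
  import Data.Fin.Permutation as Permutation
  open import Data.Fin.Properties using (toℕ-injective; toℕ-fromℕ<; toℕ<n; remQuot-combine; combine-remQuot; funToFin-finToFin; finToFun-funToFin; all?; _≟_)
  open import Data.Nat.Base as Q using (ℕ; NonZero)
  open import Data.Nat.DivMod using (_mod_; _%_; m%n<n; %-distribˡ-+; m<n⇒m%n≡m; m%n%n≡m%n; n%n≡0)
  import Data.Nat.Properties as Q
  open import Data.Product.Base using (_×_; _,_; proj₁; proj₂)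
  open import Function.Base using (_∘_)
  open import Relation.Binary.PropositionalEquality as U using (_≡_; _≗_; refl; sym; trans; cong; cong₂; module ≡-Reasoning)
  open import Relation.Nullary using (Dec; yes; no; ¬_)
  open import Relation.Nullary.Decidable using (_×-dec_; map′)
  module Cd (r : O) .{{_ : NonZero r}} where
   tj : ∀ a -> toℕ (a mod r) ≡ a % r
   tj a = toℕ-fromℕ< (m%n<n a r)
   infixl 6 _⊕_
   _⊕_ : Fin r -> Fin r -> Fin r
   c ⊕ d = (toℕ c Q.+ toℕ d) mod r
   ⊖_ : Fin r -> Fin r
   ⊖ c = (r Q.∸ toℕ c) mod r
   ug : Fin r
   ug = 0 mod r
   ms : ∀ a b -> (a % r Q.+ b) % r ≡ (a Q.+ b) % r
   ms a b = trans (%-distribˡ-+ (a % r) b r) (trans (cong (\ z -> (z Q.+ b % r) % r) (m%n%n≡m%n a r)) (sym (%-distribˡ-+ a b r)))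
   ⊕-comm : ∀ c d -> c ⊕ d ≡ d ⊕ c
   ⊕-comm c d = cong (_mod r) (e6 (toℕ c) (toℕ d))
   ⊕-assoc : ∀ c d e -> (c ⊕ d) ⊕ e ≡ c ⊕ (d ⊕ e)
   ⊕-assoc c d e = toℕ-injective (begin toℕ ((c ⊕ d) ⊕ e) ≡⟨ tj _ ⟩ (toℕ (c ⊕ d) Q.+ toℕ e) % r ≡⟨ cong (\ z -> (z Q.+ toℕ e) % r) (tj _) ⟩ ((toℕ c Q.+ toℕ d) % r Q.+ toℕ e) % r ≡⟨ ms _ _ ⟩ (toℕ c Q.+ toℕ d Q.+ toℕ e) % r ≡⟨ cong (_% r) (e7 (toℕ c) _ _) ⟩ (toℕ c Q.+ (toℕ d Q.+ toℕ e)) % r ≡⟨ cong (_% r) (e6 (toℕ c) _) ⟩ (toℕ d Q.+ toℕ e Q.+ toℕ c) % r ≡⟨ sym (ms _ _) ⟩ ((toℕ d Q.+ toℕ e) % r Q.+ toℕ c) % r ≡⟨ cong (\ z -> (z Q.+ toℕ c) % r) (sym (tj _)) ⟩ (toℕ (d ⊕ e) Q.+ toℕ c) % r ≡⟨ cong (_% r) (e6 (toℕ (d ⊕ e)) _) ⟩ (toℕ c Q.+ toℕ (d ⊕ e)) % r ≡⟨ sym (tj _) ⟩ toℕ (c ⊕ (d ⊕ e)) ∎)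
    where open ≡-Reasoning
   th : toℕ ug ≡ 0
   th = trans (tj 0) (m<n⇒m%n≡m (Q.>-nonZero⁻¹ r))
   ⊕-identityˡ : ∀ c -> ug ⊕ c ≡ c
   ⊕-identityˡ c = toℕ-injective (trans (tj _) (trans (cong (\ z -> (z Q.+ toℕ c) % r) th) (m<n⇒m%n≡m (toℕ<n c))))
   ij : ∀ c -> c ⊕ ug ≡ c
   ij c = trans (⊕-comm c ug) (⊕-identityˡ c)
   ia : ∀ c -> ⊖ c ⊕ c ≡ ug
   ia c = toℕ-injective (begin toℕ (⊖ c ⊕ c) ≡⟨ tj _ ⟩ (toℕ (⊖ c) Q.+ toℕ c) % r ≡⟨ cong (\ z -> (z Q.+ toℕ c) % r) (tj _) ⟩ ((r Q.∸ toℕ c) % r Q.+ toℕ c) % r ≡⟨ ms _ _ ⟩ (r Q.∸ toℕ c Q.+ toℕ c) % r ≡⟨ cong (_% r) (Q.m∸n+n≡m (Q.<⇒≤ (toℕ<n c))) ⟩ r % r ≡⟨ n%n≡0 r ⟩ 0 ≡⟨ sym th ⟩ toℕ ug ∎)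
    where open ≡-Reasoning
   ie : ∀ c -> c ⊕ ⊖ c ≡ ug
   ie c = trans (⊕-comm c (⊖ c)) (ia c)
   cu : ∀ c d -> ⊖ c ⊕ (c ⊕ d) ≡ d
   cu c d = trans (sym (⊕-assoc (⊖ c) c d)) (trans (cong (_⊕ d) (ia c)) (⊕-identityˡ d))
   ct : ∀ c d -> c ⊕ (⊖ c ⊕ d) ≡ d
   ct c d = trans (sym (⊕-assoc c (⊖ c) d)) (trans (cong (_⊕ d) (ie c)) (⊕-identityˡ d))
  module Group (n r : O) .{{_ : NonZero r}} where
   open Cd r public
   G : Set
   G = (Fin n -> Fin r) × Permutation′ n
   infix 4 _≈ᴳ_
   infixl 7 _∙_
   _≈ᴳ_ : G -> G -> Set
   (c , w) ≈ᴳ (d , u) = (c ≗ d) × ((w ⟨$⟩ʳ_) ≗ (u ⟨$⟩ʳ_))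
   _∙_ : G -> G -> G
   (c , w) ∙ (d , u) = (\ i -> c i ⊕ d (w ⟨$⟩ˡ i)) , u ∘ₚ w
   ε : G
   ε = (\ _ -> ug) , Permutation.id
   infix 8 _⁻¹
   _⁻¹ : G -> G
   (c , w) ⁻¹ = (\ i -> ⊖ c (w ⟨$⟩ʳ i)) , Permutation.flip w
   iI : ∀ g -> g ∙ g ⁻¹ ≈ᴳ ε
   iI (c , w) = (\ i -> trans (cong (\ j -> c i ⊕ ⊖ c j) (inverseʳ w)) (ie (c i))) , \ i -> inverseʳ w
   iG : ∀ g -> g ⁻¹ ∙ g ≈ᴳ ε
   iG (c , w) = (\ i -> ia (c (w ⟨$⟩ʳ i))) , \ i -> inverseˡ w
   -- Permutations are enumerated among all pairs of functions (f , s), as those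
   -- with s inverse to f; the other pairs will get weight zero in averages.
   Cb : Set
   Cb = (Fin n -> Fin n) × (Fin n -> Fin n) × (Fin n -> Fin r)
   sb : O
   sb = (n Q.^ n) Q.* ((n Q.^ n) Q.* (r Q.^ n))
   infix 4 _≗ᶜ_
   _≗ᶜ_ : Cb -> Cb -> Set
   (f , s , c) ≗ᶜ (f′ , s′ , c') = (f ≗ f′) × (s ≗ s′) × (c ≗ c')
   opaque
    enc : Cb -> Fin sb
    enc (f , s , c) = Data.Fin.Base.combine (funToFin f) (Data.Fin.Base.combine (funToFin s) (funToFin c))
    de : Fin sb -> Cb
    de i =
     let f , j = remQuot {n Q.^ n} ((n Q.^ n) Q.* (r Q.^ n)) i
         s , c = remQuot {n Q.^ n} (r Q.^ n) j
     in finToFun f , finToFun s , finToFun c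
    dh : ∀ x -> de (enc x) ≗ᶜ x
    dh (f , s , c) = (\ i -> trans (cong (\ z -> finToFun (p1 z) i) oy) (finToFun-funToFin f i)) , (\ i -> trans (cong (\ z -> finToFun (p1 z) i) iA) (finToFun-funToFin s i)) , (\ i -> trans (cong (\ z -> finToFun (p2 z) i) iA) (finToFun-funToFin c i))
     where
     oy : remQuot {n Q.^ n} ((n Q.^ n) Q.* (r Q.^ n)) (enc (f , s , c)) ≡ (funToFin f , Data.Fin.Base.combine (funToFin s) (funToFin c))
     oy = remQuot-combine {n Q.^ n} {(n Q.^ n) Q.* (r Q.^ n)} (funToFin f) (Data.Fin.Base.combine (funToFin s) (funToFin c))
     iA : remQuot {n Q.^ n} (r Q.^ n) (p2 (remQuot {n Q.^ n} ((n Q.^ n) Q.* (r Q.^ n)) (enc (f , s , c)))) ≡ (funToFin s , funToFin c)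
     iA = trans (cong (\ z -> remQuot {n Q.^ n} (r Q.^ n) (p2 z)) oy) (remQuot-combine {n Q.^ n} {r Q.^ n} (funToFin s) (funToFin c))
   fn : ∀ {k m} {f g : Fin k -> Fin m} -> f ≗ g -> funToFin f ≡ funToFin g
   fn {Q.zero} e = refl
   fn {Q.suc k} e = cong₂ Data.Fin.Base.combine (e Fin.zero) (fn \ i -> e (Fin.suc i))
    where import Data.Fin.Base as Fin
   opaque
    unfolding enc de
    eu : ∀ {x y} -> x ≗ᶜ y -> enc x ≡ enc y
    eu (f , s , c) = cong₂ Data.Fin.Base.combine (fn f) (cong₂ Data.Fin.Base.combine (fn s) (fn c))
    ew : ∀ i -> enc (de i) ≡ i
    ew i = trans (cong₂ Data.Fin.Base.combine (funToFin-finToFin {n} {n} f) (trans (cong₂ Data.Fin.Base.combine (funToFin-finToFin {n} {n} s) (funToFin-finToFin {n} {r} c)) (combine-remQuot {n Q.^ n} (r Q.^ n) j))) (combine-remQuot {n Q.^ n} ((n Q.^ n) Q.* (r Q.^ n)) i)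
     where
     f : Fin (n Q.^ n)
     f = p1 (remQuot {n Q.^ n} ((n Q.^ n) Q.* (r Q.^ n)) i)
     j : Fin ((n Q.^ n) Q.* (r Q.^ n))
     j = p2 (remQuot {n Q.^ n} ((n Q.^ n) Q.* (r Q.^ n)) i)
     s : Fin (n Q.^ n)
     s = p1 (remQuot {n Q.^ n} (r Q.^ n) j)
     c : Fin (r Q.^ n)
     c = p2 (remQuot {n Q.^ n} (r Q.^ n) j)
   record Va (x : Cb) : Set where
    constructor mkValid
    field
     ri : ∀ i -> p1 x (p1 (p2 x) i) ≡ i
     lL : ∀ i -> p1 (p2 x) (p1 x i) ≡ i
   val : ∀ x -> Dec (Va x)
   val (f , s , c) = map′ (\ (p , q) -> mkValid p q) (\ (mkValid p q) -> p , q) (all? (\ i -> f (s i) ≟ i) ×-dec all? (\ i -> s (f i) ≟ i))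
   Vb : ∀ {x y} -> x ≗ᶜ y -> Va x -> Va y
   Vb {f , s , c} {f′ , s′ , c'} (ef , es , ec) (mkValid p q) = mkValid (\ i -> trans (sym (trans (ef (s i)) (cong f′ (es i)))) (p i)) (\ i -> trans (sym (trans (es (f i)) (cong s′ (ef i)))) (q i))
   -- The permutation matrix of f times the diagonal matrix of c.
   el : ∀ x -> Va x -> G
   el (f , s , c) (mkValid p q) = (\ i -> c (s i)) , permutation f s p q
   i5 : Cb
   i5 = (\ i -> i) , (\ i -> i) , (\ _ -> ug)
   tr : G -> Cb -> Cb
   tr (d , w) (f , s , c) = (\ i -> w ⟨$⟩ʳ f i) , (\ i -> s (w ⟨$⟩ˡ i)) , (\ i -> d (w ⟨$⟩ʳ f i) ⊕ c i)
   unt : G -> Cb -> Cb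
   unt (d , w) (f , s , c) = (\ i -> w ⟨$⟩ˡ f i) , (\ i -> s (w ⟨$⟩ʳ i)) , (\ i -> ⊖ d (f i) ⊕ c i)
   tD : ∀ g {x y} -> x ≗ᶜ y -> tr g x ≗ᶜ tr g y
   tD (d , w) (f , s , c) = (\ i -> cong (w ⟨$⟩ʳ_) (f i)) , (\ i -> s _) , (\ i -> cong₂ _⊕_ (cong (\ j -> d (w ⟨$⟩ʳ j)) (f i)) (c i))
   u9 : ∀ g {x y} -> x ≗ᶜ y -> unt g x ≗ᶜ unt g y
   u9 (d , w) (f , s , c) = (\ i -> cong (w ⟨$⟩ˡ_) (f i)) , (\ i -> s _) , (\ i -> cong₂ _⊕_ (cong (\ j -> ⊖ d j) (f i)) (c i))
   tG : ∀ g x -> tr g (unt g x) ≗ᶜ x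
   tG (d , w) (f , s , c) = (\ i -> inverseʳ w) , (\ i -> cong s (inverseʳ w)) , (\ i -> trans (cong (\ j -> d j ⊕ (⊖ d (f i) ⊕ c i)) (inverseʳ w)) (ct _ _))
   uB : ∀ g x -> unt g (tr g x) ≗ᶜ x
   uB (d , w) (f , s , c) = (\ i -> inverseˡ w) , (\ i -> cong s (inverseˡ w)) , (\ i -> cu _ _)
   t0 : G -> Permutation sb sb
   t0 g = permutation (\ i -> enc (tr g (de i))) (\ i -> enc (unt g (de i))) (\ i -> trans (eu (ti (tD g (dh _)) (tG g _))) (ew i)) (\ i -> trans (eu (ti (u9 g (dh _)) (uB g _))) (ew i))
    where
    ti : ∀ {x y z} -> x ≗ᶜ y -> y ≗ᶜ z -> x ≗ᶜ z
    ti (a , b , c) (a' , b' , c') = (\ i -> trans (a i) (a' i)) , (\ i -> trans (b i) (b' i)) , (\ i -> trans (c i) (c' i))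
   tq : ∀ g x -> Va x -> Va (tr g x)
   tq (d , w) (f , s , c) (mkValid p q) = mkValid (\ i -> trans (cong (w ⟨$⟩ʳ_) (p _)) (inverseʳ w)) (\ i -> trans (cong s (inverseˡ w)) (q i))
   uI : ∀ g x -> Va x -> Va (unt g x)
   uI (d , w) (f , s , c) (mkValid p q) = mkValid (\ i -> trans (cong (w ⟨$⟩ˡ_) (p _)) (inverseˡ w)) (\ i -> trans (cong s (inverseʳ w)) (q i))
   eG : ∀ g x (v : Va x) (v′ : Va (tr g x)) -> g ∙ el x v ≈ᴳ el (tr g x) v′
   eG (d , w) (f , s , c) (mkValid p q) v′ = (\ i -> cong (\ j -> d j ⊕ c (s (w ⟨$⟩ˡ i))) (sym (trans (cong (w ⟨$⟩ʳ_) (p _)) (inverseʳ w)))) , \ i -> refl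
   eF : ∀ {x y} (v : Va x) (v′ : Va y) -> x ≗ᶜ y -> el x v ≈ᴳ el y v′
   eF {f , s , c} {f′ , s′ , c'} _ _ (ef , es , ec) = (\ i -> trans (cong c (es i)) (ec (s′ i))) , ef
 open Mg
 record Se : Setω where
  field
   c ℓ : Level
   K : CommutativeRing c ℓ
   local : ∀ {a b} -> In.Inv K (CommutativeRing._+_ K a b) -> In.Inv K a ⊎ In.Inv K b
   nontrivial : {A : Set (c ⊔ ℓ)} -> In.Inv K (CommutativeRing.0# K) -> A
   char0 : ∀ m -> In.Inv K (RawMonoidDefinitions._×_ (CommutativeRing.+-rawMonoid K) (Q.suc m) (CommutativeRing.1# K))
   n r : O
   {{r-positive}} : NonZero r
   ζ : CommutativeRing.Carrier K
   rw : CommutativeRing._≈_ K (Exp._^_ (CommutativeRing.semiring K) ζ r) (CommutativeRing.1# K)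
   apart : ∀ j -> 0 < j -> j < r -> In.Inv K (CommutativeRing._-_ K (Exp._^_ (CommutativeRing.semiring K) ζ j) (CommutativeRing.1# K))
 module Ps (𝕊 : Se) where
  open Se 𝕊 using (c; ℓ; K; local; nontrivial; char0; n; r; ζ; rw; apart)
  private instance
   rS : NonZero r
   rS = Se.r-positive 𝕊
  private module K = CommutativeRing K
  private module Kj = In K
  private module Ke = Lin K
  private module Grp = Group n r
  private module Col = Cd r
  private module Kl = Ri K
  private module Kn = Int K
  private module Kg = Exp K.semiring
  private module Kr = CommutativeExp K.commutativeSemiring
  private module Km = Sn K.*-commutativeMonoid
  hb : In.Inv K (K.1# K.+ K.1#)
  hb = In.Ia K (K.+-congˡ (K.+-identityʳ K.1#)) (char0 1)
  module Su = Superspace K n r ζ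
  module Pa = OrderedSetPartitions K n r ζ
  module Mf = Monomial K n r ζ
  module Rep where
   open K using (Carrier; _≈_; _+_; _*_; -_; 0#; 1#; ring)
   open Ke public
   open Grp
   open Actions ring G
   open Kj using (Inv)
   record GM (m ℓm : Level) : Set (c ⊔ ℓ ⊔ lsuc (m ⊔ ℓm)) where
    field
     aR : Action m ℓm
    open Action aR public using (space; act; act-linear)
    open La space public
    field
     aj : ∀ g h v -> act (g ∙ h) v ≈ᴹ act g (act h v)
     az : ∀ v -> act ε v ≈ᴹ v
     act-resp : ∀ {g h} -> g ≈ᴳ h -> ∀ v -> act g v ≈ᴹ act h v
    aw : G -> Li space space
    aw g = record { fun = act g ; f-cong = H.⟦⟧-cong ; f-+ = H.+ᴹ-homo ; f-* = H.*ₗ-homo }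
     where
     open import Algebra.Module.Morphism.Structures using (module LeftModuleMorphisms)
     module H = LeftModuleMorphisms.IsLeftModuleHomomorphism (act-linear g)
    aG : ∀ g v -> act g (act (g ⁻¹) v) ≈ᴹ v
    aG g v = ≈ᴹ-trans (≈ᴹ-sym (aj g (g ⁻¹) v)) (≈ᴹ-trans (act-resp (iI g) v) (az v))
    a8 : ∀ g v -> act (g ⁻¹) (act g v) ≈ᴹ v
    a8 g v = ≈ᴹ-trans (≈ᴹ-sym (aj (g ⁻¹) g v)) (≈ᴹ-trans (act-resp (iG g) v) (az v))
   module Sd {m l} (V : GM m l) where
    open GM V public using (*ₗ-assoc; *ₗ-congʳ; *ₗ-congˡ; *ₗ-distribˡ; *ₗ-identityˡ; nb; sl; *ₗ-zeroʳ; *ₗ-zeroˡ; +ᴹ-assoc; +ᴹ-commutativeMonoid; +ᴹ-cong; +ᴹ-congʳ; +ᴹ-congˡ; +ᴹ-identityʳ; +ᴹ-identityˡ; +ᴹ-interchange; -ᴹ‿cong; -ᴹ‿inverseˡ; 0ᴹ; Carrierᴹ; _*ₗ_; _+ᴹ_; _−_; _≈ᴹ_; act; aG; a8; act-resp; aj; aw; co; cL; c1; mc; space; za; ut; ∑ᴹ; uf; ∑ᴹ-+; ∑ᴹ-0; ∑ᴹ-cong; ∑ᴹ-permute; ∑ᴹ-suc; ∑ᴹ-zero; cf; ig; ih; ≈ᴹ-refl; ≈ᴹ-reflexive; ≈ᴹ-sym; ≈ᴹ-trans)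
   Eq : ∀ {m₁ l₁ m₂ l₂} (X : GM m₁ l₁) (Y : GM m₂ l₂) -> (GM.Carrierᴹ X -> GM.Carrierᴹ Y) -> Set (m₁ ⊔ l₂)
   Eq X Y f = ∀ g v -> GM._≈ᴹ_ Y (f (GM.act X g v)) (GM.act Y g (f v))
   record _⟶_ {m₁ l₁ m₂ l₂} (X : GM m₁ l₁) (Y : GM m₂ l₂) : Set (c ⊔ ℓ ⊔ m₁ ⊔ l₁ ⊔ m₂ ⊔ l₂) where
    field
     li : Li (GM.space X) (GM.space Y)
     equivariant : Eq X Y (fun li)
    open Li li public using () renaming (fun to ⟦_⟧; f-cong to ⟦⟧-cong; f-+ to ⟦⟧-+; f-* to ⟦⟧-*; f-0 to ⟦⟧-0; fv to ⟦⟧-−)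
   record _≃_ {m₁ l₁ m₂ l₂} (X : GM m₁ l₁) (Y : GM m₂ l₂) : Set (c ⊔ ℓ ⊔ m₁ ⊔ l₁ ⊔ m₂ ⊔ l₂) where
    field
     fo : X ⟶ Y
     bb : Y ⟶ X
     bc : ∀ v -> GM._≈ᴹ_ X (_⟶_.⟦_⟧ bb (_⟶_.⟦_⟧ fo v)) v
     fc : ∀ v -> GM._≈ᴹ_ Y (_⟶_.⟦_⟧ fo (_⟶_.⟦_⟧ bb v)) v
   _∘⟶_ : ∀ {m₁ l₁ m₂ l₂ m₃ l₃} {X : GM m₁ l₁} {Y : GM m₂ l₂} {Z : GM m₃ l₃} -> Y ⟶ Z -> X ⟶ Y -> X ⟶ Z
   _∘⟶_ {Z = Z} g f = record { li = cq (_⟶_.li g) (_⟶_.li f) ; equivariant = \ h v -> GM.≈ᴹ-trans Z (_⟶_.⟦⟧-cong g (_⟶_.equivariant f h v)) (_⟶_.equivariant g h _) }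
   tg : ∀ {m₁ l₁ m₂ l₂ m₃ l₃} {X : GM m₁ l₁} {Y : GM m₂ l₂} {Z : GM m₃ l₃} -> X ≃ Y -> Y ≃ Z -> X ≃ Z
   tg {X = X} {Z = Z} p q = record { fo = _≃_.fo q ∘⟶ _≃_.fo p ; bb = _≃_.bb p ∘⟶ _≃_.bb q ; bc = \ v -> GM.≈ᴹ-trans X (_⟶_.⟦⟧-cong (_≃_.bb p) (_≃_.bc q _)) (_≃_.bc p v) ; fc = \ v -> GM.≈ᴹ-trans Z (_⟶_.⟦⟧-cong (_≃_.fo q) (_≃_.fc p _)) (_≃_.fc q v) }
   sV : ∀ {m₁ l₁ m₂ l₂} {X : GM m₁ l₁} {Y : GM m₂ l₂} -> X ≃ Y -> Y ≃ X
   sV p = record { fo = _≃_.bb p ; bb = _≃_.fo p ; bc = _≃_.fc p ; fc = _≃_.bc p }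
   bij : ∀ {m₁ l₁ m₂ l₂} {X : GM m₁ l₁} {Y : GM m₂ l₂} (f : X ⟶ Y) -> (s : GM.Carrierᴹ Y -> GM.Carrierᴹ X) -> (∀ y -> GM._≈ᴹ_ Y (_⟶_.⟦_⟧ f (s y)) y) -> (∀ x -> GM._≈ᴹ_ Y (_⟶_.⟦_⟧ f x) (GM.0ᴹ Y) -> GM._≈ᴹ_ X x (GM.0ᴹ X)) -> X ≃ Y
   bij {X = X} {Y} f s ri ke = record { fo = f ; bb = record { li = record { fun = s ; f-cong = \ {u} {v} e -> injective (Y.≈ᴹ-trans (ri u) (Y.≈ᴹ-trans e (Y.≈ᴹ-sym (ri v)))) ; f-+ = \ u v -> injective (Y.≈ᴹ-trans (ri _) (Y.≈ᴹ-sym (Y.≈ᴹ-trans (⟦⟧-+ _ _) (Y.+ᴹ-cong (ri u) (ri v))))) ; f-* = \ a v -> injective (Y.≈ᴹ-trans (ri _) (Y.≈ᴹ-sym (Y.≈ᴹ-trans (⟦⟧-* _ _) (Y.*ₗ-congˡ (ri v))))) } ; equivariant = \ g v -> injective (Y.≈ᴹ-trans (ri _) (Y.≈ᴹ-sym (Y.≈ᴹ-trans (equivariant g _) (f-cong (Y.aw g) (ri v))))) } ; bc = \ v -> injective (ri _) ; fc = ri }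
    where
    module X = Sd X
    module Y = Sd Y
    open _⟶_ f
    injective : ∀ {u v} -> ⟦ u ⟧ Y.≈ᴹ ⟦ v ⟧ -> u X.≈ᴹ v
    injective e = X.za (ke _ (Y.≈ᴹ-trans (⟦⟧-− _ _) (Y.mc e)))
   module Ave (char0 : ∀ m -> Inv (RawMonoidDefinitions._×_ K.+-rawMonoid (Q.suc m) 1#)) where
    open Kl
    open Mult K.+-monoid using (×-homo-+)
    iq : Bool -> Carrier
    iq b = if b then 1# else 0#
    nat : O -> Carrier
    nat m = RawMonoidDefinitions._×_ K.+-rawMonoid m 1#
    cE : ∀ {m} -> (Fin m -> Bool) -> O
    cE {Q.zero} b = 0
    cE {Q.suc m} b = (if b zero then 1 else 0) Q.+ cE (\ i -> b (suc i))
    ck : ∀ {m} (b : Fin m -> Bool) -> ∑ (\ i -> iq (b i)) ≈ nat (cE b)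
    ck {Q.zero} b = ue _
    ck {Q.suc m} b = K.trans (sf _) (K.trans (K.+-cong (sg (b zero)) (ck (\ i -> b (suc i)))) (K.sym (×-homo-+ 1# (if b zero then 1 else 0) _)))
     where
     sg : ∀ x -> iq x ≈ nat (if x then 1 else 0)
     sg b2 = K.sym (K.+-identityʳ 1#)
     sg b1 = K.refl
    cM : ∀ {m} (b : Fin m -> Bool) i -> b i ≡ b2 -> Σ O \ p -> cE b ≡ Q.suc p
    cM b zero e rewrite e = _ , U.refl
    cM b (suc i) e with p , q <- cM (\ i -> b (suc i)) i e rewrite q = (if b zero then 1 else 0) Q.+ p , e8 (if b zero then 1 else 0) p
     where import Data.Nat.Properties as Q
    cU : ∀ {m} (b : Fin m -> Bool) i -> b i ≡ b2 -> Inv (∑ \ i -> iq (b i))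
    cU b i e with p , q <- cM b i e = In.Ia K (K.trans (K.reflexive (U.cong nat (U.sym q))) (K.sym (ck b))) (char0 p)
    vl : Fin sb -> Bool
    vl i = does (val (de i))
    ov : Inv (∑ \ i -> iq (vl i))
    ov = cU vl (enc i5) (dec-true (val _) (Vb (sK (dh i5)) (mkValid (\ _ -> U.refl) (\ _ -> U.refl))))
     where
     sK : ∀ {x y} -> x ≗ᶜ y -> y ≗ᶜ x
     sK (a , b , c) = (\ i -> U.sym (a i)) , (\ i -> U.sym (b i)) , (\ i -> U.sym (c i))
    module _ {m₁ l₁ m₂ l₂} {Y : GM m₁ l₁} {X : GM m₂ l₂} (ρ : Li (GM.space Y) (GM.space X)) where
     private
      module X = Sd X
      module Y = Sd Y
     cS : G -> Y.Carrierᴹ -> X.Carrierᴹ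
     cS g y = X.act g (fun ρ (Y.act (g ⁻¹) y))
     term : ∀ x -> Dec (Va x) -> Y.Carrierᴹ -> X.Carrierᴹ
     term x (yes v) y = cS (el x v) y
     term x (no _) y = X.0ᴹ
     tot : Y.Carrierᴹ -> X.Carrierᴹ
     tot y = X.∑ᴹ \ i -> term (de i) (val (de i)) y
     t2 : ∀ x (d : Dec (Va x)) -> Li Y.space X.space
     t2 x (yes v) = cq (X.aw (el x v)) (cq ρ (Y.aw (el x v ⁻¹)))
     t2 x (no _) = record { fun = \ _ -> X.0ᴹ ; f-cong = \ _ -> X.≈ᴹ-refl ; f-+ = \ _ _ -> X.≈ᴹ-sym (X.+ᴹ-identityˡ _) ; f-* = \ a _ -> X.≈ᴹ-sym (X.*ₗ-zeroʳ a) }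
     t7 : ∀ x (d : Dec (Va x)) y -> fun (t2 x d) y ≡ term x d y
     t7 x (yes v) y = U.refl
     t7 x (no _) y = U.refl
     gd : ∀ h g g′ -> h ∙ g ≈ᴳ g′ -> ∀ y -> X.act h (cS g y) X.≈ᴹ cS g′ (Y.act h y)
     gd h g g′ e y = X.≈ᴹ-trans (X.≈ᴹ-sym (X.aj h g _)) (X.≈ᴹ-trans (X.act-resp e _) (f-cong (X.aw g′) (f-cong ρ (Y.≈ᴹ-sym mo))))
      where
      mo : Y.act (g′ ⁻¹) (Y.act h y) Y.≈ᴹ Y.act (g ⁻¹) y
      mo = Y.≈ᴹ-trans (f-cong (Y.aw (g′ ⁻¹)) (Y.≈ᴹ-trans (f-cong (Y.aw h) (Y.≈ᴹ-sym (Y.aG g y))) (Y.≈ᴹ-trans (Y.≈ᴹ-sym (Y.aj h g _)) (Y.act-resp e _)))) (Y.a8 g′ _)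
     tx : ∀ h x x' -> x' ≗ᶜ tr h x -> ∀ d d' y -> X.act h (term x d y) X.≈ᴹ term x' d' (Y.act h y)
     tx h x x' e (yes v) (yes v′) y = gd h (el x v) (el x' v′) ((\ i -> U.trans (p1 mo i) (U.sym (p1 sk i))) , (\ i -> U.trans (p2 mo i) (U.sym (p2 sk i)))) y
      where
      mo : h ∙ el x v ≈ᴳ el (tr h x) (tq h x v)
      mo = eG h x v (tq h x v)
      sk : el x' v′ ≈ᴳ el (tr h x) (tq h x v)
      sk = eF v′ (tq h x v) e
     tx h x x' e (no _) (no _) y = f-0 (X.aw h)
     tx h x x' e (yes v) (no ¬v) y = ⊥-elim (¬v (Vb {tr h x} {x'} (let (a , b , c) = e in (\ i -> U.sym (a i)) , (\ i -> U.sym (b i)) , (\ i -> U.sym (c i))) (tq h x v)))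
     tx h x x' e (no ¬v) (yes v′) y = ⊥-elim (¬v (Vb {_} {x} (uB h x) (uI h _ (Vb e v′))))
     tB : ∀ h y -> tot (Y.act h y) X.≈ᴹ X.act h (tot y)
     tB h y = X.≈ᴹ-sym (X.≈ᴹ-trans (fj (X.aw h) _) (X.≈ᴹ-trans (X.∑ᴹ-cong \ i -> tx h (de i) (de (t0 h ⟨$⟩ʳ i)) (dh _) (val _) (val _) y) (X.≈ᴹ-sym (X.∑ᴹ-permute (\ j -> term (de j) (val (de j)) (Y.act h y)) (t0 h)))))
     av : Y ⟶ X
     av = record { li = record { fun = \ y -> s X.*ₗ tot y ; f-cong = \ e -> X.*ₗ-congˡ (X.∑ᴹ-cong \ i -> Tj i e) ; f-+ = \ u v -> X.≈ᴹ-trans (X.*ₗ-congˡ (X.≈ᴹ-trans (X.∑ᴹ-cong \ i -> T-+ i u v) (X.∑ᴹ-+ _ _))) (X.*ₗ-distribˡ s _ _) ; f-* = \ a v -> X.≈ᴹ-trans (X.*ₗ-congˡ (X.≈ᴹ-trans (X.∑ᴹ-cong \ i -> T-* i a v) (X.≈ᴹ-sym (X.uf a _)))) (X.sl s a _) } ; equivariant = \ h y -> X.≈ᴹ-trans (X.*ₗ-congˡ (tB h y)) (X.≈ᴹ-sym (f-* (X.aw h) s _)) }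
      where
      s = p1 ov
      T : ∀ i -> Li Y.space X.space
      T i = t2 (de i) (val (de i))
      eq : ∀ i y -> fun (T i) y ≡ term (de i) (val (de i)) y
      eq i = t7 (de i) (val (de i))
      Tj : ∀ i {u v} -> u Y.≈ᴹ v -> term (de i) (val (de i)) u X.≈ᴹ term (de i) (val (de i)) v
      Tj i {u} {v} e = U.subst₂ X._≈ᴹ_ (eq i u) (eq i v) (f-cong (T i) e)
      T-+ : ∀ i u v -> term (de i) (val (de i)) (u Y.+ᴹ v) X.≈ᴹ term (de i) (val (de i)) u X.+ᴹ term (de i) (val (de i)) v
      T-+ i u v = U.subst₂ X._≈ᴹ_ (eq i _) (U.cong₂ X._+ᴹ_ (eq i u) (eq i v)) (f-+ (T i) u v)
      T-* : ∀ i a v -> term (de i) (val (de i)) (a Y.*ₗ v) X.≈ᴹ a X.*ₗ term (de i) (val (de i)) v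
      T-* i a v = U.subst₂ X._≈ᴹ_ (eq i _) (U.cong (a X.*ₗ_) (eq i v)) (f-* (T i) a v)
     aZ : ∀ y x -> (∀ g -> cS g y X.≈ᴹ x) -> _⟶_.⟦_⟧ av y X.≈ᴹ x
     aZ y x h = X.≈ᴹ-trans (X.*ₗ-congˡ (X.≈ᴹ-trans (X.∑ᴹ-cong \ i -> each (de i) (val (de i))) (X.≈ᴹ-sym (X.ut (\ i -> iq (vl i)) x)))) (X.≈ᴹ-trans (X.≈ᴹ-sym (X.*ₗ-assoc _ _ x)) (X.≈ᴹ-trans (X.*ₗ-congʳ (K.trans (K.*-comm _ _) (p2 ov))) (X.*ₗ-identityˡ x)))
      where
      each : ∀ z d -> term z d y X.≈ᴹ iq (does d) X.*ₗ x
      each z (no _) = X.≈ᴹ-sym (X.*ₗ-zeroˡ x)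
      each z (yes v) = X.≈ᴹ-trans (h (el z v)) (X.≈ᴹ-sym (X.*ₗ-identityˡ x))
     f8 : ∀ {p} (P : X.Carrierᴹ -> Set p) -> (∀ {u v} -> u X.≈ᴹ v -> P u -> P v) -> P X.0ᴹ -> (∀ {u v} -> P u -> P v -> P (u X.+ᴹ v)) -> (∀ a {u} -> P u -> P (a X.*ₗ u)) -> ∀ y -> (∀ g -> P (cS g y)) -> P (_⟶_.⟦_⟧ av y)
     f8 P P-resp P-0 P-+ P-* y h = P-* _ (Pk \ i -> each (de i) (val (de i)))
      where
      each : ∀ z d -> P (term z d y)
      each z (no _) = P-0
      each z (yes v) = h (el z v)
      Pk : ∀ {m} {f : Fin m -> X.Carrierᴹ} -> (∀ i -> P (f i)) -> P (X.∑ᴹ f)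
      Pk {Q.zero} h = P-resp (X.≈ᴹ-sym (X.∑ᴹ-0 _)) P-0
      Pk {Q.suc m} h = P-resp (X.≈ᴹ-sym (X.∑ᴹ-suc _)) (P-+ (h zero) (Pk \ i -> h (suc i)))
     b5 : (f : X ⟶ Y) -> (∀ x -> fun ρ (_⟶_.⟦_⟧ f x) X.≈ᴹ x) -> ∀ x -> _⟶_.⟦_⟧ av (_⟶_.⟦_⟧ f x) X.≈ᴹ x
     b5 f ret x = aZ (_⟶_.⟦_⟧ f x) x \ g -> X.≈ᴹ-trans (f-cong (X.aw g) (X.≈ᴹ-trans (f-cong ρ (Y.≈ᴹ-sym (_⟶_.equivariant f (g ⁻¹) x))) (ret _))) (X.aG g x)
  module Ca where
   open K using (Carrier; _≈_; _+_; _*_; -_; 0#; 1#; ring)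
   open Rep
   open Ave char0
   open Kl
   open Pe K local char0 using (So; gb; sh)
   open Lk K local nontrivial using (S1; sy)
   module _ {m l p} {V : GM m l} (B : Ba (GM.space V) p) (L : V ⟶ V) (M : Fin p -> Fin p -> Carrier) (matrix : ∀ i j -> Ba.coo B (_⟶_.⟦_⟧ L (Ba.vec B j)) i ≈ M i j) (solvable : So M) where
    open GM V
    open Ba B
    open _⟶_ L
    Ll : ∀ v i -> coo ⟦ v ⟧ i ≈ ∑ (\ j -> M i j * coo v j)
    Ll v = cn _ _ (begin ⟦ v ⟧ ≈⟨ ⟦⟧-cong (spa v) ⟩ ⟦ co (coo v) vec ⟧ ≈⟨ fg li (coo v) vec ⟩ co (coo v) (\ j -> ⟦ vec j ⟧) ≈⟨ ∑ᴹ-cong (\ j -> *ₗ-congˡ (spa ⟦ vec j ⟧)) ⟩ co (coo v) (\ j -> co (coo ⟦ vec j ⟧) vec) ≈⟨ c4 (coo v) _ vec ⟩ co (\ i -> ∑ (\ j -> coo v j * coo ⟦ vec j ⟧ i)) vec ≈⟨ ∑ᴹ-cong (\ i -> *ₗ-congʳ (cb \ j -> K.trans (K.*-comm _ _) (K.*-congʳ (matrix i j)))) ⟩ co (\ i -> ∑ (\ j -> M i j * coo v j)) vec ∎)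
     where open import Relation.Binary.Reasoning.Setoid ≈ᴹ-setoid
    pU : Carrierᴹ -> Carrierᴹ
    pU v = co (p1 (solvable (coo v))) vec
    gl : ∀ v -> ⟦ pU v ⟧ ≈ᴹ v
    gl v = ≈ᴹ-trans (spa _) (≈ᴹ-trans (∑ᴹ-cong \ i -> *ₗ-congʳ (K.trans (Ll (pU v) i) (K.trans (cb \ j -> K.*-congˡ (c9 _ j)) (p2 (solvable (coo v)) i)))) (≈ᴹ-sym (spa v)))
    cZ : ∀ a -> (∀ i -> ∑ (\ j -> M i j * a j) ≈ 0#) -> ∀ j -> a j ≈ 0#
    cZ a e = sy (\ j i -> M i j) (\ u -> p1 (solvable u) , \ i -> K.trans (cb \ j -> K.*-comm _ _) (p2 (solvable u) i)) a (\ i -> K.trans (cb \ j -> K.*-comm _ _) (e i))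
    gw : ∀ v -> ⟦ v ⟧ ≈ᴹ 0ᴹ -> v ≈ᴹ 0ᴹ
    gw v e = ≈ᴹ-trans (spa v) (∑ᴹ-zero \ i -> ≈ᴹ-trans (*ₗ-congʳ (zc i)) (*ₗ-zeroˡ _))
     where
     zc : ∀ i -> coo v i ≈ 0#
     zc = cZ (coo v) \ i -> K.trans (K.sym (Ll v i)) (cn (\ _ -> 0#) _ (≈ᴹ-trans e (≈ᴹ-sym (∑ᴹ-zero \ _ -> *ₗ-zeroˡ _))) i)
    inverse : V ≃ V
    inverse = bij L pU gl gw
   record Ex {m₁ l₁ m₂ l₂ m₃ l₃} (X : GM m₁ l₁) (Y : GM m₂ l₂) (Z : GM m₃ l₃) : Set (c ⊔ ℓ ⊔ m₁ ⊔ l₁ ⊔ m₂ ⊔ l₂ ⊔ m₃ ⊔ l₃) where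
    private
     module X = Sd X
     module Y = Sd Y
     module Z = Sd Z
    field
     ik : X ⟶ Y
     pr : Y ⟶ Z
     ret : Li Y.space X.space
     rB : ∀ x -> fun ret (_⟶_.⟦_⟧ ik x) X.≈ᴹ x
     lift : Z.Carrierᴹ -> Y.Carrierᴹ
     lif : ∀ z -> _⟶_.⟦_⟧ pr (lift z) Z.≈ᴹ z
     ke : ∀ y -> _⟶_.⟦_⟧ pr y Z.≈ᴹ Z.0ᴹ -> Σ X.Carrierᴹ \ x -> _⟶_.⟦_⟧ ik x Y.≈ᴹ y
     ve : ∀ x -> _⟶_.⟦_⟧ pr (_⟶_.⟦_⟧ ik x) Z.≈ᴹ Z.0ᴹ
   -- A map π : Y → X inverting both embeddings of X identifies both quotients with its kernel.
   module _ {m₁ l₁ m₂ l₂ m₃ l₃} {X : GM m₁ l₁} {Y : GM m₂ l₂} {Z : GM m₃ l₃} (E : Ex X Y Z) (π : Y ⟶ X) (β : X ⟶ X) (β-right : ∀ x -> GM._≈ᴹ_ X (_⟶_.⟦_⟧ π (_⟶_.⟦_⟧ (Ex.ik E) (_⟶_.⟦_⟧ β x))) x) (β-left : ∀ x -> GM._≈ᴹ_ X (_⟶_.⟦_⟧ β (_⟶_.⟦_⟧ π (_⟶_.⟦_⟧ (Ex.ik E) x))) x) where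
    private
     module X = Sd X
     module Y = Sd Y
     module Z = Sd Z
     module E = Ex E
     module π = _⟶_ π
     module β = _⟶_ β
     module f = _⟶_ E.ik
     module q = _⟶_ E.pr
    rv : Y ⟶ Y
    rv = record { li = record { fun = \ y -> y Y.− h.⟦ y ⟧ ; f-cong = \ e -> Y.cf e (h.⟦⟧-cong e) ; f-+ = \ u v -> Y.≈ᴹ-trans (Y.cf Y.≈ᴹ-refl (h.⟦⟧-+ u v)) (Y.ih u v _ _) ; f-* = \ a v -> Y.≈ᴹ-trans (Y.cf Y.≈ᴹ-refl (h.⟦⟧-* a v)) (Y.≈ᴹ-trans (Y.+ᴹ-congˡ (Y.≈ᴹ-sym (Y.nb a _))) (Y.≈ᴹ-sym (Y.*ₗ-distribˡ a v _))) } ; equivariant = \ g v -> Y.≈ᴹ-trans (Y.cf Y.≈ᴹ-refl (h.equivariant g v)) (Y.≈ᴹ-sym (fv (Y.aw g) v _)) }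
     where
     module h = _⟶_ (E.ik ∘⟶ (β ∘⟶ π))
    private module p = _⟶_ rv
    rn : ∀ y -> π.⟦ p.⟦ y ⟧ ⟧ X.≈ᴹ X.0ᴹ
    rn y = X.≈ᴹ-trans (π.⟦⟧-− _ _) (X.mc (X.≈ᴹ-sym (β-right _)))
    r3 : ∀ x -> p.⟦ f.⟦ x ⟧ ⟧ Y.≈ᴹ Y.0ᴹ
    r3 x = Y.mc (f.⟦⟧-cong (X.≈ᴹ-sym (β-left x)))
    rH : ∀ y -> π.⟦ y ⟧ X.≈ᴹ X.0ᴹ -> p.⟦ y ⟧ Y.≈ᴹ y
    rH y e = Y.≈ᴹ-trans (Y.cf Y.≈ᴹ-refl (Y.≈ᴹ-trans (f.⟦⟧-cong (X.≈ᴹ-trans (β.⟦⟧-cong e) β.⟦⟧-0)) f.⟦⟧-0)) (Y.ig y)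
    gk : ∀ y -> q.⟦ p.⟦ y ⟧ ⟧ Z.≈ᴹ q.⟦ y ⟧
    gk y = Z.≈ᴹ-trans (q.⟦⟧-− _ _) (Z.≈ᴹ-trans (Z.cf Z.≈ᴹ-refl (E.ve _)) (Z.ig _))
    rl : ∀ {y y'} -> q.⟦ y ⟧ Z.≈ᴹ q.⟦ y' ⟧ -> p.⟦ y ⟧ Y.≈ᴹ p.⟦ y' ⟧
    rl {y} {y'} e with x , d <- E.ke (y Y.− y') (Z.≈ᴹ-trans (q.⟦⟧-− _ _) (Z.mc e)) = Y.za (Y.≈ᴹ-trans (Y.≈ᴹ-sym (p.⟦⟧-− y y')) (Y.≈ᴹ-trans (p.⟦⟧-cong (Y.≈ᴹ-sym d)) (r3 x)))
    b3 : Z ⟶ Y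
    b3 = record { li = record { fun = \ z -> p.⟦ E.lift z ⟧ ; f-cong = \ e -> rl (Z.≈ᴹ-trans (E.lif _) (Z.≈ᴹ-trans e (Z.≈ᴹ-sym (E.lif _)))) ; f-+ = \ u v -> Y.≈ᴹ-trans (rl (Z.≈ᴹ-trans (E.lif _) (Z.≈ᴹ-sym (Z.≈ᴹ-trans (q.⟦⟧-+ _ _) (Z.+ᴹ-cong (E.lif u) (E.lif v)))))) (p.⟦⟧-+ _ _) ; f-* = \ a v -> Y.≈ᴹ-trans (rl (Z.≈ᴹ-trans (E.lif _) (Z.≈ᴹ-sym (Z.≈ᴹ-trans (q.⟦⟧-* _ _) (Z.*ₗ-congˡ (E.lif v)))))) (p.⟦⟧-* _ _) } ; equivariant = \ g v -> Y.≈ᴹ-trans (rl (Z.≈ᴹ-trans (E.lif _) (Z.≈ᴹ-sym (Z.≈ᴹ-trans (q.equivariant g _) (f-cong (Z.aw g) (E.lif v)))))) (p.equivariant g _) }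
    dr : ∀ z -> π.⟦ _⟶_.⟦_⟧ b3 z ⟧ X.≈ᴹ X.0ᴹ
    dr z = rn (E.lift z)
    ds : ∀ y -> π.⟦ y ⟧ X.≈ᴹ X.0ᴹ -> _⟶_.⟦_⟧ b3 q.⟦ y ⟧ Y.≈ᴹ y
    ds y e = Y.≈ᴹ-trans (rl (E.lif _)) (rH y e)
    pR : ∀ z -> q.⟦ _⟶_.⟦_⟧ b3 z ⟧ Z.≈ᴹ z
    pR z = Z.≈ᴹ-trans (gk _) (E.lif z)
   module _ {m₁ l₁ m₂ l₂ m₃ l₃ m₄ l₄ p} {X : GM m₁ l₁} {Y : GM m₂ l₂} {Z : GM m₃ l₃} {Z' : GM m₄ l₄} (B : Ba (GM.space X) p) (E : Ex X Y Z) (E' : Ex X Y Z') where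
    private
     module X = Sd X
     module Y = Sd Y
     module Z = Sd Z
     module Z' = Sd Z'
     module E = Ex E
     module E' = Ex E'
     ρ = av {Y = Y} {X = X} E.ret
     ρ' = av {Y = Y} {X = X} E'.ret
     module ρ = _⟶_ ρ
     module ρ' = _⟶_ ρ'
     module f = _⟶_ E.ik
     module g = _⟶_ E'.ik
     open Ba B
     matrix : X ⟶ X -> Fin p -> Fin p -> Carrier
     matrix L i j = coo (_⟶_.⟦_⟧ L (vec j)) i
     scalar = gb (matrix (ρ' ∘⟶ E.ik)) (matrix (ρ ∘⟶ E'.ik))
     x = p1 scalar
     cW : ∀ i j -> coo (vec j) i ≈ δ i j
     cW i j = cn (\ k -> δ k j) (vec j) (X.≈ᴹ-sym (X.c1 j vec)) i
     π : Y ⟶ X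
     π = record { li = record { fun = \ y -> ρ.⟦ y ⟧ X.+ᴹ x X.*ₗ ρ'.⟦ y ⟧ ; f-cong = \ e -> X.+ᴹ-cong (ρ.⟦⟧-cong e) (X.*ₗ-congˡ (ρ'.⟦⟧-cong e)) ; f-+ = \ u v -> X.≈ᴹ-trans (X.+ᴹ-cong (ρ.⟦⟧-+ u v) (X.≈ᴹ-trans (X.*ₗ-congˡ (ρ'.⟦⟧-+ u v)) (X.*ₗ-distribˡ x _ _))) (X.+ᴹ-interchange _ _ _ _) ; f-* = \ a v -> X.≈ᴹ-trans (X.+ᴹ-cong (ρ.⟦⟧-* a v) (X.≈ᴹ-trans (X.*ₗ-congˡ (ρ'.⟦⟧-* a v)) (X.sl x a _))) (X.≈ᴹ-sym (X.*ₗ-distribˡ a _ _)) } ; equivariant = \ h v -> X.≈ᴹ-trans (X.+ᴹ-cong (ρ.equivariant h v) (X.≈ᴹ-trans (X.*ₗ-congˡ (ρ'.equivariant h v)) (X.≈ᴹ-sym (f-* (X.aw h) x _)))) (X.≈ᴹ-sym (f-+ (X.aw h) _ _)) }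
     first : X ≃ X
     first = inverse B (π ∘⟶ E.ik) (\ i j -> δ i j + x * matrix (ρ' ∘⟶ E.ik) i j) (\ i j -> K.trans (cR _ _ i) (K.+-cong (K.trans (cr (b5 {Y = Y} {X = X} E.ret E.ik E.rB (vec j)) i) (cW i j)) (cQ x _ i))) (p1 (p2 scalar))
     sec : X ≃ X
     sec = inverse B (π ∘⟶ E'.ik) (sh (matrix (ρ ∘⟶ E'.ik)) x) (\ i j -> K.trans (cR _ _ i) (K.trans (K.+-comm _ _) (K.+-congʳ (K.trans (cQ x _ i) (K.*-congˡ (K.trans (cr (b5 {Y = Y} {X = X} E'.ret E'.ik E'.rB (vec j)) i) (cW i j))))))) (p2 (p2 scalar))
     abstract
      s : Z ⟶ Y
      s = b3 E π (_≃_.bb first) (_≃_.fc first) (_≃_.bc first)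
      hn : ∀ z -> _⟶_.⟦_⟧ π (_⟶_.⟦_⟧ s z) X.≈ᴹ X.0ᴹ
      hn = dr E π (_≃_.bb first) (_≃_.fc first) (_≃_.bc first)
      ho : ∀ y -> _⟶_.⟦_⟧ π y X.≈ᴹ X.0ᴹ -> _⟶_.⟦_⟧ s (_⟶_.⟦_⟧ E.pr y) Y.≈ᴹ y
      ho = ds E π (_≃_.bb first) (_≃_.fc first) (_≃_.bc first)
      hm : ∀ z -> _⟶_.⟦_⟧ E.pr (_⟶_.⟦_⟧ s z) Z.≈ᴹ z
      hm = pR E π (_≃_.bb first) (_≃_.fc first) (_≃_.bc first)
      s′ : Z' ⟶ Y
      s′ = b3 E' π (_≃_.bb sec) (_≃_.fc sec) (_≃_.bc sec)
      gn : ∀ z -> _⟶_.⟦_⟧ π (_⟶_.⟦_⟧ s′ z) X.≈ᴹ X.0ᴹ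
      gn = dr E' π (_≃_.bb sec) (_≃_.fc sec) (_≃_.bc sec)
      gp : ∀ y -> _⟶_.⟦_⟧ π y X.≈ᴹ X.0ᴹ -> _⟶_.⟦_⟧ s′ (_⟶_.⟦_⟧ E'.pr y) Y.≈ᴹ y
      gp = ds E' π (_≃_.bb sec) (_≃_.fc sec) (_≃_.bc sec)
      gm : ∀ z -> _⟶_.⟦_⟧ E'.pr (_⟶_.⟦_⟧ s′ z) Z'.≈ᴹ z
      gm = pR E' π (_≃_.bb sec) (_≃_.fc sec) (_≃_.bc sec)
    gt : Z ≃ Z'
    gt = record { fo = E'.pr ∘⟶ s ; bb = E.pr ∘⟶ s′ ; bc = \ z -> Z.≈ᴹ-trans (_⟶_.⟦⟧-cong E.pr (gp (_⟶_.⟦_⟧ s z) (hn z))) (hm z) ; fc = \ z -> Z'.≈ᴹ-trans (_⟶_.⟦⟧-cong E'.pr (ho (_⟶_.⟦_⟧ s′ z) (gn z))) (gm z) }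
   tra : ∀ {m₁ l₁ m₂ l₂ m₃ l₃ m₄ l₄ m₅ l₅} {X : GM m₁ l₁} {Y : GM m₂ l₂} {X' : GM m₃ l₃} {Y' : GM m₄ l₄} {Z : GM m₅ l₅} -> X ≃ X' -> Y ≃ Y' -> Ex X' Y' Z -> Ex X Y Z
   tra {X = X} {Y} {X'} {Y'} {Z} φ ψ E = record { ik = _≃_.bb ψ ∘⟶ (E.ik ∘⟶ _≃_.fo φ) ; pr = E.pr ∘⟶ _≃_.fo ψ ; ret = cq (_⟶_.li (_≃_.bb φ)) (cq E.ret (_⟶_.li (_≃_.fo ψ))) ; rB = \ x -> X.≈ᴹ-trans (_⟶_.⟦⟧-cong (_≃_.bb φ) (X'.≈ᴹ-trans (f-cong E.ret (_≃_.fc ψ _)) (E.rB _))) (_≃_.bc φ x) ; lift = \ z -> _⟶_.⟦_⟧ (_≃_.bb ψ) (E.lift z) ; lif = \ z -> Z.≈ᴹ-trans (_⟶_.⟦⟧-cong E.pr (_≃_.fc ψ _)) (E.lif z)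
    ; ke = \ y e -> let x , d = E.ke _ e in _⟶_.⟦_⟧ (_≃_.bb φ) x ,
      Y.≈ᴹ-trans (_⟶_.⟦⟧-cong (_≃_.bb ψ) (Y'.≈ᴹ-trans (_⟶_.⟦⟧-cong E.ik (_≃_.fc φ x)) d)) (_≃_.bc ψ y)
    ; ve = \ x -> Z.≈ᴹ-trans (_⟶_.⟦⟧-cong E.pr (_≃_.fc ψ _)) (E.ve _) }
    where
    module X = Sd X
    module Y = Sd Y
    module X' = Sd X'
    module Y' = Sd Y'
    module Z = Sd Z
    module E = Ex E
   cY : ∀ {m₁ l₁ m₂ l₂ m₃ l₃ m₄ l₄ m₅ l₅ m₆ l₆ p} {X : GM m₁ l₁} {Y : GM m₂ l₂} {Z : GM m₅ l₅} {X' : GM m₃ l₃} {Y' : GM m₄ l₄} {Z' : GM m₆ l₆} -> Ba (GM.space X) p -> X ≃ X' -> Y ≃ Y' -> Ex X Y Z -> Ex X' Y' Z' -> Z ≃ Z'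
   cY B φ ψ E E' = gt B E (tra φ ψ E')
   record Sp {m l} (V : i9 ring m l) (p : O) : Set (c ⊔ m ⊔ l) where
    open Ke.La V
    field
     vec : Fin p -> Carrierᴹ
     coo : Carrierᴹ -> Fin p -> Carrier
     spa : ∀ v -> v ≈ᴹ co (coo v) vec
   record Sur {m l} (V : i9 ring m l) (p : O) : Set (c ⊔ ℓ ⊔ m ⊔ l) where
    open Ke.La V
    field
     va : Carrierᴹ -> Fin p -> Carrier
     vd : ∀ {u v} -> u ≈ᴹ v -> ∀ i -> va u i ≈ va v i
     vg : ∀ {k} (a : Fin k -> Carrier) w i -> va (co a w) i ≈ ∑ (\ j -> a j * va (w j) i)
     wi : (Fin p -> Carrier) -> Carrierᴹ
     vk : ∀ u i -> va (wi u) i ≈ u i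
   sU : ∀ {m l p} {V : i9 ring m l} -> Sur V p -> Sp V p -> Ba V p
   sU {V = V} S T = record { vec = vec ; coo = coo ; spa = spa ; ind = \ a e -> sy (\ j -> va (vec j)) (\ u -> coo (wi u) , \ i -> K.trans (K.sym (vg _ vec i)) (K.trans (vd (≈ᴹ-sym (spa _)) i) (vk u i))) a \ i -> K.trans (K.sym (vg a vec i)) (K.trans (vd e i) (K.trans (vd (≈ᴹ-sym (∑ᴹ-0 _)) i) (K.trans (vg {0} (\ ()) (\ ()) i) (ue _)))) }
    where
    open Ke.La V
    open Sp T
    open Sur S
   bB : ∀ {m l p} {V : i9 ring m l} -> Ba V p -> Sp V p
   bB B = record { vec = vec ; coo = coo ; spa = spa }
    where open Ba B
   b6 : ∀ {m l p} {V : i9 ring m l} -> Ba V p -> Sur V p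
   b6 {V = V} B = record { va = coo ; vd = cr ; vg = \ a w -> cn _ _ (≈ᴹ-trans (∑ᴹ-cong \ j -> *ₗ-congˡ (spa (w j))) (c4 a _ vec)) ; wi = \ u -> co u vec ; vk = c9 }
    where
    open Ke.La V
    open Ba B
   module _ {m₁ l₁ m₂ l₂} (X : GM m₁ l₁) (Y : GM m₂ l₂) (f : X ⟶ Y) where
    private
     module X = Sd X
     module Y = Sd Y
     module f = _⟶_ f
    iE : ∀ {p} v (c : Fin p -> Carrier) w -> v X.≈ᴹ X.co c w -> f.⟦ v ⟧ Y.≈ᴹ Y.co c (\ i -> f.⟦ w i ⟧)
    iE v c w e = Y.≈ᴹ-trans (f.⟦⟧-cong e) (fg f.li c w)
    cV : ∀ {p} y (c : Fin p -> Carrier) w -> y Y.≈ᴹ Y.co c (\ i -> f.⟦ w i ⟧) -> y Y.≈ᴹ f.⟦ X.co c w ⟧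
    cV y c w e = Y.≈ᴹ-trans e (Y.≈ᴹ-sym (fg f.li c w))
   sur : ∀ {m₁ l₁ m₂ l₂ p} {V : i9 ring m₁ l₁} {W : i9 ring m₂ l₂} (f : Li V W) -> Ba V p -> Sur W p -> (s : i9.Carrierᴹ W -> i9.Carrierᴹ V) -> (∀ w -> i9._≈ᴹ_ W (fun f (s w)) w) -> ∀ v -> i9._≈ᴹ_ W (fun f v) (i9.0ᴹ W) -> i9._≈ᴹ_ V v (i9.0ᴹ V)
   sur {V = V} {W} f B S s ri v e = V.≈ᴹ-trans (spa v) (V.∑ᴹ-zero \ i -> V.≈ᴹ-trans (V.*ₗ-congʳ (Ba.ind (sU S im) (coo v) (W.≈ᴹ-trans (W.≈ᴹ-sym (W.≈ᴹ-trans (f-cong f (spa v)) (fg f _ vec))) e) i)) (V.*ₗ-zeroˡ (vec i)))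
    where
    module V = Ke.La V
    module W = Ke.La W
    open Ba B
    im : Sp W _
    im = record { vec = \ i -> fun f (vec i) ; coo = \ w -> coo (s w) ; spa = \ w -> W.≈ᴹ-trans (W.≈ᴹ-sym (ri w)) (W.≈ᴹ-trans (f-cong f (spa (s w))) (fg f _ vec)) }
   tC : ∀ {m₁ l₁ m₂ l₂ p} {X : GM m₁ l₁} {Y : GM m₂ l₂} -> X ≃ Y -> Ba (GM.space X) p -> Ba (GM.space Y) p
   tC {X = X} {Y} φ B = record { vec = \ i -> _⟶_.⟦_⟧ fo (vec i) ; coo = \ y -> coo (_⟶_.⟦_⟧ bb y) ; spa = \ y -> Y.≈ᴹ-trans (Y.≈ᴹ-sym (fc y)) (Y.≈ᴹ-trans (_⟶_.⟦⟧-cong fo (spa _)) (fg (_⟶_.li fo) _ vec)) ; ind = \ a e -> ind a (X.≈ᴹ-trans (X.≈ᴹ-sym (bc _)) (X.≈ᴹ-trans (_⟶_.⟦⟧-cong bb (Y.≈ᴹ-trans (fg (_⟶_.li fo) a vec) e)) (_⟶_.⟦⟧-0 bb))) }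
    where
    module X = Sd X
    module Y = Sd Y
    open _≃_ φ
    open Ba B
   module Eu {m₁ l₁ m₂ l₂ m₃ l₃ a b} {X : GM m₁ l₁} {Y : GM m₂ l₂} {Z : GM m₃ l₃} (f : X ⟶ Y) (q : Y ⟶ Z) (ke : ∀ y -> GM._≈ᴹ_ Z (_⟶_.⟦_⟧ q y) (GM.0ᴹ Z) -> Σ (GM.Carrierᴹ X) \ x -> GM._≈ᴹ_ Y (_⟶_.⟦_⟧ f x) y) (SX : Sp (GM.space X) a) (w : Fin b -> GM.Carrierᴹ Y) (w-spans : ∀ y -> Σ (Fin b -> Carrier) \ c -> GM._≈ᴹ_ Z (_⟶_.⟦_⟧ q y) (_⟶_.⟦_⟧ q (GM.co Y c w))) where
    private
     module X = Sd X
     module Y = Sd Y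
     module Z = Sd Z
     module f = _⟶_ f
     module q = _⟶_ q
     module SX = Sp SX
    jb : ∀ {t} {T : Set t} -> (Fin a -> T) -> (Fin b -> T) -> Fin (a Q.+ b) -> T
    jb u v i = [ u , v ]′ (splitAt a i)
    fa : Fin (a Q.+ b) -> Y.Carrierᴹ
    fa = jb (\ i -> f.⟦ SX.vec i ⟧) w
    jc : ∀ c e -> Y.co (jb c e) fa Y.≈ᴹ f.⟦ X.co c SX.vec ⟧ Y.+ᴹ Y.co e w
    jc c e = Y.≈ᴹ-trans (Y.∑ᴹ-cong \ i -> Y.≈ᴹ-reflexive (p4 i)) (Y.≈ᴹ-trans (Sn.uq Y.+ᴹ-commutativeMonoid a _ _) (Y.+ᴹ-congʳ (Y.≈ᴹ-sym (fg f.li c SX.vec))))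
     where
     p4 : ∀ i -> jb c e i Y.*ₗ fa i ≡ [ (\ i -> c i Y.*ₗ f.⟦ SX.vec i ⟧) , (\ i -> e i Y.*ₗ w i) ]′ (splitAt a i)
     p4 i with splitAt a i
     ... | i1 _ = U.refl
     ... | i2 _ = U.refl
    fz : ∀ y -> Σ (Fin (a Q.+ b) -> Carrier) \ c -> y Y.≈ᴹ Y.co c fa
    fz y with e , h <- w-spans y with x , g <- ke (y Y.− Y.co e w) (Z.≈ᴹ-trans (q.⟦⟧-− _ _) (Z.mc h)) = jb (SX.coo x) e , Y.≈ᴹ-sym (Y.≈ᴹ-trans (jc _ _) (Y.≈ᴹ-trans (Y.+ᴹ-congʳ (Y.≈ᴹ-trans (f.⟦⟧-cong (X.≈ᴹ-sym (SX.spa x))) g)) (Y.≈ᴹ-trans (Y.+ᴹ-assoc _ _ _) (Y.≈ᴹ-trans (Y.+ᴹ-congˡ (Y.-ᴹ‿inverseˡ _)) (Y.+ᴹ-identityʳ y)))))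
    sx : Sp Y.space (a Q.+ b)
    sx = record { vec = fa ; coo = \ y -> p1 (fz y) ; spa = \ y -> p2 (fz y) }
   -- Exactness and splitting read off from dimensions.
   module Fr {m₁ l₁ m₂ l₂ m₃ l₃ a b} {X : GM m₁ l₁} {Y : GM m₂ l₂} {Z : GM m₃ l₃} (f : X ⟶ Y) (q : Y ⟶ Z) (BX : Ba (GM.space X) a) (BY : Ba (GM.space Y) (a Q.+ b)) (lift : GM.Carrierᴹ Z -> GM.Carrierᴹ Y) (lif : ∀ z -> GM._≈ᴹ_ Z (_⟶_.⟦_⟧ q (lift z)) z) (ke : ∀ y -> GM._≈ᴹ_ Z (_⟶_.⟦_⟧ q y) (GM.0ᴹ Z) -> Σ (GM.Carrierᴹ X) \ x -> GM._≈ᴹ_ Y (_⟶_.⟦_⟧ f x) y) (ve : ∀ x -> GM._≈ᴹ_ Z (_⟶_.⟦_⟧ q (_⟶_.⟦_⟧ f x)) (GM.0ᴹ Z)) (w : Fin b -> GM.Carrierᴹ Y) (w-spans : ∀ y -> Σ (Fin b -> Carrier) \ c -> GM._≈ᴹ_ Z (_⟶_.⟦_⟧ q y) (_⟶_.⟦_⟧ q (GM.co Y c w))) where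
    private
     module X = Sd X
     module Y = Sd Y
     module Z = Sd Z
     module f = _⟶_ f
     module q = _⟶_ q
     module BX = Ba BX
    open Eu {X = X} {Y} {Z} f q ke (bB BX) w w-spans
    B : Ba Y.space (a Q.+ b)
    B = sU (b6 BY) sx
    rC : Li Y.space X.space
    rC = eJ B X.space (jb BX.vec (\ _ -> X.0ᴹ))
    rI : ∀ x -> fun rC f.⟦ x ⟧ X.≈ᴹ x
    rI x = X.≈ᴹ-trans (X.∑ᴹ-cong \ i -> X.*ₗ-congʳ (Ba.cn B (jb (BX.coo x) (\ _ -> 0#)) f.⟦ x ⟧ (Y.≈ᴹ-sym (Y.≈ᴹ-trans (jc _ _) (Y.≈ᴹ-trans (Y.+ᴹ-cong (f.⟦⟧-cong (X.≈ᴹ-sym (BX.spa x))) (Y.∑ᴹ-zero \ i -> Y.*ₗ-zeroˡ _)) (Y.+ᴹ-identityʳ _)))) i)) (X.≈ᴹ-trans (X.∑ᴹ-cong \ i -> X.≈ᴹ-reflexive (p4 i)) (X.≈ᴹ-trans (Sn.uq X.+ᴹ-commutativeMonoid a _ _) (X.≈ᴹ-trans (X.+ᴹ-cong (X.≈ᴹ-sym (BX.spa x)) (X.∑ᴹ-zero \ _ -> X.*ₗ-zeroˡ _)) (X.+ᴹ-identityʳ x))))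
     where
     p4 : ∀ i -> jb (BX.coo x) (\ _ -> 0#) i X.*ₗ jb BX.vec (\ _ -> X.0ᴹ) i ≡ [ (\ i -> BX.coo x i X.*ₗ BX.vec i) , (\ _ -> 0# X.*ₗ X.0ᴹ) ]′ (splitAt a i)
     p4 i with splitAt a i
     ... | i1 _ = U.refl
     ... | i2 _ = U.refl
    ext : Ex X Y Z
    ext = record { ik = f ; pr = q ; ret = rC ; rB = rI ; lift = lift ; lif = lif ; ke = ke ; ve = ve }
    qb : Ba Z.space b
    qb = record { vec = \ i -> q.⟦ w i ⟧ ; coo = \ z -> p1 (w-spans (lift z)) ; spa = \ z -> Z.≈ᴹ-trans (Z.≈ᴹ-sym (lif z)) (Z.≈ᴹ-trans (p2 (w-spans (lift z))) (fg q.li _ w)) ; ind = ind }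
     where
     ind : ∀ e -> Z.co e (\ i -> q.⟦ w i ⟧) Z.≈ᴹ Z.0ᴹ -> ∀ i -> e i ≈ 0#
     ind e h i with x , g <- ke (Y.co e w) (Z.≈ᴹ-trans (fg q.li e w) h) = K.trans (K.reflexive (U.sym (va i))) (Ba.ind B (jb (\ j -> - BX.coo x j) e) (Y.≈ᴹ-trans (jc _ _) (Y.≈ᴹ-trans (Y.+ᴹ-cong (Y.≈ᴹ-trans (f.⟦⟧-cong (X.≈ᴹ-trans (X.cL _ BX.vec) (X.-ᴹ‿cong (X.≈ᴹ-sym (BX.spa x))))) (fs f.li x)) (Y.≈ᴹ-sym g)) (Y.-ᴹ‿inverseˡ _))) (a ↑ʳ i))
      where
      va : ∀ i -> jb (\ j -> - BX.coo x j) e (a ↑ʳ i) ≡ e i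
      va i rewrite splitAt-↑ʳ a b i = U.refl
  module Bas where
   open K using (Carrier; 0#; 1#; ring)
   open Su public using (Ω; scalar; x; θ; _≈Ω_; refl; sym; trans; -1Ω; 0Ω; central; x-x; x-θ; θ-θ; scalar-≈; scalar-+; scalar-*; HasBidegree; HasFermionicDegree; minus-self) renaming (_+_ to infixl 6 _+_; _*_ to infixl 7 _*_)
   private module S = Su
   od : ∀ f -> f * scalar 1# ≈Ω f
   od f = trans (sym (central 1# f)) (S.*-one f)
   Rc : Ring c (c ⊔ ℓ)
   Rc = record { Carrier = Ω ; _≈_ = _≈Ω_ ; _+_ = _+_ ; _*_ = _*_ ; -_ = -1Ω *_ ; 0# = 0Ω ; 1# = scalar 1# ; isRing = record { +-isAbelianGroup = record { isGroup = record { isMonoid = record { isSemigroup = record { isMagma = record { isEquivalence = record { refl = refl ; sym = sym ; trans = trans } ; ∙-cong = S.+-cong } ; assoc = S.+-assoc } ; identity = S.+-zero , S.+-zeroʳ } ; inverse = S.minus-selfˡ , S.minus-self ; ⁻¹-cong = S.*-cong refl } ; comm = S.+-comm } ; *-cong = S.*-cong ; *-assoc = S.*-assoc ; *-identity = S.*-one , od ; distrib = S.distribˡ , S.distribʳ } }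
   module ΩR = Ring Rc
   open ΩR public using (+-cong; +-congˡ; +-congʳ; +-assoc; +-comm; +-identityˡ; +-identityʳ; *-cong; *-congˡ; *-congʳ; *-assoc; *-identityˡ; *-identityʳ; distribˡ; distribʳ; zeroˡ; zeroʳ; setoid) renaming (-_ to infix 8 -_; _-_ to infixl 6 _-_)
   open CommutativeSemigroupProperties (CommutativeMonoid.commutativeSemigroup ΩR.+-commutativeMonoid) public using (interchange)
   open RingProperties Rc public using (-‿involutive; -‿distribˡ-*; -‿distribʳ-*; -‿+-comm; -0#≈0#)
   open Sn ΩR.+-commutativeMonoid public using () renaming (∑ to ∑Ω; ue to ∑Ω-0; sf to ∑Ω-suc; cb to ∑Ω-cong; uj to ∑Ω-zero; uh to ∑Ω-+; pc to ∑Ω-permute; sj to ∑Ω-single; ss to ∑Ω-swap; rc to ∑Ω-remove)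
   ud : ∀ {m} f (g : Fin m -> Ω) -> f * ∑Ω g ≈Ω ∑Ω (\ i -> f * g i)
   ud f = Ho.ha ΩR.+-commutativeMonoid ΩR.+-commutativeMonoid (f *_) *-congˡ (zeroʳ f) (distribˡ f)
   ub : ∀ {m} f (g : Fin m -> Ω) -> ∑Ω g * f ≈Ω ∑Ω (\ i -> g i * f)
   ub f = Ho.ha ΩR.+-commutativeMonoid ΩR.+-commutativeMonoid (_* f) *-congʳ (zeroˡ f) (distribʳ f)
   cw : ∀ {f} g h -> f * g ≈Ω g * f -> f * (g * h) ≈Ω g * (f * h)
   cw g h e = trans (sym (*-assoc _ g h)) (trans (*-congʳ e) (*-assoc g _ h))
   sd : ∀ a f g -> f * (scalar a * g) ≈Ω scalar a * (f * g)
   sd a f g = cw (scalar a) g (sym (central a f))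
   Ma : i9 ring c (c ⊔ ℓ)
   Ma = record { Carrierᴹ = Ω ; _≈ᴹ_ = _≈Ω_ ; _+ᴹ_ = _+_ ; _*ₗ_ = \ a f -> scalar a * f ; 0ᴹ = 0Ω ; -ᴹ_ = -_ ; isLeftModule = record { isLeftSemimodule = record { +ᴹ-isCommutativeMonoid = ΩR.+-isCommutativeMonoid ; isPreleftSemimodule = record { *ₗ-cong = \ e p -> *-cong (scalar-≈ e) p ; *ₗ-zeroˡ = zeroˡ ; *ₗ-distribʳ = \ f a b -> trans (*-congʳ (scalar-+ a b)) (distribʳ f _ _) ; *ₗ-identityˡ = *-identityˡ ; *ₗ-assoc = \ a b f -> trans (*-congʳ (scalar-* a b)) (*-assoc _ _ f) ; *ₗ-zeroʳ = \ a -> zeroʳ _ ; *ₗ-distribˡ = \ a -> distribˡ _ } } ; -ᴹ‿cong = *-congˡ ; -ᴹ‿inverse = ΩR.-‿inverseˡ , ΩR.-‿inverseʳ } }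
   module _ where
    open Ke
    -- A module on which Ω acts through operators satisfying its defining relations.
    record Rd {m ℓm} (V : i9 ring m ℓm) : Set (c ⊔ ℓ ⊔ m ⊔ ℓm) where
     open La V
     field
      X Θ : Fin n -> Li V V
      X-X : ∀ i j v -> fun (X i) (fun (X j) v) ≈ᴹ fun (X j) (fun (X i) v)
      X-Θ : ∀ i j v -> fun (X i) (fun (Θ j) v) ≈ᴹ fun (Θ j) (fun (X i) v)
      Θ-Θ : ∀ i j v -> fun (Θ i) (fun (Θ j) v) ≈ᴹ -ᴹ fun (Θ j) (fun (Θ i) v)
     op : Ω -> Li V V
     op (scalar a) = record { fun = a *ₗ_ ; f-cong = *ₗ-congˡ ; f-+ = *ₗ-distribˡ a ; f-* = \ b v -> sl a b v }
     op (x i) = X i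
     op (θ i) = Θ i
     op (f + g) = record { fun = \ v -> fun (op f) v +ᴹ fun (op g) v ; f-cong = \ e -> +ᴹ-cong (f-cong (op f) e) (f-cong (op g) e) ; f-+ = \ u v -> ≈ᴹ-trans (+ᴹ-cong (f-+ (op f) u v) (f-+ (op g) u v)) (+ᴹ-interchange _ _ _ _) ; f-* = \ a v -> ≈ᴹ-trans (+ᴹ-cong (f-* (op f) a v) (f-* (op g) a v)) (≈ᴹ-sym (*ₗ-distribˡ a _ _)) }
     op (f * g) = cq (op f) (op g)
     act : Ω -> Carrierᴹ -> Carrierᴹ
     act f = fun (op f)
     act-resp : ∀ {f g} -> f ≈Ω g -> ∀ v -> act f v ≈ᴹ act g v
     act-resp refl v = ≈ᴹ-refl
     act-resp (sym p) v = ≈ᴹ-sym (act-resp p v)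
     act-resp (trans p q) v = ≈ᴹ-trans (act-resp p v) (act-resp q v)
     act-resp (S.+-cong p q) v = +ᴹ-cong (act-resp p v) (act-resp q v)
     act-resp (S.*-cong {f′ = f′} p q) v = ≈ᴹ-trans (act-resp p _) (f-cong (op f′) (act-resp q v))
     act-resp (S.+-assoc f g h) v = +ᴹ-assoc _ _ _
     act-resp (S.+-comm f g) v = +ᴹ-comm _ _
     act-resp (S.+-zero f) v = ≈ᴹ-trans (+ᴹ-congʳ (*ₗ-zeroˡ v)) (+ᴹ-identityˡ _)
     act-resp (S.*-assoc f g h) v = ≈ᴹ-refl
     act-resp (S.*-one f) v = *ₗ-identityˡ _
     act-resp (S.*-zero f) v = ≈ᴹ-trans (*ₗ-zeroˡ _) (≈ᴹ-sym (*ₗ-zeroˡ v))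
     act-resp (S.distribˡ f g h) v = f-+ (op f) _ _
     act-resp (S.distribʳ f g h) v = ≈ᴹ-refl
     act-resp (scalar-≈ e) v = *ₗ-congʳ e
     act-resp (scalar-+ a b) v = *ₗ-distribʳ v a b
     act-resp (scalar-* a b) v = *ₗ-assoc a b v
     act-resp (central a f) v = ≈ᴹ-sym (f-* (op f) a v)
     act-resp (x-x i j) v = X-X i j v
     act-resp (x-θ i j) v = X-Θ i j v
     act-resp (θ-θ i j) v = ≈ᴹ-trans (Θ-Θ i j v) (≈ᴹ-sym (na _))
   xs : List (Fin n) -> Ω
   xs [] = scalar 1#
   xs (i ∷ is) = x i * xs is
   θs : List (Fin n) -> Ω
   θs [] = scalar 1#
   θs (i ∷ is) = θ i * θs is
   data Sa {p} (P : List (Fin n) -> List (Fin n) -> Set p) : Ω -> Set (c ⊔ ℓ ⊔ p) where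
    word : ∀ a is js -> P is js -> Sa P (scalar a * (xs is * θs js))
    none : Sa P 0Ω
    _+_ : ∀ {f g} -> Sa P f -> Sa P g -> Sa P (f + g)
    resp : ∀ {f g} -> f ≈Ω g -> Sa P f -> Sa P g
   Si : ∀ {p q} {P : List (Fin n) -> List (Fin n) -> Set p} {Q : List (Fin n) -> List (Fin n) -> Set q} -> (∀ {is js} -> P is js -> Q is js) -> ∀ {f} -> Sa P f -> Sa Q f
   Si h (word a is js p) = word a is js (h p)
   Si h none = none
   Si h (s + t) = Si h s + Si h t
   Si h (resp e s) = resp e (Si h s)
   Sb : ∀ {p} {P : List (Fin n) -> List (Fin n) -> Set p} a {f} -> Sa P f -> Sa P (scalar a * f)
   Sb a (word b is js p) = resp (trans (*-congʳ (scalar-* a b)) (*-assoc _ _ _)) (word (a K.* b) is js p)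
   Sb a none = resp (sym (zeroʳ _)) none
   Sb a (s + t) = resp (sym (distribˡ _ _ _)) (Sb a s + Sb a t)
   Sb a (resp e s) = resp (*-congˡ e) (Sb a s)
   -- The even part generated by the variables.
   infixl 6 _⊞_
   infixl 7 _⊠_
   data Pb : Set c where
    con : Carrier -> Pb
    var : Fin n -> Pb
    _⊞_ _⊠_ : Pb -> Pb -> Pb
   ι : Pb -> Ω
   ι (con a) = scalar a
   ι (var i) = x i
   ι (a ⊞ b) = ι a + ι b
   ι (a ⊠ b) = ι a * ι b
   xc : ∀ i f -> x i * f ≈Ω f * x i
   xc i (scalar a) = sym (central a (x i))
   xc i (x j) = x-x i j
   xc i (θ j) = x-θ i j
   xc i (f + g) = trans (distribˡ _ _ _) (trans (+-cong (xc i f) (xc i g)) (sym (distribʳ _ _ _)))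
   xc i (f * g) = trans (sym (*-assoc _ _ _)) (trans (*-congʳ (xc i f)) (trans (*-assoc _ _ _) (trans (*-congˡ (xc i g)) (sym (*-assoc _ _ _)))))
   cc : ∀ a f -> ι a * f ≈Ω f * ι a
   cc (con a) f = central a f
   cc (var i) f = xc i f
   cc (a ⊞ b) f = trans (distribʳ _ _ _) (trans (+-cong (cc a f) (cc b f)) (sym (distribˡ _ _ _)))
   cc (a ⊠ b) f = trans (*-assoc _ _ _) (trans (*-congˡ (cc b f)) (trans (sym (*-assoc _ _ _)) (trans (*-congʳ (cc a f)) (*-assoc _ _ _))))
   cd : ∀ a f g -> f * (ι a * g) ≈Ω ι a * (f * g)
   cd a f g = cw (ι a) g (sym (cc a f))
   infix 4 _≈ᴾ_
   record _≈ᴾ_ (a b : Pb) : Set (c ⊔ ℓ) where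
    constructor sk
    field un : ι a ≈Ω ι b
   open _≈ᴾ_ public
   Po : CommutativeRing c (c ⊔ ℓ)
   Po = record { Carrier = Pb ; _≈_ = _≈ᴾ_ ; _+_ = _⊞_ ; _*_ = _⊠_ ; -_ = con (K.- 1#) ⊠_ ; 0# = con 0# ; 1# = con 1# ; isCommutativeRing = record { isRing = record { +-isAbelianGroup = record { isGroup = record { isMonoid = record { isSemigroup = record { isMagma = record { isEquivalence = record { refl = sk refl ; sym = \ (sk p) -> sk (sym p) ; trans = \ (sk p) (sk q) -> sk (trans p q) } ; ∙-cong = \ (sk p) (sk q) -> sk (+-cong p q) } ; assoc = \ a b d -> sk (+-assoc _ _ _) } ; identity = (\ a -> sk (+-identityˡ _)) , \ a -> sk (+-identityʳ _) } ; inverse = (\ a -> sk (ΩR.-‿inverseˡ _)) , \ a -> sk (ΩR.-‿inverseʳ _) ; ⁻¹-cong = \ (sk p) -> sk (*-congˡ p) }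
       ; comm = \ a b -> sk (+-comm _ _) }
      ; *-cong = \ (sk p) (sk q) -> sk (*-cong p q)
      ; *-assoc = \ a b d -> sk (*-assoc _ _ _)
      ; *-identity = (\ a -> sk (*-identityˡ _)) , \ a -> sk (*-identityʳ _)
      ; distrib = (\ a b d -> sk (distribˡ _ _ _)) , \ a b d -> sk (distribʳ _ _ _) }
     ; *-comm = \ a b -> sk (cc a (ι b)) } }
   module P = CommutativeRing Po
   open Exp P.semiring public using () renaming (_^_ to infixr 8 _^ᴾ_; ^-homo-* to ^ᴾ-+; ^-cong to ^ᴾ-cong)
   open Ri Po public using () renaming (∑ to ∑ᴾ; ue to ∑ᴾ-0; sf to ∑ᴾ-suc; cb to ∑ᴾ-cong; ∑-zero to ∑ᴾ-zero; ∑-+ to ∑ᴾ-+; ui to ∑ᴾ-*ˡ; uv to ∑ᴾ-*ʳ; ss to ∑ᴾ-swap)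
   uw : ∀ {m} (f : Fin m -> Pb) -> ι (∑ᴾ f) ≈Ω ∑Ω (\ i -> ι (f i))
   uw = Ho.ha P.+-commutativeMonoid ΩR.+-commutativeMonoid ι un refl (\ _ _ -> refl)
   data Pc : O -> Pb -> Set (c ⊔ ℓ) where
    con : ∀ {d} a -> Pc d (con a)
    var : ∀ i -> Pc 1 (var i)
    _⊞_ : ∀ {d a b} -> Pc d a -> Pc d b -> Pc d (a ⊞ b)
    _⊠_ : ∀ {d e a b} -> Pc d a -> Pc e b -> Pc (d Q.+ e) (a ⊠ b)
    wea : ∀ {d e a} -> d ≤ e -> Pc d a -> Pc e a
    resp : ∀ {d a b} -> a ≈ᴾ b -> Pc d a -> Pc d b
   Pd : ∀ {d a} m -> Pc d a -> Pc (m Q.* d) (a ^ᴾ m)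
   Pd Q.zero p = con 1#
   Pd (Q.suc m) p = p ⊠ Pd m p
   Pf : ∀ {d m} {f : Fin m -> Pb} -> (∀ i -> Pc d (f i)) -> Pc d (∑ᴾ f)
   Pf {m = Q.zero} p = resp (P.sym (∑ᴾ-0 _)) (con 0#)
   Pf {m = Q.suc m} p = resp (P.sym (∑ᴾ-suc _)) (p Fin.zero ⊞ Pf (\ i -> p (Fin.suc i)))
    where import Data.Fin.Base as Fin
   xb : List (Fin n) -> Pb
   xb [] = con 1#
   xb (i ∷ is) = var i ⊠ xb is
   xa : ∀ is -> xs is ≈Ω ι (xb is)
   xa [] = refl
   xa (i ∷ is) = *-congˡ (xa is)
   xd : ∀ is -> Pc (length is) (xb is)
   xd [] = con 1#
   xd (i ∷ is) = var i ⊠ xd is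
   Bo : O -> O -> List (Fin n) -> List (Fin n) -> Set
   Bo D q is js = (length is ≤ D) × (length js ≡ q)
   -- x-degree at most D and fermionic degree q.
   Fil : O -> O -> Ω -> Set (c ⊔ ℓ)
   Fil D q = Sa (Bo D q)
   Fa : ∀ {D E q f} -> D ≤ E -> Fil D q f -> Fil E q f
   Fa l = Si \ (p , e) -> e2 p l , e
   Fj : ∀ {D q f} i -> Fil D q f -> Fil (Q.suc D) q (x i * f)
   Fj i (word a is js (p , e)) = resp (trans (*-congˡ (*-assoc _ _ _)) (sym (sd a (x i) _))) (word a (i ∷ is) js (Q.s≤s p , e))
   Fj i none = resp (sym (zeroʳ _)) none
   Fj i (s + t) = resp (sym (distribˡ _ _ _)) (Fj i s + Fj i t)
   Fj i (resp e s) = resp (*-congˡ e) (Fj i s)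
   Fb : ∀ {d D q a f} -> Pc d a -> Fil D q f -> Fil (d Q.+ D) q (ι a * f)
   Fb {d} {D} (con a) s = Fa (e0 D d) (Sb a s)
   Fb (var i) s = Fj i s
   Fb (p ⊞ q) s = resp (sym (distribʳ _ _ _)) (Fb p s + Fb q s)
   Fb {D = D} (_⊠_ {d} {e} p q) s = resp (sym (*-assoc _ _ _)) (Fa (e1 (U.sym (e7 d e D))) (Fb p (Fb q s)))
   Fb {D = D} (wea l p) s = Fa (Q.+-monoˡ-≤ D l) (Fb p s)
   Fb (resp e p) s = resp (*-congʳ (un e)) (Fb p s)
   Fd : ∀ {D q f} i -> Fil D q f -> Fil D (Q.suc q) (θ i * f)
   Fd i (word a is js (p , e)) = resp (trans (*-congˡ (trans (sym (cw (xs is) (θs js) (xg i is))) refl)) (sym (sd a (θ i) _))) (word a is (i ∷ js) (p , U.cong Q.suc e))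
    where
    xg : ∀ i is -> θ i * xs is ≈Ω xs is * θ i
    xg i [] = sym (central 1# (θ i))
    xg i (j ∷ is) = trans (cw (x j) (xs is) (sym (x-θ j i))) (trans (*-congˡ (xg i is)) (sym (*-assoc _ _ _)))
   Fd i none = resp (sym (zeroʳ _)) none
   Fd i (s + t) = resp (sym (distribˡ _ _ _)) (Fd i s + Fd i t)
   Fd i (resp e s) = resp (*-congˡ e) (Fd i s)
   Fc : ∀ js -> Fil 0 (length js) (θs js)
   Fc js = resp (trans (*-identityˡ _) (*-identityˡ _)) (word 1# [] js (Q.z≤n , U.refl))
   Fn : ∀ {D q f} is -> Fil D q f -> Fil (length is Q.+ D) q (xs is * f)
   Fn [] s = resp (sym (*-identityˡ _)) s
   Fn (i ∷ is) s = resp (sym (*-assoc _ _ _)) (Fj i (Fn is s))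
   Fh : ∀ {D q f} js -> Fil D q f -> Fil D (length js Q.+ q) (θs js * f)
   Fh [] s = resp (sym (*-identityˡ _)) s
   Fh (i ∷ is) s = resp (sym (*-assoc _ _ _)) (Fd i (Fh is s))
   Fk : ∀ {D q E q′ f g} -> Fil D q f -> Fil E q′ g -> Fil (D Q.+ E) (q Q.+ q′) (f * g)
   Fk {E = E} (word a is js (p , U.refl)) t = resp (trans (*-congˡ (sym (*-assoc _ _ _))) (sym (*-assoc _ _ _))) (Sb a (Fa (Q.+-monoˡ-≤ E p) (Fn is (Fh js t))))
   Fk none t = resp (sym (zeroˡ _)) none
   Fk (s + s′) t = resp (sym (distribʳ _ _ _)) (Fk s t + Fk s′ t)
   Fk (resp e s) t = resp (*-congʳ e) (Fk s t)
   bi : ∀ {d q f} -> HasBidegree d q f -> Fil d q f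
   bi (HasBidegree.scalar a) = resp (trans (*-congˡ (*-identityˡ _)) (od _)) (word a [] [] (Q.z≤n , U.refl))
   bi (HasBidegree.x i) = resp (od _) (Fj i (Fc []))
   bi (HasBidegree.θ i) = resp (od _) (Fd i (Fc []))
   bi HasBidegree.zero = none
   bi (s HasBidegree.+ t) = bi s + bi t
   bi (s HasBidegree.* t) = Fk (bi s) (bi t)
   bi (HasBidegree.resp e s) = resp e (bi s)
   fe : ∀ {q f} -> HasFermionicDegree q f -> Σ O \ D -> Fil D q f
   fe (HasFermionicDegree.homogeneous d) = _ , bi d
   fe (s HasFermionicDegree.+ t) with D , p <- fe s | E , q <- fe t = D Q.+ E , Fa (e9 D E) p + Fa (e0 E D) q
   fe (HasFermionicDegree.resp e s) with D , p <- fe s = D , resp e p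
   xe : ∀ is -> HasBidegree (length is) 0 (xs is)
   xe [] = HasBidegree.scalar 1#
   xe (i ∷ is) = HasBidegree.x i HasBidegree.* xe is
   sn : ∀ js -> HasBidegree 0 (length js) (θs js)
   sn [] = HasBidegree.scalar 1#
   sn (i ∷ is) = HasBidegree.θ i HasBidegree.* sn is
   Fi : ∀ {D q f} -> Fil D q f -> HasFermionicDegree q f
   Fi (word a is js (_ , U.refl)) = HasFermionicDegree.homogeneous (HasBidegree.scalar a HasBidegree.* (xe is HasBidegree.* sn js))
   Fi none = HasFermionicDegree.homogeneous {p = 0} HasBidegree.zero
   Fi (s + t) = Fi s HasFermionicDegree.+ Fi t
   Fi (resp e s) = HasFermionicDegree.resp e (Fi s)
  module Ro where
   open K
   open Exp semiring using (_^_; ^-homo-*; ^-assocʳ; ^-congˡ)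
   open Col
   open import Relation.Binary.Reasoning.Setoid setoid
   1^ : ∀ m -> 1# ^ m ≈ 1#
   1^ Q.zero = refl
   1^ (Q.suc m) = trans (*-identityˡ _) (1^ m)
   r7 : ∀ m -> ζ ^ (r Q.* m) ≈ 1#
   r7 m = trans (sym (^-assocʳ ζ r m)) (trans (^-congˡ m rw) (1^ m))
   uC : ∀ a -> ζ ^ (a % r) ≈ ζ ^ a
   uC a = sym (begin ζ ^ a ≡⟨ U.cong (ζ ^_) (m≡m%n+[m/n]*n a r) ⟩ ζ ^ (a % r Q.+ (a / r) Q.* r) ≈⟨ ^-homo-* ζ (a % r) _ ⟩ ζ ^ (a % r) * ζ ^ ((a / r) Q.* r) ≡⟨ U.cong (\ e -> ζ ^ (a % r) * ζ ^ e) (Q.*-comm (a / r) r) ⟩ ζ ^ (a % r) * ζ ^ (r Q.* (a / r)) ≈⟨ *-congˡ (r7 (a / r)) ⟩ ζ ^ (a % r) * 1# ≈⟨ *-identityʳ _ ⟩ ζ ^ (a % r) ∎)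
   -- ζ to the power of a colour and its inverse.
   pow inv : Fin r -> Carrier
   pow d = ζ ^ toℕ d
   inv d = ζ ^ (r Q.∸ toℕ d)
   pf : ∀ d -> pow d * inv d ≈ 1#
   pf d = trans (sym (^-homo-* ζ (toℕ d) _)) (trans (reflexive (U.cong (ζ ^_) (Q.m+[n∸m]≡n (Q.<⇒≤ (toℕ<n d))))) rw)
   pk : ∀ d e -> pow (d ⊕ e) ≈ pow d * pow e
   pk d e = trans (reflexive (U.cong (ζ ^_) (tj _))) (trans (uC _) (^-homo-* ζ (toℕ d) (toℕ e)))
   ph : pow ug ≈ 1#
   ph = reflexive (U.cong (ζ ^_) th)
   iw : ∀ {a b b'} -> a * b ≈ 1# -> a * b' ≈ 1# -> b ≈ b'
   iw {a} {b} {b'} p q = begin b ≈⟨ sym (*-identityʳ b) ⟩ b * 1# ≈⟨ *-congˡ (sym q) ⟩ b * (a * b') ≈⟨ sym (*-assoc b a b') ⟩ b * a * b' ≈⟨ *-congʳ (trans (*-comm b a) p) ⟩ 1# * b' ≈⟨ *-identityˡ b' ⟩ b' ∎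
   il : inv ug ≈ 1#
   il = iw (pf ug) (trans (*-identityʳ _) ph)
   iu : ∀ d e -> inv (d ⊕ e) ≈ inv d * inv e
   iu d e = iw (pf (d ⊕ e)) (begin pow (d ⊕ e) * (inv d * inv e) ≈⟨ *-congʳ (pk d e) ⟩ pow d * pow e * (inv d * inv e) ≈⟨ swap _ _ _ _ ⟩ (pow d * inv d) * (pow e * inv e) ≈⟨ *-cong (pf d) (pf e) ⟩ 1# * 1# ≈⟨ *-identityˡ 1# ⟩ 1# ∎)
    where
    open Kn using (solve; _:=_; _:*_)
    swap : ∀ a b c d -> a * b * (c * d) ≈ (a * c) * (b * d)
    swap = solve 4 (\ a b c d -> a :* b :* (c :* d) := (a :* c) :* (b :* d)) refl
   pK : ∀ d m -> pow d ^ (r Q.* m) ≈ 1#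
   pK d m = begin pow d ^ (r Q.* m) ≈⟨ ^-assocʳ ζ (toℕ d) (r Q.* m) ⟩ ζ ^ (toℕ d Q.* (r Q.* m)) ≡⟨ U.cong (ζ ^_) (U.trans (Q.*-comm (toℕ d) _) (Q.*-assoc r m (toℕ d))) ⟩ ζ ^ (r Q.* (m Q.* toℕ d)) ≈⟨ r7 _ ⟩ 1# ∎
   i4 : ∀ d m -> inv d ^ (r Q.* m) ≈ 1#
   i4 d m = begin inv d ^ (r Q.* m) ≈⟨ ^-assocʳ ζ (r Q.∸ toℕ d) (r Q.* m) ⟩ ζ ^ ((r Q.∸ toℕ d) Q.* (r Q.* m)) ≡⟨ U.cong (ζ ^_) (U.trans (Q.*-comm (r Q.∸ toℕ d) _) (Q.*-assoc r m _)) ⟩ ζ ^ (r Q.* (m Q.* (r Q.∸ toℕ d))) ≈⟨ r7 _ ⟩ 1# ∎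
  module Op where
   open K using (Carrier; 0#; 1#; ring)
   open Kg using (_^_)
   open Ro using (inv; il; iu; i4)
   open Su using (actΩ; actΩ-cong)
   open Bas
   open Grp
   open import Relation.Binary.Reasoning.Setoid setoid
   κ : G -> Fin n -> Carrier
   κ (colour , w) i = inv (colour (w ⟨$⟩ʳ i))
   private
    cI : ∀ a b b' z -> b K.≈ b' -> scalar (a K.* b) * z ≈Ω scalar b' * (scalar a * z)
    cI a b b' z e = trans (*-congʳ (trans (scalar-≈ (K.trans (K.*-comm a b) (K.*-congʳ e))) (scalar-* b' a))) (*-assoc _ _ _)
   ai : ∀ g h f -> actΩ (g ∙ h) f ≈Ω actΩ g (actΩ h f)
   ai g h (scalar a) = refl
   ai (d , w) (e , u) (x i) = trans (*-congʳ (scalar-≈ (iu (d (w ⟨$⟩ʳ (u ⟨$⟩ʳ i))) (e (w ⟨$⟩ˡ (w ⟨$⟩ʳ (u ⟨$⟩ʳ i))))))) (cI (inv (d (w ⟨$⟩ʳ (u ⟨$⟩ʳ i)))) (inv (e (w ⟨$⟩ˡ (w ⟨$⟩ʳ (u ⟨$⟩ʳ i))))) (inv (e (u ⟨$⟩ʳ i))) _ (K.reflexive (U.cong (\ j -> inv (e j)) (inverseˡ w))))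
   ai (d , w) (e , u) (θ i) = trans (*-congʳ (scalar-≈ (iu (d (w ⟨$⟩ʳ (u ⟨$⟩ʳ i))) (e (w ⟨$⟩ˡ (w ⟨$⟩ʳ (u ⟨$⟩ʳ i))))))) (cI (inv (d (w ⟨$⟩ʳ (u ⟨$⟩ʳ i)))) (inv (e (w ⟨$⟩ˡ (w ⟨$⟩ʳ (u ⟨$⟩ʳ i))))) (inv (e (u ⟨$⟩ʳ i))) _ (K.reflexive (U.cong (\ j -> inv (e j)) (inverseˡ w))))
   ai g h (f + f′) = +-cong (ai g h f) (ai g h f′)
   ai g h (f * f′) = *-cong (ai g h f) (ai g h f′)
   am : ∀ f -> actΩ ε f ≈Ω f
   am (scalar a) = refl
   am (x i) = trans (*-congʳ (scalar-≈ il)) (*-identityˡ _)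
   am (θ i) = trans (*-congʳ (scalar-≈ il)) (*-identityˡ _)
   am (f + g) = +-cong (am f) (am g)
   am (f * g) = *-cong (am f) (am g)
   al : ∀ {g h} -> g ≈ᴳ h -> ∀ f -> actΩ g f ≈Ω actΩ h f
   al e (scalar a) = refl
   al {d , w} {d' , w'} (p , q) (x i) rewrite q i | p (w' ⟨$⟩ʳ i) = refl
   al {d , w} {d' , w'} (p , q) (θ i) rewrite q i | p (w' ⟨$⟩ʳ i) = refl
   al {g} {h} e (f + f′) = +-cong (al {g} {h} e f) (al {g} {h} e f′)
   al {g} {h} e (f * f′) = *-cong (al {g} {h} e f) (al {g} {h} e f′)
   aq : ∀ g {m} (f : Fin m -> Ω) -> actΩ g (∑Ω f) ≈Ω ∑Ω (\ i -> actΩ g (f i))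
   aq g = Ho.ha ΩR.+-commutativeMonoid ΩR.+-commutativeMonoid (actΩ g) (actΩ-cong g) refl (\ _ _ -> refl)
   a3 : ∀ g i e -> actΩ g (ι (var i ^ᴾ e)) ≈Ω scalar (κ g i ^ e) * ι (var (p2 g ⟨$⟩ʳ i) ^ᴾ e)
   a3 g i Q.zero = sym (*-identityˡ _)
   a3 g i (Q.suc e) = trans (*-congˡ (a3 g i e)) (trans (*-assoc _ _ _) (trans (*-congˡ (sd _ _ _)) (trans (sym (*-assoc _ _ _)) (*-congʳ (sym (scalar-* _ _))))))
   pq : O -> Pb
   pq m = ∑ᴾ \ i -> var i ^ᴾ (r Q.* m)
   p : O -> Ω
   p m = ι (pq m)
   dC : O -> Ω
   dC e = ∑Ω \ i -> ι (var i ^ᴾ e) * θ i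
   da : O -> O
   da m = r Q.* m Q.+ (r Q.∸ 1)
   -- Up to the factor r(m+1), the differential of p (m+1).
   d : O -> Ω
   d m = dC (da m)
   sP : ∀ m -> Q.suc (da m) ≡ r Q.* Q.suc m
   sP m = U.trans (U.sym (e8 (r Q.* m) _)) (U.trans (U.cong (r Q.* m Q.+_) (Q.m+[n∸m]≡n (Q.>-nonZero⁻¹ r))) (U.trans (e6 (r Q.* m) r) (U.sym (Q.*-suc r m))))
   pS : ∀ m g -> actΩ g (p m) ≈Ω p m
   pS m g = begin actΩ g (p m) ≈⟨ actΩ-cong g (uw _) ⟩ actΩ g (∑Ω \ i -> ι (var i ^ᴾ (r Q.* m))) ≈⟨ aq g _ ⟩ ∑Ω (\ i -> actΩ g (ι (var i ^ᴾ (r Q.* m)))) ≈⟨ ∑Ω-cong (\ i -> trans (a3 g i (r Q.* m)) (trans (*-congʳ (scalar-≈ (i4 (p1 g (p2 g ⟨$⟩ʳ i)) m))) (*-identityˡ _))) ⟩ ∑Ω (\ i -> ι (var (p2 g ⟨$⟩ʳ i) ^ᴾ (r Q.* m))) ≈⟨ sym (∑Ω-permute (\ i -> ι (var i ^ᴾ (r Q.* m))) (p2 g)) ⟩ ∑Ω (\ i -> ι (var i ^ᴾ (r Q.* m))) ≈⟨ sym (uw _) ⟩ p m ∎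
   d2 : ∀ m g -> actΩ g (d m) ≈Ω d m
   d2 m g = begin actΩ g (d m) ≈⟨ aq g _ ⟩ ∑Ω (\ i -> actΩ g (ι (var i ^ᴾ e)) * (scalar (κ g i) * θ (w ⟨$⟩ʳ i))) ≈⟨ ∑Ω-cong (\ i -> begin actΩ g (ι (var i ^ᴾ e)) * (scalar (κ g i) * θ (w ⟨$⟩ʳ i)) ≈⟨ trans (sd _ _ _) (*-congˡ (*-congʳ (a3 g i e))) ⟩ scalar (κ g i) * (scalar (κ g i ^ e) * ι (var (w ⟨$⟩ʳ i) ^ᴾ e) * θ (w ⟨$⟩ʳ i)) ≈⟨ trans (*-congˡ (*-assoc _ _ _)) (trans (sym (*-assoc _ _ _)) (*-congʳ (sym (scalar-* _ _)))) ⟩ scalar (κ g i ^ Q.suc e) * (ι (var (w ⟨$⟩ʳ i) ^ᴾ e) * θ (w ⟨$⟩ʳ i)) ≈⟨ trans (*-congʳ (scalar-≈ (K.trans (K.reflexive (U.cong (κ g i ^_) (sP m))) (i4 (p1 g (w ⟨$⟩ʳ i)) (Q.suc m))))) (*-identityˡ _) ⟩ ι (var (w ⟨$⟩ʳ i) ^ᴾ e) * θ (w ⟨$⟩ʳ i) ∎) ⟩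
    ∑Ω (\ i -> ι (var (w ⟨$⟩ʳ i) ^ᴾ e) * θ (w ⟨$⟩ʳ i)) ≈⟨ sym (∑Ω-permute (\ i -> ι (var i ^ᴾ e) * θ i) w) ⟩
    d m ∎
    where
    e = da m
    w = p2 g
   -- The derivation of Ω killing the variables and sending θᵢ to xᵢ^(rm) θᵢ.
   D : O -> Ω -> Ω
   D m (scalar a) = 0Ω
   D m (x i) = 0Ω
   D m (θ i) = ι (var i ^ᴾ (r Q.* m)) * θ i
   D m (f + g) = D m f + D m g
   D m (f * g) = D m f * g + f * D m g
   private
    lz : ∀ {f g f′ g′} -> f ≈Ω 0Ω -> g ≈Ω 0Ω -> f * g′ + f′ * g ≈Ω 0Ω
    lz e e' = trans (+-cong (trans (*-congʳ e) (zeroˡ _)) (trans (*-congˡ e') (zeroʳ _))) (+-identityˡ _)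
   Dc : ∀ m a f -> D m (scalar a * f) ≈Ω scalar a * D m f
   Dc m a f = trans (+-congʳ (zeroˡ f)) (+-identityˡ _)
   Da : ∀ m {f g} -> f ≈Ω g -> D m f ≈Ω D m g
   Da m refl = refl
   Da m (sym e) = sym (Da m e)
   Da m (trans e e') = trans (Da m e) (Da m e')
   Da m (Superspace.+-cong e e') = +-cong (Da m e) (Da m e')
   Da m (Superspace.*-cong e e') = +-cong (*-cong (Da m e) e') (*-cong e (Da m e'))
   Da m (Superspace.+-assoc f g h) = +-assoc _ _ _
   Da m (Superspace.+-comm f g) = +-comm _ _
   Da m (Superspace.+-zero f) = +-identityˡ _
   Da m (Superspace.*-assoc f g h) = trans (+-congʳ (distribʳ _ _ _)) (trans (+-assoc _ _ _) (+-cong (*-assoc _ _ _) (trans (+-cong (*-assoc _ _ _) (*-assoc _ _ _)) (sym (distribˡ _ _ _)))))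
   Da m (Superspace.*-one f) = trans (Dc m 1# f) (*-identityˡ _)
   Da m (Superspace.*-zero f) = trans (Dc m 0# f) (zeroˡ _)
   Da m (Superspace.distribˡ f g h) = trans (+-cong (distribˡ _ _ _) (distribˡ _ _ _)) (interchange _ _ _ _)
   Da m (Superspace.distribʳ f g h) = trans (+-cong (distribʳ _ _ _) (distribʳ _ _ _)) (interchange _ _ _ _)
   Da m (scalar-≈ e) = refl
   Da m (scalar-+ a b) = sym (+-identityˡ _)
   Da m (scalar-* a b) = sym (lz refl refl)
   Da m (central a f) = trans (Dc m a f) (trans (central a _) (trans (sym (+-identityʳ _)) (+-congˡ (sym (zeroʳ _)))))
   Da m (x-x i j) = trans (lz refl refl) (sym (lz refl refl))
   Da m (x-θ i j) = begin 0Ω * θ j + x i * (e * θ j) ≈⟨ trans (+-congʳ (zeroˡ _)) (+-identityˡ _) ⟩ x i * (e * θ j) ≈⟨ xc i _ ⟩ e * θ j * x i ≈⟨ sym (trans (+-congˡ (zeroʳ _)) (+-identityʳ _)) ⟩ e * θ j * x i + θ j * 0Ω ∎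
    where e = ι (var j ^ᴾ (r Q.* m))
   Da m (θ-θ i j) = begin a * θ i * θ j + θ i * (b * θ j) ≈⟨ +-cong (*-assoc _ _ _) (cd (var j ^ᴾ (r Q.* m)) (θ i) (θ j)) ⟩ a * (θ i * θ j) + b * (θ i * θ j) ≈⟨ +-cong (*-congˡ (θ-θ i j)) (*-congˡ (θ-θ i j)) ⟩ a * - (θ j * θ i) + b * - (θ j * θ i) ≈⟨ +-comm _ _ ⟩ b * - (θ j * θ i) + a * - (θ j * θ i) ≈⟨ +-cong (sd _ _ _) (sd _ _ _) ⟩ - (b * (θ j * θ i)) + - (a * (θ j * θ i)) ≈⟨ sym (distribˡ _ _ _) ⟩ - (b * (θ j * θ i) + a * (θ j * θ i)) ≈⟨ *-congˡ (+-cong (sym (*-assoc _ _ _)) (sym (cd (var i ^ᴾ (r Q.* m)) (θ j) (θ i)))) ⟩ - (b * θ j * θ i + θ j * (a * θ i)) ≈⟨ sym (Dc m _ _) ⟩ D m (- (θ j * θ i)) ∎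
    where
    a = ι (var i ^ᴾ (r Q.* m))
    b = ι (var j ^ᴾ (r Q.* m))
   Df : ∀ m a -> D m (ι a) ≈Ω 0Ω
   Df m (con a) = refl
   Df m (var i) = refl
   Df m (a ⊞ b) = trans (+-cong (Df m a) (Df m b)) (+-identityˡ _)
   Df m (a ⊠ b) = lz (Df m a) (Df m b)
   Dd : ∀ m a f -> D m (ι a * f) ≈Ω ι a * D m f
   Dd m a f = trans (+-congʳ (trans (*-congʳ (Df m a)) (zeroˡ f))) (+-identityˡ _)
   Dj : ∀ m {k} (f : Fin k -> Ω) -> D m (∑Ω f) ≈Ω ∑Ω (\ i -> D m (f i))
   Dj m = Ho.ha ΩR.+-commutativeMonoid ΩR.+-commutativeMonoid (D m) (Da m) refl (\ _ _ -> refl)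
   D-d : ∀ m e -> D m (d e) ≈Ω d (e Q.+ m)
   D-d m e = trans (Dj m _) (∑Ω-cong \ i -> trans (Dd m _ _) (trans (sym (*-assoc _ _ _)) (*-congʳ (un (P.trans (P.sym (^ᴾ-+ (var i) (da e) (r Q.* m))) (P.reflexive (U.cong (var i ^ᴾ_) eh)))))))
    where
    eh : da e Q.+ r Q.* m ≡ da (e Q.+ m)
    eh = U.trans (e7 (r Q.* e) _ _) (U.trans (U.cong (r Q.* e Q.+_) (e6 (r Q.∸ 1) _)) (U.trans (U.sym (e7 (r Q.* e) _ _)) (U.cong (Q._+ (r Q.∸ 1)) (U.sym (Q.*-distribˡ-+ r e m)))))
   D-D : ∀ m m' f -> D m (D m' f) ≈Ω D m' (D m f)
   D-D m m' (scalar a) = refl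
   D-D m m' (x i) = refl
   D-D m m' (θ i) = trans (Dd m _ _) (trans (cw _ _ (cc (var i ^ᴾ (r Q.* m')) _)) (sym (Dd m' _ _)))
   D-D m m' (f + g) = +-cong (D-D m m' f) (D-D m m' g)
   D-D m m' (f * g) = trans (interchange _ _ _ _) (+-cong (+-congʳ (*-congʳ (D-D m m' f))) (+-congˡ (*-congˡ (D-D m m' g))))
   De : ∀ m g f -> D m (actΩ g f) ≈Ω actΩ g (D m f)
   De m g (scalar a) = refl
   De m g (x i) = trans (Dc m _ _) (zeroʳ _)
   De m g (θ i) = begin D m (scalar (κ g i) * θ (w ⟨$⟩ʳ i)) ≈⟨ Dc m _ _ ⟩ scalar (κ g i) * (ι (var (w ⟨$⟩ʳ i) ^ᴾ (r Q.* m)) * θ (w ⟨$⟩ʳ i)) ≈⟨ sym (sd _ _ _) ⟩ ι (var (w ⟨$⟩ʳ i) ^ᴾ (r Q.* m)) * (scalar (κ g i) * θ (w ⟨$⟩ʳ i)) ≈⟨ *-congʳ (sym (trans (a3 g i (r Q.* m)) (trans (*-congʳ (scalar-≈ (i4 (p1 g (w ⟨$⟩ʳ i)) m))) (*-identityˡ _)))) ⟩ actΩ g (ι (var i ^ᴾ (r Q.* m))) * (scalar (κ g i) * θ (w ⟨$⟩ʳ i)) ∎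
    where w = p2 g
   De m g (f + h) = +-cong (De m g f) (De m g h)
   De m g (f * h) = +-cong (*-congʳ (De m g f)) (*-congˡ (De m g h))
   Dg : ∀ m {E q f} -> Fil E q f -> Fil (r Q.* m Q.+ E) q (D m f)
   Dg m {E} (word a is js (l , U.refl)) = resp (sym (Dc m a _)) (Sb a (resp (sym (trans (Da m (*-congʳ (xa is))) (trans (Dd m (xb is) _) (*-congʳ (sym (xa is)))))) (Fa (e2 (Q.+-monoˡ-≤ _ l) (e1 (e6 E _))) (Fn is (Dh js)))))
    where
    open import Data.List.Base using ([]; _∷_; length)
    Dh : ∀ js -> Fil (r Q.* m) (length js) (D m (θs js))
    Dh [] = none
    Dh (j ∷ js) = resp (+-congʳ (sym (*-assoc _ _ _))) (Fa (e1 (U.trans (e5 _) (Q.*-identityʳ _))) (Fb (Pd (r Q.* m) (var j)) (Fc (j ∷ js))) + Fd j (Dh js))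
   Dg m none = none
   Dg m (s + t) = Dg m s + Dg m t
   Dg m (resp e s) = resp (Da m e) (Dg m s)
  module Fl where
   open K using (Carrier; 0#; 1#; ring)
   open Su using (actΩ; actΩ-cong; actΩ-fermionicDegree)
   open Bas
   open Op
   open Grp
   open Rep
   open import Relation.Binary.Reasoning.Setoid setoid
   ae : ∀ g {E q f} -> Fil E q f -> Fil E q (actΩ g f)
   ae g (word a is js (l , U.refl)) = Sb a (Fa (e2 (e1 (e5 _)) l) (Fk (ax is) (af js)))
    where
    ax : ∀ is -> Fil (length is) 0 (actΩ g (xs is))
    ax List.[] = Fc List.[]
    ax (i List.∷ is) = resp (sym (*-assoc _ _ _)) (Sb _ (Fj _ (ax is)))
    af : ∀ js -> Fil 0 (length js) (actΩ g (θs js))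
    af List.[] = Fc List.[]
    af (i List.∷ is) = resp (sym (*-assoc _ _ _)) (Sb _ (Fd _ (af is)))
   ae g none = none
   ae g (s + t) = ae g s + ae g t
   ae g (resp e s) = resp (actΩ-cong g e) (ae g s)
   module To (s : Bool) (cs : O -> Carrier) (q : O) where
    part : Bool -> O -> Ω -> Ω
    part b2 m f = 0Ω
    part b1 m f = - D m f
    -- On a multiple of θ_J this multiplies by Σ xᵢ^(rm) - cₘ, where i runs over
    -- all indices if s holds and over those outside J otherwise.
    P : O -> Ω -> Ω
    P m f = p m * f + (part s m f + scalar (K.- cs m) * f)
    pN : ∀ t m {f g} -> f ≈Ω g -> part t m f ≈Ω part t m g
    pN b2 m e = refl
    pN b1 m e = *-congˡ (Da m e)
    pL : ∀ t m f g -> part t m (f + g) ≈Ω part t m f + part t m g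
    pL b2 m f g = sym (+-identityˡ _)
    pL b1 m f g = distribˡ _ _ _
    pD : ∀ t m a f -> part t m (scalar a * f) ≈Ω scalar a * part t m f
    pD b2 m a f = sym (zeroʳ _)
    pD b1 m a f = trans (*-congˡ (Dc m a f)) (sd a _ _)
    pE : ∀ t m a f -> part t m (ι a * f) ≈Ω ι a * part t m f
    pE b2 m a f = sym (zeroʳ _)
    pE b1 m a f = trans (*-congˡ (Dd m a f)) (cd a _ _)
    pM : ∀ t m {E q f} -> Fil E q f -> Fil (r Q.* m Q.+ E) q (part t m f)
    pM b2 m h = none
    pM b1 m h = Sb _ (Dg m h)
    pP : ∀ t m m' f -> part t m (part t m' f) ≈Ω part t m' (part t m f)
    pP b2 m m' f = refl
    pP b1 m m' f = *-congˡ (trans (Dc m _ _) (trans (*-congˡ (D-D m m' f)) (sym (Dc m' _ _))))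
    pO : ∀ t m g f -> part t m (actΩ g f) ≈Ω actΩ g (part t m f)
    pO b2 m g f = refl
    pO b1 m g f = *-congˡ (De m g f)
    Pl : ∀ m {f g} -> f ≈Ω g -> P m f ≈Ω P m g
    Pl m e = +-cong (*-congˡ e) (+-cong (pN s m e) (*-congˡ e))
    P-+ : ∀ m f g -> P m (f + g) ≈Ω P m f + P m g
    P-+ m f g = trans (+-cong (distribˡ _ _ _) (trans (+-cong (pL s m f g) (distribˡ _ _ _)) (interchange _ _ _ _))) (interchange _ _ _ _)
    Pi : ∀ m a f -> P m (scalar a * f) ≈Ω scalar a * P m f
    Pi m a f = trans (+-cong (sd a _ _) (trans (+-cong (pD s m a f) (sd a _ _)) (sym (distribˡ _ _ _)))) (sym (distribˡ _ _ _))
    P-0 : ∀ m -> P m 0Ω ≈Ω 0Ω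
    P-0 m = trans (Pl m (sym (zeroˡ 0Ω))) (trans (Pi m 0# 0Ω) (zeroˡ _))
    Pn : ∀ m a f -> P m (ι a * f) ≈Ω ι a * P m f
    Pn m a f = trans (+-cong (cd a _ _) (trans (+-cong (pE s m a f) (cd a _ _)) (sym (distribˡ _ _ _)))) (sym (distribˡ _ _ _))
    Pq : ∀ m g f -> P m (actΩ g f) ≈Ω actΩ g (P m f)
    Pq m g f = +-cong (*-congʳ (sym (pS m g))) (+-congʳ (pO s m g f))
    g9 : ∀ m -> Pc (r Q.* m) (pq m)
    g9 m = Pf \ i -> wea (e1 (Q.*-identityʳ _)) (Pd (r Q.* m) (var i))
    Pg : ∀ m {E q f} -> Fil E q f -> Fil (r Q.* m Q.+ E) q (P m f)
    Pg m {E} h = Fb (g9 m) h + (pM s m h + Sb _ (Fa (e0 E _) h))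
    P-P : ∀ m m' f -> P m (P m' f) ≈Ω P m' (P m f)
    P-P m m' f = begin P m (p m' * f + (part s m' f + scalar c' * f)) ≈⟨ trans (P-+ m _ _) (+-congˡ (P-+ m _ _)) ⟩ P m (p m' * f) + (P m (part s m' f) + P m (scalar c' * f)) ≈⟨ +-cong (Pn m (pq m') f) (+-cong gh (Pi m c' f)) ⟩ p m' * P m f + (part s m' (P m f) + scalar c' * P m f) ∎
     where
     c' = K.- cs m'
     gh : P m (part s m' f) ≈Ω part s m' (P m f)
     gh = sym (trans (pL s m' _ _) (+-cong (pE s m' (pq m) f) (trans (pL s m' _ _) (+-cong (pP s m' m f) (pD s m' _ f)))))
    P-d : ∀ m e v -> P m (d e * v) ≈Ω d e * P m v + part s m (d e) * v
    P-d m e v = trans (+-cong (sym (cd (pq m) _ _)) (+-cong (spl s) (sym (sd _ _ _)))) (begin d e * (p m * v) + ((d e * part s m v + part s m (d e) * v) + d e * (scalar c' * v)) ≈⟨ +-congˡ (trans (+-assoc _ _ _) (trans (+-congˡ (+-comm _ _)) (sym (+-assoc _ _ _)))) ⟩ d e * (p m * v) + ((d e * part s m v + d e * (scalar c' * v)) + part s m (d e) * v) ≈⟨ sym (+-assoc _ _ _) ⟩ (d e * (p m * v) + (d e * part s m v + d e * (scalar c' * v))) + part s m (d e) * v ≈⟨ +-congʳ (sym (trans (distribˡ _ _ _) (+-congˡ (distribˡ _ _ _)))) ⟩ d e * P m v + part s m (d e) * v ∎)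
     where
     c' = K.- cs m
     spl : ∀ t -> part t m (d e * v) ≈Ω d e * part t m v + part t m (d e) * v
     spl b2 = sym (trans (+-cong (zeroʳ _) (zeroˡ _)) (+-identityˡ _))
     spl b1 = trans (distribˡ _ _ _) (trans (+-comm _ _) (+-cong (sym (sd _ _ _)) (sym (*-assoc _ _ _))))
    -- Fermionic degree q and x-degree at most D - rm.
    Sh : O -> O -> Ω -> Set (c ⊔ ℓ)
    Sh m D = Sa \ is js -> (r Q.* m Q.+ length is ≤ D) × (length js ≡ q)
    Pr : ∀ m D is js -> r Q.* m Q.+ length is ≤ D -> length js ≡ q -> ∀ m' -> Sh m (r Q.* m' Q.+ D) (P m' (xs is * θs js))
    Pr m D is js l e m' = Si (\ {is'} (l' , e') -> e2 (Q.+-monoʳ-≤ (r Q.* m) l') (e2 (e1 (rea (r Q.* m) (r Q.* m') (length is))) (Q.+-monoʳ-≤ (r Q.* m') l)) , e') (Pg m' (resp (*-identityˡ _) (word 1# is js (e3 , e))))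
     where
     rea : ∀ a b e -> a Q.+ (b Q.+ e) ≡ b Q.+ (a Q.+ e)
     rea a b e = U.trans (U.sym (e7 a b e)) (U.trans (U.cong (Q._+ e) (e6 a b)) (e7 b a e))
    Ph : ∀ m' m {D f} -> Sh m D f -> Sh m (r Q.* m' Q.+ D) (P m' f)
    Ph m' m {D} (word a is js (l , e)) = resp (sym (Pi m' a _)) (Sb a (Pr m D is js l e m'))
    Ph m' m none = resp (sym (P-0 m')) none
    Ph m' m (h + h') = resp (sym (P-+ m' _ _)) (Ph m' m h + Ph m' m h')
    Ph m' m (resp e h) = resp (Pl m' e) (Ph m' m h)
    a0 : ∀ g m {D f} -> Sh m D f -> Sh m D (actΩ g f)
    a0 g m {D} (word a is js (l , e)) = Sb a (Si (\ (l' , e') -> e2 (Q.+-monoʳ-≤ (r Q.* m) l') l , e') (ae g (resp (*-identityˡ _) (word 1# is js (e3 , e)))))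
    a0 g m none = none
    a0 g m (h + h') = a0 g m h + a0 g m h'
    a0 g m (resp e h) = resp (actΩ-cong g e) (a0 g m h)
    data Sub (j D : O) : Ω -> Set (c ⊔ ℓ) where
     rel : ∀ m {E q′ v} -> suc q′ ≡ q -> Fil E q′ v -> E Q.+ da m ≤ D -> Sub j D (d m * v)
     img : ∀ m {v} -> m < j -> Sh (suc m) D v -> Sub j D (P (suc m) v)
     none : Sub j D 0Ω
     _+_ : ∀ {f g} -> Sub j D f -> Sub j D g -> Sub j D (f + g)
     resp : ∀ {f g} -> f ≈Ω g -> Sub j D f -> Sub j D g
    Sj : ∀ {i j D E} -> i ≤ j -> D ≤ E -> ∀ {f} -> Sub i D f -> Sub j E f
    Sj i≤j D≤E (rel m e h l) = rel m e h (e2 l D≤E)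
    Sj i≤j D≤E (img m l h) = img m (e2 l i≤j) (Si (\ (l , e) -> e2 l D≤E , e) h)
    Sj i≤j D≤E none = none
    Sj i≤j D≤E (h + h') = Sj i≤j D≤E h + Sj i≤j D≤E h'
    Sj i≤j D≤E (resp e h) = resp e (Sj i≤j D≤E h)
    Sg : ∀ {j D} a {f} -> Sub j D f -> Sub j D (scalar a * f)
    Sg a (rel m e h l) = resp (sd a _ _) (rel m e (Sb a h) l)
    Sg a (img m l h) = resp (Pi _ a _) (img m l (Sb a h))
    Sg a none = resp (sym (zeroʳ _)) none
    Sg a (h + h') = resp (sym (distribˡ _ _ _)) (Sg a h + Sg a h')
    Sg a (resp e h) = resp (*-congˡ e) (Sg a h)
    Sr : ∀ g {j D f} -> Sub j D f -> Sub j D (actΩ g f)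
    Sr g (rel m e h l) = resp (*-congʳ (sym (d2 m g))) (rel m e (ae g h) l)
    Sr g (img m l h) = resp (Pq _ g _) (img m l (a0 g _ h))
    Sr g none = none
    Sr g (h + h') = Sr g h + Sr g h'
    Sr g (resp e h) = resp (actΩ-cong g e) (Sr g h)
    Sx : ∀ m' {j D f} -> Sub j D f -> Sub j (r Q.* m' Q.+ D) (P m' f)
    Sx m' {j} {D} (rel m {E} {q′} {v} e h l) = resp (sym (P-d m' m v)) (rel m e (Pg m' h) (e2 (e1 (e7 (r Q.* m') E _)) (Q.+-monoʳ-≤ (r Q.* m') l)) + sec s)
     where
     eh : E Q.+ da (m Q.+ m') ≤ r Q.* m' Q.+ D
     eh = e2 (e1 (U.trans (U.cong (\ z -> E Q.+ (z Q.+ (r Q.∸ 1))) (U.trans (Q.*-distribˡ-+ r m m') (e6 (r Q.* m) _))) (U.trans (U.cong (E Q.+_) (e7 (r Q.* m') _ _)) (U.trans (U.sym (e7 E (r Q.* m') _)) (U.trans (U.cong (Q._+ da m) (e6 E _)) (e7 (r Q.* m') E _)))))) (Q.+-monoʳ-≤ (r Q.* m') l)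
     sec : ∀ t -> Sub j (r Q.* m' Q.+ D) (part t m' (d m) * v)
     sec b2 = resp (sym (zeroˡ _)) none
     sec b1 = resp (trans (*-congˡ (*-congʳ (sym (D-d m' m)))) (sym (*-assoc _ _ _))) (Sg (K.- 1#) (rel (m Q.+ m') e h eh))
    Sx m' (img m l h) = resp (P-P (suc m) m' _) (img m l (Ph m' (suc m) h))
    Sx m' none = resp (sym (P-0 m')) none
    Sx m' (h + h') = resp (sym (P-+ m' _ _)) (Sx m' h + Sx m' h')
    Sx m' (resp e h) = resp (Pl m' e) (Sx m' h)
    equal : ∀ {j D f g} -> f ≈Ω g -> Sub j D (f - g)
    equal e = resp (sym (trans (+-congʳ e) (ΩR.-‿inverseʳ _))) none
    -- The filtered piece F_D modulo the first j images.
    space : O -> O -> i9 ring (c ⊔ ℓ) (c ⊔ ℓ)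
    space j D = record { Carrierᴹ = Σ Ω (Fil D q) ; _≈ᴹ_ = \ f g -> Sub j D (p1 f - p1 g) ; _+ᴹ_ = \ (f , h) (g , h') -> f + g , h + h' ; _*ₗ_ = \ a (f , h) -> scalar a * f , Sb a h ; 0ᴹ = 0Ω , none ; -ᴹ_ = \ (f , h) -> - f , Sb _ h ; isLeftModule = record { isLeftSemimodule = record { +ᴹ-isCommutativeMonoid = record { isMonoid = record { isSemigroup = record { isMagma = record { isEquivalence = record { refl = equal refl ; sym = \ {f} {g} h -> resp (flip {p1 f} {p1 g}) (Sg (K.- 1#) h) ; trans = \ {f} {g} {k} h h' -> resp (telescope {p1 f} {p1 g} {p1 k}) (h + h') }
           ; ∙-cong = \ {u} {v} {u′} {v′} h h' -> resp (trans (interchange (p1 u) (- p1 v) (p1 u′) (- p1 v′)) (+-congˡ (sym (distribˡ _ _ _)))) (h + h') }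
          ; assoc = \ _ _ _ -> equal (+-assoc _ _ _) }
         ; identity = (\ _ -> equal (+-identityˡ _)) , \ _ -> equal (+-identityʳ _) }
        ; comm = \ _ _ -> equal (+-comm _ _) }
       ; isPreleftSemimodule = record { *ₗ-cong = \ {a} {b} {u} {v} e h -> resp {g = scalar a * p1 u - scalar b * p1 v} (trans (distribˡ _ _ _) (+-congˡ (trans (sd _ _ _) (*-congˡ (*-congʳ (scalar-≈ e)))))) (Sg a h) ; *ₗ-zeroˡ = \ _ -> equal (zeroˡ _) ; *ₗ-distribʳ = \ _ a b -> equal (trans (*-congʳ (scalar-+ a b)) (distribʳ _ _ _)) ; *ₗ-identityˡ = \ _ -> equal (*-identityˡ _) ; *ₗ-assoc = \ a b _ -> equal (trans (*-congʳ (scalar-* a b)) (*-assoc _ _ _)) ; *ₗ-zeroʳ = \ a -> equal (zeroʳ _) ; *ₗ-distribˡ = \ _ _ _ -> equal (distribˡ _ _ _) } }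
      ; -ᴹ‿cong = \ {u} {v} h -> resp {g = - p1 u - - p1 v} (trans (distribˡ _ _ _) (+-congˡ (sd _ _ _))) (Sg (K.- 1#) h)
      ; -ᴹ‿inverse = (\ _ -> equal (ΩR.-‿inverseˡ _)) , \ _ -> equal (ΩR.-‿inverseʳ _) } }
     where
     flip : ∀ {f g} -> - (f - g) ≈Ω g - f
     flip {f} {g} = trans (distribˡ _ _ _) (trans (+-comm _ _) (+-congʳ (-‿involutive g)))
     telescope : ∀ {f g h} -> (f - g) + (g - h) ≈Ω f - h
     telescope {f} {g} {h} = trans (+-assoc _ _ _) (+-congˡ (trans (sym (+-assoc _ _ _)) (trans (+-congʳ (ΩR.-‿inverseˡ g)) (+-identityˡ _))))
    A : O -> O -> GM (c ⊔ ℓ) (c ⊔ ℓ)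
    A j D = record { aR = record { space = space j D ; act = \ g (f , h) -> actΩ g f , ae g h ; act-linear = \ g -> isH {V = space j D} {W = space j D} record { fun = \ (f , h) -> actΩ g f , ae g h ; f-cong = \ h -> Sr g h ; f-+ = \ _ _ -> equal refl ; f-* = \ _ _ -> equal refl } } ; aj = \ g h (f , _) -> equal (ai g h f) ; az = \ (f , _) -> equal (am f) ; act-resp = \ {g} {h} e (f , _) -> equal (al {g} {h} e f) }
    Pp : ∀ m f g -> P m (f - g) ≈Ω P m f - P m g
    Pp m f g = trans (P-+ m f _) (+-congˡ (Pi m _ g))
    multiplication : ∀ m j D -> A j D ⟶ A j (r Q.* m Q.+ D)
    multiplication m j D = record { li = record { fun = \ (f , h) -> P m f , Pg m h ; f-cong = \ {f} {g} h -> resp (Pp m (p1 f) (p1 g)) (Sx m h) ; f-+ = \ (f , _) (g , _) -> equal (P-+ m f g) ; f-* = \ a (f , _) -> equal (Pi m a f) } ; equivariant = \ g (f , _) -> equal (Pq m g f) }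
    qu : ∀ j D -> A j D ⟶ A (suc j) D
    qu j D = record { li = record { fun = \ f -> f ; f-cong = Sj (Q.n≤1+n j) e3 ; f-+ = \ _ _ -> equal refl ; f-* = \ _ _ -> equal refl } ; equivariant = \ _ _ -> equal refl }
    s2 : ∀ {j D f} -> Sub (suc j) D f -> Σ Ω \ v -> Sh (suc j) D v × Sub j D (f - P (suc j) v)
    s2 (rel m e h l) = 0Ω , none , resp (sym (trans (+-congˡ (trans (*-congˡ (P-0 _)) (zeroʳ _))) (+-identityʳ _))) (rel m e h l)
    s2 {j} (img m {v} l h) with Q.m≤n⇒m<n∨m≡n (Q.≤-pred l)
    ... | i1 m<j = 0Ω , none , resp (sym (trans (+-congˡ (trans (*-congˡ (P-0 _)) (zeroʳ _))) (+-identityʳ _))) (img m m<j h)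
    ... | i2 U.refl = v , h , equal refl
    s2 none = 0Ω , none , equal (sym (P-0 _))
    s2 {j} (_+_ {f} {g} h h') with v , a , b <- s2 h | w , a' , b' <- s2 h' = v + w , a + a' , resp (trans (interchange f (- P (suc j) v) g (- P (suc j) w)) (+-congˡ (trans (sym (distribˡ _ _ _)) (*-congˡ (sym (P-+ (suc j) v w)))))) (b + b')
    s2 (resp e h) with v , a , b <- s2 h = v , a , resp (+-congʳ e) b
    Shi : ∀ m {D f} -> Sh m (r Q.* m Q.+ D) f -> Fil D q f
    Shi m = Si \ (l , e) -> Q.+-cancelˡ-≤ (r Q.* m) _ _ l , e
    Fm : ∀ m {D f} -> Fil D q f -> Sh m (r Q.* m Q.+ D) f
    Fm m = Si \ (l , e) -> Q.+-monoʳ-≤ (r Q.* m) l , e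
    Ss : ∀ m {D f} -> D < r Q.* m -> Sh m D f -> f ≈Ω 0Ω
    Ss m l (word a is js (l' , _)) with () <- Q.<⇒≱ l (e2 (e9 _ _) l')
    Ss m l none = refl
    Ss m l (h + h') = trans (+-cong (Ss m l h) (Ss m l h')) (+-identityˡ _)
    Ss m l (resp e h) = trans (sym e) (Ss m l h)
    mz : ∀ j D (y : Σ Ω (Fil (r Q.* suc j Q.+ D) q)) -> Sub (suc j) (r Q.* suc j Q.+ D) (p1 y - 0Ω) -> Σ (Σ Ω (Fil D q)) \ u -> Sub j (r Q.* suc j Q.+ D) (P (suc j) (p1 u) - p1 y)
    mz j D (f , _) h with v , a , b <- s2 h = (v , Shi (suc j) a) , resp (trans (*-congˡ (+-congʳ (trans (+-congˡ (zeroʳ _)) (+-identityʳ f)))) (trans (distribˡ _ _ _) (trans (+-comm _ _) (+-congʳ (-‿involutive _))))) (Sg (K.- 1#) b)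
    m6 : ∀ j D (u : Σ Ω (Fil D q)) -> Sub (suc j) (r Q.* suc j Q.+ D) (P (suc j) (p1 u) - 0Ω)
    m6 j D (f , h) = resp (sym (trans (+-congˡ (zeroʳ _)) (+-identityʳ _))) (img j (Q.n<1+n j) (Fm (suc j) h))
    qa : ∀ j D -> D < r Q.* suc j -> A j D ≃ A (suc j) D
    qa j D l = bij (qu j D) (\ f -> f) (\ _ -> equal refl)
     \ (f , _) h -> let v , a , b = s2 h in
      resp (trans (+-congˡ (trans (*-congˡ (trans (Pl _ (Ss (suc j) l a)) (P-0 _))) (zeroʳ _))) (+-identityʳ _)) b
  module Com (q k : O) (N : O -> O -> O) (Na : ∀ j D -> j < k -> D < r Q.* suc j -> N j D ≡ N (suc j) D) (Nb : ∀ j D -> j < k -> N j (r Q.* suc j Q.+ D) ≡ N j D Q.+ N (suc j) (r Q.* suc j Q.+ D)) where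
   open K using (Carrier)
   open Rep
   open Ca
   open Fl
   data Pos (e : O) : O -> Set where
    low : ∀ {D} -> D < e -> Pos e D
    hj : ∀ D -> Pos e (e Q.+ D)
   pT : ∀ e D -> Pos e D
   pT e D with D Q.<? e
   ... | yes l = low l
   ... | no h with D' , U.refl <- Q.m≤n⇒∃[o]m+o≡n (Q.≮⇒≥ h) = hj D'
   module Bb (s : Bool) (cs : O -> Carrier) (top : ∀ D -> Sp (To.space s cs q k D) (N k D)) (bot : ∀ D -> Sur (To.space s cs q 0 D) (N 0 D)) where
    open To s cs q
    sx : ∀ t j -> t Q.+ j ≡ k -> ∀ D -> Sp (space j D) (N j D)
    sx zero j U.refl = top
    sx (suc t) j e = <-rec (\ D -> Sp (space j D) (N j D)) sg
     where
     j<k : j < k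
     j<k = e2 (Q.s≤s (e0 j t)) (e1 e)
     ni : ∀ D -> Sp (space (suc j) D) (N (suc j) D)
     ni = sx t (suc j) (U.trans (e8 t j) e)
     sg : ∀ D -> (∀ {E} -> E < D -> Sp (space j E) (N j E)) -> Sp (space j D) (N j D)
     sg D rec with pT (r Q.* suc j) D
     ... | low l = U.subst (Sp (space j D)) (U.sym (Na j D j<k l)) record { vec = vec ; coo = coo ; spa = \ v -> iE (A (suc j) D) (A j D) bb v (coo v) vec (spa v) }
      where
      open Sp (ni D)
      bb : A (suc j) D ⟶ A j D
      bb = _≃_.bb (qa j D l)
     ... | hj E = U.subst (Sp (space j D)) (U.sym (Nb j E j<k)) (Eu.sx {X = A j E} {A j D} {A (suc j) D} (multiplication (suc j) j E) (qu j D) (mz j E) (rec (Q.m<n+m E (Q.>-nonZero⁻¹ _ {{Q.m*n≢0 r (suc j)}}))) vec (\ v -> coo v , cV (A j D) (A (suc j) D) (qu j D) v (coo v) vec (spa v)))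
      where open Sp (ni D)
    bas : ∀ j -> j ≤ k -> ∀ D -> Ba (space j D) (N j D)
    ext : ∀ j -> j < k -> ∀ D -> Ex (A j D) (A j (r Q.* suc j Q.+ D)) (A (suc j) (r Q.* suc j Q.+ D))
    private
     ni : ∀ j -> j < k -> ∀ D -> Sp (space (suc j) D) (N (suc j) D)
     ni j j<k = sx (k Q.∸ suc j) (suc j) (Q.m∸n+n≡m j<k)
     open Bas using (module ΩR)
    module Dim j (j<k : j < k) D = Fr {X = A j D} {A j (r Q.* suc j Q.+ D)} {A (suc j) (r Q.* suc j Q.+ D)} (multiplication (suc j) j D) (qu j _) (bas j (Q.<⇒≤ j<k) D) (U.subst (Ba (space j _)) (Nb j D j<k) (bas j (Q.<⇒≤ j<k) _)) (\ f -> f) (\ _ -> equal ΩR.refl) (mz j D) (m6 j D) (Sp.vec (ni j j<k _)) (\ v -> Sp.coo (ni j j<k _) v , cV (A j (r Q.* suc j Q.+ D)) (A (suc j) (r Q.* suc j Q.+ D)) (qu j _) v _ _ (Sp.spa (ni j j<k _) v))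
    bas zero _ D = sU (bot D) (sx k 0 (e5 k) D)
    bas (suc j) j<k D with pT (r Q.* suc j) D
    ... | low l = U.subst (Ba (space (suc j) D)) (Na j D j<k l) (tC (qa j D l) (bas j (Q.<⇒≤ j<k) D))
    ... | hj E = Dim.qb j j<k E
    ext j j<k D = Dim.ext j j<k D
   module _ (s s′ : Bool) (cs cs' : O -> Carrier) (top : ∀ D -> Sp (To.space s cs q k D) (N k D)) (bot : ∀ D -> Sur (To.space s cs q 0 D) (N 0 D)) (top' : ∀ D -> Sp (To.space s′ cs' q k D) (N k D)) (bottom' : ∀ D -> Sur (To.space s′ cs' q 0 D) (N 0 D)) where
    private
     module T = To s cs q
     module T' = To s′ cs' q
     module B = Bb s cs top bot
     module B' = Bb s′ cs' top' bottom'
    s4 : ∀ {s s′ cs cs' D f} -> To.Sub s cs q 0 D f -> To.Sub s′ cs' q 0 D f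
    s4 (To.rel m e h l) = To.rel m e h l
    s4 To.none = To.none
    s4 (h To.+ h') = s4 h To.+ s4 h'
    s4 (To.resp e h) = To.resp e (s4 h)
    c2 : ∀ j -> j ≤ k -> ∀ D -> T.A j D ≃ T'.A j D
    c2 zero j≤k D = record { fo = record { li = record { fun = \ f -> f ; f-cong = s4 ; f-+ = \ _ _ -> T'.equal refl ; f-* = \ _ _ -> T'.equal refl } ; equivariant = \ _ _ -> T'.equal refl } ; bb = record { li = record { fun = \ f -> f ; f-cong = s4 ; f-+ = \ _ _ -> T.equal refl ; f-* = \ _ _ -> T.equal refl } ; equivariant = \ _ _ -> T.equal refl } ; bc = \ _ -> T.equal refl ; fc = \ _ -> T'.equal refl }
     where open Bas using (refl)
    c2 (suc j) j<k D with pT (r Q.* suc j) D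
    ... | low l = tg (sV (T.qa j D l)) (tg (c2 j (Q.<⇒≤ j<k) D) (T'.qa j D l))
    ... | hj E = cY (B.bas j (Q.<⇒≤ j<k) E) (c2 j (Q.<⇒≤ j<k) E) (c2 j (Q.<⇒≤ j<k) (r Q.* suc j Q.+ E)) (B.ext j j<k E) (B'.ext j j<k E)
  module Cou where
   open import Data.Bool.Base using (Bool; true; false; if_then_else_)
   open import Data.List.Base using (List; []; _∷_; _++_; map; length)
   open import Data.List.Relation.Binary.Permutation.Propositional as Perm using (_↭_; prep; swap; ↭-refl; ↭-sym; ↭-trans)
   open import Data.List.Relation.Binary.Permutation.Propositional.Properties using (shift; ++⁺ˡ)
   open import Data.Nat.ListAction using (sum; product)
   open import Data.Nat.ListAction.Properties using (product-++)
   open import Data.List.Properties using (map-++)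
   open import Data.Maybe.Base using (Maybe; just; nothing)
   open import Data.Nat.Base using (ℕ; zero; suc; _+_; _*_; _∸_; _≤_; _<_; z≤n; s≤s; s≤s⁻¹)
   open import Data.Nat.Properties
   open import Data.Product.Base using (∃₂; _×_; _,_)
   open import Data.Vec.Base using (Vec; []; _∷_)
   open import Data.Empty using (⊥-elim)
   open import Relation.Binary.Definitions using (tri<; tri≈; tri>)
   open import Relation.Binary.PropositionalEquality using (_≡_; _≗_; refl; sym; trans; cong; cong₂; subst; module ≡-Reasoning)
   open import Relation.Nullary using (yes; no; does)
   open import Relation.Nullary.Decidable using (dec-true; dec-false)
   private
    exc : ∀ a b c -> a + (b + c) ≡ b + (a + c)
    exc a b c = trans (sym (+-assoc a b c)) (trans (cong (_+ c) (+-comm a b)) (+-assoc b a c))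
    f2 : ∀ a b c d -> (a + b) + (c + d) ≡ (a + c) + (b + d)
    f2 a b c d = trans (+-assoc a b _) (trans (cong (a +_) (exc b c d)) (sym (+-assoc a c _)))
   -- Sum of f (D - t) over t ≤ D below the bound; nothing means no bound.
   sp : Maybe O -> (O -> O) -> O -> O
   sp (just zero) f D = 0
   sp nothing f zero = f 0
   sp (just (suc b)) f zero = f 0
   sp nothing f (suc D) = f (suc D) + sp nothing f D
   sp (just (suc b)) f (suc D) = f (suc D) + sp (just b) f D
   -- The number of tuples with the given bounds and sum at most D.
   tu : List (Maybe O) -> O -> O
   tu [] D = 1
   tu (b ∷ bs) D = sp b (tu bs) D
   bt : ∀ b {S P f} D -> (∀ E -> S ≤ E -> f E ≡ P) -> b + S ≤ D -> sp (just b) f D ≡ b * P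
   bt zero D h l = refl
   bt (suc b) (suc D) h (s≤s l) = cong₂ _+_ (h (suc D) (≤-trans (m≤n+m _ b) (m≤n⇒m≤1+n l))) (bt b D h l)
   t6 : ∀ bs {D} -> sum bs ≤ D -> tu (map just bs) D ≡ Data.Nat.ListAction.product bs
   t6 [] l = refl
   t6 (b ∷ bs) l = bt b _ (\ E -> t6 bs) l
   bv : ∀ e f D -> sp nothing f (e + D) ≡ sp nothing f D + sp (just e) f (e + D)
   bv zero f D = sym (+-identityʳ _)
   bv (suc e) f D = trans (cong (f _ +_) (bv e f D)) (exc (f (suc (e + D))) (sp nothing f D) _)
   sz : ∀ e f D -> D < e -> sp nothing f D ≡ sp (just e) f D
   sz (suc e) f zero l = refl
   sz (suc e) f (suc D) (s≤s l) = cong (f _ +_) (sz e f D l)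
   s8 : ∀ b {f g} D -> (∀ E -> E ≤ D -> f E ≡ g E) -> sp b f D ≡ sp b g D
   s8 (just zero) D e = refl
   s8 nothing zero e = e 0 z≤n
   s8 (just (suc b)) zero e = e 0 z≤n
   s8 nothing (suc D) e = cong₂ _+_ (e _ ≤-refl) (s8 nothing D \ E l -> e E (m≤n⇒m≤1+n l))
   s8 (just (suc b)) (suc D) e = cong₂ _+_ (e _ ≤-refl) (s8 (just b) D \ E l -> e E (m≤n⇒m≤1+n l))
   sN : ∀ b {f g} -> f ≗ g -> sp b f ≗ sp b g
   sN b e D = s8 b D \ E _ -> e E
   sX : ∀ b f g D -> sp b (\ E -> f E + g E) D ≡ sp b f D + sp b g D
   sX (just zero) f g D = refl
   sX nothing f g zero = refl
   sX (just (suc b)) f g zero = refl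
   sX nothing f g (suc D) = trans (cong (f (suc D) + g (suc D) +_) (sX nothing f g D)) (f2 (f (suc D)) _ _ _)
   sX (just (suc b)) f g (suc D) = trans (cong (f (suc D) + g (suc D) +_) (sX (just b) f g D)) (f2 (f (suc D)) _ _ _)
   del : (O -> O) -> O -> O
   del f zero = 0
   del f (suc D) = f D
   sv : ∀ b f D -> sp b (del f) D ≡ del (sp b f) D
   sv (just zero) f zero = refl
   sv (just zero) f (suc D) = refl
   sv nothing f zero = refl
   sv (just (suc b)) f zero = refl
   sv nothing f (suc zero) = +-identityʳ _
   sv nothing f (suc (suc D)) = cong (f _ +_) (sv nothing f (suc D))
   sv (just (suc b)) f (suc zero) = trans (cong (f 0 +_) (sv (just b) f zero)) (+-identityʳ _)
   sv (just (suc b)) f (suc (suc D)) = cong (f _ +_) (sv (just b) f (suc D))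
   bx : ∀ b f D -> sp (just (suc b)) f D ≡ f D + sp (just b) (del f) D
   bx b f zero = sym (trans (cong (f 0 +_) (sv (just b) f 0)) (+-identityʳ _))
   bx b f (suc D) = cong (f _ +_) (sym (sv (just b) f (suc D)))
   sC : ∀ b D -> sp b (\ _ -> 0) D ≡ 0
   sC (just zero) D = refl
   sC nothing zero = refl
   sC (just (suc b)) zero = refl
   sC nothing (suc D) = sC nothing D
   sC (just (suc b)) (suc D) = sC (just b) D
   s9 : ∀ a b f D -> sp (just a) (sp b f) D ≡ sp b (sp (just a) f) D
   s9 zero b f D = sym (sC b D)
   s9 (suc a) b f D = begin sp (just (suc a)) (sp b f) D ≡⟨ bx a (sp b f) D ⟩ sp b f D + sp (just a) (del (sp b f)) D ≡⟨ cong (sp b f D +_) (sN (just a) (\ E -> sym (sv b f E)) D) ⟩ sp b f D + sp (just a) (sp b (del f)) D ≡⟨ cong (sp b f D +_) (s9 a b (del f) D) ⟩ sp b f D + sp b (sp (just a) (del f)) D ≡⟨ sym (sX b f _ D) ⟩ sp b (\ E -> f E + sp (just a) (del f) E) D ≡⟨ sN b (\ E -> sym (bx a f E)) D ⟩ sp b (sp (just (suc a)) f) D ∎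
    where open ≡-Reasoning
   sB : ∀ a b f D -> sp a (sp b f) D ≡ sp b (sp a f) D
   sB (just a) b f D = s9 a b f D
   sB nothing b f D = begin sp nothing (sp b f) D ≡⟨ sz (suc D) _ D (n<1+n D) ⟩ sp (just (suc D)) (sp b f) D ≡⟨ s9 (suc D) b f D ⟩ sp b (sp (just (suc D)) f) D ≡⟨ s8 b D (\ E l -> sym (sz (suc D) f E (s≤s l))) ⟩ sp b (sp nothing f) D ∎
    where open ≡-Reasoning
   tc : ∀ {bs cs} -> bs ↭ cs -> tu bs ≗ tu cs
   tc Perm.refl D = refl
   tc (prep b p) D = sN b (tc p) D
   tc {_ ∷ _ ∷ bs} (Data.List.Relation.Binary.Permutation.Propositional.swap a b p) D = trans (sB a b (tu bs) D) (sN b (sN a (tc p)) D)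
   tc (Perm.trans p q) D = trans (tc p D) (tc q D)
   ta : {A : Set} -> (A -> O) -> List A -> O
   ta f [] = 0
   ta f (a ∷ as) = f a + ta f as
   td : {A : Set} {f g : A -> O} -> f ≗ g -> ∀ as -> ta f as ≡ ta g as
   td e [] = refl
   td e (a ∷ as) = cong₂ _+_ (e a) (td e as)
   tA : ∀ {A : Set} (f g : A -> O) as -> ta (\ a -> f a + g a) as ≡ ta f as + ta g as
   tA f g [] = refl
   tA f g (a ∷ as) = trans (cong (f a + g a +_) (tA f g as)) (f2 (f a) _ _ _)
   ts : ∀ {A : Set} (f : A -> O) as bs -> ta f (as ++ bs) ≡ ta f as + ta f bs
   ts f [] bs = refl
   ts f (a ∷ as) bs = trans (cong (f a +_) (ts f as bs)) (sym (+-assoc (f a) _ _))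
   tk : ∀ {A B : Set} (f : B -> O) (g : A -> B) as -> ta f (map g as) ≡ ta (\ a -> f (g a)) as
   tk f g [] = refl
   tk f g (a ∷ as) = cong (f (g a) +_) (tk f g as)
   tn : ∀ {A : Set} c (f : A -> O) as -> ta (\ a -> c * f a) as ≡ c * ta f as
   tn c f [] = sym (*-zeroʳ c)
   tn c f (a ∷ as) = trans (cong (c * f a +_) (tn c f as)) (sym (*-distribˡ-+ c (f a) _))
   -- The subsets of size q, as bit vectors.
   ch : ∀ n -> O -> List (Vec Bool n)
   ch zero zero = [] ∷ []
   ch zero (suc q) = []
   ch (suc n) zero = map (b1 ∷_) (ch n 0)
   ch (suc n) (suc q) = map (b1 ∷_) (ch n (suc q)) ++ map (b2 ∷_) (ch n q)
   module Bou (r : O) where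
    -- Here c counts the preceding elements outside the subset.
    ins : ∀ {n} -> O -> Vec Bool n -> List O
    ins c [] = []
    ins c (b2 ∷ J) = r ∸ 1 + r * c ∷ ins c J
    ins c (b1 ∷ J) = ins (suc c) J
    oc : O -> O -> List (Maybe O)
    oc j zero = []
    oc j (suc i) = (if does (i <? j) then just (r * suc i) else nothing) ∷ oc j i
    ou : O -> List O
    ou zero = []
    ou (suc m) = r * suc m ∷ ou m
    ok : ∀ i j -> i ≤ j -> map just (ou i) ≡ oc j i
    ok zero j l = refl
    ok (suc i) j l rewrite dec-true (i <? j) l = cong (just (r * suc i) ∷_) (ok i j (≤-trans (n≤1+n i) l))
    bou : ∀ {n} -> O -> O -> Vec Bool n -> List (Maybe O)
    bou j k J = map just (ins 0 J) ++ oc j k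
    oj : ∀ {i j} k -> k ≤ i -> k ≤ j -> oc i k ≡ oc j k
    oj zero l l' = refl
    oj {i} {j} (suc k) l l' rewrite dec-true (k <? i) l | dec-true (k <? j) l' = cong (_ ∷_) (oj k (≤-trans (n≤1+n k) l) (≤-trans (n≤1+n k) l'))
    ox : ∀ {j} k -> j < k -> ∃₂ \ xs ys -> (oc j k ≡ xs ++ nothing ∷ ys) × (oc (suc j) k ≡ xs ++ just (r * suc j) ∷ ys)
    ox {j} (suc k) l with <-cmp k j
    ... | tri< k<j _ _ = ⊥-elim (<⇒≱ k<j (s≤s⁻¹ l))
    ... | tri≈ ¬l refl _ rewrite dec-false (k <? k) ¬l | dec-true (k <? suc k) (n<1+n k) = [] , oc k k , refl , cong (just (r * suc k) ∷_) (oj k (n≤1+n k) ≤-refl)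
    ... | tri> ¬l _ j<k rewrite dec-false (k <? j) ¬l | dec-false (k <? suc j) (≤⇒≯ j<k) with ox k j<k
    ... | xs , ys , e , e' = nothing ∷ xs , ys , cong (nothing ∷_) e , cong (nothing ∷_) e'
    b8 : ∀ {n j} k (J : Vec Bool n) -> j < k -> ∃₂ \ v bs -> (bou j k J ↭ nothing ∷ bs) × (bou (suc j) k J ↭ just v ∷ bs) × (v ≡ r * suc j)
    b8 {j = j} k J l with ox k l
    ... | xs , ys , e , e' = r * suc j , as ++ (xs ++ ys) , subst (\ z -> as ++ z ↭ nothing ∷ as ++ (xs ++ ys)) (sym e) (md nothing) , subst (\ z -> as ++ z ↭ just (r * suc j) ∷ as ++ (xs ++ ys)) (sym e') (md (just (r * suc j))) , refl
     where
     as = map just (ins 0 J)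
     md : ∀ b -> as ++ (xs ++ b ∷ ys) ↭ b ∷ as ++ (xs ++ ys)
     md b = ↭-trans (++⁺ˡ as (Data.List.Relation.Binary.Permutation.Propositional.Properties.shift b xs ys)) (Data.List.Relation.Binary.Permutation.Propositional.Properties.shift b as (xs ++ ys))
    N : O -> O -> O -> O -> O -> O
    N n q k j D = ta (\ J -> tu (bou j k J) D) (ch n q)
    Nb : ∀ n q k j D -> j < k -> N n q k j (r * suc j + D) ≡ N n q k j D + N n q k (suc j) (r * suc j + D)
    Nb n q k j D l = trans (td each (ch n q)) (tA _ _ (ch n q))
     where
     each : ∀ J -> tu (bou j k J) (r * suc j + D) ≡ tu (bou j k J) D + tu (bou (suc j) k J) (r * suc j + D)
     each J with b8 k J l
     ... | _ , bs , p , p′ , refl = trans (tc p _) (trans (bv (r * suc j) (tu bs) D) (sym (cong₂ _+_ (tc p D) (tc p′ _))))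
    Na : ∀ n q k j D -> j < k -> D < r * suc j -> N n q k j D ≡ N n q k (suc j) D
    Na n q k j D l l' = td each (ch n q)
     where
     each : ∀ J -> tu (bou j k J) D ≡ tu (bou (suc j) k J) D
     each J with b8 k J l
     ... | _ , bs , p , p′ , refl = trans (tc p _) (trans (sz (r * suc j) (tu bs) D l') (sym (tc p′ _)))
    Nc : ∀ n q k {D} -> ta (\ J -> sum (ins 0 J ++ ou k)) (ch n q) ≤ D -> N n q k k D ≡ Data.Nat.ListAction.product (ou k) * ta (\ J -> Data.Nat.ListAction.product (ins 0 J)) (ch n q)
    Nc n q k {D} l = trans (go (ch n q) l) (tn (Data.Nat.ListAction.product (ou k)) (\ J -> Data.Nat.ListAction.product (ins 0 J)) (ch n q))
     where
     each : ∀ J -> sum (ins 0 J ++ ou k) ≤ D -> tu (bou k k J) D ≡ Data.Nat.ListAction.product (ou k) * Data.Nat.ListAction.product (ins 0 J)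
     each J l = trans (cong (\ bs -> tu bs D) (trans (cong (map just (ins 0 J) ++_) (sym (ok k k ≤-refl))) (sym (map-++ just (ins 0 J) (ou k))))) (trans (t6 (ins 0 J ++ ou k) l) (trans (product-++ (ins 0 J) (ou k)) (*-comm (Data.Nat.ListAction.product (ins 0 J)) _)))
     go : ∀ Js -> ta (\ J -> sum (ins 0 J ++ ou k)) Js ≤ D -> ta (\ J -> tu (bou k k J) D) Js ≡ ta (\ J -> Data.Nat.ListAction.product (ou k) * Data.Nat.ListAction.product (ins 0 J)) Js
     go [] l = refl
     go (J ∷ Js) l = cong₂ _+_ (each J (m+n≤o⇒m≤o _ l)) (go Js (m+n≤o⇒n≤o _ l))
  open Cou
  private module Bnd = Bou r
  module Roo {c ℓ} (R : CommutativeRing c ℓ) (r : O) .{{_ : NonZero r}} (ζ : CommutativeRing.Carrier R) (rw : CommutativeRing._≈_ R (Exp._^_ (CommutativeRing.semiring R) ζ r) (CommutativeRing.1# R)) (apart : ∀ j -> 0 < j -> j < r -> In.Inv R (CommutativeRing._-_ R (Exp._^_ (CommutativeRing.semiring R) ζ j) (CommutativeRing.1# R)))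
   where
   open CommutativeRing R hiding (zero)
   open Exp semiring using (_^_; ^-homo-*)
   open In R
   open Sn *-commutativeMonoid using () renaming (∑ to ∏; ue to ∏-0; sf to ∏-suc; cb to ∏-cong)
   open Int R using (solve; _:=_; _:+_; _:*_; _:-_; :-_)
   open import Relation.Binary.Reasoning.Setoid setoid
   private
    -- Signed elementary symmetric functions.
    E : List Carrier -> O -> Carrier
    E [] zero = 1#
    E [] (suc k) = 0#
    E (s ∷ S) zero = E S zero
    E (s ∷ S) (suc k) = E S (suc k) - s * E S k
    F : List Carrier -> Carrier -> Carrier -> Carrier
    F [] x y = 1#
    F (s ∷ S) x y = (x - s * y) * F S x y
    ev : (O -> Carrier) -> O -> Carrier -> Carrier -> Carrier
    ev e zero x y = e 0
    ev e (suc m) x y = x * ev e m x y + e (suc m) * y ^ suc m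
    bey : ∀ S k -> length S < k -> E S k ≈ 0#
    bey [] (suc k) l = refl
    bey (s ∷ S) (suc k) (s≤s l) = trans (+-cong (bey S (suc k) (Q.m≤n⇒m≤1+n l)) (-‿cong (trans (*-congˡ (bey S k l)) (zeroʳ s)))) (-‿inverseʳ 0#)
    ej : ∀ s S m x y -> ev (E (s ∷ S)) (suc m) x y ≈ ev (E S) (suc m) x y - s * y * ev (E S) m x y
    ej s S zero x y = bg x y s (E S 0) (E S 1) (y ^ 1) (*-identityʳ y)
     where
     bg : ∀ x y s a b z -> z ≈ y -> x * a + (b - s * a) * z ≈ (x * a + b * z) - s * y * a
     bg x y s a b z e = trans (+-congˡ (*-congˡ e)) (trans (lem x y s a b) (+-congʳ (+-congˡ (*-congˡ (sym e)))))
      where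
      lem : ∀ x y s a b -> x * a + (b - s * a) * y ≈ (x * a + b * y) - s * y * a
      lem = solve 5 (\ x y s a b -> x :* a :+ (b :- s :* a) :* y := (x :* a :+ b :* y) :- s :* y :* a) refl
    ej s S (suc m) x y = trans (+-congʳ (*-congˡ (ej s S m x y))) (first x y s (ev (E S) (suc m) x y) (ev (E S) m x y) (E S (suc (suc m))) (E S (suc m)) (y ^ suc m))
     where
     first : ∀ x y s u v a b z -> x * (u - s * y * v) + (a - s * b) * (y * z) ≈ (x * u + a * (y * z)) - s * y * (x * v + b * z)
     first x y s u v a b z = trans (+-congʳ (lF x y s u v)) (trans (+-congˡ (ld y s a b z)) (l2 (x * u) (s * y) (x * v) (a * (y * z)) (b * z)))
      where
      lF : ∀ x y s u v -> x * (u - s * y * v) ≈ x * u - s * y * (x * v)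
      lF = solve 5 (\ x y s u v -> x :* (u :- s :* y :* v) := x :* u :- s :* y :* (x :* v)) refl
      ld : ∀ y s a b z -> (a - s * b) * (y * z) ≈ a * (y * z) - s * y * (b * z)
      ld = solve 5 (\ y s a b z -> (a :- s :* b) :* (y :* z) := a :* (y :* z) :- s :* y :* (b :* z)) refl
      l2 : ∀ a b c d e -> (a - b * c) + (d - b * e) ≈ (a + d) - b * (c + e)
      l2 = solve 5 (\ a b c d e -> (a :- b :* c) :+ (d :- b :* e) := (a :+ d) :- b :* (c :+ e)) refl
    Ft : ∀ S x y -> F S x y ≈ ev (E S) (length S) x y
    Ft [] x y = refl
    Ft (s ∷ S) x y = begin (x - s * y) * F S x y ≈⟨ *-congˡ (Ft S x y) ⟩ (x - s * y) * V ≈⟨ spl x (s * y) V ⟩ x * V - s * y * V ≈⟨ +-congʳ (sym (trans (+-congˡ (trans (*-congʳ (bey S _ e3)) (zeroˡ _))) (+-identityʳ _))) ⟩ ev (E S) (suc (length S)) x y - s * y * V ≈⟨ sym (ej s S (length S) x y) ⟩ ev (E (s ∷ S)) (suc (length S)) x y ∎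
     where
     V = ev (E S) (length S) x y
     spl : ∀ a b v -> (a - b) * v ≈ a * v - b * v
     spl = solve 3 (\ a b v -> (a :- b) :* v := a :* v :- b :* v) refl
    sH : ∀ s S k -> E (S ++ s ∷ []) k ≈ E (s ∷ S) k
    sH s [] zero = refl
    sH s [] (suc k) = refl
    sH s (t ∷ S) zero = sH s S zero
    sH s (t ∷ S) (suc zero) = trans (+-cong (sH s S 1) (-‿cong (*-congˡ (sH s S 0)))) (lem _ _ _ _)
     where
     lem : ∀ a b d e -> (a - b) - d * e ≈ (a - d * e) - b
     lem = solve 4 (\ a b d e -> (a :- b) :- d :* e := (a :- d :* e) :- b) refl
    sH s (t ∷ S) (suc (suc k)) = trans (+-cong (sH s S (suc (suc k))) (-‿cong (*-congˡ (sH s S (suc k))))) (lem _ _ _ _ _)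
     where
     lem : ∀ a s b t d -> (a - s * b) - t * (b - s * d) ≈ (a - t * b) - s * (b - t * d)
     lem = solve 5 (\ a s b t d -> (a :- s :* b) :- t :* (b :- s :* d) := (a :- t :* b) :- s :* (b :- t :* d)) refl
    powers : O -> O -> List Carrier
    powers a zero = []
    powers a (suc m) = ζ ^ a ∷ powers (suc a) m
    l8 : ∀ a m -> length (powers a m) ≡ m
    l8 a zero = U.refl
    l8 a (suc m) = U.cong suc (l8 (suc a) m)
    pH : ∀ a m -> powers a (suc m) ≡ powers a m ++ ζ ^ (a Q.+ m) ∷ []
    pH a zero = U.cong (\ z -> ζ ^ z ∷ []) (U.sym (e5 a))
    pH a (suc m) = U.cong (ζ ^ a ∷_) (U.trans (pH (suc a) m) (U.cong (\ z -> powers (suc a) m ++ ζ ^ z ∷ []) (U.sym (e8 a m))))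
    sc : ∀ a m k -> E (powers (suc a) m) k ≈ ζ ^ k * E (powers a m) k
    sc a zero zero = sym (*-identityˡ 1#)
    sc a zero (suc k) = sym (zeroʳ _)
    sc a (suc m) zero = sc (suc a) m zero
    sc a (suc m) (suc k) = trans (+-cong (sc (suc a) m (suc k)) (-‿cong (*-congˡ (sc (suc a) m k)))) (lem ζ (ζ ^ k) _ (ζ ^ a) _)
     where
     lem : ∀ z k u a v -> z * k * u - z * a * (k * v) ≈ z * k * (u - a * v)
     lem = solve 5 (\ z k u a v -> z :* k :* u :- z :* a :* (k :* v) := z :* k :* (u :- a :* v)) refl
    -- Multiplication by ζ permutes the r-th roots of unity.
    rot : ∀ m -> ζ ^ suc m ≈ 1# -> ∀ k -> ζ ^ k * E (powers 0 (suc m)) k ≈ E (powers 0 (suc m)) k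
    rot m e k = begin ζ ^ k * E (powers 0 (suc m)) k ≈⟨ sym (sc 0 (suc m) k) ⟩ E (powers 1 (suc m)) k ≡⟨ U.cong (\ S -> E S k) (pH 1 m) ⟩ E (powers 1 m ++ ζ ^ suc m ∷ []) k ≈⟨ sH _ (powers 1 m) k ⟩ E (ζ ^ suc m ∷ powers 1 m) k ≈⟨ g0 k ⟩ E (1# ∷ powers 1 m) k ∎
     where
     g0 : ∀ k -> E (ζ ^ suc m ∷ powers 1 m) k ≈ E (1# ∷ powers 1 m) k
     g0 zero = refl
     g0 (suc k) = +-congˡ (-‿cong (*-congʳ e))
    cN : ∀ S -> E S 0 ≈ 1#
    cN [] = refl
    cN (s ∷ S) = cN S
    ep : ∀ e m x y -> (∀ k -> 0 < k -> k ≤ m -> e k ≈ 0#) -> ev e m x y ≈ x ^ m * e 0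
    ep e zero x y z = sym (*-identityˡ _)
    ep e (suc m) x y z = trans (+-cong (*-congˡ (ep e m x y \ k p l -> z k p (Q.m≤n⇒m≤1+n l))) (trans (*-congʳ (z (suc m) (s≤s z≤n) e3)) (zeroˡ _))) (trans (+-identityʳ _) (sym (*-assoc _ _ _)))
    Fv : ∀ m -> suc m ≡ r -> ∀ x y -> F (powers 0 (suc m)) x y ≈ x ^ suc m - y ^ suc m
    Fv m e x y = trans (sha x y) (+-congˡ (trans (*-congʳ lN) (neg (y ^ suc m))))
     where
     S = powers 0 (suc m)
     mid : ∀ k -> 0 < k -> k ≤ m -> E S k ≈ 0#
     mid k p l = can (apart k p (e4 (s≤s l) (e1 e))) (trans (distribʳ _ _ _) (trans (+-cong (rot m (trans (reflexive (U.cong (ζ ^_) e)) rw) k) (mi (E S k))) (-‿inverseʳ _)))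
      where
      mi : ∀ a -> - 1# * a ≈ - a
      mi a = trans (solve 2 (\ o a -> (:- o) :* a := :- (o :* a)) refl 1# a) (-‿cong (*-identityˡ a))
     sha : ∀ x y -> F S x y ≈ x ^ suc m + E S (suc m) * y ^ suc m
     sha x y = trans (Ft S x y) (trans (reflexive (U.cong (\ z -> ev (E S) z x y) (l8 0 (suc m)))) (+-congʳ (*-congˡ (trans (ep (E S) m x y mid) (trans (*-congˡ (cN S)) (*-identityʳ _))))))
     os : ∀ j -> 1# ^ j ≈ 1#
     os zero = refl
     os (suc j) = trans (*-identityˡ _) (os j)
     lN : E S (suc m) ≈ - 1#
     lN = begin E S (suc m) ≈⟨ sym (trans (+-congʳ (+-congˡ (trans (*-congˡ (os (suc m))) (*-identityʳ _)))) (lem (1# ^ suc m) (E S (suc m)))) ⟩ (1# ^ suc m + E S (suc m) * 1# ^ suc m) - 1# ^ suc m ≈⟨ +-congʳ (sym (sha 1# 1#)) ⟩ F S 1# 1# - 1# ^ suc m ≈⟨ +-cong (trans (*-congʳ (mc (sym (*-identityˡ 1#)))) (zeroˡ _)) (-‿cong (os (suc m))) ⟩ 0# - 1# ≈⟨ +-identityˡ _ ⟩ - 1# ∎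
      where
      lem : ∀ a b -> (a + b) - a ≈ b
      lem = solve 2 (\ a b -> (a :+ b) :- a := b) refl
     neg : ∀ a -> - 1# * a ≈ - a
     neg a = trans (solve 2 (\ o a -> (:- o) :* a := :- (o :* a)) refl 1# a) (-‿cong (*-identityˡ a))
    Fp : ∀ a m x y -> ∏ {m} (\ i -> x - ζ ^ (a Q.+ toℕ i) * y) ≈ F (powers a m) x y
    Fp a zero x y = ∏-0 _
    Fp a (suc m) x y = trans (∏-suc _) (*-cong (+-congˡ (-‿cong (*-congʳ (reflexive (U.cong (ζ ^_) (e5 a)))))) (trans (∏-cong \ i -> +-congˡ (-‿cong (*-congʳ (reflexive (U.cong (ζ ^_) (e8 a (toℕ i))))))) (Fp (suc a) m x y)))
   rD : ∀ x y -> ∏ {r} (\ i -> x - ζ ^ toℕ i * y) ≈ x ^ r - y ^ r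
   rD x y = go r U.refl
    where
    go : ∀ m -> m ≡ r -> ∏ {m} (\ i -> x - ζ ^ toℕ i * y) ≈ x ^ m - y ^ m
    go zero e with () <- U.subst NonZero (U.sym e) (Q.>-nonZero (Q.>-nonZero⁻¹ r))
    go (suc m) e = trans (Fp 0 (suc m) x y) (Fv m e x y)
  sb : ∀ {m} -> Vec Bool m -> O
  sb [] = 0
  sb (b2 ∷ J) = Q.suc (sb J)
  sb (b1 ∷ J) = sb J
  ce : ∀ {m} (J : Vec Bool m) -> J ∈ ch m (sb J)
  ce [] = here U.refl
  ce {Q.suc m} (b2 ∷ J) = ∈-++⁺ʳ _ (∈-map⁺ (b2 ∷_) (ce J))
  ce {Q.suc m} (b1 ∷ J) with sb J | ce J
  ... | Q.zero | h = ∈-map⁺ (b1 ∷_) h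
  ... | Q.suc q | h = ∈-++⁺ˡ (∈-map⁺ (b1 ∷_) h)
  module Wo where
   open K using (Carrier; 0#; 1#)
   open Bas
   open Op
   open Fl
   open Int Po using (solve; _:=_; _:+_; _:*_; _:-_; :-_)
   open import Relation.Binary.Reasoning.Setoid setoid
   infix 4 _≈±_
   data _≈±_ (f g : Ω) : Set (c ⊔ ℓ) where
    pb : f ≈Ω g -> f ≈± g
    mi : f ≈Ω - g -> f ≈± g
   ff : ∀ {f g} -> f ≈± g -> g ≈± f
   ff (pb e) = pb (sym e)
   ff (mi e) = mi (sym (trans (*-congˡ e) (-‿involutive _)))
   tb : ∀ {f g h} -> f ≈± g -> g ≈± h -> f ≈± h
   tb (pb e) (pb e') = pb (trans e e')
   tb (pb e) (mi e') = mi (trans e e')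
   tb (mi e) (pb e') = mi (trans e (*-congˡ e'))
   tb (mi e) (mi e') = pb (trans e (trans (*-congˡ e') (-‿involutive _)))
   uc : ∀ h {f g} -> f ≈± g -> h * f ≈± h * g
   uc h (pb e) = pb (*-congˡ e)
   uc h (mi e) = mi (trans (*-congˡ e) (sd _ h _))
   uk : ∀ i -> θ i * θ i ≈Ω 0Ω
   uk i = begin θ i * θ i ≈⟨ sym (*-identityˡ _) ⟩ scalar 1# * (θ i * θ i) ≈⟨ *-congʳ (scalar-≈ (K.trans (K.sym (p2 hb)) (K.*-comm _ _))) ⟩ scalar (p1 hb K.* (1# K.+ 1#)) * (θ i * θ i) ≈⟨ trans (*-congʳ (scalar-* _ _)) (*-assoc _ _ _) ⟩ scalar (p1 hb) * (scalar (1# K.+ 1#) * (θ i * θ i)) ≈⟨ *-congˡ (trans (*-congʳ (scalar-+ 1# 1#)) (distribʳ _ _ _)) ⟩ scalar (p1 hb) * (scalar 1# * (θ i * θ i) + scalar 1# * (θ i * θ i)) ≈⟨ *-congˡ (trans (+-cong (trans (*-identityˡ _) (θ-θ i i)) (*-identityˡ _)) (ΩR.-‿inverseˡ _)) ⟩ scalar (p1 hb) * 0Ω ≈⟨ zeroʳ _ ⟩ 0Ω ∎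
   mem : ∀ {m} -> (Fin m -> Fin n) -> Vec Bool m -> List (Fin n)
   mem f [] = []
   mem f (b2 ∷ J) = f zero ∷ mem (f ∘ suc) J
   mem f (b1 ∷ J) = mem (f ∘ suc) J
   oa : ∀ {m} -> (Fin m -> Fin n) -> Vec Bool m -> List (Fin n)
   oa f [] = []
   oa f (b2 ∷ J) = oa (f ∘ suc) J
   oa f (b1 ∷ J) = f zero ∷ oa (f ∘ suc) J
   ob : ∀ {m} (f : Fin m -> Fin n) J i -> lookup J i ≡ b1 -> f i ∈ oa f J
   ob f (b1 ∷ J) zero e = here U.refl
   ob f (b2 ∷ J) (suc i) e = ob (f ∘ suc) J i e
   ob f (b1 ∷ J) (suc i) e = there (ob (f ∘ suc) J i e)
   lt : ∀ {m} (f : Fin m -> Fin n) J -> length (oa f J) Q.+ sb J ≡ m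
   lt f [] = U.refl
   lt f (b2 ∷ J) = U.trans (e8 _ _) (U.cong Q.suc (lt (f ∘ suc) J))
   lt f (b1 ∷ J) = U.cong Q.suc (lt (f ∘ suc) J)
   ua : Vec Bool n -> Ω
   ua J = θs (mem id J)
   lc : ∀ {m} (f : Fin m -> Fin n) J -> length (mem f J) ≡ sb J
   lc f [] = U.refl
   lc f (b2 ∷ J) = U.cong Q.suc (lc (f ∘ suc) J)
   lc f (b1 ∷ J) = lc (f ∘ suc) J
   io : ∀ {m} (f : Fin m -> Fin n) J i -> lookup J i ≡ b1 -> θ (f i) * θs (mem f J) ≈± θs (mem f (J [ i ]≔ b2))
   io f (b1 ∷ J) zero e = pb refl
   io f (b1 ∷ J) (suc i) e = io (f ∘ suc) J i e
   io f (b2 ∷ J) (suc i) e = tb (mi (trans (sym (*-assoc _ _ _)) (trans (*-congʳ (θ-θ _ _)) (trans (*-assoc _ _ _) (*-congˡ (*-assoc _ _ _)))))) (uc (θ (f zero)) (io (f ∘ suc) J i e))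
   ip : ∀ {m} (f : Fin m -> Fin n) J i -> lookup J i ≡ b2 -> θ (f i) * θs (mem f J) ≈Ω 0Ω
   ip f (b2 ∷ J) zero e = trans (sym (*-assoc _ _ _)) (trans (*-congʳ (uk _)) (zeroˡ _))
   ip f (b1 ∷ J) (suc i) e = ip (f ∘ suc) J i e
   ip f (b2 ∷ J) (suc i) e = begin θ (f (suc i)) * (θ (f zero) * w) ≈⟨ trans (sym (*-assoc _ _ _)) (*-congʳ (θ-θ _ _)) ⟩ - (θ (f zero) * θ (f (suc i))) * w ≈⟨ trans (*-assoc _ _ _) (*-congˡ (*-assoc _ _ _)) ⟩ - (θ (f zero) * (θ (f (suc i)) * w)) ≈⟨ *-congˡ (trans (*-congˡ (ip (f ∘ suc) J i e)) (zeroʳ _)) ⟩ - 0Ω ≈⟨ -0#≈0# ⟩ 0Ω ∎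
    where w = θs (mem (f ∘ suc) J)
   weight : ∀ {m} -> (Fin m -> Fin n) -> Vec Bool m -> O
   weight f [] = 0
   weight f (b2 ∷ J) = toℕ (f zero) Q.+ weight (f ∘ suc) J
   weight f (b1 ∷ J) = weight (f ∘ suc) J
   wc : ∀ {m} (f : Fin m -> Fin n) J i -> lookup J i ≡ b1 -> weight f (J [ i ]≔ b2) ≡ toℕ (f i) Q.+ weight f J
   wc f (b1 ∷ J) zero e = U.refl
   wc f (b1 ∷ J) (suc i) e = wc (f ∘ suc) J i e
   wc f (b2 ∷ J) (suc i) e = U.trans (U.cong (toℕ (f zero) Q.+_) (wc (f ∘ suc) J i e)) (U.trans (U.sym (e7 a b _)) (U.trans (U.cong (Q._+ weight (f ∘ suc) J) (e6 a b)) (e7 b a _)))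
    where
    a = toℕ (f zero)
    b = toℕ (f (suc i))
   wb : ∀ {m} (f : Fin m -> Fin n) J -> weight f J ≤ weight f (replicate m b2)
   wb f [] = Q.z≤n
   wb f (b1 ∷ J) = e2 (wb (f ∘ suc) J) (e0 _ _)
   wb f (b2 ∷ J) = Q.+-monoʳ-≤ (toℕ (f zero)) (wb (f ∘ suc) J)
   s7 : ∀ {m} (J : Vec Bool m) i -> lookup J i ≡ b1 -> sb (J [ i ]≔ b2) ≡ Q.suc (sb J)
   s7 (b1 ∷ J) zero e = U.refl
   s7 (b1 ∷ J) (suc i) e = s7 J i e
   s7 (b2 ∷ J) (suc i) e = U.cong Q.suc (s7 J i e)
   nor : ∀ js -> θs js ≈Ω 0Ω ⊎ Σ (Vec Bool n) \ J -> (sb J ≡ length js) × (θs js ≈± ua J)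
   nor [] = i2 (replicate n b1 , bn n , pb (reflexive (U.sym (U.cong θs (mr n id)))))
    where
    open ΩR using (reflexive)
    bn : ∀ m -> sb (replicate m b1) ≡ 0
    bn Q.zero = U.refl
    bn (Q.suc m) = bn m
    mr : ∀ m (f : Fin m -> Fin n) -> mem f (replicate m b1) ≡ []
    mr Q.zero f = U.refl
    mr (Q.suc m) f = mr m (f ∘ suc)
   nor (j ∷ js) with nor js
   ... | i1 e = i1 (trans (*-congˡ e) (zeroʳ _))
   ... | i2 (J , s , e) with lookup J j in eq
   ... | b1 = i2 (J [ j ]≔ b2 , U.trans (s7 J j eq) (U.cong Q.suc s) , tb (uc (θ j) e) (io id J j eq))
   ... | b2 = i1 (vc e)
    where
    vc : θs js ≈± ua J -> θ j * θs js ≈Ω 0Ω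
    vc (pb e) = trans (*-congˡ e) (ip id J j eq)
    vc (mi e) = trans (*-congˡ e) (trans (sd _ _ _) (trans (*-congˡ (ip id J j eq)) -0#≈0#))
   infixl 6 _⊟_
   _⊟_ : Pb -> Pb -> Pb
   _⊟_ = P._-_
   X : Fin n -> Pb
   X i = var i ^ᴾ r
   van : List (Fin n) -> Pb -> Pb
   van [] t = con 1#
   van (l ∷ ls) t = (t ⊟ X l) ⊠ van ls t
   vh : ∀ {i ls} -> i ∈ ls -> van ls (X i) ≈ᴾ con 0#
   vh (here U.refl) = P.trans (P.*-congʳ (P.-‿inverseʳ _)) (P.zeroˡ _)
   vh (there m) = P.trans (P.*-congˡ (vh m)) (P.zeroʳ _)
   -- Combinations of the d (m + i) with coefficients in the variables; the coefficient
   -- of θᵢ vanishes at i in ls.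
   red : List (Fin n) -> O -> Ω
   red ls m = ∑Ω \ i -> ι (var i ^ᴾ da m ⊠ van ls (X i)) * θ i
   rF : ∀ m -> red [] m ≈Ω d m
   rF m = ∑Ω-cong \ i -> *-congʳ (un (P.*-identityʳ _))
   rA : ∀ l ls m v -> red (l ∷ ls) m * v ≈Ω red ls (Q.suc m) * v - red ls m * (ι (X l) * v)
   rA l ls m v = begin red (l ∷ ls) m * v ≈⟨ *-congʳ (∑Ω-cong \ i -> trans (*-congʳ (un (spl i))) (trans (distribʳ _ _ _) (+-congˡ (trans (*-assoc _ _ _) (*-congˡ (*-assoc _ _ _)))))) ⟩ (∑Ω \ i -> term (Q.suc m) i + - (ι (X l) * term m i)) * v ≈⟨ *-congʳ (∑Ω-+ _ _) ⟩ (red ls (Q.suc m) + (∑Ω \ i -> - (ι (X l) * term m i))) * v ≈⟨ distribʳ _ _ _ ⟩ red ls (Q.suc m) * v + (∑Ω \ i -> - (ι (X l) * term m i)) * v ≈⟨ +-congˡ (*-congʳ (sym (trans (*-congˡ (ud _ _)) (ud _ _)))) ⟩ red ls (Q.suc m) * v + - (ι (X l) * red ls m) * v ≈⟨ +-congˡ (trans (*-assoc _ _ _) (*-congˡ (trans (*-assoc _ _ _) (sym (cd (X l) _ _))))) ⟩ red ls (Q.suc m) * v - red ls m * (ι (X l) * v) ∎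
    where
    term : O -> Fin n -> Ω
    term m i = ι (var i ^ᴾ da m ⊠ van ls (X i)) * θ i
    eb : da m Q.+ r ≡ da (Q.suc m)
    eb = U.trans (e6 _ r) (U.trans (U.sym (e7 r (r Q.* m) _)) (U.cong (Q._+ (r Q.∸ 1)) (U.sym (Q.*-suc r m))))
    spl : ∀ i -> var i ^ᴾ da m ⊠ ((X i ⊟ X l) ⊠ van ls (X i)) ≈ᴾ var i ^ᴾ da (Q.suc m) ⊠ van ls (X i) ⊟ X l ⊠ (var i ^ᴾ da m ⊠ van ls (X i))
    spl i = P.trans (lem _ _ _ _) (P.+-congʳ (P.*-congʳ (P.trans (P.sym (^ᴾ-+ (var i) (da m) r)) (P.reflexive (U.cong (var i ^ᴾ_) eb)))))
     where
     lem : ∀ a t l v -> a ⊠ ((t ⊟ l) ⊠ v) ≈ᴾ (a ⊠ t) ⊠ v ⊟ l ⊠ (a ⊠ v)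
     lem = solve 4 (\ a t l v -> a :* ((t :- l) :* v) := (a :* t) :* v :- l :* (a :* v)) P.refl
   Xa : ∀ i -> Pc r (X i)
   Xa i = wea (e1 (Q.*-identityʳ r)) (Pd r (var i))
   kd : Bool -> Pb -> Pb
   kd b2 a = a
   kd b1 a = con 0#
   -- The sum of xᵢ^(rm) over i outside J, and over i in J if s holds.
   ac : Bool -> ∀ {m} -> (Fin m -> Fin n) -> Vec Bool m -> O -> Pb
   ac s f [] e = con 0#
   ac s f (b1 ∷ J) e = var (f zero) ^ᴾ (r Q.* e) ⊞ ac s (f ∘ suc) J e
   ac s f (b2 ∷ J) e = kd s (var (f zero) ^ᴾ (r Q.* e)) ⊞ ac s (f ∘ suc) J e
   pa : ∀ {m} -> (Fin m -> Fin n) -> Vec Bool m -> O -> Pb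
   pa f [] e = con 0#
   pa f (b1 ∷ J) e = pa (f ∘ suc) J e
   pa f (b2 ∷ J) e = var (f zero) ^ᴾ (r Q.* e) ⊞ pa (f ∘ suc) J e
   a6 : ∀ {m} (f : Fin m -> Fin n) J e -> ∑ᴾ (\ i -> var (f i) ^ᴾ (r Q.* e)) ≈ᴾ ac b2 f J e
   a6 f [] e = ∑ᴾ-0 _
   a6 f (b1 ∷ J) e = P.trans (∑ᴾ-suc _) (P.+-congˡ (a6 (f ∘ suc) J e))
   a6 f (b2 ∷ J) e = P.trans (∑ᴾ-suc _) (P.+-congˡ (a6 (f ∘ suc) J e))
   a5 : ∀ {m} (f : Fin m -> Fin n) J e -> ∑ᴾ (\ i -> var (f i) ^ᴾ (r Q.* e)) ≈ᴾ ac b1 f J e ⊞ pa f J e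
   a5 f [] e = P.trans (∑ᴾ-0 _) (P.sym (P.+-identityˡ _))
   a5 f (b1 ∷ J) e = P.trans (∑ᴾ-suc _) (P.trans (P.+-congˡ (a5 (f ∘ suc) J e)) (P.sym (P.+-assoc _ _ _)))
   a5 f (b2 ∷ J) e = P.trans (∑ᴾ-suc _) (P.trans (P.+-congˡ (a5 (f ∘ suc) J e)) (P.trans (solve 3 (\ a b v -> a :+ (b :+ v) := b :+ (a :+ v)) P.refl _ _ _) (P.+-congʳ (P.sym (P.+-identityˡ _)))))
   Db : ∀ {m} (f : Fin m -> Fin n) J e -> D e (θs (mem f J)) ≈Ω ι (pa f J e) * θs (mem f J)
   Db f [] e = sym (zeroˡ _)
   Db f (b1 ∷ J) e = Db (f ∘ suc) J e
   Db f (b2 ∷ J) e = trans (+-cong (*-assoc _ _ _) (trans (*-congˡ (Db (f ∘ suc) J e)) (cd (pa (f ∘ suc) J e) _ _))) (sym (distribʳ _ _ _))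
   module _ (s : Bool) (cs : O -> Carrier) (q : O) where
    open To s cs q using (Sub; P; part; Pn; rel; resp; _+_; Sg)
    ry : ∀ ls m {j D E q′ v} -> Q.suc q′ ≡ q -> Fil E q′ v -> E Q.+ (r Q.* length ls Q.+ da m) ≤ D -> Sub j D (red ls m * v)
    ry [] m {E = E} e h l = resp (*-congʳ (sym (rF m))) (rel m e h (e2 (e1 (U.cong (\ z -> E Q.+ (z Q.+ da m)) (U.sym (Q.*-zeroʳ r)))) l))
    ry (t ∷ ls) m {D = D} {E} e h l = resp (sym (rA t ls m _)) (ry ls (Q.suc m) e h (e2 (e1 first) l) + Sg _ (ry ls m e (Fb (Xa t) h) (e2 (e1 sec) l)))
     where
     L = r Q.* length ls
     B = da m
     first : E Q.+ (L Q.+ da (Q.suc m)) ≡ E Q.+ (r Q.* Q.suc (length ls) Q.+ B)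
     first = U.cong (E Q.+_) (U.trans (U.cong (\ z -> L Q.+ (z Q.+ (r Q.∸ 1))) (Q.*-suc r m)) (U.trans (U.cong (L Q.+_) (e7 r _ _)) (U.trans (U.sym (e7 L r B)) (U.cong (Q._+ B) (U.trans (e6 L r) (U.sym (Q.*-suc r (length ls))))))))
     sec : r Q.+ E Q.+ (L Q.+ B) ≡ E Q.+ (r Q.* Q.suc (length ls) Q.+ B)
     sec = U.trans (U.cong (Q._+ (L Q.+ B)) (e6 r E)) (U.trans (e7 E r _) (U.cong (E Q.+_) (U.trans (U.sym (e7 r L B)) (U.cong (Q._+ B) (U.sym (Q.*-suc r (length ls)))))))
    Pj : ∀ m a J -> P m (ι a * ua J) ≈Ω ι (a ⊠ ac s id J m) * ua J + scalar (K.- cs m) * (ι a * ua J)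
    Pj m a J = begin P m (ι a * ua J) ≈⟨ Pn m a _ ⟩ ι a * (p m * ua J + (part s m (ua J) + scalar (K.- cs m) * ua J)) ≈⟨ *-congˡ (trans (sym (+-assoc _ _ _)) (+-congʳ (mul s))) ⟩ ι a * (ι (ac s id J m) * ua J + scalar (K.- cs m) * ua J) ≈⟨ distribˡ _ _ _ ⟩ ι a * (ι (ac s id J m) * ua J) + ι a * (scalar (K.- cs m) * ua J) ≈⟨ +-cong (sym (*-assoc _ _ _)) (sd _ _ _) ⟩ ι (a ⊠ ac s id J m) * ua J + scalar (K.- cs m) * (ι a * ua J) ∎
     where
     mul : ∀ t -> p m * ua J + part t m (ua J) ≈Ω ι (ac t id J m) * ua J
     mul b2 = trans (+-identityʳ _) (*-congʳ (un (a6 id J m)))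
     mul b1 = trans (+-cong (trans (*-congʳ (un (a5 id J m))) (distribʳ _ _ _)) (*-congˡ (Db id J m))) (trans (+-assoc _ _ _) (trans (+-congˡ (ΩR.-‿inverseʳ _)) (+-identityʳ _)))
    record Cl {ℓ'} (S : Ω -> Set ℓ') : Set (c ⊔ ℓ ⊔ ℓ') where
     field
      Sc : ∀ {f g} -> f ≈Ω g -> S f -> S g
      S-+ : ∀ {f g} -> S f -> S g -> S (f + g)
      Sv : ∀ a {f} -> S f -> S (scalar a * f)
      S-0 : S 0Ω
     Sy : ∀ {m} {f : Fin m -> Ω} -> (∀ i -> S (f i)) -> S (∑Ω f)
     Sy {Q.zero} h = Sc (sym (∑Ω-0 _)) S-0
     Sy {Q.suc m} h = Sc (sym (∑Ω-suc _)) (S-+ (h zero) (Sy \ i -> h (suc i)))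
     S2 : ∀ {f g} -> f ≈± g -> S g -> S f
     S2 (pb e) h = Sc (sym e) h
     S2 (mi e) h = Sc (sym e) (Sv _ h)
     S6 : ∀ {m} (f : Fin m -> Ω) j -> S (∑Ω f) -> (∀ i -> i ≢ j -> S (f i)) -> S (f j)
     S6 {m} f j h z = Sc iM (S-+ h (Sy \ i -> Sv (K.- 1#) (ow i (i ≟ j))))
      where
      g : ∀ i -> Dec (i ≡ j) -> Ω
      g i (yes _) = 0Ω
      g i (no _) = f i
      ow : ∀ i d -> S (g i d)
      ow i (yes _) = S-0
      ow i (no p) = z i p
      en : ∀ i -> i ≢ j -> ∀ d -> f i + - g i d ≈Ω 0Ω
      en i p (yes e) with () <- p e
      en i p (no _) = ΩR.-‿inverseʳ _
      gz : ∀ d -> f j + - g j d ≈Ω f j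
      gz (yes _) = trans (+-congˡ (zeroʳ _)) (+-identityʳ _)
      gz (no p) with () <- p U.refl
      iM : ∑Ω f + (∑Ω \ i -> - g i (i ≟ j)) ≈Ω f j
      iM = trans (sym (∑Ω-+ _ _)) (trans (∑Ω-single _ j \ i p -> en i p (i ≟ j)) (gz (j ≟ j)))
    module _ {ℓ'} {S : Ω -> Set ℓ'} (cl : Cl S) {k D : O} (Sw : ∀ {f} -> Sub k D f -> S f) (J : Vec Bool n) (s3 : sb J ≡ q) where
     open Cl cl
     module Ew j (j∈J : lookup J j ≡ b2) where
      Ja : Vec Bool n
      Ja = J [ j ]≔ b1
      ja : lookup Ja j ≡ b1
      ja = lookup∘update j J b1
      res : Ja [ j ]≔ b2 ≡ J
      res = U.trans ([]≔-idempotent J j) (U.trans (U.cong (J [ j ]≔_) (U.sym j∈J)) ([]≔-lookup J j))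
      sS : Q.suc (sb Ja) ≡ q
      sS = U.trans (U.sym (s7 Ja j ja)) (U.trans (U.cong sb res) s3)
      gv : ∀ {i} -> lookup Ja i ≡ b1 -> sb (Ja [ i ]≔ b2) ≡ q
      gv i∉J₀ = U.trans (s7 Ja _ i∉J₀) sS
      wo : ∀ {i} -> lookup Ja i ≡ b1 -> toℕ j < toℕ i -> weight id J < weight id (Ja [ i ]≔ b2)
      wo {i} i∉J₀ j<i = e4 (Q.≤-<-trans (e1 (U.trans (U.cong (weight id) (U.sym res)) (wc id Ja j ja))) (Q.+-monoˡ-< (weight id Ja) j<i)) (e1 (U.sym (wc id Ja i i∉J₀)))
     cT : ∀ j ls (j∈J : lookup J j ≡ b2) -> (let open Ew j j∈J) -> (∀ i -> i ∈ ls ⊎ lookup J i ≡ b2 ⊎ (lookup Ja i ≡ b1 -> ∀ {d a} -> Pc d a -> d ≤ D -> S (ι a * ua (Ja [ i ]≔ b2)))) ->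
      ∀ {e u} -> Pc e u -> e Q.+ (r Q.* length ls Q.+ da 0) ≤ D ->
      S (ι ((var j ^ᴾ da 0 ⊠ van ls (X j)) ⊠ u) * ua J)
     cT j ls j∈J cases {e} {u} deg l = S2 (ff m7) (S6 en j eI ot)
      where
      open Ew j j∈J
      coefficient : Fin n -> Pb
      coefficient i = var i ^ᴾ da 0 ⊠ van ls (X i)
      en : Fin n -> Ω
      en i = ι (coefficient i ⊠ u) * (θ i * ua Ja)
      eI : S (∑Ω en)
      eI = Sc (trans (ub _ _) (∑Ω-cong \ i -> trans (*-assoc _ _ _) (trans (*-congˡ (cd u (θ i) _)) (sym (*-assoc _ _ _))))) (Sw (ry ls 0 {E = e Q.+ 0} {sb Ja} sS (Fb deg (U.subst (\ z -> Fil 0 z (ua Ja)) (lc id Ja) (Fc _))) (e2 (e1 (U.cong (Q._+ (r Q.* length ls Q.+ da 0)) (e5 e))) l)))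
      m7 : en j ≈± ι (coefficient j ⊠ u) * ua J
      m7 = uc _ (U.subst (\ z -> θ j * ua Ja ≈± ua z) res (io id Ja j ja))
      vj : ∀ ls i -> Pc (r Q.* length ls) (van ls (X i))
      vj [] i = con 1#
      vj (t ∷ ls) i = wea (e1 (U.sym (Q.*-suc r (length ls)))) ((Xa i ⊞ (con {d = 0} (K.- 1#) ⊠ Xa t)) ⊠ vj ls i)
      eH : ∀ i -> Pc (da 0 Q.+ r Q.* length ls Q.+ e) (coefficient i ⊠ u)
      eH i = (wea (e1 (Q.*-identityʳ _)) (Pd (da 0) (var i)) ⊠ vj ls i) ⊠ deg
      eA : da 0 Q.+ r Q.* length ls Q.+ e ≤ D
      eA = e2 (e1 (U.trans (e6 _ e) (U.cong (e Q.+_) (e6 (da 0) _)))) l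
      ze : ∀ {a f} -> f ≈Ω 0Ω -> S (ι a * f)
      ze e = Sc (sym (trans (*-congˡ e) (zeroʳ _))) S-0
      ot : ∀ i -> i ≢ j -> S (en i)
      ot i i≢j with lookup Ja i in i∈J₀
      ... | b2 = ze {coefficient i ⊠ u} (ip id Ja i i∈J₀)
      ... | b1 with cases i
      ... | i1 i∈ls = Sc (sym (trans (*-congʳ (un (P.trans (P.*-congʳ (P.trans (P.*-congˡ (vh i∈ls)) (P.zeroʳ _))) (P.zeroˡ _)))) (zeroˡ _))) S-0
      ... | i2 (i1 ii) with () <- U.trans (U.sym i∈J₀) (U.trans (lookup∘update′ i≢j J b1) ii)
      ... | i2 (i2 hi) = S2 (uc _ (io id Ja i i∈J₀)) (hi i∈J₀ (eH i) eA)
  module Cc where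
   open K using (Carrier; 0#; 1#)
   open Kg using (_^_)
   open Bas using (Pb; con; var; _⊞_; _⊠_; _≈ᴾ_; sk; un; Po; module P; _^ᴾ_; ^ᴾ-+; ∑ᴾ; ∑ᴾ-0; ∑ᴾ-suc; ∑ᴾ-cong; ∑ᴾ-zero; ∑ᴾ-+; ∑ᴾ-*ˡ; ∑ᴾ-*ʳ; Pc; Pd; wea; resp; scalar-≈; scalar-*; scalar-+; refl)
   open Ro using (1^)
   module PD = Pc
   open Kj using (Inv)
   open Wo
   open Bnd
   open Sn P.*-commutativeMonoid using () renaming (∑ to ∏; ue to ∏-0; sf to ∏-suc; cb to ∏-cong; uq to ∏-++; ss to ∏-swap; rd to ∏-remQuot)
   open Int Po using (solve; _:=_; _:+_; _:*_; _:-_; :-_)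
   open import Relation.Binary.Reasoning.Setoid P.setoid
   cD : ∀ a b -> con (a K.* b) ≈ᴾ con a ⊠ con b
   cD a b = sk (scalar-* a b)
   cO : ∀ a b -> con (a K.+ b) ≈ᴾ con a ⊞ con b
   cO a b = sk (scalar-+ a b)
   ci : ∀ {a b} -> a K.≈ b -> con a ≈ᴾ con b
   ci e = sk (scalar-≈ e)
   cH : ∀ a m -> con (a ^ m) ≈ᴾ con a ^ᴾ m
   cH a Q.zero = P.refl
   cH a (Q.suc m) = P.trans (cD a (a ^ m)) (P.*-congˡ (cH a m))
   c7 : ∀ a -> con (K.- a) ≈ᴾ P.- con a
   c7 a = P.trans (ci (K.sym (-1*x≈-x a))) (cD (K.- 1#) a)
    where open import Algebra.Properties.Ring K.ring using (-1*x≈-x)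
   nat : O -> Carrier
   nat m = RawMonoidDefinitions._×_ K.+-rawMonoid m 1#
   data Td : List O -> Set c where
    l1 : Td []
    nf : ∀ {s bs} -> (Fin s -> Pb) -> (Fin s -> Td bs) -> Td (s ∷ bs)
   cha : ∀ {s} -> (Fin s -> Pb) -> (Fin s -> Pb -> O -> List Pb) -> Pb -> O -> List Pb
   cha {Q.zero} form g u D = []
   cha {Q.suc s} form g u Q.zero = g zero u 0
   cha {Q.suc s} form g u (Q.suc D) = g zero u (Q.suc D) ++ cha (form ∘ suc) (g ∘ suc) (u ⊠ form zero) D
   -- The products of initial segments of forms along the branches, of degree at most D above u.
   lea : ∀ {bs} -> Td bs -> Pb -> O -> List Pb
   lea l1 u D = u ∷ []
   lea (nf form sub) u D = cha form (\ i -> lea (sub i)) u D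
   l9 : ∀ {bs} (t : Td bs) u {D E} -> sum bs ≤ D -> sum bs ≤ E -> lea t u D ≡ lea t u E
   l9 l1 u l l' = U.refl
   l9 {s ∷ bs} (nf form sub) u l l' = go s form (\ i -> lea (sub i)) (\ i u -> l9 (sub i) u) u l l'
    where
    go : ∀ s (form : Fin s -> Pb) g -> (∀ i u {D E} -> sum bs ≤ D -> sum bs ≤ E -> g i u D ≡ g i u E) -> ∀ u {D E} -> s Q.+ sum bs ≤ D -> s Q.+ sum bs ≤ E -> cha form g u D ≡ cha form g u E
    go Q.zero form g h u l l' = U.refl
    go (Q.suc s) form g h u (s≤s l) (s≤s l') = U.cong₂ _++_ (h zero u (bel l) (bel l')) (go s (form ∘ suc) (g ∘ suc) (\ i -> h (suc i)) _ l l')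
     where
     bel : ∀ {D} -> s Q.+ sum bs ≤ D -> sum bs ≤ Q.suc D
     bel l = e2 (e0 _ s) (e2 l (Q.n≤1+n _))
   ln : ∀ {bs} (t : Td bs) u D -> length (lea t u D) ≡ tu (map just bs) D
   ln l1 u D = U.refl
   ln {s ∷ bs} (nf form sub) u D = go s form (\ i -> lea (sub i)) (\ i -> ln (sub i)) u D
    where
    go : ∀ s (form : Fin s -> Pb) g -> (∀ i u D -> length (g i u D) ≡ tu (map just bs) D) -> ∀ u D -> length (cha form g u D) ≡ sp (just s) (tu (map just bs)) D
    go Q.zero form g h u D = U.refl
    go (Q.suc s) form g h u Q.zero = h zero u 0
    go (Q.suc s) form g h u (Q.suc D) = U.trans (length-++ (g zero u (Q.suc D))) (U.cong₂ Q._+_ (h zero u (Q.suc D)) (go s (form ∘ suc) (g ∘ suc) (\ i -> h (suc i)) (u ⊠ form zero) D))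
   og : ∀ m -> (Fin m -> Fin n) -> Td (ou m)
   og Q.zero ys = l1
   og (Q.suc m) ys = nf (\ i -> var (ys (p2 (remQuot {r} (Q.suc m) i)))) (\ i -> og m (ys ∘ punchIn (p2 (remQuot {r} (Q.suc m) i))))
   fi : ∀ {m} -> O -> Vec Bool m -> O
   fi c [] = c
   fi c (b2 ∷ J) = fi c J
   fi c (b1 ∷ J) = fi (Q.suc c) J
   fd : ∀ {c} -> Fin n -> (Fin c -> Fin n) -> Fin (r Q.∸ 1 Q.+ r Q.* c) -> Pb
   fd {c} j ls i = [ (\ _ -> var j) , (\ i -> let a , l = remQuot {r} c i in var j ⊟ con (ζ ^ toℕ a) ⊠ var (ls l)) ]′ (splitAt (r Q.∸ 1) i)
   fw : ∀ {c} j (ls : Fin c -> Fin n) i -> Pc 1 (fd j ls i)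
   fw j ls i with splitAt (r Q.∸ 1) i
   ... | i1 _ = var _
   ... | i2 _ = var _ PD.⊞ (con {d = 0} _ PD.⊠ (con {d = 0} _ PD.⊠ var _))
   su : ∀ {m c} -> (Fin m -> Fin n) -> (J : Vec Bool m) -> (Fin c -> Fin n) -> Td (ins c J ++ ou (fi c J))
   su {c = c} f [] ls = og c ls
   su f (b1 ∷ J) ls = su (f ∘ suc) J (f zero Vector.∷ ls)
   su f (b2 ∷ J) ls = nf (fd (f zero) ls) (\ _ -> su (f ∘ suc) J ls)
   module _ {ℓ'} (T : Pb -> Set ℓ') (Tb : ∀ {a b} -> a ≈ᴾ b -> T a -> T b) (Tc : ∀ {a b} -> T a -> T b -> T (a ⊞ b)) (Tf : ∀ s {a} -> T a -> T (con s ⊠ a)) (T-0 : T (con 0#)) where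
    -- The multiples of u by polynomials of degree at most b are under consideration.
    Ki : Pb -> O -> Pb -> O -> Set (c ⊔ ℓ ⊔ ℓ')
    Ki u b g e = ∀ {d a} -> Pc d a -> e Q.+ d ≤ b -> T (u ⊠ (g ⊠ a))
    module _ {u : Pb} {b : O} where
     Ka : ∀ {g h e} -> g ≈ᴾ h -> Ki u b g e -> Ki u b h e
     Ka p κ d l = Tb (P.*-congˡ (P.*-congʳ p)) (κ d l)
     Kb : ∀ {g h e} -> Ki u b g e -> Ki u b h e -> Ki u b (g ⊞ h) e
     Kb κ κ' d l = Tb (P.trans (P.sym (P.distribˡ _ _ _)) (P.*-congˡ (P.sym (P.distribʳ _ _ _)))) (Tc (κ d l) (κ' d l))
     Kc : ∀ {g h d e} -> Pc d h -> Ki u b g e -> Ki u b (h ⊠ g) (d Q.+ e)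
     Kc {g} {h} {d} {e} p κ {d'} q l = Tb (P.*-congˡ (P.trans (P.sym (P.*-assoc _ _ _)) (P.*-congʳ (P.*-comm g h)))) (κ (p PD.⊠ q) (e2 (e1 (U.trans (U.sym (e7 e d d')) (U.cong (Q._+ d') (e6 e d)))) l))
     Kd : ∀ {g e e'} -> e ≤ e' -> Ki u b g e -> Ki u b g e'
     Kd l κ {d} p l' = κ p (e2 (Q.+-monoˡ-≤ d l) l')
     Kh : ∀ {g e} s -> Ki u b g e -> Ki u b (con s ⊠ g) e
     Kh s κ = Kc (con {d = 0} s) κ
     Kf : ∀ {g e} -> Ki u b g e -> Ki u b (P.- g) e
     Kf = Kh (K.- 1#)
     Ks : ∀ {e} -> Ki u b (con 0#) e
     Ks p l = Tb (P.sym (P.trans (P.*-congˡ (P.zeroˡ _)) (P.zeroʳ _))) T-0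
     Kp : ∀ {s g e} -> Inv s -> Ki u b (con s ⊠ g) e -> Ki u b g e
     Kp {s} (t , p) κ = Ka (P.trans (P.sym (P.*-assoc _ _ _)) (P.trans (P.*-congʳ (P.trans (P.sym (cD t s)) (ci (K.trans (K.*-comm t s) p)))) (P.*-identityˡ _))) (Kh t κ)
    Be : Pb -> O -> Pb -> O -> Set (c ⊔ ℓ ⊔ ℓ')
    Be u b u′ b' = ∀ {g e} -> Ki u b g e -> Ki u′ b' g e
    Kq : ∀ {u b f} -> Pc 1 f -> Be u (Q.suc b) (u ⊠ f) b
    Kq {u} {b} {f} p {g} {e} κ {d} {a} q l = Tb (P.trans (P.*-congˡ (solve 3 (\ g f a -> g :* (f :* a) := f :* (g :* a)) P.refl g f a)) (P.sym (P.*-assoc _ _ _))) (κ (p PD.⊠ q) (e2 (e1 (e8 e d)) (s≤s l)))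
    Cov : ∀ {bs} -> Td bs -> Pb -> O -> Set (c ⊔ ℓ ⊔ ℓ')
    Cov t u b = (∀ v -> v ∈ lea t u b -> T v) -> ∀ {d a} -> Pc d a -> d ≤ b -> T (u ⊠ a)
    nd : ∀ {s bs} (form : Fin s -> Pb) (sub : Fin s -> Td bs) -> (∀ i -> Pc 1 (form i)) -> ∀ u b -> (∀ i {u′ b'} -> Be u b u′ b' -> Ki u′ b' (form i) 1 -> Cov (sub i) u′ b') -> Ki u b (∏ form) s -> Cov (nf form sub) u b
    nd {Q.zero} form sub deg u b pi κ h p l = Tb (P.*-congˡ (P.trans (P.*-congʳ (∏-0 _)) (P.*-identityˡ _))) (κ p l)
    nd {Q.suc s} form sub deg u Q.zero pi κ h = pi zero (\ κ -> κ) (\ _ ()) h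
    nd {Q.suc s} form sub deg u (Q.suc b) pi κ h = pi zero (\ κ -> κ) first (\ v m -> h v (∈-++⁺ˡ m))
     where
     rb : ∀ {d a} -> Pc d a -> d ≤ b -> T (u ⊠ form zero ⊠ a)
     rb = nd (form ∘ suc) (sub ∘ suc) (\ i -> deg (suc i)) (u ⊠ form zero) b (\ i bel -> pi (suc i) (\ κ -> bel (Kq (deg zero) κ))) (\ p l -> Tb (P.trans (P.*-congˡ (P.trans (P.*-congʳ (∏-suc form)) (P.*-assoc _ _ _))) (P.sym (P.*-assoc _ _ _))) (κ p (s≤s l))) (\ v m -> h v (∈-++⁺ʳ _ m))
     first : Ki u (Q.suc b) (form zero) 1
     first p (s≤s l) = Tb (P.*-assoc _ _ _) (rb p l)
    lA : ∀ u b -> (∀ i -> Ki u b (var i) 1) -> Cov l1 u b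
    lA u b κ h {d} {a} p l = Tb (P.*-congˡ (P.*-identityʳ a)) (go p (con 1#) (e2 (e1 (e5 d)) l) (Tb (P.sym (P.*-identityʳ u)) (h u (here U.refl))))
     where
     go : ∀ {d a e g} -> Pc d a -> Pc e g -> d Q.+ e ≤ b -> T (u ⊠ g) -> T (u ⊠ (a ⊠ g))
     go (con s) q l t = Tb (solve 3 (\ s u g -> s :* (u :* g) := u :* (s :* g)) P.refl _ _ _) (Tf s t)
     go (var i) q l t = κ i q l
     go (p PD.⊞ p′) q l t = Tb (P.trans (P.sym (P.distribˡ _ _ _)) (P.*-congˡ (P.sym (P.distribʳ _ _ _)))) (Tc (go p q l t) (go p′ q l t))
     go {e = e} (PD._⊠_ {d} {d'} p p′) q l t = Tb (P.*-congˡ (P.sym (P.*-assoc _ _ _))) (go p (p′ PD.⊠ q) l' (go p′ q (e2 (e0 _ d) l') t))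
      where
      l' : d Q.+ (d' Q.+ e) ≤ b
      l' = e2 (e1 (U.sym (e7 d d' e))) l
     go {e = e} (wea l' p) q l t = go p q (e2 (Q.+-monoˡ-≤ e l') l) t
     go (resp s p) q l t = Tb (P.*-congˡ (P.*-congʳ s)) (go p q l t)
    cj : ∀ m a -> ∏ {m} (\ _ -> a) ≈ᴾ a ^ᴾ m
    cj Q.zero a = ∏-0 _
    cj (Q.suc m) a = P.trans (∏-suc _) (P.*-congˡ (cj m a))
    -- The product of the X l is, up to an invertible factor, a combination of the
    -- weighted power sums, by evaluating ∏ (t - X l) at the X l and summing.
    module Ne {m} (ys : Fin (Q.suc m) -> Fin n) (β : Fin (Q.suc m) -> O) (u : Pb) (b : O) (powers : ∀ e -> 1 ≤ e -> e ≤ Q.suc m -> Ki u b (∑ᴾ \ l -> con (nat (Q.suc (β l))) ⊠ var (ys l) ^ᴾ (r Q.* e)) (r Q.* e)) where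
     Λ : List (Fin n) -> O -> Pb
     Λ ls e = ∑ᴾ \ l -> (con (nat (Q.suc (β l))) ⊠ var (ys l) ^ᴾ (r Q.* e)) ⊠ van ls (X (ys l))
     u7 : ∀ t ls e -> Λ (t ∷ ls) e ≈ᴾ Λ ls (Q.suc e) ⊟ X t ⊠ Λ ls e
     u7 t ls e = begin Λ (t ∷ ls) e ≈⟨ ∑ᴾ-cong (\ l -> P.trans (lem _ _ _ _ _) (P.+-congʳ (P.*-congʳ (P.*-congˡ (po l))))) ⟩ ∑ᴾ (\ l -> term (Q.suc e) l ⊞ (P.- X t) ⊠ term e l) ≈⟨ ∑ᴾ-+ (term (Q.suc e)) _ ⟩ Λ ls (Q.suc e) ⊞ ∑ᴾ (\ l -> (P.- X t) ⊠ term e l) ≈⟨ P.+-congˡ (P.sym (∑ᴾ-*ˡ (P.- X t) (term e))) ⟩ Λ ls (Q.suc e) ⊞ (P.- X t) ⊠ Λ ls e ≈⟨ P.+-congˡ (solve 2 (\ x a -> (:- x) :* a := :- (x :* a)) P.refl _ _) ⟩ Λ ls (Q.suc e) ⊟ X t ⊠ Λ ls e ∎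
      where
      term : O -> Fin (Q.suc m) -> Pb
      term e l = (con (nat (Q.suc (β l))) ⊠ var (ys l) ^ᴾ (r Q.* e)) ⊠ van ls (X (ys l))
      lem : ∀ w a y t v -> (w ⊠ a) ⊠ ((y ⊟ t) ⊠ v) ≈ᴾ (w ⊠ (y ⊠ a)) ⊠ v ⊞ (P.- t) ⊠ ((w ⊠ a) ⊠ v)
      lem = solve 5 (\ w a y t v -> (w :* a) :* ((y :- t) :* v) := (w :* (y :* a)) :* v :+ (:- t) :* ((w :* a) :* v)) P.refl
      po : ∀ l -> X (ys l) ⊠ var (ys l) ^ᴾ (r Q.* e) ≈ᴾ var (ys l) ^ᴾ (r Q.* Q.suc e)
      po l = P.trans (P.sym (^ᴾ-+ (var (ys l)) r (r Q.* e))) (P.reflexive (U.cong (var (ys l) ^ᴾ_) (U.sym (Q.*-suc r e))))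
     pos : ∀ ls e -> 1 ≤ e -> e Q.+ length ls ≤ Q.suc m -> Ki u b (Λ ls e) (r Q.* (e Q.+ length ls))
     pos [] e p l = Kd (e1 (U.cong (r Q.*_) (U.sym (e5 e)))) (Ka (∑ᴾ-cong \ i -> P.sym (P.*-identityʳ _)) (powers e p (e2 (e1 (U.sym (e5 e))) l)))
     pos (t ∷ ls) e p l = Ka (P.sym (u7 t ls e)) (Kb (Kd (e1 (U.cong (r Q.*_) (U.sym shift))) (pos ls (Q.suc e) (s≤s z≤n) (e2 (e1 (U.sym shift)) l))) (Kf (Kd (e1 (U.trans (U.sym (Q.*-suc r _)) (U.cong (r Q.*_) (U.sym shift)))) (Kc (Xa t) (pos ls e p (e2 (Q.+-monoʳ-≤ e (Q.n≤1+n _)) l))))))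
      where
      shift : e Q.+ Q.suc (length ls) ≡ Q.suc e Q.+ length ls
      shift = e8 e (length ls)
     σ : Pb
     σ = ∑ᴾ \ l -> con (nat (Q.suc (β l)))
     ne : List (Fin n) -> Pb
     ne [] = con 1#
     ne (t ∷ ls) = (P.- X t) ⊠ ne ls
     constant : ∀ ls -> length ls ≤ Q.suc m -> Ki u b (Λ ls 0 ⊟ σ ⊠ ne ls) (r Q.* length ls)
     constant [] l = Ka (P.sym (P.trans (P.+-congʳ (∑ᴾ-cong \ l -> P.trans (P.*-identityʳ _) (P.trans (P.*-congˡ (P.reflexive (U.cong (var (ys l) ^ᴾ_) (Q.*-zeroʳ r)))) (P.*-identityʳ _)))) (P.trans (P.+-congˡ (P.-‿cong (P.*-identityʳ σ))) (P.-‿inverseʳ σ)))) Ks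
     constant (t ∷ ls) l = Ka (P.sym (P.trans (P.+-congʳ (u7 t ls 0)) (lem _ _ _ _ _))) (Kb (pos ls 1 e3 l) (Kf (Kd (e1 (U.sym (Q.*-suc r _))) (Kc (Xa t) (constant ls (e2 (Q.n≤1+n _) l))))))
      where
      lem : ∀ a x v s p -> (a ⊟ x ⊠ v) ⊟ s ⊠ ((P.- x) ⊠ p) ≈ᴾ a ⊞ (P.- (x ⊠ (v ⊟ s ⊠ p)))
      lem = solve 5 (\ a x v s p -> (a :- x :* v) :- s :* ((:- x) :* p) := a :+ (:- (x :* (v :- s :* p)))) P.refl
     sI : ∀ {m} -> (Fin m -> O) -> O
     sI {Q.zero} f = 0
     sI {Q.suc m} f = f zero Q.+ sI (f ∘ suc)
     ng : ∀ {m} (f : Fin m -> O) -> ∑ᴾ (\ l -> con (nat (f l))) ≈ᴾ con (nat (sI f))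
     ng {Q.zero} f = ∑ᴾ-0 _
     ng {Q.suc m} f = P.trans (∑ᴾ-suc _) (P.trans (P.+-congˡ (ng (f ∘ suc))) (P.trans (P.sym (cO _ _)) (ci (K.sym (×-homo-+ 1# (f zero) _)))))
      where open Mult K.+-monoid using (×-homo-+)
     roots : ∀ {k} (zs : Fin k -> Fin n) l -> van (Data.List.Base.tabulate zs) (X (zs l)) ≈ᴾ con 0#
     roots zs zero = P.trans (P.*-congʳ (P.-‿inverseʳ _)) (P.zeroˡ _)
     roots zs (suc l) = P.trans (P.*-congˡ (roots (zs ∘ suc) l)) (P.zeroʳ _)
     sig : ∀ {k} (zs : Fin k -> Fin n) -> Σ Carrier \ s -> ∏ (\ l -> X (zs l)) ≈ᴾ con s ⊠ ne (Data.List.Base.tabulate zs)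
     sig {Q.zero} zs = 1# , P.trans (∏-0 _) (P.sym (P.*-identityˡ _))
     sig {Q.suc k} zs with s , e <- sig (zs ∘ suc) = K.- s , P.trans (∏-suc _) (P.trans (P.*-congˡ e) (P.trans (solve 3 (\ x s v -> x :* (s :* v) := (:- s) :* ((:- x) :* v)) P.refl _ _ _) (P.*-congʳ (P.sym (c7 s)))))
     pZ : Ki u b (∏ \ l -> X (ys l)) (r Q.* Q.suc m)
     pZ = Ka (P.sym (p2 (sig ys))) (Kh _ (Kp (char0 (β zero Q.+ sI (\ l -> Q.suc (β (suc l))))) (Ka (P.trans (P.trans (P.-‿cong (P.trans (P.+-congʳ (P.trans (∑ᴾ-cong \ l -> P.trans (P.*-congˡ (roots ys l)) (P.zeroʳ _)) (∑ᴾ-zero \ _ -> P.refl))) (P.+-identityˡ _))) (-‿involutive _)) (P.*-congʳ (ng (\ l -> Q.suc (β l))))) (Kf (Kd (e1 (U.cong (r Q.*_) len)) (constant (Data.List.Base.tabulate ys) (e1 len)))))))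
      where
      open import Algebra.Properties.Ring P.ring using (-‿involutive)
      len : length (Data.List.Base.tabulate ys) ≡ Q.suc m
      len = length-tabulate ys
    module _ {m} (ys : Fin m -> Fin n) (u : Pb) (b : O) where
     Re : Fin n -> Set (c ⊔ ℓ ⊔ ℓ')
     Re i = Ki u b (var i) 1 ⊎ Σ (Fin m) \ l -> Σ Carrier \ s -> (s ^ r K.≈ 1#) × Ki u b (var i ⊟ con s ⊠ var (ys l)) 1
    we : ∀ {m} -> (Fin m -> Fin n) -> (Fin m -> O) -> O -> Pb
    we ys β e = ∑ᴾ \ l -> con (nat (Q.suc (β l))) ⊠ var (ys l) ^ᴾ (r Q.* e)
    Ko : ∀ {u b g} e -> 1 ≤ e -> Pc 1 g -> Ki u b g 1 -> Ki u b (g ^ᴾ e) e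
    Ko {g = g} (Q.suc e) _ p κ = Ka (P.*-comm (g ^ᴾ e) g) (Kd (e1 (U.trans (U.cong (Q._+ 1) (Q.*-identityʳ e)) (e6 e 1))) (Kc (Pd e p) κ))
    rp : ∀ {e} -> 1 ≤ e -> 1 ≤ r Q.* e
    rp p = Q.*-mono-≤ (Q.>-nonZero⁻¹ r) p
    rJ : ∀ {m} (ys : Fin (Q.suc m) -> Fin n) β b₀ {u b} -> Ki u b (var (ys b₀)) 1 -> ∀ e -> 1 ≤ e -> Ki u b (we ys β e) (r Q.* e) -> Ki u b (we (ys ∘ punchIn b₀) (β ∘ punchIn b₀) e) (r Q.* e)
    rJ ys β b₀ κ e p κ' = Ka (P.trans (P.+-congʳ (Ri.rc Po b₀ _)) (solve 2 (\ a s -> (a :+ s) :- a := s) P.refl _ _)) (Kb κ' (Kf (Kh _ (Ko (r Q.* e) (rp p) (var _) κ))))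
    om : ∀ m (ys : Fin m -> Fin n) (β : Fin m -> O) u b -> (∀ e -> 1 ≤ e -> e ≤ m -> Ki u b (we ys β e) (r Q.* e)) -> (∀ i -> Re ys u b i) -> Cov (og m ys) u b
    om Q.zero ys β u b powers reduces = lA u b \ i -> ki (reduces i)
     where
     ki : ∀ {i} -> Re ys u b i -> Ki u b (var i) 1
     ki (i1 κ) = κ
    om (Q.suc m) ys β u b powers reduces = nd (\ i -> var (ys (p2 (remQuot {r} (Q.suc m) i)))) (\ i -> og m (ys ∘ punchIn (p2 (remQuot {r} (Q.suc m) i)))) (\ i -> var _) u b pi (Ka (P.sym wh) (Ne.pZ ys β u b powers))
     where
     wh : ∏ (\ i -> var (ys (p2 (remQuot {r} (Q.suc m) i)))) ≈ᴾ ∏ (\ l -> X (ys l))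
     wh = P.trans (∏-remQuot r (\ (a , l) -> var (ys l))) (P.trans (∏-swap _) (∏-cong \ l -> cj r (var (ys l))))
     pi : ∀ i {u′ b'} -> Be u b u′ b' -> Ki u′ b' (var (ys (p2 (remQuot {r} (Q.suc m) i)))) 1 -> Cov (og m (ys ∘ punchIn (p2 (remQuot {r} (Q.suc m) i)))) u′ b'
     pi i {u′} {b'} bel κ = om m (ys ∘ punchIn b₀) (β ∘ punchIn b₀) u′ b' (\ e p l -> rJ ys β b₀ κ e p (bel (powers e p (Q.m≤n⇒m≤1+n l)))) (\ j -> rP (reduces j))
      where
      b₀ = p2 (remQuot {r} (Q.suc m) i)
      rP : ∀ {j} -> Re ys u b j -> Re (ys ∘ punchIn b₀) u′ b' j
      rP (i1 κ') = i1 (bel κ')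
      rP (i2 (l , s , e , κ')) with b₀ ≟ l
      ... | yes U.refl = i1 (Ka (solve 2 (\ x a -> (x :- a) :+ a := x) P.refl _ _) (Kb (bel κ') (Kh s κ)))
      ... | no b₀≢l = i2 (punchOut b₀≢l , s , e , Ka (P.reflexive (U.cong (\ z -> var _ ⊟ con s ⊠ var (ys z)) (U.sym (punchIn-punchOut b₀≢l)))) (bel κ'))
    Rb : ∀ {m C} -> (Fin m -> Fin n) -> Vec Bool m -> (Fin C -> Fin n) -> Pb -> O -> Set (c ⊔ ℓ ⊔ ℓ')
    Rb f [] ls u b = Lift _ ⊤
    Rb f (b1 ∷ J) ls u b = Rb (f ∘ suc) J (f zero Vector.∷ ls) u b
    Rb {C = C} f (b2 ∷ J) ls u b = Ki u b (var (f zero) ^ᴾ (r Q.∸ 1) ⊠ van (Data.List.Base.tabulate ls) (X (f zero))) (r Q.∸ 1 Q.+ r Q.* C) × Rb (f ∘ suc) J ls u b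
    Ra : ∀ {m c} (f : Fin m -> Fin n) J (ls : Fin c -> Fin n) {u b u′ b'} -> Be u b u′ b' -> Rb f J ls u b -> Rb f J ls u′ b'
    Ra f [] ls bel ρ = ρ
    Ra f (b1 ∷ J) ls bel ρ = Ra (f ∘ suc) J _ bel ρ
    Ra f (b2 ∷ J) ls bel (κ , ρ) = bel κ , Ra (f ∘ suc) J ls bel ρ
    f9 : ∀ a -> con a ^ᴾ r ≈ᴾ con (a ^ r)
    f9 a = P.sym (cH a r)
    a2 : ∀ j -> 0 < j -> j < r -> In.Inv Po (con ζ ^ᴾ j ⊟ con 1#)
    a2 j p q with y , e <- apart j p q = con y , P.trans (P.*-congʳ (P.trans (P.+-cong (P.sym (cH ζ j)) (P.sym (c7 1#))) (P.sym (cO _ _)))) (P.trans (P.sym (cD _ y)) (ci e))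
    open Roo Po r (con ζ) (P.trans (f9 ζ) (ci rw)) a2 using (rD)
    fp : ∀ {c} j (ls : Fin c -> Fin n) -> ∏ (fd j ls) ≈ᴾ var j ^ᴾ (r Q.∸ 1) ⊠ van (Data.List.Base.tabulate ls) (X j)
    fp {c} j ls = P.trans (∏-++ (r Q.∸ 1) _ _) (P.*-cong (cj _ _) (P.trans (∏-remQuot r (\ (a , l) -> var j ⊟ con (ζ ^ toℕ a) ⊠ var (ls l))) (P.trans (∏-swap _) (P.trans (∏-cong \ l -> P.trans (∏-cong \ a -> P.+-congˡ (P.-‿cong (P.*-congʳ (cH ζ (toℕ a))))) (rD (var j) (var (ls l)))) (col ls)))))
     where
     col : ∀ {c} (ls : Fin c -> Fin n) -> ∏ (\ l -> X j ⊟ X (ls l)) ≈ᴾ van (Data.List.Base.tabulate ls) (X j)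
     col {Q.zero} ls = ∏-0 _
     col {Q.suc c} ls = P.trans (∏-suc _) (P.*-congˡ (col (ls ∘ suc)))
    wd : ∀ {m} (ys : Fin m -> Fin n) β l e -> we ys (Vector.updateAt β l Q.suc) e ≈ᴾ we ys β e ⊞ var (ys l) ^ᴾ (r Q.* e)
    wd {Q.suc m} ys β zero e = P.trans (∑ᴾ-suc _) (P.trans (P.+-congʳ (P.trans (P.*-congʳ (cO 1# _)) (P.trans (P.distribʳ _ _ _) (P.+-congʳ (P.*-identityˡ _))))) (P.trans (solve 3 (\ x w s -> (x :+ w) :+ s := (w :+ s) :+ x) P.refl _ _ _) (P.+-congʳ (P.sym (∑ᴾ-suc _)))))
    wd {Q.suc m} ys β (suc l) e = P.trans (∑ᴾ-suc _) (P.trans (P.+-congˡ (wd (ys ∘ suc) (β ∘ suc) l e)) (P.trans (P.sym (P.+-assoc _ _ _)) (P.+-congʳ (P.sym (∑ᴾ-suc _)))))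
    Kk : ∀ {u b g h} e -> 1 ≤ e -> Pc 1 g -> Pc 1 h -> Ki u b (g ⊟ h) 1 -> Ki u b (g ^ᴾ e ⊟ h ^ᴾ e) e
    Kk (Q.suc Q.zero) _ p q κ = Ka (P.sym (P.+-cong (P.*-identityʳ _) (P.-‿cong (P.*-identityʳ _)))) κ
    Kk {g = g} {h} (Q.suc (Q.suc e)) _ p q κ = Ka (lem g h (g ^ᴾ Q.suc e) (h ^ᴾ Q.suc e)) (Kb (Kc p (Kk (Q.suc e) (s≤s z≤n) p q κ)) (Kd (e1 (U.trans (U.cong (Q._+ 1) (Q.*-identityʳ (Q.suc e))) (e6 (Q.suc e) 1))) (Kc (Pd (Q.suc e) q) κ)))
     where
     lem : ∀ g h a b -> g ⊠ (a ⊟ b) ⊞ b ⊠ (g ⊟ h) ≈ᴾ g ⊠ a ⊟ h ⊠ b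
     lem = solve 4 (\ g h a b -> g :* (a :- b) :+ b :* (g :- h) := g :* a :- h :* b) P.refl
    pY : ∀ {u b i l s} -> s ^ r K.≈ 1# -> ∀ e -> 1 ≤ e -> Ki u b (var i ⊟ con s ⊠ var l) 1 -> Ki u b (var i ^ᴾ (r Q.* e) ⊟ var l ^ᴾ (r Q.* e)) (r Q.* e)
    pY {i = i} {l} {s} p e l' κ = Ka (P.+-congˡ (P.-‿cong po)) (Kk (r Q.* e) (rp l') (var i) (con {d = 0} s PD.⊠ var l) κ)
     where
     open CommutativeExp P.commutativeSemiring using () renaming (^-distrib-* to ^ᴾ-*)
     open Kg using (^-assocʳ; ^-congˡ)
     po : (con s ⊠ var l) ^ᴾ (r Q.* e) ≈ᴾ var l ^ᴾ (r Q.* e)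
     po = P.trans (^ᴾ-* (con s) (var l) (r Q.* e)) (P.trans (P.*-congʳ (P.trans (P.sym (cH s (r Q.* e))) (ci (K.trans (K.sym (^-assocʳ s r e)) (K.trans (^-congˡ e p) (1^ e)))))) (P.*-identityˡ _))
    sD : ∀ t {m c} (f : Fin m -> Fin n) J (ls : Fin c -> Fin n) (β : Fin c -> O) u b -> Rb f J ls u b -> (∀ e -> 1 ≤ e -> e ≤ fi c J -> Ki u b (we ls β e ⊞ ac t f J e) (r Q.* e)) -> (∀ i -> (Σ (Fin m) \ j -> i ≡ f j) ⊎ Re ls u b i) -> Cov (su f J ls) u b
    sD t {c = c} f [] ls β u b ρ powers reduces = om c ls β u b (\ e p l -> Ka (P.+-identityʳ _) (powers e p l)) \ i -> [ (\ ()) , id ]′ (reduces i)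
    sD t f (b1 ∷ J) ls β u b ρ powers reduces = sD t (f ∘ suc) J (f zero Vector.∷ ls) (0 Vector.∷ β) u b ρ (\ e p l -> Ka (P.trans (solve 3 (\ w x a -> w :+ (x :+ a) := (x :+ w) :+ a) P.refl _ _ _) (P.+-congʳ (P.sym (P.trans (∑ᴾ-suc _) (P.+-congʳ (P.trans (P.*-congʳ (ci (K.+-identityʳ 1#))) (P.*-identityˡ _))))))) (powers e p l)) (\ i -> sg i (reduces i))
     where
     sg : ∀ i -> (Σ _ \ j -> i ≡ f j) ⊎ Re ls u b i -> (Σ _ \ j -> i ≡ f (suc j)) ⊎ Re (f zero Vector.∷ ls) u b i
     sg i (i1 (zero , U.refl)) = i2 (i2 (zero , 1# , 1^ r , Ka (P.sym (P.trans (P.+-congˡ (P.-‿cong (P.*-identityˡ _))) (P.-‿inverseʳ _))) Ks))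
     sg i (i1 (suc j , e)) = i1 (j , e)
     sg i (i2 (i1 κ)) = i2 (i1 κ)
     sg i (i2 (i2 (l , s , e , κ))) = i2 (i2 (suc l , s , e , κ))
    sD t {c = c} f (b2 ∷ J) ls β u b (κ , ρ) powers reduces = nd (fd (f zero) ls) (\ _ -> su (f ∘ suc) J ls) (fw (f zero) ls) u b (\ i bel κ' -> g7 bel (cla i κ')) (Ka (P.sym (fp (f zero) ls)) κ)
     where
     cla : ∀ i {u′ b'} -> Ki u′ b' (fd (f zero) ls i) 1 -> Re ls u′ b' (f zero)
     cla i κ' with splitAt (r Q.∸ 1) i
     ... | i1 _ = i1 κ'
     ... | i2 i' = i2 (p2 (remQuot {r} c i') , ζ ^ toℕ (p1 (remQuot {r} c i')) , root (toℕ (p1 (remQuot {r} c i'))) , κ')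
      where
      open Kg using (^-assocʳ; ^-congˡ)
      root : ∀ a -> (ζ ^ a) ^ r K.≈ 1#
      root a = K.trans (^-assocʳ ζ a r) (K.trans (K.reflexive (U.cong (ζ ^_) (Q.*-comm a r))) (K.trans (K.sym (^-assocʳ ζ r a)) (K.trans (^-congˡ a rw) (1^ a))))
     sg : ∀ {u′ b'} -> Be u b u′ b' -> Re ls u′ b' (f zero) -> ∀ i -> (Σ _ \ j -> i ≡ f j) ⊎ Re ls u b i -> (Σ _ \ j -> i ≡ f (suc j)) ⊎ Re ls u′ b' i
     sg bel z i (i1 (zero , U.refl)) = i2 z
     sg bel z i (i1 (suc j , e)) = i1 (j , e)
     sg bel z i (i2 (i1 κ)) = i2 (i1 (bel κ))
     sg bel z i (i2 (i2 (l , s , e , κ))) = i2 (i2 (l , s , e , bel κ))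
     g7 : ∀ {u′ b'} -> Be u b u′ b' -> Re ls u′ b' (f zero) -> Cov (su (f ∘ suc) J ls) u′ b'
     g7 {u′} {b'} bel z = fin t powers z
      where
      fin : ∀ t′ -> (∀ e -> 1 ≤ e -> e ≤ fi c J -> Ki u b (we ls β e ⊞ ac t′ f (b2 ∷ J) e) (r Q.* e)) -> Re ls u′ b' (f zero) -> Cov (su (f ∘ suc) J ls) u′ b'
      fin b1 powers _ = sD b1 (f ∘ suc) J ls β u′ b' (Ra (f ∘ suc) J ls bel ρ) (\ e p l -> Ka (P.+-congˡ (P.+-identityˡ _)) (bel (powers e p l))) (\ i -> sg bel z i (reduces i))
      fin b2 powers (i1 κ') = sD b2 (f ∘ suc) J ls β u′ b' (Ra (f ∘ suc) J ls bel ρ) (\ e p l -> Ka (solve 3 (\ w x a -> (w :+ (x :+ a)) :- x := w :+ a) P.refl _ _ _) (Kb (bel (powers e p l)) (Kf (Kd (e1 U.refl) (Ko (r Q.* e) (rp p) (var _) κ'))))) (\ i -> sg bel z i (reduces i))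
      fin b2 powers (i2 (l₀ , s , e₀ , κ')) = sD b2 (f ∘ suc) J ls (Vector.updateAt β l₀ Q.suc) u′ b' (Ra (f ∘ suc) J ls bel ρ) (\ e p l -> Ka (P.trans (solve 4 (\ w x a y -> (w :+ (x :+ a)) :- (x :- y) := (w :+ y) :+ a) P.refl _ _ _ _) (P.+-congʳ (P.sym (wd ls β l₀ e)))) (Kb (bel (powers e p l)) (Kf (pY e₀ e p κ')))) (\ i -> sg bel z i (reduces i))
  tf : ∀ {A : Set} {f g : A -> O} as -> (∀ a -> a ∈ as -> f a ≡ g a) -> ta f as ≡ ta g as
  tf [] e = U.refl
  tf (a ∷ as) e = U.cong₂ Q._+_ (e a (here U.refl)) (tf as \ b m -> e b (there m))
  lr : ∀ {A : Set} {b} {B : Set b} (f : A -> List B) as -> length (concatMap f as) ≡ ta (\ a -> length (f a)) as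
  lr f [] = U.refl
  lr f (a ∷ as) = U.trans (length-++ (f a)) (U.cong (length (f a) Q.+_) (lr f as))
  cm : ∀ {n} q {J : Vec Bool n} -> J ∈ ch n q -> sb J ≡ q
  cm {Q.zero} Q.zero (here U.refl) = U.refl
  cm {Q.suc n} Q.zero m with J , m' , U.refl <- ∈-map⁻ (b1 ∷_) m = cm 0 m'
  cm {Q.suc n} (Q.suc q) m with ∈-++⁻ (map (b1 ∷_) (ch n (Q.suc q))) m
  ... | i1 m' with J , m″ , U.refl <- ∈-map⁻ (b1 ∷_) m' = cm (Q.suc q) m″
  ... | i2 m' with J , m″ , U.refl <- ∈-map⁻ (b2 ∷_) m' = U.cong Q.suc (cm q m″)
  module Spa where
   open K using (Carrier; 0#; 1#; ring)
   open Bas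
   open Op
   open Fl
   open Cc
   open Wo
   open Bnd
   open Ca using (Sp)
   Ga : ∀ {bs} -> Td bs -> Set (c ⊔ ℓ)
   Ga l1 = Lift _ ⊤
   Ga (nf form sub) = (∀ i -> Pc 1 (form i)) × (∀ i -> Ga (sub i))
   l6 : ∀ {bs} (t : Td bs) -> Ga t -> ∀ {e u} -> Pc e u -> ∀ b {v} -> v ∈ lea t u b -> Pc (e Q.+ b) v
   l6 l1 g p b (here U.refl) = wea (e9 _ b) p
   l6 {s ∷ bs} (nf form sub) (g , g′) p b m = go s form (\ i -> lea (sub i)) g (\ i -> l6 (sub i) (g′ i)) p b m
    where
    go : ∀ s (form : Fin s -> Pb) l -> (∀ i -> Pc 1 (form i)) -> (∀ i {e u} -> Pc e u -> ∀ b {v} -> v ∈ l i u b -> Pc (e Q.+ b) v) -> ∀ {e u} -> Pc e u -> ∀ b {v} -> v ∈ cha form l u b -> Pc (e Q.+ b) v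
    go (Q.suc s) form l g h p Q.zero m = h zero p 0 m
    go (Q.suc s) form l g h {e} {u} p (Q.suc b) m with ∈-++⁻ (l zero u (Q.suc b)) m
    ... | i1 m' = h zero p (Q.suc b) m'
    ... | i2 m' = wea (e1 (e7 e 1 b)) (go s (form ∘ suc) (l ∘ suc) (\ i -> g (suc i)) (\ i -> h (suc i)) (p PD.⊠ g zero) b m')
   l7 : ∀ {bs} (t : Td bs) u {b b'} -> b ≤ b' -> ∀ {v} -> v ∈ lea t u b -> v ∈ lea t u b'
   l7 l1 u l m = m
   l7 {s ∷ bs} (nf form sub) u l m = go s form (\ i -> lea (sub i)) (\ i -> l7 (sub i)) u l m
    where
    go : ∀ s (form : Fin s -> Pb) g -> (∀ i u {b b'} -> b ≤ b' -> ∀ {v} -> v ∈ g i u b -> v ∈ g i u b') -> ∀ u {b b'} -> b ≤ b' -> ∀ {v} -> v ∈ cha form g u b -> v ∈ cha form g u b'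
    go (Q.suc s) form g h u {Q.zero} {Q.zero} l m = m
    go (Q.suc s) form g h u {Q.zero} {Q.suc b'} l m = ∈-++⁺ˡ (h zero u z≤n m)
    go (Q.suc s) form g h u {Q.suc b} {Q.suc b'} (s≤s l) m with ∈-++⁻ (g zero u (Q.suc b)) m
    ... | i1 m' = ∈-++⁺ˡ (h zero u (s≤s l) m')
    ... | i2 m' = ∈-++⁺ʳ _ (go s (form ∘ suc) (g ∘ suc) (\ i -> h (suc i)) (u ⊠ form zero) l m')
   oo : ∀ m ys -> Ga (og m ys)
   oo Q.zero ys = Level.lift tt
   oo (Q.suc m) ys = (\ i -> var _) , \ i -> oo m _
   sQ : ∀ {m C} (f : Fin m -> Fin n) J (ls : Fin C -> Fin n) -> Ga (su f J ls)
   sQ f [] ls = oo _ ls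
   sQ f (b1 ∷ J) ls = sQ (f ∘ suc) J _
   sQ f (b2 ∷ J) ls = fw (f zero) ls , \ _ -> sQ (f ∘ suc) J ls
   fm : ∀ {m} C (J : Vec Bool m) -> fi C J Q.+ sb J ≡ C Q.+ m
   fm C [] = U.refl
   fm {Q.suc m} C (b1 ∷ J) = U.trans (fm (Q.suc C) J) (U.sym (e8 C m))
   fm {Q.suc m} C (b2 ∷ J) = U.trans (e8 _ _) (U.trans (U.cong Q.suc (fm C J)) (U.sym (e8 C m)))
   module _ (s : Bool) (cs : O -> Carrier) (q k : O) (k+q : k Q.+ q ≡ n) where
    open To s cs q
    tz : (J : Vec Bool n) -> Td (ins 0 J ++ ou (fi 0 J))
    tz J = su id J (\ ())
    fB : ∀ J -> sb J ≡ q -> fi 0 J ≡ k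
    fB J e = Q.+-cancelʳ-≡ q _ _ (U.trans (U.cong (fi 0 J Q.+_) (U.sym e)) (U.trans (fm 0 J) (U.sym k+q)))
    wa : O -> Vec Bool n -> List Ω
    wa D J = map (\ v -> ι v * ua J) (lea (tz J) (con 1#) D)
    fa : O -> List Ω
    fa D = concatMap (wa D) (ch n q)
    ly : ∀ D -> length (fa D) ≡ N n q k k D
    ly D = U.trans (lr (wa D) (ch n q)) (tf (ch n q) \ J m -> U.trans (length-map _ (lea (tz J) (con 1#) D)) (U.trans (ln (tz J) (con 1#) D) (U.cong (\ bs -> tu bs D) (U.trans (map-++ just (ins 0 J) _) (U.cong (map just (ins 0 J) ++_) (U.trans (U.cong (\ z -> map just (ou z)) (fB J (cm q m))) (ok k k e3)))))))
    -- From this degree on the family is constant.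
    sa : O
    sa = ta (\ J -> sum (ins 0 J ++ ou (fi 0 J))) (ch n q)
    fy : ∀ {D E} -> sa ≤ D -> sa ≤ E -> fa D ≡ fa E
    fy {D} {E} = go (ch n q)
     where
     go : ∀ Js -> ta (\ J -> sum (ins 0 J ++ ou (fi 0 J))) Js ≤ D -> ta (\ J -> sum (ins 0 J ++ ou (fi 0 J))) Js ≤ E -> concatMap (wa D) Js ≡ concatMap (wa E) Js
     go [] l l' = U.refl
     go (J ∷ Js) l l' = U.cong₂ _++_ (U.cong (map (\ v -> ι v * ua J)) (l9 (tz J) (con 1#) (Q.m+n≤o⇒m≤o _ l) (Q.m+n≤o⇒m≤o _ l'))) (go Js (Q.m+n≤o⇒n≤o _ l) (Q.m+n≤o⇒n≤o _ l'))
    Ff : ∀ {D d a} J -> sb J ≡ q -> Pc d a -> d ≤ D -> Fil D q (ι a * ua J)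
    Ff {d = d} J e p l = Fa (e2 (e1 (e5 d)) l) (Fb p (U.subst (\ z -> Fil 0 z (ua J)) (U.trans (lc id J) e) (Fc _)))
    wn : ∀ D Js {f} -> f ∈ concatMap (wa D) Js -> Σ (Vec Bool n) \ J -> (J ∈ Js) × (f ∈ wa D J)
    wn D (J ∷ Js) m with ∈-++⁻ (wa D J) m
    ... | i1 m' = J , here U.refl , m'
    ... | i2 m' with J' , a , b <- wn D Js m' = J' , there a , b
    ft : ∀ D {f} -> f ∈ fa D -> Fil D q f
    ft D m with J , J∈ , m' <- wn D (ch n q) m with v , v∈ , U.refl <- ∈-map⁻ (\ v -> ι v * ua J) m' = Ff J (cm q J∈) (l6 (tz J) (sQ id J _) (con {d = 0} 1#) D v∈) e3
    fh : ∀ D J -> sb J ≡ q -> ∀ {v} -> v ∈ lea (tz J) (con 1#) D -> ι v * ua J ∈ fa D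
    fh D J e m = go (ch n q) (U.subst (\ z -> J ∈ ch n z) e (ce J))
     where
     go : ∀ Js -> J ∈ Js -> _ ∈ concatMap (wa D) Js
     go (J ∷ Js) (here U.refl) = ∈-++⁺ˡ (∈-map⁺ (\ v -> ι v * ua J) m)
     go (J ∷ Js) (there m') = ∈-++⁺ʳ (wa D J) (go Js m')
    Sq : ∀ {j D f} -> Sub j D f -> Fil D q f
    Sq (rel m {E} U.refl h l) = Fa (e2 (e1 (e6 _ E)) l) (Fk (dA m) h)
     where
     Fe : ∀ {m D q} {f : Fin m -> Ω} -> (∀ i -> Fil D q (f i)) -> Fil D q (∑Ω f)
     Fe {Q.zero} h = Sa.resp (sym (∑Ω-0 _)) Sa.none
     Fe {Q.suc m} h = Sa.resp (sym (∑Ω-suc _)) (h zero Sa.+ Fe \ i -> h (suc i))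
     dA : ∀ m -> Fil (da m) 1 (d m)
     dA m = Fe \ i -> Sa.resp (*-congˡ (od (θ i))) (Fa (e1 (U.trans (e5 _) (Q.*-identityʳ _))) (Fb (Pd (da m) (var i)) (Fc (i ∷ []))))
    Sq {D = D} (img m _ h) = go h
     where
     go : ∀ {v} -> Sh (Q.suc m) D v -> Fil D q (P (Q.suc m) v)
     go (Sa.word a is js (l , e)) = Sa.resp (sym (Pi _ a _)) (Sb a (Fa l (Pg (Q.suc m) (Sa.resp (*-identityˡ _) (Sa.word 1# is js (e3 , e))))))
     go Sa.none = Sa.resp (sym (P-0 _)) Sa.none
     go (h Sa.+ h') = Sa.resp (sym (P-+ _ _ _)) (go h Sa.+ go h')
     go (Sa.resp e h) = Sa.resp (Pl _ e) (go h)
    Sq none = Sa.none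
    Sq (h + h') = Sq h Sa.+ Sq h'
    Sq (resp e h) = Sa.resp e (Sq h)
    module _ (D : O) where
     open Lin.La K (space k D) using (_≈ᴹ_; co; cC; cB; c1; ≈ᴹ-trans; ≈ᴹ-sym; ∑ᴹ-zero; +ᴹ-cong; *ₗ-congˡ; *ₗ-zeroˡ; 0ᴹ)
     vec : Fin (length (fa D)) -> Σ Ω (Fil D q)
     vec i = List.lookup (fa D) i , ft D (∈-lookup i)
     S : Ω -> Set (c ⊔ ℓ)
     S f = Σ (Fil D q f) \ h -> Σ (Fin (length (fa D)) -> Carrier) \ a -> _≈ᴹ_ (f , h) (co a vec)
     S4 : ∀ {f g} (h : Fil D q f) (h' : Fil D q g) -> Sub k D (f - g) -> Σ (Fin (length (fa D)) -> Carrier) (\ a -> _≈ᴹ_ (g , h') (co a vec)) -> S f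
     S4 {f} {g} h h' e (a , p) = h , a , ≈ᴹ-trans {f , h} {g , h'} {co a vec} e p
     cl : Cl s cs q S
     cl = record { Sc = \ e (h , a , p) -> S4 (Sa.resp e h) h (equal (sym e)) (a , p) ; S-+ = \ {f} {g} (h , a , p) (h' , a' , p′) -> (h Sa.+ h') , (\ i -> a i K.+ a' i) , ≈ᴹ-trans {f + g , h Sa.+ h'} {p1 (co a vec) + p1 (co a' vec) , p2 (co a vec) Sa.+ p2 (co a' vec)} {co (\ i -> a i K.+ a' i) vec} (+ᴹ-cong {f , h} {co a vec} {g , h'} {co a' vec} p p′) (≈ᴹ-sym {co (\ i -> a i K.+ a' i) vec} {p1 (co a vec) + p1 (co a' vec) , p2 (co a vec) Sa.+ p2 (co a' vec)} (cC a a' vec)) ; Sv = \ t {f} (h , a , p) -> Sb t h , (\ i -> t K.* a i) ,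
        ≈ᴹ-trans {scalar t * f , Sb t h} {scalar t * p1 (co a vec) , Sb t (p2 (co a vec))} {co (\ i -> t K.* a i) vec} (*ₗ-congˡ {t} {f , h} {co a vec} p) (≈ᴹ-sym {co (\ i -> t K.* a i) vec} {scalar t * p1 (co a vec) , Sb t (p2 (co a vec))} (cB t a vec))
      ; S-0 = Sa.none , (\ _ -> 0#) , ≈ᴹ-sym {co (\ _ -> 0#) vec} {0ᴹ} (∑ᴹ-zero \ i -> *ₗ-zeroˡ (vec i)) }
     open Cl cl
     Sw : ∀ {f} -> Sub k D f -> S f
     Sw {f} h = S4 (Sq h) Sa.none (resp (sym (trans (+-congˡ (zeroʳ _)) (+-identityʳ _))) h) (p2 S-0)
     S5 : ∀ {f} -> f ∈ fa D -> S f
     S5 {f} m = S4 (ft D m) (p2 (vec i)) (equal (ΩR.reflexive (Any.lookup-index m))) ((\ j -> Ri.δ K j i) , ≈ᴹ-sym {co (\ j -> Ri.δ K j i) vec} {vec i} (c1 i vec))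
      where
      i = Any.index m
     cov : ∀ E -> E ≤ D -> (∀ E' -> E' < E -> ∀ {f} -> Fil E' q f -> S f) -> ∀ fuel J -> sb J ≡ q -> weight id (replicate n b2) < weight id J Q.+ fuel -> ∀ {d a} -> Pc d a -> d ≤ E -> S (ι a * ua J)
     cov E E≤D lo Q.zero J e w = ⊥-elim (Q.<⇒≱ w (e2 (e1 (e5 _)) (wb id J)))
     cov E E≤D lo (Q.suc fuel) J s3 w {d} {a} p l = Tb (P.*-identityˡ a) (sD T Tb Tc Tf T-0 s id J (\ ()) (\ ()) (con 1#) E (relations id J (\ ()) (\ _ -> U.refl) (\ i j l -> l) (\ i -> i2 (i2 (i , U.refl)))) powers (\ i -> i1 (i , U.refl)) (\ v m -> S5 (fh D J s3 (l7 (tz J) (con 1#) E≤D m))) p l)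
      where
      T : Pb -> Set (c ⊔ ℓ)
      T a = S (ι a * ua J)
      Tb : ∀ {a b} -> a ≈ᴾ b -> T a -> T b
      Tb e = Sc (*-congʳ (un e))
      Tc : ∀ {a b} -> T a -> T b -> T (a ⊞ b)
      Tc h h' = Sc (sym (distribʳ _ _ _)) (S-+ h h')
      Tf : ∀ t {a} -> T a -> T (con t ⊠ a)
      Tf t h = Sc (sym (*-assoc _ _ _)) (Sv t h)
      T-0 : T (con 0#)
      T-0 = Sc (sym (zeroˡ _)) S-0
      hi : ∀ J' -> sb J' ≡ q -> weight id J < weight id J' -> ∀ {d a} -> Pc d a -> d ≤ E -> S (ι a * ua J')
      hi J' e l = cov E E≤D lo fuel J' e (e4 w (e2 (e1 (e8 _ fuel)) (Q.+-monoˡ-≤ fuel l)))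
      powers : ∀ e -> 1 ≤ e -> e ≤ fi 0 J -> Ki T Tb Tc Tf T-0 (con 1#) E (we T Tb Tc Tf T-0 (\ ()) (\ ()) e ⊞ ac s id J e) (r Q.* e)
      powers (Q.suc e) _ le {d'} {a} p′ l' = Tb (P.trans (P.*-comm a _) (P.trans (P.*-congʳ (P.trans (P.sym (P.+-identityˡ _)) (P.+-congʳ (P.sym (∑ᴾ-0 _))))) (P.sym (P.*-identityˡ _)))) (Sc (trans (+-congʳ (Pj s cs q (Q.suc e) a J)) (trans (+-assoc _ _ _) (trans (+-congˡ (ΩR.-‿inverseʳ _)) (+-identityʳ _)))) (S-+ (Sw (Sj e3 E≤D (img e (e2 le (e1 (fB J s3))) (Si (\ (l₁ , l₂) -> e2 (Q.+-monoʳ-≤ (r Q.* Q.suc e) l₁) l' , l₂) bg)))) (Sv (K.- 1#) (Sv _ (lo d' (e4 (Q.m<n+m d' (Q.>-nonZero⁻¹ _ {{Q.m*n≢0 r (Q.suc e)}})) l') bg)))))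
       where
       bg : Fil d' q (ι a * ua J)
       bg = Ff J s3 p′ e3
      relations : ∀ {m C} (f : Fin m -> Fin n) J' (ls : Fin C -> Fin n) -> (∀ i -> lookup J (f i) ≡ lookup J' i) -> (∀ i j -> toℕ i < toℕ j -> toℕ (f i) < toℕ (f j)) -> (∀ i -> i ∈ Data.List.Base.tabulate ls ⊎ lookup J i ≡ b2 ⊎ Σ (Fin m) \ j -> i ≡ f j) -> Rb T Tb Tc Tf T-0 f J' ls (con 1#) E
      relations f [] ls agree mb cases = Level.lift tt
      relations f (b1 ∷ J') ls agree mb cases = relations (f ∘ suc) J' _ (\ i -> agree (suc i)) (\ i j l -> mb (suc i) (suc j) (s≤s l)) (\ i -> sg (cases i))
       where
       sg : ∀ {i} -> i ∈ Data.List.Base.tabulate ls ⊎ lookup J i ≡ b2 ⊎ (Σ _ \ j -> i ≡ f j) -> i ∈ Data.List.Base.tabulate (f zero Vector.∷ ls) ⊎ lookup J i ≡ b2 ⊎ (Σ _ \ j -> i ≡ f (suc j))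
       sg (i1 m) = i1 (there m)
       sg (i2 (i1 e)) = i2 (i1 e)
       sg (i2 (i2 (zero , e))) = i1 (here e)
       sg (i2 (i2 (suc j , e))) = i2 (i2 (j , e))
      relations {C = C} f (b2 ∷ J') ls agree mb cases = ki , relations (f ∘ suc) J' ls (\ i -> agree (suc i)) (\ i j l -> mb (suc i) (suc j) (s≤s l)) (\ i -> sg (cases i))
       where
       sg : ∀ {i} -> i ∈ Data.List.Base.tabulate ls ⊎ lookup J i ≡ b2 ⊎ (Σ _ \ j -> i ≡ f j) -> i ∈ Data.List.Base.tabulate ls ⊎ lookup J i ≡ b2 ⊎ (Σ _ \ j -> i ≡ f (suc j))
       sg (i1 m) = i1 m
       sg (i2 (i1 e)) = i2 (i1 e)
       sg (i2 (i2 (zero , U.refl))) = i2 (i1 (agree zero))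
       sg (i2 (i2 (suc j , e))) = i2 (i2 (j , e))
       open Ew s cs q cl {k} {D} Sw J s3 (f zero) (agree zero)
       o2 : ∀ i -> i ∈ Data.List.Base.tabulate ls ⊎ lookup J i ≡ b2 ⊎ (lookup Ja i ≡ b1 -> ∀ {d a} -> Pc d a -> d ≤ E -> S (ι a * ua (Ja [ i ]≔ b2)))
       o2 i with cases i
       ... | i1 m = i1 m
       ... | i2 (i1 e) = i2 (i1 e)
       ... | i2 (i2 (zero , U.refl)) = i2 (i1 (agree zero))
       ... | i2 (i2 (suc j , U.refl)) = i2 (i2 \ i∉J₀ -> hi (Ja [ f (suc j) ]≔ b2) (gv i∉J₀) (wo i∉J₀ (mb zero (suc j) (s≤s z≤n))))
       bg : da 0 ≡ r Q.∸ 1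
       bg = U.cong (Q._+ (r Q.∸ 1)) (Q.*-zeroʳ r)
       ki : Ki T Tb Tc Tf T-0 (con 1#) E (var (f zero) ^ᴾ (r Q.∸ 1) ⊠ van (Data.List.Base.tabulate ls) (X (f zero))) (r Q.∸ 1 Q.+ r Q.* C)
       ki {d'} p′ l' = Tb (P.trans (P.*-congʳ (P.*-congʳ (P.reflexive (U.cong (var (f zero) ^ᴾ_) bg)))) (P.sym (P.*-identityˡ _))) (cT s cs q cl (\ h -> Sw (Sj e3 E≤D h)) J s3 (f zero) (Data.List.Base.tabulate ls) (agree zero) o2 p′ (e2 (e1 (U.trans (U.cong₂ (\ v w -> d' Q.+ (r Q.* v Q.+ w)) (length-tabulate ls) bg) (U.trans (e6 d' _) (U.cong (Q._+ d') (e6 (r Q.* C) _))))) l'))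
     eve : ∀ E -> E ≤ D -> ∀ {f} -> Fil E q f -> S f
     eve = <-rec (\ E -> E ≤ D -> ∀ {f} -> Fil E q f -> S f) sg
      where
      sg : ∀ E -> (∀ {E'} -> E' < E -> E' ≤ D -> ∀ {f} -> Fil E' q f -> S f) -> E ≤ D -> ∀ {f} -> Fil E q f -> S f
      sg E rec E≤D = go
       where
       go : ∀ {f} -> Fil E q f -> S f
       go (Sa.word a is js (l , e)) = Sv a (from (nor js))
        where
        from : θs js ≈Ω 0Ω ⊎ (Σ (Vec Bool n) \ J -> (sb J ≡ length js) × (θs js ≈± ua J)) -> S (xs is * θs js)
        from (i1 z) = Sc (sym (trans (*-congˡ z) (zeroʳ _))) S-0
        from (i2 (J , e' , z)) = S2 (uc (xs is) z) (Sc (*-congʳ (sym (xa is))) (cov E E≤D (\ E' l' -> rec l' (e2 (Q.<⇒≤ l') E≤D)) (Q.suc (weight id (replicate n b2))) J (U.trans e' e) (e0 _ (weight id J)) (xd is) l))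
       go Sa.none = S-0
       go (h Sa.+ h') = S-+ (go h) (go h')
       go (Sa.resp e h) = Sc e (go h)
     sx : Sp (space k D) (N n q k k D)
     sx = U.subst (Sp (space k D)) (ly D) record { vec = vec ; coo = \ (f , h) -> p1 (p2 (eve D e3 h))
      ; spa = \ (f , h) -> let (h' , a , p) = eve D e3 h in
        ≈ᴹ-trans {f , h} {f , h'} {co a vec} (equal refl) p }
  -- Ω acts on a tower of function spaces, one storey (θ-degree, x-degree) for each index; at a
  -- site with a value, the variable acts as that value.
  module St where
   open K using (Carrier; _≈_; 0#; 1#; ring)
   open Kg using (_^_)
   open Ke
   data Sl : Set c where
    va : Carrier -> Sl
    coefficient : O -> Sl
   p4 : ∀ {m ℓm} -> Set -> i9 ring m ℓm -> i9 ring m ℓm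
   p4 I V = record { Carrierᴹ = I -> Carrierᴹ ; _≈ᴹ_ = \ u v -> ∀ i -> u i ≈ᴹ v i ; _+ᴹ_ = \ u v i -> u i +ᴹ v i ; _*ₗ_ = \ a u i -> a *ₗ u i ; 0ᴹ = \ _ -> 0ᴹ ; -ᴹ_ = \ u i -> -ᴹ u i ; isLeftModule = record { isLeftSemimodule = record { +ᴹ-isCommutativeMonoid = record { isMonoid = record { isSemigroup = record { isMagma = record { isEquivalence = record { refl = \ _ -> ≈ᴹ-refl ; sym = \ e i -> ≈ᴹ-sym (e i) ; trans = \ e e' i -> ≈ᴹ-trans (e i) (e' i) } ; ∙-cong = \ e e' i -> +ᴹ-cong (e i) (e' i) } ; assoc = \ _ _ _ _ -> +ᴹ-assoc _ _ _ } ; identity = (\ _ _ -> +ᴹ-identityˡ _) , \ _ _ -> +ᴹ-identityʳ _ } ; comm = \ _ _ _ -> +ᴹ-comm _ _ } ; isPreleftSemimodule = record { *ₗ-cong = \ e e' i -> *ₗ-cong e (e' i)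
       ; *ₗ-zeroˡ = \ _ _ -> *ₗ-zeroˡ _
       ; *ₗ-distribʳ = \ _ _ _ _ -> *ₗ-distribʳ _ _ _
       ; *ₗ-identityˡ = \ _ _ -> *ₗ-identityˡ _
       ; *ₗ-assoc = \ _ _ _ _ -> *ₗ-assoc _ _ _
       ; *ₗ-zeroʳ = \ _ _ -> *ₗ-zeroʳ _
       ; *ₗ-distribˡ = \ _ _ _ _ -> *ₗ-distribˡ _ _ _ } }
     ; -ᴹ‿cong = \ e i -> -ᴹ‿cong (e i)
     ; -ᴹ‿inverse = (\ _ _ -> -ᴹ‿inverseˡ _) , \ _ _ -> -ᴹ‿inverseʳ _ } }
    where open i9 V
   V : O -> i9 ring c ℓ
   V Q.zero = TensorUnit.leftModule
   V (Q.suc m) = p4 (Bool × O) (V m)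
   module _ {m : O} where
    open La (V m)
    sig : Bool -> Carrierᴹ -> Carrierᴹ
    sig b1 v = v
    sig b2 v = -ᴹ v
    du : Bool -> Li (V m) (V m)
    du b1 = record { fun = \ v -> v ; f-cong = \ e -> e ; f-+ = \ _ _ -> ≈ᴹ-refl ; f-* = \ _ _ -> ≈ᴹ-refl }
    du b2 = record { fun = -ᴹ_ ; f-cong = -ᴹ‿cong ; f-+ = \ u v -> ≈ᴹ-sym (⁻¹-∙-comm u v) ; f-* = \ a v -> ≈ᴹ-sym (nb a v) }
    ee : Li (V m) (V m) -> Li (V (Q.suc m)) (V (Q.suc m))
    ee L = record { fun = \ v i -> fun L (v i) ; f-cong = \ e i -> f-cong L (e i) ; f-+ = \ u v i -> f-+ L (u i) (v i) ; f-* = \ a v i -> f-* L a (v i) }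
    odd : Li (V m) (V m) -> Li (V (Q.suc m)) (V (Q.suc m))
    odd L = record { fun = \ v (b , e) -> fun (M b) (v (b , e)) ; f-cong = \ p (b , e) -> f-cong (M b) (p (b , e)) ; f-+ = \ u v (b , e) -> f-+ (M b) (u (b , e)) (v (b , e)) ; f-* = \ a v (b , e) -> f-* (M b) a (v (b , e)) }
     where
     M : Bool -> Li (V m) (V m)
     M b = cq (du b) L
    mu : Sl -> Li (V (Q.suc m)) (V (Q.suc m))
    mu (va t) = record { fun = \ v i -> t *ₗ v i ; f-cong = \ e i -> *ₗ-congˡ (e i) ; f-+ = \ u v i -> *ₗ-distribˡ t (u i) (v i) ; f-* = \ a v i -> sl t a (v i) }
    mu (coefficient _) = record { fun = shift ; f-cong = \ { p (b , Q.zero) -> ≈ᴹ-refl ; p (b , Q.suc e) -> p (b , e) } ; f-+ = \ { u v (b , Q.zero) -> ≈ᴹ-sym (+ᴹ-identityˡ _) ; u v (b , Q.suc e) -> ≈ᴹ-refl } ; f-* = \ { a v (b , Q.zero) -> ≈ᴹ-sym (*ₗ-zeroʳ a) ; a v (b , Q.suc e) -> ≈ᴹ-refl } }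
     where
     shift : (Bool × O -> Carrierᴹ) -> Bool × O -> Carrierᴹ
     shift v (b , Q.zero) = 0ᴹ
     shift v (b , Q.suc e) = v (b , e)
    wed : Li (V (Q.suc m)) (V (Q.suc m))
    wed = record { fun = ra ; f-cong = \ { p (b1 , e) -> ≈ᴹ-refl ; p (b2 , e) -> p (b1 , e) } ; f-+ = \ { u v (b1 , e) -> ≈ᴹ-sym (+ᴹ-identityˡ _) ; u v (b2 , e) -> ≈ᴹ-refl } ; f-* = \ { a v (b1 , e) -> ≈ᴹ-sym (*ₗ-zeroʳ a) ; a v (b2 , e) -> ≈ᴹ-refl } }
     where
     ra : (Bool × O -> Carrierᴹ) -> Bool × O -> Carrierᴹ
     ra v (b1 , e) = 0ᴹ
     ra v (b2 , e) = v (b1 , e)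
    eo : ∀ s (L : Li (V m) (V m)) v i -> fun (mu s) (fun (ee L) v) i ≈ᴹ fun (ee L) (fun (mu s) v) i
    eo (va t) L v i = ≈ᴹ-sym (f-* L t (v i))
    eo (coefficient _) L v (b , Q.zero) = ≈ᴹ-sym (f-0 L)
    eo (coefficient _) L v (b , Q.suc e) = ≈ᴹ-refl
    oi : ∀ s (L : Li (V m) (V m)) v i -> fun (mu s) (fun (odd L) v) i ≈ᴹ fun (odd L) (fun (mu s) v) i
    oi (va t) L v (b1 , e) = ≈ᴹ-sym (f-* L t _)
    oi (va t) L v (b2 , e) = ≈ᴹ-trans (nb t _) (-ᴹ‿cong (≈ᴹ-sym (f-* L t _)))
    oi (coefficient _) L v (b1 , Q.zero) = ≈ᴹ-sym (f-0 L)
    oi (coefficient _) L v (b2 , Q.zero) = ≈ᴹ-sym (≈ᴹ-trans (-ᴹ‿cong (f-0 L)) -0ᴹ)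
    oi (coefficient _) L v (b , Q.suc e) = ≈ᴹ-refl
    mk : ∀ s v i -> fun (mu s) (fun wed v) i ≈ᴹ fun wed (fun (mu s) v) i
    mk (va t) v (b1 , e) = *ₗ-zeroʳ t
    mk (va t) v (b2 , e) = ≈ᴹ-refl
    mk (coefficient _) v (b1 , Q.zero) = ≈ᴹ-refl
    mk (coefficient _) v (b2 , Q.zero) = ≈ᴹ-refl
    mk (coefficient _) v (b1 , Q.suc e) = ≈ᴹ-refl
    mk (coefficient _) v (b2 , Q.suc e) = ≈ᴹ-refl
    eC : ∀ (L : Li (V m) (V m)) v i -> fun (ee L) (fun wed v) i ≈ᴹ fun wed (fun (ee L) v) i
    eC L v (b1 , e) = f-0 L
    eC L v (b2 , e) = ≈ᴹ-refl
    ol : ∀ (L : Li (V m) (V m)) v i -> fun (odd L) (fun wed v) i ≈ᴹ -ᴹ fun wed (fun (odd L) v) i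
    ol L v (b1 , e) = ≈ᴹ-trans (f-0 L) (≈ᴹ-sym -0ᴹ)
    ol L v (b2 , e) = ≈ᴹ-refl
    wm : ∀ v i -> fun wed (fun wed v) i ≈ᴹ 0ᴹ
    wm v (b1 , e) = ≈ᴹ-refl
    wm v (b2 , e) = ≈ᴹ-refl
    eB : (L M : Li (V m) (V m)) -> (∀ v -> fun L (fun M v) ≈ᴹ fun M (fun L v)) -> ∀ v i -> fun (ee L) (fun (odd M) v) i ≈ᴹ fun (odd M) (fun (ee L) v) i
    eB L M h v (b1 , e) = h _
    eB L M h v (b2 , e) = ≈ᴹ-trans (fs L _) (-ᴹ‿cong (h _))
    oq : (L M : Li (V m) (V m)) -> (∀ v -> fun L (fun M v) ≈ᴹ -ᴹ fun M (fun L v)) -> ∀ v i -> fun (odd L) (fun (odd M) v) i ≈ᴹ -ᴹ fun (odd M) (fun (odd L) v) i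
    oq L M h v (b1 , e) = h _
    oq L M h v (b2 , e) = -ᴹ‿cong (≈ᴹ-trans (fs L _) (≈ᴹ-trans (-ᴹ‿cong (h _)) (-ᴹ‿cong (≈ᴹ-sym (fs M _)))))
   X : ∀ {m} -> (Fin m -> Sl) -> Fin m -> Li (V m) (V m)
   X {Q.suc m} s zero = mu {m} (s zero)
   X {Q.suc m} s (suc i) = ee {m} (X (s ∘ suc) i)
   Θ : ∀ {m} -> Fin m -> Li (V m) (V m)
   Θ {Q.suc m} zero = wed {m}
   Θ {Q.suc m} (suc i) = odd {m} (Θ i)
   X-X : ∀ {m} (s : Fin m -> Sl) (i j : Fin m) (v : i9.Carrierᴹ (V m)) -> i9._≈ᴹ_ (V m) (fun (X s i) (fun (X s j) v)) (fun (X s j) (fun (X s i) v))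
   X-X {Q.suc m} s zero zero v i = i9.≈ᴹ-refl (V m)
   X-X {Q.suc m} s zero (suc j) v i = eo {m} (s zero) (X (s ∘ suc) j) v i
   X-X {Q.suc m} s (suc k) zero v i = i9.≈ᴹ-sym (V m) (eo {m} (s zero) (X (s ∘ suc) k) v i)
   X-X {Q.suc m} s (suc k) (suc j) v i = X-X (s ∘ suc) k j (v i)
   X-Θ : ∀ {m} (s : Fin m -> Sl) (i j : Fin m) (v : i9.Carrierᴹ (V m)) -> i9._≈ᴹ_ (V m) (fun (X s i) (fun (Θ j) v)) (fun (Θ j) (fun (X s i) v))
   X-Θ {Q.suc m} s zero zero v i = mk {m} (s zero) v i
   X-Θ {Q.suc m} s zero (suc j) v i = oi {m} (s zero) (Θ j) v i
   X-Θ {Q.suc m} s (suc k) zero v i = eC {m} (X (s ∘ suc) k) v i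
   X-Θ {Q.suc m} s (suc k) (suc j) v i = eB {m} (X (s ∘ suc) k) (Θ j) (X-Θ (s ∘ suc) k j) v i
   Θ-Θ : ∀ {m} (i j : Fin m) (v : i9.Carrierᴹ (V m)) -> i9._≈ᴹ_ (V m) (fun (Θ i) (fun (Θ j) v)) (i9.-ᴹ_ (V m) (fun (Θ j) (fun (Θ i) v)))
   Θ-Θ {Q.suc m} zero zero v i = ≈ᴹ-trans (wm {m} v i) (≈ᴹ-sym (≈ᴹ-trans (-ᴹ‿cong (wm {m} v i)) -0ᴹ))
    where open La (V m)
   Θ-Θ {Q.suc m} zero (suc j) v i = ≈ᴹ-trans (≈ᴹ-sym (⁻¹-involutive _)) (-ᴹ‿cong (≈ᴹ-sym (ol {m} (Θ j) v i)))
    where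
    open La (V m)
    open import Algebra.Properties.Group +ᴹ-group using (⁻¹-involutive)
   Θ-Θ {Q.suc m} (suc k) zero v i = ol {m} (Θ k) v i
   Θ-Θ {Q.suc m} (suc k) (suc j) v i = oq {m} (Θ k) (Θ j) (Θ-Θ k j) v i
   rep : (s : Fin n -> Sl) -> Bas.Rd (V n)
   rep s = record { X = X s ; Θ = Θ ; X-X = X-X s ; X-Θ = X-Θ s ; Θ-Θ = Θ-Θ }
   eb : Sl -> O
   eb (va _) = 0
   eb (coefficient e) = e
   loc : Sl -> O -> Carrier
   loc (va t) e = t ^ e
   loc (coefficient κ) e = if e Q.≡ᵇ κ then 1# else 0#
   l3 : ∀ s -> loc s (eb s) ≈ 1#
   l3 (va t) = K.refl
   l3 (coefficient κ) = K.reflexive (U.cong (\ b -> if b then 1# else 0#) (dec-true (κ Q.≟ κ) U.refl))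
   top : ∀ {m} -> (Fin m -> Sl) -> Li (V m) (V 0)
   top {Q.zero} s = record { fun = \ v -> v ; f-cong = \ e -> e ; f-+ = \ _ _ -> K.refl ; f-* = \ _ _ -> K.refl }
   top {Q.suc m} s = record { fun = \ v -> fun (top (s ∘ suc)) (v at) ; f-cong = \ e -> f-cong (top (s ∘ suc)) (e at) ; f-+ = \ u v -> f-+ (top (s ∘ suc)) (u at) (v at) ; f-* = \ a v -> f-* (top (s ∘ suc)) a (v at) }
    where
    at : Bool × O
    at = b2 , eb (s zero)
   pd : ∀ m -> Bool × O -> i9.Carrierᴹ (V m) -> i9.Carrierᴹ (V (Q.suc m))
   pd m (b , e) v (b' , e') = en (b Data.Bool.≟ b') (e Q.≟ e')
    where
    open import Relation.Nullary using (Dec; yes; no)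
    import Data.Bool
    en : Dec (b ≡ b') -> Dec (e ≡ e') -> i9.Carrierᴹ (V m)
    en (yes _) (yes _) = v
    en _ _ = i9.0ᴹ (V m)
   vac : ∀ m -> i9.Carrierᴹ (V m)
   vac Q.zero = 1#
   vac (Q.suc m) = pd m (b1 , 0) (vac m)
  fb : ∀ {m} -> Vec Bool m
  fb = replicate _ b2
  sM : ∀ {m} (J : Vec Bool m) -> sb J ≡ m -> J ≡ fb
  sM [] e = U.refl
  sM (b2 ∷ J) e = U.cong (b2 ∷_) (sM J (Q.suc-injective e))
  sM (b1 ∷ J) e = ⊥-elim (Q.<⇒≢ (Q.s≤s (s1 J)) e)
   where
   s1 : ∀ {m} (J : Vec Bool m) -> sb J ≤ m
   s1 [] = Q.z≤n
   s1 (b2 ∷ J) = Q.s≤s (s1 J)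
   s1 (b1 ∷ J) = Q.m≤n⇒m≤1+n (s1 J)
  aL : ∀ {m} (J : Vec Bool m) -> (∀ i -> lookup J i ≡ b2) -> J ≡ fb
  aL [] e = U.refl
  aL (b ∷ J) e = U.cong₂ _∷_ (e zero) (aL J \ i -> e (suc i))
  module Tg where
   open K using (Carrier; 0#; 1#; ring)
   open Kg using (_^_)
   open Bas
   open Op
   open Fl
   open Wo hiding (X)
   open Kj using (Inv; Ih; Ie; Il; Ia)
   Top : Ω -> Set (c ⊔ ℓ)
   Top w = Σ Pb \ a -> w ≈Ω ι a * ua fb
   sA : ∀ js -> length js ≡ n -> Σ Carrier \ s -> θs js ≈Ω scalar s * ua fb
   sA js e with nor js
   ... | i1 z = 0# , trans z (sym (zeroˡ _))
   ... | i2 (J , s , z) rewrite sM J (U.trans s e) = from z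
    where
    from : θs js ≈± ua fb -> Σ Carrier \ s -> θs js ≈Ω scalar s * ua fb
    from (pb z) = 1# , trans z (sym (*-identityˡ _))
    from (mi z) = K.- 1# , z
   Fg : ∀ {E w} -> Fil E n w -> Top w
   Fg (Sa.word a is js (l , e)) with s , z <- sA js e = con a ⊠ (con s ⊠ xb is) , trans (*-congˡ (trans (*-cong (xa is) z) (trans (sd _ _ _) (sym (*-assoc _ _ _))))) (sym (*-assoc _ _ _))
   Fg Sa.none = con 0# , sym (zeroˡ _)
   Fg (h Sa.+ h') with a , e <- Fg h | b , e' <- Fg h' = a ⊞ b , trans (+-cong e e') (sym (distribʳ _ _ _))
   Fg (Sa.resp e h) with a , e' <- Fg h = a , trans (sym e) e'
   Dl : ∀ m {w} -> Top w -> D m w ≈Ω p m * w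
   Dl m {w} (a , e) = trans (Da m e) (trans (Dd m a _) (trans (*-congˡ (trans (Db id fb m) (*-congʳ (un (pC id))))) (trans (cd (pq m) (ι a) _) (*-congˡ (sym e)))))
    where
    pC : ∀ {k} (f : Fin k -> Fin n) -> pa f fb m ≈ᴾ ∑ᴾ (\ i -> var (f i) ^ᴾ (r Q.* m))
    pC {Q.zero} f = P.sym (∑ᴾ-0 _)
    pC {Q.suc k} f = P.trans (P.+-congˡ (pC (f ∘ suc))) (P.sym (∑ᴾ-suc _))
   -- Elements of θ-degree one.
   η : (Fin n -> Pb) -> Ω
   η a = ∑Ω \ i -> ι (a i) * θ i
   uD : ∀ a b -> η a * η b ≈Ω - (η b * η a)
   uD a b = trans (ed a b) (trans (∑Ω-cong \ i -> ∑Ω-cong \ j -> flip i j) (trans (∑Ω-swap _) (trans (∑Ω-cong \ j -> sym (ud _ _)) (trans (sym (ud _ _)) (*-congˡ (sym (ed b a)))))))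
    where
    ed : ∀ a b -> η a * η b ≈Ω ∑Ω \ i -> ∑Ω \ j -> ι (a i) * θ i * (ι (b j) * θ j)
    ed a b = trans (ub _ _) (∑Ω-cong \ i -> ud _ _)
    flip : ∀ i j -> ι (a i) * θ i * (ι (b j) * θ j) ≈Ω - (ι (b j) * θ j * (ι (a i) * θ i))
    flip i j = trans (cd (b j) _ _) (trans (*-congˡ (trans (*-assoc _ _ _) (trans (*-congˡ (θ-θ i j)) (sd _ _ _)))) (trans (sd _ _ _) (*-congˡ (trans (sym (cF (b j) (a i))) (sym (*-assoc _ _ _))) ) ))
     where
     cF : ∀ b a -> ι b * (θ j * (ι a * θ i)) ≈Ω ι b * (ι a * (θ j * θ i))
     cF b a = *-congˡ (cd a (θ j) (θ i))
   uK : ∀ a -> η a * η a ≈Ω 0Ω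
   uK a = begin w ≈⟨ sym (*-identityˡ _) ⟩ scalar 1# * w ≈⟨ *-congʳ (scalar-≈ (K.trans (K.sym (p2 hb)) (K.*-comm _ _))) ⟩ scalar (p1 hb K.* (1# K.+ 1#)) * w ≈⟨ trans (*-congʳ (scalar-* _ _)) (*-assoc _ _ _) ⟩ scalar (p1 hb) * (scalar (1# K.+ 1#) * w) ≈⟨ *-congˡ (trans (*-congʳ (scalar-+ 1# 1#)) (distribʳ _ _ _)) ⟩ scalar (p1 hb) * (scalar 1# * w + scalar 1# * w) ≈⟨ *-congˡ (trans (+-cong (trans (*-identityˡ _) (uD a a)) (*-identityˡ _)) (ΩR.-‿inverseˡ _)) ⟩ scalar (p1 hb) * 0Ω ≈⟨ zeroʳ _ ⟩ 0Ω ∎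
    where
    w = η a * η a
    open import Relation.Binary.Reasoning.Setoid setoid
   ap : List (Fin n -> Pb) -> Ω -> Ω
   ap [] u = u
   ap (a ∷ as) u = ap as (η a * u)
   ag : ∀ as {u v} -> u ≈Ω v -> ap as u ≈Ω ap as v
   ag [] e = e
   ag (a ∷ as) e = ag as (*-congˡ e)
   aS : ∀ as u v -> ap as (u + v) ≈Ω ap as u + ap as v
   aS [] u v = refl
   aS (a ∷ as) u v = trans (ag as (distribˡ _ _ _)) (aS as _ _)
   a1 : ∀ as a u -> ap as (ι a * u) ≈Ω ι a * ap as u
   a1 [] a u = refl
   a1 (b ∷ as) a u = trans (ag as (cd a _ _)) (a1 as a _)
   a4 : ∀ as a u -> ap as (scalar a * u) ≈Ω scalar a * ap as u
   a4 as a u = a1 as (con a) u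
   aT : ∀ as -> ap as 0Ω ≈Ω 0Ω
   aT as = trans (ag as (sym (zeroˡ 0Ω))) (trans (a4 as 0# 0Ω) (zeroˡ _))
   aY : ∀ as {m} (f : Fin m -> Ω) -> ap as (∑Ω f) ≈Ω ∑Ω (\ i -> ap as (f i))
   aY as = Ho.ha ΩR.+-commutativeMonoid ΩR.+-commutativeMonoid (ap as) (ag as) (aT as) (aS as)
   aP : ∀ as {u v} -> u ≈± v -> ap as u ≈± ap as v
   aP as (pb e) = pb (ag as e)
   aP as (mi e) = mi (trans (ag as e) (a4 as _ _))
   zb : ∀ {f g} -> f ≈± g -> g ≈Ω 0Ω -> f ≈Ω 0Ω
   zb (pb e) z = trans e z
   zb (mi e) z = trans e (trans (*-congˡ z) -0#≈0#)
   aD : ∀ as a u -> η a * ap as u ≈± ap as (η a * u)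
   aD [] a u = pb refl
   aD (b ∷ as) a u = tb (aD as a (η b * u)) (aP as (mi (trans (sym (*-assoc _ _ _)) (trans (*-congʳ (uD a b)) (trans (*-assoc _ _ _) (*-congˡ (*-assoc _ _ _)))))))
   aO : ∀ {as a} u -> a ∈ as -> η a * ap as u ≈Ω 0Ω
   aO {_ ∷ as} {a} u (here U.refl) = zb (aD as a (η a * u)) (trans (ag as (trans (sym (*-assoc _ _ _)) (trans (*-congʳ (uK a)) (zeroˡ u)))) (aT as))
   aO {b ∷ as} u (there m) = aO (η b * u) m
   Fe : ∀ {m D q} {f : Fin m -> Ω} -> (∀ i -> Fil D q (f i)) -> Fil D q (∑Ω f)
   Fe {Q.zero} h = Sa.resp (sym (∑Ω-0 _)) Sa.none
   Fe {Q.suc m} h = Sa.resp (sym (∑Ω-suc _)) (h zero Sa.+ Fe \ i -> h (suc i))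
   a7 : ∀ as {E q u} -> (∀ {a} -> a ∈ as -> ∀ i -> Pc 0 (a i)) -> Fil E q u -> Fil E (length as Q.+ q) (ap as u)
   a7 [] d h = h
   a7 (a ∷ as) {E} {q} {u} d h = U.subst (\ z -> Fil E z (ap (a ∷ as) u)) (e8 (length as) q) (a7 as (\ m -> d (there m)) (Sa.resp (sym (ub _ _)) (Fe \ i -> Sa.resp (sym (*-assoc _ _ _)) (Fb (d (here U.refl) i) (Fd i h)))))
   module _ {k : O} where
    open Pa using (Place; inZero; inBlock)
    open Ro using (pow; inv)
    open St using (Sl; coefficient; va)
    si : (Fin k -> Carrier) -> Place k -> Sl
    si y (inZero κ) = coefficient (toℕ κ)
    si y (inBlock b κ) = va (pow κ K.* y b)
    ya : (Fin k -> Carrier) -> List (Fin k) -> O -> Carrier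
    ya y [] m = 0#
    ya y (b ∷ cs) m = y b ^ (r Q.* m) K.+ ya y cs m
    me : Fin k -> Place k -> Carrier
    me b (inZero κ) = 0#
    me b (inBlock b' κ) = if does (b ≟ b') then inv κ else 0#
   module Fx {k : O} (place : Fin n -> OrderedSetPartitions.Place K n r ζ k) (y : Fin k -> Carrier) (bs : List (Fin k)) (lab : ∀ {i b κ} -> place i ≡ OrderedSetPartitions.inBlock b κ -> b ∈ bs) where
    open Pa using (Place; inZero; inBlock)
    open Ro using (pow; inv; pf; pK; iw)
    open St
    open Ke using (Li; fun; f-cong; f-+; f-*; f-0; fs; fj; module La)
    open Kl using (∑; cb; ui; uv; sj; ss; ∑-zero)
    sw : Fin n -> Sl
    sw i = si y (place i)
    φ : Fin k -> Fin n -> Pb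
    φ b i = con (me b (place i))
    φs : List (Fin k) -> List (Fin n -> Pb)
    φs [] = []
    φs (b ∷ bs) = φ b ∷ φs bs
    sF : ∀ {b bs} -> b ∈ bs -> φ b ∈ φs bs
    sF (here U.refl) = here U.refl
    sF (there m) = there (sF m)
    module R = Rd (rep sw)
    module VL = La (V n)
    open R using (act; op; act-resp)
    τ : Li (V n) (V 0)
    τ = top sw
    ψ : Ω -> Carrier
    ψ u = fun τ (act (ap (φs bs) u) (vac n))
    cy : ∀ {u v} -> u ≈Ω v -> ψ u K.≈ ψ v
    cy e = f-cong τ (act-resp (ag (φs bs) e) (vac n))
    u5 : ∀ u v -> ψ (u + v) K.≈ ψ u K.+ ψ v
    u5 u v = K.trans (f-cong τ (act-resp (aS (φs bs) u v) (vac n))) (f-+ τ _ _)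
    sr : ∀ a u -> ψ (scalar a * u) K.≈ a K.* ψ u
    sr a u = K.trans (f-cong τ (act-resp (a4 (φs bs) a u) (vac n))) (f-* τ a _)
    uE : ψ 0Ω K.≈ 0#
    uE = K.trans (cy (sym (zeroˡ 0Ω))) (K.trans (sr 0# 0Ω) (K.zeroˡ _))
    f4 : ∀ {u} -> u ≈Ω 0Ω -> ∀ v -> act u v VL.≈ᴹ VL.0ᴹ
    f4 e v = VL.≈ᴹ-trans (act-resp e v) (VL.*ₗ-zeroˡ v)
    -- The polynomials acting as scalars.
    Ab : Pb -> Carrier -> Set (c ⊔ ℓ)
    Ab a s = ∀ v -> act (ι a) v VL.≈ᴹ s VL.*ₗ v
    Ac : ∀ s -> Ab (con s) s
    Ac s v = VL.≈ᴹ-refl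
    Ai : ∀ {a b s t} -> Ab a s -> Ab b t -> Ab (a ⊞ b) (s K.+ t)
    Ai h h' v = VL.≈ᴹ-trans (VL.+ᴹ-cong (h v) (h' v)) (VL.≈ᴹ-sym (VL.*ₗ-distribʳ v _ _))
    Af : ∀ {a b s t} -> Ab a s -> Ab b t -> Ab (a ⊠ b) (s K.* t)
    Af {a} {s = s} {t} h h' v = VL.≈ᴹ-trans (f-cong (op (ι a)) (h' v)) (VL.≈ᴹ-trans (h _) (VL.≈ᴹ-sym (VL.*ₗ-assoc s t v)))
    Ak : ∀ {a s} e -> Ab a s -> Ab (a ^ᴾ e) (s ^ e)
    Ak Q.zero h v = VL.≈ᴹ-refl
    Ak {a} (Q.suc e) h = Af {a} {a ^ᴾ e} h (Ak {a} e h)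
    Ah : ∀ {a s t} -> s K.≈ t -> Ab a s -> Ab a t
    Ah e h v = VL.≈ᴹ-trans (h v) (VL.*ₗ-congʳ e)
    Xb : ∀ {m} (s : Fin m -> Sl) i {t} -> s i ≡ va t -> ∀ v -> i9._≈ᴹ_ (V m) (fun (X s i) v) (i9._*ₗ_ (V m) t v)
    Xb {Q.suc m} s zero e v j rewrite e = i9.≈ᴹ-refl (V m)
    Xb {Q.suc m} s (suc i) e v j = Xb (s ∘ suc) i e (v j)
    Ae : ∀ {i b κ} -> place i ≡ inBlock b κ -> Ab (var i) (pow κ K.* y b)
    Ae {i} e = Xb sw i (U.cong (si y) e)
    ir : ∀ {m} -> (Fin m -> Sl) -> Fin m -> O -> i9.Carrierᴹ (V m) -> i9.Carrierᴹ (V m)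
    ir s i Q.zero v = v
    ir s i (Q.suc e) v = fun (X s i) (ir s i e v)
    t5 : ∀ {m} (s : Fin m -> Sl) i {κ e} -> s i ≡ coefficient κ -> κ < e -> ∀ v -> fun (top s) (ir s i e v) K.≈ 0#
    t5 {Q.suc m} s (suc i) {e = e} p l v = K.trans (f-cong (top (s ∘ suc)) (pG e v (b2 , eb (s zero)))) (t5 (s ∘ suc) i p l _)
     where
     pG : ∀ e v j -> i9._≈ᴹ_ (V m) (ir s (suc i) e v j) (ir (s ∘ suc) i e (v j))
     pG Q.zero v j = i9.≈ᴹ-refl (V m)
     pG (Q.suc e) v j = f-cong (X (s ∘ suc) i) (pG e v j)
    t5 {Q.suc m} s zero {κ} {e} p l v rewrite p = K.trans (f-cong (top (s ∘ suc)) (low e κ l v)) (f-0 (top (s ∘ suc)))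
     where
     low : ∀ e κ' -> κ' < e -> ∀ v -> i9._≈ᴹ_ (V m) (ir s zero e v (b2 , κ')) (i9.0ᴹ (V m))
     low (Q.suc e) Q.zero _ v rewrite p = i9.≈ᴹ-refl (V m)
     low (Q.suc e) (Q.suc κ') (Q.s≤s l) v rewrite p = low e κ' l v
    ay : ∀ i e v -> act (ι (var i ^ᴾ e)) v VL.≈ᴹ ir sw i e v
    ay i Q.zero v = VL.*ₗ-identityˡ v
    ay i (Q.suc e) v = f-cong (X sw i) (ay i e v)
    kc : ∀ {i κ e} -> place i ≡ inZero κ -> toℕ κ < e -> ∀ v -> fun τ (act (ι (var i ^ᴾ e)) v) K.≈ 0#
    kc {i} {κ} {e} p l v = K.trans (f-cong τ (ay i e v)) (t5 sw i (U.cong (si y) p) l v)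
    mx : ∀ {i b κ} -> place i ≡ inBlock b κ -> me b (place i) ≡ inv κ
    mx {b = b} e rewrite e | dec-true (b ≟ b) U.refl = U.refl
    mn : ∀ {i b b' κ} -> place i ≡ inBlock b κ -> b' ≢ b -> me b' (place i) ≡ 0#
    mn {b = b} {b'} e p rewrite e | dec-false (b' ≟ b) p = U.refl
    mp : ∀ {i κ} b -> place i ≡ inZero κ -> me b (place i) ≡ 0#
    mp b e rewrite e = U.refl
    pI : ∀ κ m -> pow κ ^ da m K.≈ inv κ
    pI κ m = iw (K.trans (K.reflexive (U.cong (pow κ ^_) (sP m))) (pK κ (Q.suc m))) (pf κ)
    open import Algebra.Properties.CommutativeSemiring.Exp K.commutativeSemiring using (^-distrib-*)
    kb : ∀ b u -> η (φ b) * ap (φs bs) u ≈Ω 0Ω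
    kb b u with any? (b ≟_) bs
    ... | yes m = aO u (sF m)
    ... | no ¬m = trans (*-congʳ (∑Ω-zero \ i -> trans (*-congʳ (scalar-≈ (K.reflexive (oh (place i) U.refl)))) (zeroˡ _))) (zeroˡ _)
     where
     oh : ∀ {i} z -> place i ≡ z -> me b z ≡ 0#
     oh (inZero κ) e = U.refl
     oh (inBlock b' κ) e with b ≟ b'
     ... | yes U.refl = ⊥-elim (¬m (lab e))
     ... | no _ = U.refl
    dJ : ∀ m v -> ψ (d m * v) K.≈ 0#
    dJ m v = dv (aD (φs bs) _ v) (K.trans (f-cong τ (act-resp (ub W _) (vac n))) (K.trans (f-cong τ (ak _)) (K.trans (fj τ _) (K.trans (u4 \ i -> term i) (K.trans (ss _) (∑-zero \ b -> K.trans (K.sym (ui (y b ^ e) _)) (K.trans (K.*-congˡ (vc b)) (K.zeroʳ _))))))))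
     where
     e = da m
     W = ap (φs bs) v
     rg : Ω -> Carrier
     rg u = fun τ (act u (vac n))
     dv : ∀ {f} -> f ≈± ap (φs bs) (d m * v) -> rg f K.≈ 0# -> ψ (d m * v) K.≈ 0#
     dv (pb q) z = K.trans (f-cong τ (act-resp (sym q) (vac n))) z
     dv (mi q) z = K.trans (f-cong τ (act-resp (trans (sym (-‿involutive _)) (*-congˡ (sym q))) (vac n))) (K.trans (f-* τ _ _) (K.trans (K.*-congˡ z) (K.zeroʳ _)))
     ak : ∀ {k} (f : Fin k -> Ω) -> act (∑Ω f) (vac n) VL.≈ᴹ VL.∑ᴹ (\ i -> act (f i) (vac n))
     ak = Ho.ha ΩR.+-commutativeMonoid VL.+ᴹ-commutativeMonoid (\ u -> act u (vac n)) (\ q -> act-resp q (vac n)) (VL.*ₗ-zeroˡ _) (\ _ _ -> VL.≈ᴹ-refl)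
     u4 : ∀ {k} {f g : Fin k -> Carrier} -> (∀ i -> f i K.≈ g i) -> La.∑ᴹ (V 0) f K.≈ ∑ g
     u4 h = Ho.ha (i9.+ᴹ-commutativeMonoid (V 0)) K.+-commutativeMonoid (\ z -> z) (\ z -> z) K.refl (\ _ _ -> K.refl) _ ⟨≈⟩ cb h
      where
      infixr 5 _⟨≈⟩_
      _⟨≈⟩_ = K.trans
     vc : ∀ b -> ∑ (\ i -> me b (place i) K.* rg (θ i * W)) K.≈ 0#
     vc b = K.trans (K.sym (K.trans (f-cong τ (act-resp (ub W _) (vac n))) (K.trans (f-cong τ (ak _)) (K.trans (fj τ _) (u4 \ i -> f-* τ _ _))))) (K.trans (f-cong τ (f4 (kb b v) (vac n))) (f-0 τ))
     term : ∀ i -> rg (ι (var i ^ᴾ e) * θ i * W) K.≈ ∑ (\ b -> y b ^ e K.* (me b (place i) K.* rg (θ i * W)))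
     term i = go (place i) U.refl
      where
      go : ∀ z -> place i ≡ z -> rg (ι (var i ^ᴾ e) * θ i * W) K.≈ ∑ (\ b -> y b ^ e K.* (me b (place i) K.* rg (θ i * W)))
      go (inZero κ) q = K.trans (kc {e = e} q (e4 (toℕ<n κ) (e0 _ _)) _) (K.sym (∑-zero \ b -> K.trans (K.*-congˡ (K.trans (K.*-congʳ (K.reflexive (mp b q))) (K.zeroˡ _))) (K.zeroʳ _)))
      go (inBlock b κ) q = K.trans (f-cong τ (Ak {var i} e (Ae q) _)) (K.trans (f-* τ _ _) (K.trans (K.*-congʳ (K.trans (^-distrib-* (pow κ) (y b) e) (K.trans (K.*-comm _ _) (K.*-congˡ (K.trans (pI κ m) (K.reflexive (U.sym (mx q)))))))) (K.trans (K.*-assoc _ _ _) (K.sym (sj _ b \ b' p -> K.trans (K.*-congˡ (K.trans (K.*-congʳ (K.reflexive (mn q p))) (K.zeroˡ _))) (K.zeroʳ _))))))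
    aN : ∀ as {u u′} s w -> act u w VL.≈ᴹ s VL.*ₗ act u′ w -> act (ap as u) w VL.≈ᴹ s VL.*ₗ act (ap as u′) w
    aN [] s w h = h
    aN (a ∷ as) s w h = aN as s w (VL.≈ᴹ-trans (f-cong (op (η a)) h) (f-* (op (η a)) s _))
    aE : ∀ a w -> act (η a) w VL.≈ᴹ VL.∑ᴹ (\ i -> act (ι (a i) * θ i) w)
    aE a w = Ho.ha ΩR.+-commutativeMonoid VL.+ᴹ-commutativeMonoid (\ u -> act u w) (\ q -> act-resp q w) (VL.*ₗ-zeroˡ _) (\ _ _ -> VL.≈ᴹ-refl) _
    Dm : ∀ m b w -> act (D m (η (φ b))) w VL.≈ᴹ (y b ^ (r Q.* m)) VL.*ₗ act (η (φ b)) w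
    Dm m b w = VL.≈ᴹ-trans (act-resp (trans (Dj m _) (∑Ω-cong \ i -> trans (Dc m _ _) (sym (*-assoc _ _ _)))) w) (VL.≈ᴹ-trans (aE _ w) (VL.≈ᴹ-trans (VL.∑ᴹ-cong \ i -> term i (place i) U.refl) (VL.≈ᴹ-sym (VL.≈ᴹ-trans (VL.*ₗ-congˡ (aE (φ b) w)) (VL.uf _ _)))))
     where
     e = r Q.* m
     term : ∀ i z -> place i ≡ z -> act (ι (φ b i ⊠ var i ^ᴾ e) * θ i) w VL.≈ᴹ (y b ^ e) VL.*ₗ act (ι (φ b i) * θ i) w
     ab : ∀ i -> me b (place i) ≡ 0# -> act (ι (φ b i ⊠ var i ^ᴾ e) * θ i) w VL.≈ᴹ (y b ^ e) VL.*ₗ act (ι (φ b i) * θ i) w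
     ab i q rewrite q = VL.≈ᴹ-trans (VL.*ₗ-zeroˡ _) (VL.≈ᴹ-sym (VL.≈ᴹ-trans (VL.*ₗ-congˡ (VL.*ₗ-zeroˡ _)) (VL.*ₗ-zeroʳ _)))
     term i (inZero κ) q = ab i (mp b q)
     term i (inBlock b' κ) q with b ≟ b'
     ... | no b≢b' = ab i (mn q b≢b')
     ... | yes U.refl = VL.≈ᴹ-trans (VL.*ₗ-congˡ (Ah {var i ^ᴾ e} sW (Ak {var i} e (Ae q)) _)) (VL.sl _ _ _)
      where
      sW : (pow κ K.* y b) ^ e K.≈ y b ^ e
      sW = K.trans (^-distrib-* (pow κ) (y b) e) (K.trans (K.*-congʳ (pK κ m)) (K.*-identityˡ _))
    Dk : ∀ m cs v -> act (D m (ap (φs cs) v)) (vac n) VL.≈ᴹ act (ap (φs cs) (D m v)) (vac n) VL.+ᴹ ya y cs m VL.*ₗ act (ap (φs cs) v) (vac n)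
    Dk m [] v = VL.≈ᴹ-sym (VL.≈ᴹ-trans (VL.+ᴹ-congˡ (VL.*ₗ-zeroˡ _)) (VL.+ᴹ-identityʳ _))
    Dk m (b ∷ cs) v = VL.≈ᴹ-trans (Dk m cs (η (φ b) * v)) (VL.≈ᴹ-trans (VL.+ᴹ-congʳ (VL.≈ᴹ-trans (act-resp (aS (φs cs) _ _) (vac n)) (VL.≈ᴹ-trans (VL.+ᴹ-congʳ (aN (φs cs) (y b ^ (r Q.* m)) (vac n) (Dm m b _))) (VL.+ᴹ-comm _ _)))) (VL.≈ᴹ-trans (VL.+ᴹ-assoc _ _ _) (VL.+ᴹ-congˡ (VL.≈ᴹ-sym (VL.*ₗ-distribʳ _ _ _)))))
    lg : ∀ cs -> length (φs cs) ≡ length cs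
    lg [] = U.refl
    lg (_ ∷ cs) = U.cong Q.suc (lg cs)
    sq : ∀ cs {a} -> a ∈ φs cs -> ∀ i -> Pc 0 (a i)
    sq (b ∷ cs) (here U.refl) i = con _
    sq (b ∷ cs) (there m) i = sq cs m i
    f7 : ∀ {E q u} -> length bs Q.+ q ≡ n -> Fil E q u -> Top (ap (φs bs) u)
    f7 {E} {q} {u} e h = Fg (U.subst (\ z -> Fil E z (ap (φs bs) u)) (U.trans (U.cong (Q._+ q) (lg bs)) e) (a7 (φs bs) (sq bs) h))
    module _ (q : O) (tot : length bs Q.+ q ≡ n) where
     hr : ∀ m {E v} -> Fil E q v -> ψ (p m * v) K.≈ ψ (D m v) K.+ ya y bs m K.* ψ v
     hr m {v = v} h = K.trans (f-cong τ (act-resp (trans (a1 (φs bs) (pq m) v) (sym (Dl m (f7 tot h)))) (vac n))) (K.trans (f-cong τ (Dk m bs v)) (K.trans (f-+ τ _ _) (K.+-congˡ (f-* τ _ _))))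
     Pt : ∀ cs m -> cs m K.≈ ya y bs m -> ∀ {E v} -> Fil E q v -> ψ (To.P b1 cs q m v) K.≈ 0#
     Pt cs m e {v = v} h = K.trans (u5 _ _) (K.trans (K.+-cong (hr m h) (K.trans (u5 _ _) (K.+-cong (sr _ _) (sr _ _)))) (K.trans (K.+-congˡ (K.+-congˡ (K.*-congʳ (K.-‿cong e)))) (cX 1# (K.*-identityˡ _) (ψ v) (ya y bs m))))
      where
      open Kn using (solve; _:=_; _:+_; _:*_; :-_)
      cX : ∀ {d} o -> o K.* d K.≈ d -> ∀ a s -> (d K.+ s K.* a) K.+ ((K.- o) K.* d K.+ (K.- s) K.* a) K.≈ 0#
      cX {d} o eq a s = K.trans (lem d a s o) (K.trans (K.+-congˡ (K.-‿cong eq)) (K.-‿inverseʳ d))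
       where
       lem : ∀ d a s o -> (d K.+ s K.* a) K.+ ((K.- o) K.* d K.+ (K.- s) K.* a) K.≈ d K.+ K.- (o K.* d)
       lem = solve 4 (\ d a s o -> (d :+ s :* a) :+ ((:- o) :* d :+ (:- s) :* a) := d :+ :- (o :* d)) K.refl
     Sm : ∀ cs j D -> (∀ m -> cs m K.≈ ya y bs m) -> ∀ {f} -> To.Sub b1 cs q j D f -> ψ f K.≈ 0#
     Sm cs j D e (To.rel m _ h l) = dJ m _
     Sm cs j D e (To.img m _ h) = Pt cs (Q.suc m) (e (Q.suc m)) {D} (Si (\ (l , e) -> e2 (e0 _ _) l , e) h)
     Sm cs j D e To.none = uE
     Sm cs j D e (h To.+ h') = K.trans (u5 _ _) (K.trans (K.+-cong (Sm cs j D e h) (Sm cs j D e h')) (K.+-identityˡ _))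
     Sm cs j D e (To.resp p h) = K.trans (cy (sym p)) (Sm cs j D e h)
    bd : ∀ {s cs q D f} -> To.Sub s cs q 0 D f -> ψ f K.≈ 0#
    bd (To.rel m _ h l) = dJ m _
    bd To.none = uE
    bd (h To.+ h') = K.trans (u5 _ _) (K.trans (K.+-cong (bd h) (bd h')) (K.+-identityˡ _))
    bd (To.resp p h) = K.trans (cy (sym p)) (bd h)
    opaque
     Ev : Pb -> Carrier
     Ev g = fun τ (act (ι g * ua fb) (vac n))
     Ea : ∀ {g h} -> g ≈ᴾ h -> Ev g K.≈ Ev h
     Ea e = f-cong τ (act-resp (*-congʳ {ua fb} (un e)) (vac n))
     Eb : ∀ {a s} -> Ab a s -> ∀ g -> Ev (a ⊠ g) K.≈ s K.* Ev g
     Eb h g = K.trans (f-cong τ (h (act (ι g * ua fb) (vac n)))) (f-* τ _ _)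
     El : ∀ {i κ e} -> place i ≡ inZero κ -> toℕ κ < e -> ∀ g -> Ev (var i ^ᴾ e ⊠ g) K.≈ 0#
     El {e = e} p l g = kc {e = e} p l (act (ι g * ua fb) (vac n))
     Eg : ∀ g h -> Ev (g ⊞ h) K.≈ Ev g K.+ Ev h
     Eg g h = f-+ τ _ _
     Ei : ∀ {u g} -> ap (φs bs) u ≈Ω ι g * ua fb -> ψ u K.≈ Ev g
     Ei e = f-cong τ (act-resp e (vac n))
    open Sn P.*-commutativeMonoid using () renaming (∑ to ∏; ue to ∏-0; sf to ∏-suc)
    open Km using () renaming (∑ to ∏K; ue to ∏K-0; sf to ∏K-suc; uj to ∏K-one)
    monomial : ∀ {m j} -> (Fin m -> Sl) -> (Fin j -> Fin m) -> (Fin j -> O) -> i9.Carrierᴹ (V m) -> i9.Carrierᴹ (V m)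
    monomial {j = Q.zero} s f e v = v
    monomial {j = Q.suc j} s f e v = ir s (f zero) (e zero) (monomial s (f ∘ suc) (e ∘ suc) v)
    wj : ∀ {m j} -> (Fin j -> Fin m) -> i9.Carrierᴹ (V m) -> i9.Carrierᴹ (V m)
    wj {j = Q.zero} f v = v
    wj {m} {j = Q.suc j} f v = fun (Θ {m} (f zero)) (wj {m} (f ∘ suc) v)
    ix : ∀ {m} (s : Fin m -> Sl) i e {u v} -> i9._≈ᴹ_ (V m) u v -> i9._≈ᴹ_ (V m) (ir s i e u) (ir s i e v)
    ix s i Q.zero h = h
    ix s i (Q.suc e) h = f-cong (X s i) (ix s i e h)
    aI : ∀ {j} (f : Fin j -> Fin n) e v -> act (ι (∏ \ i -> var (f i) ^ᴾ e i)) v VL.≈ᴹ monomial sw f e v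
    aI {Q.zero} f e v = VL.≈ᴹ-trans (act-resp (un (∏-0 _)) v) (VL.*ₗ-identityˡ v)
    aI {Q.suc j} f e v = VL.≈ᴹ-trans (act-resp (un (∏-suc _)) v) (VL.≈ᴹ-trans (ay (f zero) (e zero) _) (ix sw (f zero) (e zero) (aI (f ∘ suc) (e ∘ suc) v)))
    aJ : ∀ {j} (f : Fin j -> Fin n) v -> act (θs (mem f fb)) v VL.≈ᴹ wj {n} f v
    aJ {Q.zero} f v = VL.*ₗ-identityˡ v
    aJ {Q.suc j} f v = f-cong (Θ (f zero)) (aJ (f ∘ suc) v)
    sY : ∀ m -> i9.Carrierᴹ (V m)
    sY Q.zero = 1#
    sY (Q.suc m) = pd m (b2 , 0) (sY m)
    pW : ∀ m a {u v} -> i9._≈ᴹ_ (V m) u v -> i9._≈ᴹ_ (V (Q.suc m)) (pd m a u) (pd m a v)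
    pW m (b , e) h (b' , e') with b Data.Bool.≟ b' | e Q.≟ e'
    ... | yes _ | yes _ = h
    ... | yes _ | no _ = i9.≈ᴹ-refl (V m)
    ... | no _ | _ = i9.≈ᴹ-refl (V m)
    wl : ∀ {m j} (f : Fin j -> Fin m) v -> i9._≈ᴹ_ (V (Q.suc m)) (wj {Q.suc m} (suc ∘ f) (pd m (b1 , 0) v)) (pd m (b1 , 0) (wj {m} f v))
    wl {m} {Q.zero} f v = i9.≈ᴹ-refl (V (Q.suc m))
    wl {m} {Q.suc j} f v = i9.≈ᴹ-trans (V (Q.suc m)) (f-cong (Θ {Q.suc m} (suc (f zero))) (wl {m} (f ∘ suc) v)) sg
     where
     w = wj {m} (f ∘ suc) v
     sg : i9._≈ᴹ_ (V (Q.suc m)) (fun (Θ (suc (f zero))) (pd m (b1 , 0) w)) (pd m (b1 , 0) (fun (Θ (f zero)) w))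
     sg (b1 , Q.zero) = i9.≈ᴹ-refl (V m)
     sg (b1 , Q.suc e) = f-0 (Θ (f zero))
     sg (b2 , e) = i9.≈ᴹ-trans (V m) (i9.-ᴹ‿cong (V m) (f-0 (Θ (f zero)))) (La.-0ᴹ (V m))
    wk : ∀ m -> i9._≈ᴹ_ (V m) (wj {m} id (vac m)) (sY m)
    wk Q.zero = K.refl
    wk (Q.suc m) = i9.≈ᴹ-trans (V (Q.suc m)) (f-cong (Θ {Q.suc m} zero) (i9.≈ᴹ-trans (V (Q.suc m)) (wl {m} id (vac m)) (pW m (b1 , 0) (wk m)))) sg
     where
     sg : i9._≈ᴹ_ (V (Q.suc m)) (fun (Θ {Q.suc m} zero) (pd m (b1 , 0) (sY m))) (pd m (b2 , 0) (sY m))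
     sg (b1 , e) = i9.≈ᴹ-refl (V m)
     sg (b2 , Q.zero) = i9.≈ᴹ-refl (V m)
     sg (b2 , Q.suc e) = i9.≈ᴹ-refl (V m)
    i3 : ∀ {m} (s : Fin (Q.suc m) -> Sl) i e v -> i9._≈ᴹ_ (V (Q.suc m)) (ir s (suc i) e (pd m (b2 , 0) v)) (pd m (b2 , 0) (ir (s ∘ suc) i e v))
    i3 {m} s i Q.zero v = i9.≈ᴹ-refl (V (Q.suc m))
    i3 {m} s i (Q.suc e) v = i9.≈ᴹ-trans (V (Q.suc m)) (f-cong (X s (suc i)) (i3 s i e v)) sg
     where
     w = ir (s ∘ suc) i e v
     sg : i9._≈ᴹ_ (V (Q.suc m)) (fun (X s (suc i)) (pd m (b2 , 0) w)) (pd m (b2 , 0) (fun (X (s ∘ suc) i) w))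
     sg (b1 , e) = f-0 (X (s ∘ suc) i)
     sg (b2 , Q.zero) = i9.≈ᴹ-refl (V m)
     sg (b2 , Q.suc e) = f-0 (X (s ∘ suc) i)
    mv : ∀ {m j} (s : Fin (Q.suc m) -> Sl) (f : Fin j -> Fin m) e v -> i9._≈ᴹ_ (V (Q.suc m)) (monomial s (suc ∘ f) e (pd m (b2 , 0) v)) (pd m (b2 , 0) (monomial (s ∘ suc) f e v))
    mv {m} {Q.zero} s f e v = i9.≈ᴹ-refl (V (Q.suc m))
    mv {m} {Q.suc j} s f e v = i9.≈ᴹ-trans (V (Q.suc m)) (ix s (suc (f zero)) (e zero) (mv s (f ∘ suc) (e ∘ suc) v)) (i3 s (f zero) (e zero) _)
    mt : ∀ {m j} (s : Fin m -> Sl) (f : Fin j -> Fin m) e {u v} -> i9._≈ᴹ_ (V m) u v -> i9._≈ᴹ_ (V m) (monomial s f e u) (monomial s f e v)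
    mt {j = Q.zero} s f e h = h
    mt {j = Q.suc j} s f e h = ix s (f zero) (e zero) (mt s (f ∘ suc) (e ∘ suc) h)
    tm : ∀ {m} (s : Fin m -> Sl) e -> fun (top s) (monomial s id e (sY m)) K.≈ ∏K (\ i -> loc (s i) (e i))
    tm {Q.zero} s e = K.sym (∏K-0 _)
    tm {Q.suc m} s e = K.trans (f-cong (top (s ∘ suc)) (i9.≈ᴹ-trans (V m) (ix s zero (e zero) (mv s id (e ∘ suc) (sY m)) (b2 , eb (s zero))) (r9 (s zero) U.refl (e zero) _))) (K.trans (f-* (top (s ∘ suc)) _ _) (K.trans (K.*-congˡ (tm (s ∘ suc) (e ∘ suc))) (K.sym (∏K-suc _))))
     where
     open i9 (V m) using (_≈ᴹ_; ≈ᴹ-refl; ≈ᴹ-sym; ≈ᴹ-trans; _*ₗ_; *ₗ-congˡ; *ₗ-assoc; *ₗ-identityˡ; *ₗ-zeroˡ)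
     tow : O -> i9.Carrierᴹ (V m) -> i9.Carrierᴹ (V (Q.suc m))
     tow e w = ir s zero e (pd m (b2 , 0) w)
     bot : ∀ {z κ} -> z ≡ coefficient κ -> ∀ v -> fun (mu {m} z) v (b2 , 0) ≈ᴹ i9.0ᴹ (V m)
     bot U.refl v = ≈ᴹ-refl
     lo : ∀ {z κ} -> z ≡ coefficient κ -> ∀ v j -> fun (mu {m} z) v (b2 , Q.suc j) ≈ᴹ v (b2 , j)
     lo U.refl v j = ≈ᴹ-refl
     at : ∀ {κ} -> s zero ≡ coefficient κ -> ∀ e j w -> tow e w (b2 , j) ≈ᴹ loc (coefficient j) e *ₗ w
     at p Q.zero Q.zero w = ≈ᴹ-sym (*ₗ-identityˡ w)
     at p Q.zero (Q.suc j) w = ≈ᴹ-sym (*ₗ-zeroˡ w)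
     at p (Q.suc e) Q.zero w = ≈ᴹ-trans (bot p _) (≈ᴹ-sym (*ₗ-zeroˡ w))
     at p (Q.suc e) (Q.suc j) w = ≈ᴹ-trans (lo p _ j) (at p e j w)
     r9 : ∀ z -> s zero ≡ z -> ∀ e w -> tow e w (b2 , eb (s zero)) ≈ᴹ loc (s zero) e *ₗ w
     r9 (coefficient κ) p e w = U.subst (\ z -> tow e w (b2 , eb z) ≈ᴹ loc z e *ₗ w) (U.sym p) (at p e κ w)
     r9 (va t) p e w = U.subst (\ z -> tow e w (b2 , eb z) ≈ᴹ loc z e *ₗ w) (U.sym p) (go e)
      where
      go : ∀ e -> tow e w (b2 , 0) ≈ᴹ (t ^ e) *ₗ w
      go Q.zero = ≈ᴹ-sym (*ₗ-identityˡ w)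
      go (Q.suc e) = ≈ᴹ-trans (Xb s zero p (tow e w) (b2 , 0)) (≈ᴹ-trans (*ₗ-congˡ (go e)) (≈ᴹ-sym (*ₗ-assoc t _ w)))
    opaque
     unfolding Ev
     Eh : (e : Fin n -> O) -> Ev (∏ \ i -> var i ^ᴾ e i) K.≈ ∏K (\ i -> loc (sw i) (e i))
     Eh e = K.trans (f-cong τ (VL.≈ᴹ-trans (aI id e (act (ua fb) (vac n))) (mt sw id e (VL.≈ᴹ-trans (aJ id (vac n)) (wk n))))) (tm sw e)
    Er : Ev (∏ \ i -> var i ^ᴾ eb (sw i)) K.≈ 1#
    Er = K.trans (Eh (eb ∘ sw)) (∏K-one \ i -> l3 (sw i))
    p5 : {b b' : Fin k} {κ κ' : Fin r} -> inBlock b κ ≡ inBlock b' κ' -> b ≡ b'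
    p5 U.refl = U.refl
    lD : ∀ (J : Vec Bool n) {i} j -> lookup J i ≡ b2 -> lookup (J [ j ]≔ b2) i ≡ b2
    lD J {i} j e with i ≟ j
    ... | yes U.refl = lookup∘update i J b2
    ... | no p = U.trans (lookup∘update′ p J b2) e
    module Rf (re : Fin k -> Fin n) (colour : Fin k -> Fin r) (r0 : ∀ {b} -> b ∈ bs -> place (re b) ≡ inBlock b (colour b)) where
     sR : ∀ {b} -> b ∈ bs -> ∀ J -> (∀ {i κ} -> place i ≡ inBlock b κ -> i ≡ re b ⊎ lookup J i ≡ b2) -> η (φ b) * ua J ≈Ω scalar (inv (colour b)) * (θ (re b) * ua J)
     sR {b} m J ot = trans (ub _ _) (trans (∑Ω-single _ (re b) \ i p -> trans (*-assoc _ _ _) (ve i p (place i) U.refl)) (trans (*-assoc _ _ _) (*-congʳ (scalar-≈ (K.reflexive (mx (r0 m)))))))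
      where
      ve : ∀ i -> i ≢ re b -> ∀ z -> place i ≡ z -> scalar (me b (place i)) * (θ i * ua J) ≈Ω 0Ω
      ve i p (inZero κ) e = trans (*-congʳ (scalar-≈ (K.reflexive (mp b e)))) (zeroˡ _)
      ve i p (inBlock b' κ) e with b ≟ b'
      ... | no b≢b' = trans (*-congʳ (scalar-≈ (K.reflexive (mn e b≢b')))) (zeroˡ _)
      ... | yes U.refl with ot e
      ... | i1 i≡ = ⊥-elim (p i≡)
      ... | i2 ii = trans (*-congˡ (ip id J i ii)) (zeroʳ _)
     i7 : ∀ κ -> Inv (inv κ)
     i7 κ = pow κ , K.trans (K.*-comm _ _) (pf κ)
     t9 : ∀ cs J -> Unique cs -> (∀ {b} -> b ∈ cs -> b ∈ bs) -> (∀ {b} -> b ∈ cs -> lookup J (re b) ≡ b1) -> (∀ {b} -> b ∈ cs -> ∀ {i κ} -> place i ≡ inBlock b κ -> i ≡ re b ⊎ lookup J i ≡ b2) -> (∀ i -> lookup J i ≡ b2 ⊎ Σ (Fin k) \ b -> (b ∈ cs) × (i ≡ re b)) -> Σ Carrier \ s -> Inv s × (ap (φs cs) (ua J) ≈Ω scalar s * ua fb)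
     t9 [] J u sub fr ot cov = 1# , Ih , trans (ΩR.reflexive (U.cong ua (aL J \ i -> hq (cov i)))) (sym (*-identityˡ _))
      where
      hq : ∀ {i} -> lookup J i ≡ b2 ⊎ (Σ (Fin k) \ b -> (b ∈ []) × (i ≡ re b)) -> lookup J i ≡ b2
      hq (i1 e) = e
     t9 (b ∷ cs) J (b∉ AllPairs.∷ u) sub fr ot cov = ad (io id J (re b) (fr (here U.refl))) (t9 cs (J [ re b ]≔ b2) u (\ m -> sub (there m)) fre (\ m p -> [ i1 , (\ q -> i2 (lD J (re b) q)) ]′ (ot (there m) p)) g8)
      where
      fre : ∀ {b'} -> b' ∈ cs -> lookup (J [ re b ]≔ b2) (re b') ≡ b1
      fre {b'} m = U.trans (lookup∘update′ dis J b2) (fr (there m))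
       where
       dis : re b' ≢ re b
       dis q = All.lookup b∉ m (U.sym (p5 (U.trans (U.sym (r0 (sub (there m)))) (U.trans (U.cong place q) (r0 (sub (here U.refl)))))))
      g8 : ∀ i -> lookup (J [ re b ]≔ b2) i ≡ b2 ⊎ Σ (Fin k) \ b -> (b ∈ cs) × (i ≡ re b)
      g8 i with cov i
      ... | i1 q = i1 (lD J (re b) q)
      ... | i2 (b , here U.refl , U.refl) = i1 (lookup∘update i J b2)
      ... | i2 (b' , there m , q) = i2 (b' , m , q)
      sta : ap (φs cs) (η (φ b) * ua J) ≈Ω scalar (inv (colour b)) * ap (φs cs) (θ (re b) * ua J)
      sta = trans (ag (φs cs) (sR (sub (here U.refl)) J (ot (here U.refl)))) (a4 (φs cs) _ _)
      ad : θ (re b) * ua J ≈± ua (J [ re b ]≔ b2) -> (Σ Carrier \ s -> Inv s × (ap (φs cs) (ua (J [ re b ]≔ b2)) ≈Ω scalar s * ua fb)) -> Σ Carrier \ s -> Inv s × (ap (φs cs) (η (φ b) * ua J) ≈Ω scalar s * ua fb)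
      ad (pb q) (s , i , e) = inv (colour b) K.* s , Ie (i7 (colour b)) i , trans sta (trans (*-congˡ (trans (ag (φs cs) q) e)) (trans (sym (*-assoc _ _ _)) (*-congʳ (sym (scalar-* _ _)))))
      ad (mi q) (s , i , e) = inv (colour b) K.* (K.- 1# K.* s) , Ie (i7 (colour b)) (Ie (Il Ih) i) , trans sta (trans (*-congˡ (trans (ag (φs cs) q) (trans (a4 (φs cs) _ _) (trans (*-congˡ e) (trans (sym (*-assoc _ _ _)) (*-congʳ (sym (scalar-* _ _)))))))) (trans (sym (*-assoc _ _ _)) (*-congʳ (sym (scalar-* _ _)))))
     rk : List (Fin k) -> O
     rk [] = 0
     rk (b ∷ cs) = toℕ (re b) Q.+ rk cs
     module _ (min : ∀ {i b κ} -> place i ≡ inBlock b κ -> toℕ (re b) ≤ toℕ i) where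
      Ha : Vec Bool n -> List (Fin k) -> Set
      Ha J cs = (weight id (fb {n}) < weight id J Q.+ rk cs) ⊎ (weight id (fb {n}) ≤ weight id J Q.+ rk cs) × Σ (Fin k) \ b -> (b ∈ cs) × (lookup J (re b) ≡ b2)
      hd : ∀ cs J -> Ha J cs -> ap (φs cs) (ua J) ≈Ω 0Ω
      hd [] J (i1 h) = ⊥-elim (Q.<⇒≱ h (e2 (e1 (e5 _)) (wb id J)))
      hd (b ∷ cs) J h = trans (ag (φs cs) (ub _ _)) (trans (aY (φs cs) _) (∑Ω-zero \ i -> term i (place i) U.refl))
       where
       zd : ∀ {s} i -> s ≡ 0# -> ap (φs cs) (scalar s * θ i * ua J) ≈Ω 0Ω
       zd i U.refl = trans (ag (φs cs) (trans (*-congʳ (zeroˡ _)) (zeroˡ _))) (aT (φs cs))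
       term : ∀ i z -> place i ≡ z -> ap (φs cs) (scalar (me b (place i)) * θ i * ua J) ≈Ω 0Ω
       term i (inZero κ) e = zd i (mp b e)
       term i (inBlock b' κ) e with b ≟ b'
       ... | no b≢b' = zd i (mn e b≢b')
       ... | yes U.refl with lookup J i in ii
       ... | b2 = trans (ag (φs cs) (trans (*-assoc _ _ _) (trans (*-congˡ (ip id J i ii)) (zeroʳ _)))) (aT (φs cs))
       ... | b1 = trans (ag (φs cs) (*-assoc _ _ _)) (trans (a4 (φs cs) _ _) (trans (*-congˡ (zb (aP (φs cs) (io id J i ii)) (hd cs (J [ i ]≔ b2) (hea h)))) (zeroʳ _)))
        where
        w = weight id J
        ρ = rk cs
        m₀ = toℕ (re b)
        tot : weight id (J [ i ]≔ b2) Q.+ ρ ≡ w Q.+ (toℕ i Q.+ ρ)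
        tot = U.trans (U.cong (Q._+ ρ) (U.trans (wc id J i ii) (e6 (toℕ i) w))) (e7 w _ _)
        gc : w Q.+ (m₀ Q.+ ρ) ≤ weight id (J [ i ]≔ b2) Q.+ ρ
        gc = e2 (Q.+-monoʳ-≤ w (Q.+-monoˡ-≤ ρ (min e))) (e1 (U.sym tot))
        hea : Ha J (b ∷ cs) -> Ha (J [ i ]≔ b2) cs
        hea (i1 l) = i1 (e4 l gc)
        hea (i2 (l , b' , there m , q)) = i2 (e2 l gc , b' , m , lD J i q)
        hea (i2 (l , _ , here U.refl , q)) = i1 (Q.≤-<-trans l (e4 (Q.+-monoʳ-< w (Q.+-monoˡ-< ρ str)) (e1 (U.sym tot))))
         where
         str : m₀ < toℕ i
         str with Q.m≤n⇒m<n∨m≡n (min e)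
         ... | i1 l = l
         ... | i2 q′ with () <- U.trans (U.sym ii) (U.trans (U.cong (lookup J) (U.sym (toℕ-injective q′))) q)
  uz : {A B : Set} (f : A -> List B) (key : B -> A) -> (∀ a {x} -> x ∈ f a -> key x ≡ a) -> (∀ a -> Unique (f a)) -> ∀ {as} -> Unique as -> Unique (concatMap f as)
  uz f key h u [] = []
  uz f key h u {a ∷ as} (a∉ ∷ v) = ++⁺ (u a) (uz f key h u v)
   \ (m , m') -> let b , b∈ , m″ = ori as m' in All.lookup a∉ b∈ (U.trans (U.sym (h a m)) (h b m″))
   where
   ori : ∀ bs {x} -> x ∈ concatMap f bs -> Σ _ \ b -> (b ∈ bs) × (x ∈ f b)
   ori (b ∷ bs) m with ∈-++⁻ (f b) m
   ... | i1 m' = b , here U.refl , m'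
   ... | i2 m' with c , c∈ , m″ <- ori bs m' = c , there c∈ , m″
  uu : ∀ n q -> Unique (ch n q)
  uu Q.zero Q.zero = All.[] ∷ []
  uu Q.zero (Q.suc q) = []
  uu (Q.suc n) Q.zero = map⁺ (\ { U.refl -> U.refl }) (uu n 0)
  uu (Q.suc n) (Q.suc q) = ++⁺ (map⁺ (\ { U.refl -> U.refl }) (uu n (Q.suc q))) (map⁺ (\ { U.refl -> U.refl }) (uu n q)) \ (m , m') -> dm (p2 (p2 (∈-map⁻ (b1 ∷_) m))) (p2 (p2 (∈-map⁻ (b2 ∷_) m')))
   where
   dm : ∀ {J J' J″} -> J ≡ b1 ∷ J' -> J ≡ b2 ∷ J″ -> _
   dm U.refl ()
  lp : {A : Set} {as : List A} -> Unique as -> ∀ i j -> List.lookup as i ≡ List.lookup as j -> i ≡ j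
  lp (_ ∷ _) zero zero e = U.refl
  lp (a∉ ∷ _) zero (suc j) e = ⊥-elim (All.lookup a∉ (∈-lookup j) e)
  lp (a∉ ∷ _) (suc i) zero e = ⊥-elim (All.lookup a∉ (∈-lookup i) (U.sym e))
  lp (_ ∷ u) (suc i) (suc j) e = U.cong suc (lp u i j e)
  module Dig where
   open Bnd
   -- C counts the preceding indices outside the subset.
   data Di : ∀ {m} -> O -> Vec Bool m -> Set where
    end : ∀ {C} -> Di C []
    inn : ∀ {m C} {J : Vec Bool m} -> Fin (r Q.∸ 1 Q.+ r Q.* C) -> Di C J -> Di C (b2 ∷ J)
    out : ∀ {m C} {J : Vec Bool m} -> O -> Di (Q.suc C) J -> Di C (b1 ∷ J)
   db : ∀ {m C} {J : Vec Bool m} -> Di C J -> O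
   db end = 0
   db (inn t d) = toℕ t Q.+ db d
   db (out t d) = t Q.+ db d
   mix : ∀ {m} -> O -> Vec Bool m -> List (Maybe O)
   mix C [] = []
   mix C (b2 ∷ J) = just (r Q.∸ 1 Q.+ r Q.* C) ∷ mix C J
   mix C (b1 ∷ J) = nothing ∷ mix (Q.suc C) J
   em : ∀ {m} -> Vec Bool m -> O
   em [] = 0
   em (b2 ∷ J) = em J
   em (b1 ∷ J) = Q.suc (em J)
   eg : ∀ {m} (J : Vec Bool m) -> em J Q.+ sb J ≡ m
   eg [] = U.refl
   eg (b2 ∷ J) = U.trans (e8 _ _) (U.cong Q.suc (eg J))
   eg (b1 ∷ J) = U.cong Q.suc (eg J)
   ml : ∀ {m} C (J : Vec Bool m) -> mix C J ↭ map just (ins C J) ++ oc 0 (em J)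
   ml C [] = ↭-refl
   ml C (b2 ∷ J) = prep _ (ml C J)
   ml C (b1 ∷ J) = ↭-trans (prep nothing (ml (Q.suc C) J)) (↭-sym (Data.List.Relation.Binary.Permutation.Propositional.Properties.shift nothing (map just (ins (Q.suc C) J)) _))
   pair : {A B : Set} -> B -> A -> B × A
   pair b a = b , a
   bo : ∀ {A : Set} s -> (O -> List A) -> O -> List (Fin s × A)
   bo Q.zero g D = []
   bo (Q.suc s) g Q.zero = map (pair zero) (g 0)
   bo (Q.suc s) g (Q.suc D) = map (pair zero) (g (Q.suc D)) ++ map (Data.Product.Base.map₁ suc) (bo s g D)
   se : ∀ {m} C (J : Vec Bool m) -> O -> List (Di C J)
   se C [] D = end ∷ []
   se C (b2 ∷ J) D = map (\ (t , d) -> inn t d) (bo _ (se C J) D)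
   se C (b1 ∷ J) D = map (\ (t , d) -> out (toℕ t) d) (bo (Q.suc D) (se (Q.suc C) J) D)
   lq : ∀ {A : Set} s (g : O -> List A) h -> (∀ D -> length (g D) ≡ h D) -> ∀ D -> length (bo s g D) ≡ sp (just s) h D
   lq Q.zero g h e D = U.refl
   lq (Q.suc s) g h e Q.zero = U.trans (length-map (pair zero) (g 0)) (e 0)
   lq (Q.suc s) g h e (Q.suc D) = U.trans (length-++ (map (pair zero) (g (Q.suc D)))) (U.cong₂ Q._+_ (U.trans (length-map (pair zero) (g (Q.suc D))) (e (Q.suc D))) (U.trans (length-map (Data.Product.Base.map₁ suc) (bo s g D)) (lq s g h e D)))
   lu : ∀ {m} C (J : Vec Bool m) D -> length (se C J D) ≡ tu (mix C J) D
   lu C [] D = U.refl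
   lu C (b2 ∷ J) D = U.trans (length-map _ (bo (r Q.∸ 1 Q.+ r Q.* C) (se C J) D)) (lq (r Q.∸ 1 Q.+ r Q.* C) (se C J) (tu (mix C J)) (lu C J) D)
   lu C (b1 ∷ J) D = U.trans (length-map _ (bo (Q.suc D) (se (Q.suc C) J) D)) (U.trans (lq (Q.suc D) (se (Q.suc C) J) _ (lu (Q.suc C) J) D) (U.sym (sz (Q.suc D) (tu (mix (Q.suc C) J)) D (Q.n<1+n D))))
   uy : ∀ {A : Set} s (g : O -> List A) -> (∀ D -> Unique (g D)) -> ∀ D -> Unique (bo s g D)
   uy Q.zero g u D = []
   uy (Q.suc s) g u Q.zero = map⁺ (\ { U.refl -> U.refl }) (u 0)
   uy (Q.suc s) g u (Q.suc D) = ++⁺ (map⁺ (\ { U.refl -> U.refl }) (u (Q.suc D))) (map⁺ (\ { U.refl -> U.refl }) (uy s g u D)) \ (m , m') -> dm (p2 (p2 (∈-map⁻ (pair zero) m))) (p2 (p2 (∈-map⁻ (Data.Product.Base.map₁ suc) m')))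
    where
    dm : ∀ {A : Set} {x : Fin (Q.suc s) × A} {a b} -> x ≡ (zero , a) -> x ≡ Data.Product.Base.map₁ suc b -> _
    dm U.refl ()
   u2 : ∀ {m} C (J : Vec Bool m) D -> Unique (se C J D)
   u2 C [] D = All.[] ∷ []
   u2 C (b2 ∷ J) D = map⁺ (\ { U.refl -> U.refl }) (uy _ _ (u2 C J) D)
   u2 C (b1 ∷ J) D = map⁺ injective (uy (Q.suc D) _ (u2 (Q.suc C) J) D)
    where
    injective : {p p′ : Fin (Q.suc D) × Di (Q.suc C) J} -> out (toℕ (p1 p)) (p2 p) ≡ out (toℕ (p1 p′)) (p2 p′) -> p ≡ p′
    injective {t , d} {t′ , d'} e = U.cong₂ _,_ (toℕ-injective (p1 (pQ e))) (p2 (pQ e))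
     where
     pQ : ∀ {t t′ d d'} -> _≡_ {A = Di C (b1 ∷ J)} (out t d) (out t′ d') -> (t ≡ t′) × (d ≡ d')
     pQ U.refl = U.refl , U.refl
   bk : ∀ {A : Set} s (g : O -> List A) (w : A -> O) -> (∀ D {a} -> a ∈ g D -> w a ≤ D) -> ∀ D {t a} -> (t , a) ∈ bo s g D -> toℕ t Q.+ w a ≤ D
   bk (Q.suc s) g w h Q.zero m with a , a∈ , U.refl <- ∈-map⁻ (pair zero) m = h 0 a∈
   bk (Q.suc s) g w h (Q.suc D) m with ∈-++⁻ (map (pair zero) (g (Q.suc D))) m
   ... | i1 m' with a , a∈ , U.refl <- ∈-map⁻ (pair zero) m' = h (Q.suc D) a∈
   ... | i2 m' with (t , a) , a∈ , U.refl <- ∈-map⁻ (Data.Product.Base.map₁ suc) m' = s≤s (bk s g w h D a∈)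
   sL : ∀ {m} C (J : Vec Bool m) D {d} -> d ∈ se C J D -> db d ≤ D
   sL C [] D (here U.refl) = z≤n
   sL C (b2 ∷ J) D m with (t , d) , d∈ , U.refl <- ∈-map⁻ (\ (t , d) -> inn t d) m = bk _ (se C J) db (sL C J) D d∈
   sL C (b1 ∷ J) D m with (t , d) , d∈ , U.refl <- ∈-map⁻ (\ (t , d) -> out (toℕ t) d) m = bk _ (se (Q.suc C) J) db (sL (Q.suc C) J) D d∈
   data Exc : ∀ {m C} {J : Vec Bool m} -> Di C J -> Di C J -> Set where
    iF : ∀ {m C} {J : Vec Bool m} {t u} {d e : Di C J} -> toℕ t < toℕ u -> Exc (inn t d) (inn u e)
    iJ : ∀ {m C} {J : Vec Bool m} {t u} {d e : Di C J} -> Exc d e -> Exc (inn t d) (inn u e)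
    o3 : ∀ {m C} {J : Vec Bool m} {t u} {d e : Di (Q.suc C) J} -> t < u -> Exc (out t d) (out u e)
    o4 : ∀ {m C} {J : Vec Bool m} {t u} {d e : Di (Q.suc C) J} -> Exc d e -> Exc (out t d) (out u e)
   c6 : ∀ {m C} {J : Vec Bool m} (d e : Di C J) -> Exc d e ⊎ (db e ≤ db d × (db d ≤ db e -> d ≡ e))
   c6 end end = i2 (z≤n , \ _ -> U.refl)
   c6 (inn t d) (inn u e) with toℕ t Q.<? toℕ u | c6 d e
   ... | Relation.Nullary.yes l | _ = i1 (iF l)
   ... | Relation.Nullary.no _ | i1 x = i1 (iJ x)
   ... | Relation.Nullary.no ¬l | i2 (l , h) = i2 (Q.+-mono-≤ (Q.≮⇒≥ ¬l) l , \ l' ->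
      let t≤u = Q.+-cancelʳ-≤ (db d) _ _ (e2 l' (Q.+-monoʳ-≤ (toℕ u) l))
          t≡u = toℕ-injective (Q.≤-antisym t≤u (Q.≮⇒≥ ¬l))
      in U.cong₂ inn t≡u (h (Q.+-cancelˡ-≤ (toℕ t) _ _ (e2 l' (Q.+-monoˡ-≤ _ (Q.≮⇒≥ ¬l))))))
   c6 (out t d) (out u e) with t Q.<? u | c6 d e
   ... | Relation.Nullary.yes l | _ = i1 (o3 l)
   ... | Relation.Nullary.no _ | i1 x = i1 (o4 x)
   ... | Relation.Nullary.no ¬l | i2 (l , h) = i2 (Q.+-mono-≤ (Q.≮⇒≥ ¬l) l , \ l' ->
      let t≤u = Q.+-cancelʳ-≤ (db d) _ _ (e2 l' (Q.+-monoʳ-≤ u l))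
          t≡u = Q.≤-antisym t≤u (Q.≮⇒≥ ¬l)
      in U.cong₂ out t≡u (h (Q.+-cancelˡ-≤ t _ _ (e2 l' (Q.+-monoˡ-≤ _ (Q.≮⇒≥ ¬l))))))
  module S7 where
   open K using (Carrier; 0#; 1#; ring)
   open Kg using (_^_)
   open Bas
   open Cc
   open Wo hiding (X)
   open Bnd
   open Dig
   open Tg
   open Pa using (Place; inZero; inBlock)
   open Ro using (1^; pow; pK; ph)
   open Col using (ug)
   open Kj
   open Kn using (solve; _:=_; _:+_; _:*_; _:-_; :-_)
   open Ca using (Sur)
   -- Differences of multiples of roots of unity by distinct integers.
   pF : ∀ a b m -> Σ Carrier \ q -> (a K.- b) K.* q K.≈ a ^ m K.- b ^ m
   pF a b Q.zero = 0# , K.trans (K.zeroʳ _) (K.sym (K.-‿inverseʳ 1#))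
   pF a b (Q.suc m) with q , e <- pF a b m = a K.* q K.+ b ^ m , K.trans (lF a b q (b ^ m)) (K.trans (K.+-congʳ (K.*-congˡ e)) (ld a b (a ^ m) (b ^ m)))
    where
    lF : ∀ a b q v -> (a K.- b) K.* (a K.* q K.+ v) K.≈ a K.* ((a K.- b) K.* q) K.+ (a K.- b) K.* v
    lF = solve 4 (\ a b q v -> (a :- b) :* (a :* q :+ v) := a :* ((a :- b) :* q) :+ (a :- b) :* v) K.refl
    ld : ∀ a b u v -> a K.* (u K.- v) K.+ (a K.- b) K.* v K.≈ a K.* u K.- b K.* v
    ld = solve 4 (\ a b u v -> a :* (u :- v) :+ (a :- b) :* v := a :* u :- b :* v) K.refl
   ro : (κ : Fin r) -> pow κ ^ r K.≈ 1#
   ro κ = K.trans (K.reflexive (U.cong (pow κ ^_) (U.sym (Q.*-identityʳ r)))) (pK κ 1)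
   nk : ∀ a m -> nat a ^ m K.≈ nat (a Q.^ m)
   nk a Q.zero = K.sym (K.+-identityʳ 1#)
   nk a (Q.suc m) = K.trans (K.*-congˡ (nk a m)) (K.sym (×1-homo-* a (a Q.^ m)))
    where open SemiringMult K.semiring using (×1-homo-*)
   iv : ∀ a b -> a Q.^ r ≡ b Q.^ r -> a ≡ b
   iv a b e with Q.<-cmp a b
   ... | tri≈ _ p _ = p
   ... | tri< l _ _ = ⊥-elim (Q.<⇒≢ (Q.^-monoˡ-< r l) e)
   ... | tri> _ _ l = ⊥-elim (Q.<⇒≢ (Q.^-monoˡ-< r l) (U.sym e))
   dk : ∀ (κ κ' : Fin r) a b -> a ≢ b -> Inv (pow κ K.* nat a K.- pow κ' K.* nat b)
   dk κ κ' a b a≢b with q , e <- pF (pow κ K.* nat a) (pow κ' K.* nat b) r = Ij (Ia (K.sym (K.trans e (K.+-cong (po κ a) (K.-‿cong (po κ' b))))) (Pe.nh K local char0 (a Q.^ r) (b Q.^ r) (\ p -> a≢b (iv a b p))))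
    where
    open Kr using (^-distrib-*)
    po : ∀ κ a -> (pow κ K.* nat a) ^ r K.≈ nat (a Q.^ r)
    po κ a = K.trans (^-distrib-* _ _ r) (K.trans (K.*-congʳ (ro κ)) (K.trans (K.*-identityˡ _) (nk a r)))
   Ic : ∀ a -> Inv (ζ ^ a)
   Ic Q.zero = Ih
   Ic (Q.suc a) = Ie (It r rw) (Ic a)
    where
    It : ∀ m -> ζ ^ m K.≈ 1# -> .{{NonZero m}} -> Inv ζ
    It (Q.suc m) e = ζ ^ m , e
   lE : (κ κ' : Fin r) -> toℕ κ < toℕ κ' -> Inv (pow κ' K.- pow κ)
   lE κ κ' l with j , e <- Q.m≤n⇒∃[o]m+o≡n l = Ia (K.trans (lem (ζ ^ toℕ κ) (ζ ^ Q.suc j) 1#) (K.+-cong (K.trans (K.sym (^-homo-* ζ (toℕ κ) (Q.suc j))) (K.reflexive (U.cong (ζ ^_) (U.trans (e8 (toℕ κ) j) e)))) (K.-‿cong (K.*-identityʳ _)))) (Ie (Ic (toℕ κ)) (apart (Q.suc j) (s≤s z≤n) (Q.≤-<-trans (e2 (e0 (Q.suc j) (toℕ κ)) (e1 (U.trans (e8 (toℕ κ) j) e))) (toℕ<n κ'))))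
    where
    open Kg using (^-homo-*)
    lem : ∀ a b o -> a K.* (b K.- o) K.≈ a K.* b K.- a K.* o
    lem = solve 3 (\ a b o -> a :* (b :- o) := a :* b :- a :* o) K.refl
   dl : {κ κ' : Fin r} -> κ ≢ κ' -> Inv (pow κ K.- pow κ')
   dl {κ} {κ'} p with Q.<-cmp (toℕ κ) (toℕ κ')
   ... | tri≈ _ e _ = ⊥-elim (p (toℕ-injective e))
   ... | tri> _ _ l = lE κ' κ l
   ... | tri< l _ _ = Ia (lem _ _) (Il (lE κ κ' l))
    where
    lem : ∀ a b -> K.- (a K.- b) K.≈ b K.- a
    lem = solve 2 (\ a b -> :- (a :- b) := b :- a) K.refl
   poi : Fin n -> O -> O
   poi i t = Q.suc (toℕ i Q.+ t Q.* n)
   p3 : ∀ {i j t u} -> poi i t ≡ poi j u -> (i ≡ j) × (t ≡ u)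
   p3 {i} {j} {t} {u} e = iB , Q.*-cancelʳ-≡ t u n (Q.+-cancelˡ-≡ (toℕ i) _ _ (U.trans (Q.suc-injective e) (U.cong (\ z -> toℕ z Q.+ u Q.* n) (U.sym iB))))
    where
    instance
     ns : NonZero n
     ns = Q.>-nonZero (e2 (s≤s z≤n) (toℕ<n i))
    rO : ∀ (i : Fin n) t -> (toℕ i Q.+ t Q.* n) % n ≡ toℕ i
    rO i t = U.trans ([m+kn]%n≡m%n (toℕ i) t n) (m<n⇒m%n≡m (toℕ<n i))
    iB : i ≡ j
    iB = toℕ-injective (U.trans (U.sym (rO i t)) (U.trans (U.cong (_% n) (Q.suc-injective e)) (rO j u)))
   nob : Fin 0 -> Fin n
   nob ()
   d3 : ∀ {C} -> (Fin C -> Fin n) -> Fin (r Q.∸ 1 Q.+ r Q.* C) -> Place n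
   d3 {C} ls t = [ inZero , (\ i -> inBlock (ls (p2 (remQuot {r} C i))) (p1 (remQuot {r} C i))) ]′ (splitAt (r Q.∸ 1) t)
   -- A block is labelled by its least element, of colour zero.
   pl : ∀ {m C} {J : Vec Bool m} -> (Fin m -> Fin n) -> (Fin C -> Fin n) -> Di C J -> Fin m -> Place n
   pl f ls (inn t d) zero = d3 ls t
   pl f ls (inn t d) (suc i) = pl (f ∘ suc) ls d i
   pl f ls (out t d) zero = inBlock (f zero) ug
   pl f ls (out t d) (suc i) = pl (f ∘ suc) (f zero Vector.∷ ls) d i
   pj : ∀ {m C} {J : Vec Bool m} -> (Fin m -> Fin n) -> Di C J -> Fin m -> O
   pj f (inn t d) zero = 0
   pj f (inn t d) (suc i) = pj (f ∘ suc) d i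
   pj f (out t d) zero = poi (f zero) t
   pj f (out t d) (suc i) = pj (f ∘ suc) d i
   oe : ∀ {m} (f : Fin m -> Fin n) J {b} -> b ∈ oa f J -> Σ (Fin m) \ i -> (b ≡ f i) × (lookup J i ≡ b1)
   oe f (b2 ∷ J) m with i , e , p <- oe (f ∘ suc) J m = suc i , e , p
   oe f (b1 ∷ J) (here U.refl) = zero , U.refl , U.refl
   oe f (b1 ∷ J) (there m) with i , e , p <- oe (f ∘ suc) J m = suc i , e , p
   u1 : ∀ {m} (f : Fin m -> Fin n) J -> (∀ {i j} -> f i ≡ f j -> i ≡ j) -> Unique (oa f J)
   u1 f [] inj = []
   u1 f (b2 ∷ J) inj = u1 (f ∘ suc) J \ e -> Data.Fin.Properties.suc-injective (inj e)
   u1 f (b1 ∷ J) inj = All.tabulate fr ∷ u1 (f ∘ suc) J \ e -> Data.Fin.Properties.suc-injective (inj e)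
    where
    fr : ∀ {b} -> b ∈ oa (f ∘ suc) J -> f zero ≢ b
    fr m e with i , p , _ <- oe (f ∘ suc) J m with () <- inj (U.trans e p)
   pt : ∀ {m C} {J : Vec Bool m} f (ls : Fin C -> Fin n) (d : Di C J) i {b κ} -> pl f ls d i ≡ inBlock b κ -> b ∈ oa f J ⊎ Σ (Fin C) \ l -> b ≡ ls l
   pt {C = C} f ls (inn t d) zero e with splitAt (r Q.∸ 1) t
   pt {C = C} f ls (inn t d) zero U.refl | i2 i = i2 (p2 (remQuot {r} C i) , U.refl)
   pt f ls (inn t d) (suc i) e = pt (f ∘ suc) ls d i e
   pt f ls (out t d) zero U.refl = i1 (here U.refl)
   pt f ls (out t d) (suc i) e with pt (f ∘ suc) (f zero Vector.∷ ls) d i e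
   ... | i1 m = i1 (there m)
   ... | i2 (zero , p) = i1 (here p)
   ... | i2 (suc l , p) = i2 (l , p)
   pu : ∀ {m C} {J : Vec Bool m} f (ls : Fin C -> Fin n) (d : Di C J) -> (∀ i j -> toℕ i < toℕ j -> toℕ (f i) < toℕ (f j)) -> (∀ l i -> toℕ (ls l) < toℕ (f i)) -> ∀ i {b κ} -> pl f ls d i ≡ inBlock b κ -> toℕ b ≤ toℕ (f i)
   pu {C = C} f ls (inn t d) mb bel zero e with splitAt (r Q.∸ 1) t
   pu {C = C} f ls (inn t d) mb bel zero U.refl | i2 i = Q.<⇒≤ (bel (p2 (remQuot {r} C i)) zero)
   pu f ls (inn t d) mb bel (suc i) e = pu (f ∘ suc) ls d (\ i j l -> mb (suc i) (suc j) (s≤s l)) (\ l i -> bel l (suc i)) i e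
   pu f ls (out t d) mb bel zero U.refl = e3
   pu f ls (out t d) mb bel (suc i) e = pu (f ∘ suc) (f zero Vector.∷ ls) d (\ i j l -> mb (suc i) (suc j) (s≤s l)) (\ { zero i -> mb zero (suc i) (s≤s z≤n) ; (suc l) i -> bel l (suc i) }) i e
   py : ∀ {m C} {J : Vec Bool m} f (ls : Fin C -> Fin n) (d : Di C J) i -> lookup J i ≡ b1 -> pl f ls d i ≡ inBlock (f i) ug
   py f ls (inn t d) (suc i) e = py (f ∘ suc) ls d i e
   py f ls (out t d) zero e = U.refl
   py f ls (out t d) (suc i) e = py (f ∘ suc) _ d i e
   wf : ∀ {m} (f : Fin m -> Fin n) J -> weight f J Q.+ List.foldr (\ b s -> toℕ b Q.+ s) 0 (oa f J) ≡ weight f (fb {m})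
   wf f [] = U.refl
   wf f (b2 ∷ J) = U.trans (e7 (toℕ (f zero)) _ _) (U.cong (toℕ (f zero) Q.+_) (wf (f ∘ suc) J))
   wf f (b1 ∷ J) = U.trans (U.sym (e7 w _ _)) (U.trans (U.cong (Q._+ s) (e6 w _)) (U.trans (e7 (toℕ (f zero)) w s) (U.cong (toℕ (f zero) Q.+_) (wf (f ∘ suc) J))))
    where
    w = weight (f ∘ suc) J
    s = List.foldr (\ b s -> toℕ b Q.+ s) 0 (oa (f ∘ suc) J)
   s6 : ∀ {m} (J J' : Vec Bool m) -> sb J ≤ sb J' -> J ≢ J' -> Σ (Fin m) \ i -> (lookup J i ≡ b1) × (lookup J' i ≡ b2)
   s6 [] [] l p = ⊥-elim (p U.refl)
   s6 (b1 ∷ J) (b2 ∷ J') l p = zero , U.refl , U.refl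
   s6 (b1 ∷ J) (b1 ∷ J') l p with i , e , e' <- s6 J J' l (\ q -> p (U.cong (b1 ∷_) q)) = suc i , e , e'
   s6 (b2 ∷ J) (b2 ∷ J') (s≤s l) p with i , e , e' <- s6 J J' l (\ q -> p (U.cong (b2 ∷_) q)) = suc i , e , e'
   s6 (b2 ∷ J) (b1 ∷ J') l p with i , e , e' <- s6 J J' (e2 (Q.n≤1+n _) l) (\ { U.refl -> Q.<⇒≱ (Q.n<1+n _) l }) = suc i , e , e'
   pre : ∀ {s} -> (Fin s -> Pb) -> Fin s -> Pb
   pre F zero = con 1#
   pre F (suc t) = F zero ⊠ pre (F ∘ suc) t
   pA : ∀ {s} (F : Fin s -> Pb) (t u : Fin s) -> toℕ t < toℕ u -> Σ Pb \ g -> pre F u ≈ᴾ F t ⊠ g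
   pA F zero (suc u) l = _ , P.refl
   pA F (suc t) (suc u) (s≤s l) with g , e <- pA (F ∘ suc) t u l = F zero ⊠ g , P.trans (P.*-congˡ e) (P.trans (P.sym (P.*-assoc _ _ _)) (P.trans (P.*-congʳ (P.*-comm _ _)) (P.*-assoc _ _ _)))
   pJ : ∀ {s} (F : Fin s -> Pb) (t u : Fin s) a -> toℕ t < toℕ u -> ((v : Fin s) -> toℕ v ≤ toℕ t -> F v ≡ a) -> Σ Pb \ g -> pre F u ≈ᴾ a ^ᴾ Q.suc (toℕ t) ⊠ g
   pJ F zero (suc u) a l h = _ , P.*-congʳ (P.trans (P.reflexive (h zero z≤n)) (P.sym (P.*-identityʳ a)))
   pJ F (suc t) (suc u) a (s≤s l) h with g , e <- pJ (F ∘ suc) t u a l (\ v l -> h (suc v) (s≤s l)) = g , P.trans (P.*-cong (P.reflexive (h zero z≤n)) e) (P.sym (P.*-assoc _ _ _))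
   px : ∀ {s} (F : Fin s -> Pb) (t : Fin s) a -> ((v : Fin s) -> toℕ v < toℕ t -> F v ≡ a) -> pre F t ≈ᴾ a ^ᴾ toℕ t
   px F zero a h = P.refl
   px F (suc t) a h = P.*-cong (P.reflexive (h zero (s≤s z≤n))) (px (F ∘ suc) t a \ v l -> h (suc v) (s≤s l))
   p0 : Fin n -> ∀ {s} -> Fin s -> Pb
   p0 j t = var j ⊟ con (nat (poi j (toℕ t)))
   fac : ∀ {m C} {J : Vec Bool m} -> (Fin m -> Fin n) -> (Fin C -> Fin n) -> Di C J -> Pb
   fac f ls end = con 1#
   fac f ls (inn t d) = pre (fd (f zero) ls) t ⊠ fac (f ∘ suc) ls d
   fac f ls (out t d) = pre (p0 (f zero)) (fromℕ t) ⊠ fac (f ∘ suc) (f zero Vector.∷ ls) d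
   p8 : ∀ {s} (F : Fin s -> Pb) -> (∀ i -> Pc 1 (F i)) -> ∀ t -> Pc (toℕ t) (pre F t)
   p8 F h zero = con 1#
   p8 F h (suc t) = h zero PD.⊠ p8 (F ∘ suc) (\ i -> h (suc i)) t
   fk : ∀ {m C} {J : Vec Bool m} f (ls : Fin C -> Fin n) (d : Di C J) -> Pc (db d) (fac f ls d)
   fk f ls end = con 1#
   fk f ls (inn t d) = p8 _ (fw (f zero) ls) t PD.⊠ fk (f ∘ suc) ls d
   fk f ls (out t d) = wea (e1 (toℕ-fromℕ t)) (p8 _ (\ i -> var _ PD.⊞ (con {d = 0} _ PD.⊠ con {d = 1} _)) (fromℕ t)) PD.⊠ fk (f ∘ suc) _ d
   f1 : ∀ {C} j (ls : Fin C -> Fin n) t -> toℕ t < r Q.∸ 1 -> fd j ls t ≡ var j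
   f1 j ls t l rewrite splitAt-< (r Q.∸ 1) t l = U.refl
   module At {Ja : Vec Bool n} (d₀ : Di 0 Ja) where
    place : Fin n -> Place n
    place = pl id nob d₀
    he : Fin n -> O
    he = pj id d₀
    lab : ∀ {i b κ} -> place i ≡ inBlock b κ -> b ∈ oa id Ja
    lab {i} {b} e = [ id , (\ (l , _) -> ⊥-elim (nq l)) ]′ (pt id nob d₀ i e)
     where
     nq : Fin 0 -> ⊥
     nq ()
    open Fx place (\ b -> nat (he b)) (oa id Ja) lab public
    open St using (eb; coefficient; va)
    open Sn P.*-commutativeMonoid using () renaming (∑ to ∏; ue to ∏-0; sf to ∏-suc)
    rL : ∀ {b} -> Σ (Fin n) (\ i -> (b ≡ i) × (lookup Ja i ≡ b1)) -> place b ≡ inBlock b ug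
    rL (i , U.refl , e) = py id nob d₀ i e
    open Rf id (\ _ -> ug) (\ m -> rL (oe id Ja m)) public
    Eva : Pb -> Pb -> Set (c ⊔ ℓ)
    Eva g h = Σ Carrier \ s -> Inv s × ∀ rb -> Ev (g ⊠ rb) K.≈ s K.* Ev (h ⊠ rb)
    Ep : ∀ {g h} -> g ≈ᴾ h -> Eva g h
    Ep e = 1# , Ih , \ rb -> K.trans (Ea (P.*-congʳ e)) (K.sym (K.*-identityˡ _))
    Ek : ∀ {g h g′ h'} -> Eva g h -> Eva g′ h' -> Eva (g ⊠ g′) (h ⊠ h')
    Ek {g} {h} {g′} {h'} (s , i , e) (s′ , i' , e') = s K.* s′ , Ie i i' , \ rb -> K.trans (Ea (P.*-assoc g g′ rb)) (K.trans (e (g′ ⊠ rb)) (K.trans (K.*-congˡ (K.trans (Ea (swap h g′ rb)) (K.trans (e' (h ⊠ rb)) (K.*-congˡ (Ea (P.trans (swap h' h rb) (P.sym (P.*-assoc h h' rb)))))))) (K.sym (K.*-assoc s s′ _))))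
     where
     swap : ∀ a b d -> a ⊠ (b ⊠ d) ≈ᴾ b ⊠ (a ⊠ d)
     swap a b d = P.trans (P.sym (P.*-assoc a b d)) (P.trans (P.*-congʳ (P.*-comm a b)) (P.*-assoc b a d))
    aU : ∀ {g h s} -> Inv s -> Ab g s -> h ≈ᴾ con 1# -> Eva g h
    aU {s = s} i a e = s , i , \ rb -> K.trans (Eb a rb) (K.*-congˡ (Ea (P.sym (P.trans (P.*-congʳ e) (P.*-identityˡ rb)))))
    p9 : ∀ {s} (F : Fin s -> Pb) (t : Fin s) -> ((u : Fin s) -> toℕ u < toℕ t -> Σ Carrier \ v -> Inv v × Ab (F u) v) -> Σ Carrier \ v -> Inv v × Ab (pre F t) v
    p9 F zero h = 1# , Ih , Ac 1#
    p9 F (suc t) h with v , i , a <- h zero (s≤s z≤n) | w , j , b <- p9 (F ∘ suc) t (\ u l -> h (suc u) (s≤s l)) = v K.* w , Ie i j , Af {F zero} {pre (F ∘ suc) t} a b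
    record Co {m C} {J : Vec Bool m} (f : Fin m -> Fin n) (ls : Fin C -> Fin n) (d : Di C J) : Set where
     field
      at : ∀ i -> place (f i) ≡ pl f ls d i
      tw : ∀ i -> lookup J i ≡ b1 -> he (f i) ≡ pj f d i
      bg : ∀ l -> place (ls l) ≡ inBlock (ls l) ug
      bf : ∀ l -> Σ O \ t -> he (ls l) ≡ poi (ls l) t
      injective : ∀ l l' -> ls l ≡ ls l' -> l ≡ l'
      bel : ∀ l i -> toℕ (ls l) < toℕ (f i)
      mb : ∀ i j -> toℕ i < toℕ j -> toℕ (f i) < toℕ (f j)
    sta : Co id nob d₀
    sta = record { at = \ _ -> U.refl ; tw = \ _ _ -> U.refl ; bg = \ () ; bf = \ () ; injective = \ () ; bel = \ () ; mb = \ _ _ l -> l }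
    nn : ∀ {m C} {J : Vec Bool m} {f : Fin (Q.suc m) -> Fin n} {ls : Fin C -> Fin n} {t} {d : Di C J} -> Co f ls (inn t d) -> Co (f ∘ suc) ls d
    nn c = record { at = \ i -> at (suc i) ; tw = \ i -> tw (suc i) ; bg = bg ; bf = bf ; injective = injective ; bel = \ l i -> bel l (suc i) ; mb = \ i j l -> mb (suc i) (suc j) (s≤s l) }
     where open Co c
    np : ∀ {m C} {J : Vec Bool m} {f : Fin (Q.suc m) -> Fin n} {ls : Fin C -> Fin n} {t} {d : Di (Q.suc C) J} -> Co f ls (out t d) -> Co (f ∘ suc) (f zero Vector.∷ ls) d
    np {f = f} {ls} {t} c = record { at = \ i -> at (suc i) ; tw = \ i -> tw (suc i) ; bg = \ { zero -> at zero ; (suc l) -> bg l } ; bf = \ { zero -> t , tw zero U.refl ; (suc l) -> bf l } ; injective = \ { zero zero e -> U.refl ; zero (suc l) e -> ⊥-elim (new l (U.sym e)) ; (suc l) zero e -> ⊥-elim (new l e) ; (suc l) (suc l') e -> U.cong suc (injective l l' e) } ; bel = \ { zero i -> mb zero (suc i) (s≤s z≤n) ; (suc l) i -> bel l (suc i) } ; mb = \ i j l -> mb (suc i) (suc j) (s≤s l) }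
     where
     open Co c
     new : ∀ l -> ls l ≢ f zero
     new l e = Q.<⇒≢ (bel l zero) (U.cong toℕ e)
    module _ {m C} {J : Vec Bool m} {f : Fin m -> Fin n} {ls : Fin C -> Fin n} {d : Di C J} (context : Co f ls d) where
     open Co context
     bA : ∀ l -> Ab (var (ls l)) (nat (he (ls l)))
     bA l = Ah {var (ls l)} (K.trans (K.*-congʳ ph) (K.*-identityˡ _)) (Ae (bg l))
     f0 : ∀ {j κ l} -> place j ≡ inBlock (ls l) κ -> ∀ t {i} -> splitAt (r Q.∸ 1) t ≡ i2 i -> Ab (fd j ls t) (pow κ K.* nat (he (ls l)) K.- pow (p1 (remQuot {r} C i)) K.* nat (he (ls (p2 (remQuot {r} C i)))))
     f0 {j} p t {i} e rewrite e = Ah {form} (K.+-congˡ (-1*x≈-x _)) (Ai {var j} {P.- (con ζ^a ⊠ var l)} (Ae p) (Af {con (K.- 1#)} {con ζ^a ⊠ var l} (Ac _) (Af {con ζ^a} {var l} (Ac _) (bA (p2 (remQuot {r} C i))))))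
      where
      open import Algebra.Properties.Ring ring using (-1*x≈-x)
      ζ^a = ζ ^ toℕ (p1 (remQuot {r} C i))
      l = ls (p2 (remQuot {r} C i))
      form = var j ⊟ con ζ^a ⊠ var l
     hh : ∀ l -> Inv (nat (he (ls l)))
     hh l = U.subst (\ z -> Inv (nat z)) (U.sym (p2 (bf l))) (char0 (toℕ (ls l) Q.+ p1 (bf l) Q.* n))
     vm : ∀ κ l -> Inv (pow κ K.* nat (he (ls l)))
     vm κ l = Ie (Ic (toℕ κ)) (hh l)
     fA : ∀ {j} t {i} -> splitAt (r Q.∸ 1) t ≡ i2 i -> place j ≡ inBlock (ls (p2 (remQuot {r} C i))) (p1 (remQuot {r} C i)) -> ∀ u -> u ≢ t -> Σ Carrier \ v -> Inv v × Ab (fd j ls u) v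
     fA {j} t {i} e p u u≢t = go (splitAt (r Q.∸ 1) u) U.refl
      where
      κ = p1 (remQuot {r} C i)
      l = p2 (remQuot {r} C i)
      go : ∀ z -> splitAt (r Q.∸ 1) u ≡ z -> Σ Carrier \ v -> Inv v × Ab (fd j ls u) v
      go (i1 _) eq = _ , vm κ l , U.subst (\ z -> Ab z (pow κ K.* nat (he (ls l)))) (U.sym low) (Ae p)
       where
       low : fd j ls u ≡ var j
       low rewrite eq = U.refl
      go (i2 i') eq = _ , aX (l ≟ l') , f0 p u eq
       where
       κ' = p1 (remQuot {r} C i')
       l' = p2 (remQuot {r} C i')
       us : l ≡ l' -> κ ≢ κ'
       us l≡l' q = u≢t (U.trans (U.sym (splitAt⁻¹-↑ʳ {r Q.∸ 1} eq)) (U.trans (U.cong (r Q.∸ 1 ↑ʳ_) (U.trans (U.sym (combine-remQuot {r} C i')) (U.trans (U.cong₂ Data.Fin.Base.combine (U.sym q) (U.sym l≡l')) (combine-remQuot {r} C i)))) (splitAt⁻¹-↑ʳ {r Q.∸ 1} e)))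
       aX : Dec (l ≡ l') -> Inv (pow κ K.* nat (he (ls l)) K.- pow κ' K.* nat (he (ls l')))
       aX (no l≢l') = dk κ κ' (he (ls l)) (he (ls l')) \ h -> l≢l' (injective l l' (p1 (p3 {t = p1 (bf l)} {p1 (bf l')} (U.trans (U.sym (p2 (bf l))) (U.trans h (p2 (bf l')))))))
       aX (yes l≡l') = Ia (K.trans (solve 3 (\ a b y -> (a :- b) :* y := a :* y :- b :* y) K.refl (pow κ) (pow κ') (nat (he (ls l)))) (K.+-congˡ (K.-‿cong (K.*-congˡ (K.reflexive (U.cong (\ z -> nat (he (ls z))) l≡l')))))) (Ie (dl {κ} {κ'} (us l≡l')) (hh l))
    dw : ∀ {C} (ls : Fin C -> Fin n) t {κ} -> splitAt (r Q.∸ 1) t ≡ i1 κ -> (d3 ls t ≡ inZero κ) × (toℕ t ≡ toℕ κ) × (toℕ t < r Q.∸ 1)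
    dw ls t {κ} e rewrite e = U.refl , p , U.subst (_< r Q.∸ 1) (U.sym p) (toℕ<n κ)
     where
     p : toℕ t ≡ toℕ κ
     p = U.trans (U.cong toℕ (U.sym (splitAt⁻¹-↑ˡ e))) (toℕ-↑ˡ κ _)
    bq : ∀ {C} (ls : Fin C -> Fin n) t {i} -> splitAt (r Q.∸ 1) t ≡ i2 i -> d3 ls t ≡ inBlock (ls (p2 (remQuot {r} C i))) (p1 (remQuot {r} C i))
    bq ls t e rewrite e = U.refl
    pz : ∀ {j} -> place j ≡ inBlock j ug -> ∀ {s} (t : Fin s) -> Ab (p0 j t) (nat (he j) K.- nat (poi j (toℕ t)))
    pz {j} p t = Ah {p0 j t} (K.+-cong (K.trans (K.*-congʳ ph) (K.*-identityˡ _)) (-1*x≈-x _)) (Ai {var j} {P.- con y} (Ae p) (Af {con (K.- 1#)} {con y} (Ac _) (Ac y)))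
     where
     open import Algebra.Properties.Ring ring using (-1*x≈-x)
     y = nat (poi j (toℕ t))
    uo : ∀ {m C} {J : Vec Bool m} {f : Fin m -> Fin n} {ls : Fin C -> Fin n} (d : Di C J) -> Co f ls d -> Eva (fac f ls d) (∏ \ i -> var (f i) ^ᴾ eb (sw (f i)))
    uo end context = Ep (P.sym (∏-0 _))
    uo {f = f} {ls} (inn t d) context = extend (splitAt (r Q.∸ 1) t) U.refl
     where
     open Co context
     wh : Eva (pre (fd (f zero) ls) t) (var (f zero) ^ᴾ eb (sw (f zero))) -> Eva (fac f ls (inn t d)) (∏ \ i -> var (f i) ^ᴾ eb (sw (f i)))
     wh h = let s , i , e = Ek h (uo d (nn context)) in s , i , \ rb -> K.trans (e rb) (K.*-congˡ (Ea (P.*-congʳ (P.sym (∏-suc _)))))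
     extend : ∀ z -> splitAt (r Q.∸ 1) t ≡ z -> Eva (fac f ls (inn t d)) (∏ \ i -> var (f i) ^ᴾ eb (sw (f i)))
     extend (i1 κ) e with p , q , l <- dw ls t e = wh (Ep (P.trans (px (fd (f zero) ls) t (var (f zero)) \ v l' -> f1 (f zero) ls v (Q.<-trans l' l)) (P.reflexive (U.cong (var (f zero) ^ᴾ_) (U.trans q (U.sym (U.cong (eb ∘ si (\ b -> nat (he b))) (U.trans (at zero) p))))))))
     extend (i2 i) e with v , i' , a <- p9 (fd (f zero) ls) t (\ u l -> fA context t e (U.trans (at zero) (bq ls t e)) u \ { U.refl -> Q.<-irrefl U.refl l }) = wh (aU i' a (P.reflexive (U.cong (\ z -> var (f zero) ^ᴾ eb (si (\ b -> nat (he b)) z)) (U.trans (at zero) (bq ls t e)))))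
    uo {f = f} {ls} (out t d) context with v , i , a <- p9 (p0 (f zero)) (fromℕ t) (\ u l -> _ , Pe.nh K local char0 (he (f zero)) (poi (f zero) (toℕ u)) (\ h -> Q.<⇒≢ (e4 l (e1 (toℕ-fromℕ t))) (U.sym (p2 (p3 {f zero} {f zero} {t} {toℕ u} (U.trans (U.sym (Co.tw context zero U.refl)) h))))) , pz (Co.at context zero) u)
     = let s , i , e = Ek (aU i a (P.reflexive (U.cong (\ z -> var (f zero) ^ᴾ eb (si (\ b -> nat (he b)) z)) (Co.at context zero)))) (uo d (np context))
      in s , i , \ rb -> K.trans (e rb) (K.*-congˡ (Ea (P.*-congʳ (P.sym (∏-suc _)))))
    vc : ∀ {m C} {J : Vec Bool m} {f : Fin m -> Fin n} {ls : Fin C -> Fin n} {d e : Di C J} -> Co f ls d -> Exc d e -> ∀ rb -> Ev (fac f ls e ⊠ rb) K.≈ 0#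
    vc {f = f} {ls} {inn t d} {inn u e} context (iF l) rb = go (splitAt (r Q.∸ 1) t) U.refl
     where
     open Co context
     regroup : ∀ {p a g e} -> p ≈ᴾ a ⊠ g -> (p ⊠ e) ⊠ rb ≈ᴾ a ⊠ (g ⊠ (e ⊠ rb))
     regroup h = P.trans (P.*-assoc _ _ _) (P.trans (P.*-congʳ h) (P.*-assoc _ _ _))
     go : ∀ z -> splitAt (r Q.∸ 1) t ≡ z -> Ev (fac f ls (inn u e) ⊠ rb) K.≈ 0#
     go (i1 κ) q with p , h , l' <- dw ls t q with g , k <- pJ (fd (f zero) ls) t u (var (f zero)) l (\ v l″ -> f1 (f zero) ls v (Q.≤-<-trans l″ l')) = K.trans (Ea (regroup k)) (El (U.trans (at zero) p) (s≤s (e1 (U.sym h))) _)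
     go (i2 i) q with g , k <- pA (fd (f zero) ls) t u l = K.trans (Ea (regroup k)) (K.trans (Eb (f0 context (U.trans (at zero) (bq ls t q)) t q) _) (K.trans (K.*-congʳ (K.-‿inverseʳ _)) (K.zeroˡ _)))
    vc {f = f} {ls} {inn t d} {inn u e} context (iJ v) rb = K.trans (Ea (P.trans (P.*-congʳ (P.*-comm _ _)) (P.*-assoc _ _ _))) (vc (nn context) v _)
    vc {f = f} {ls} {out t d} {out u e} context (o3 l) rb with g , k <- pA (p0 (f zero)) (fromℕ< (Q.m<n⇒m<1+n l)) (fromℕ u) (U.subst₂ _<_ (U.sym (toℕ-fromℕ< (Q.m<n⇒m<1+n l))) (U.sym (toℕ-fromℕ u)) l) = K.trans (Ea (P.trans (P.*-assoc _ _ _) (P.trans (P.*-congʳ k) (P.*-assoc _ _ _)))) (K.trans (Eb (pz (at zero) (fromℕ< (Q.m<n⇒m<1+n l))) _) (K.trans (K.*-congʳ (mc (K.reflexive (U.cong nat (U.trans (tw zero U.refl) (U.cong (poi (f zero)) (U.sym (toℕ-fromℕ< (Q.m<n⇒m<1+n l))))))))) (K.zeroˡ _)))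
     where open Co context
    vc {f = f} {ls} {out t d} {out u e} context (o4 v) rb = K.trans (Ea (P.trans (P.*-congʳ (P.*-comm _ _)) (P.*-assoc _ _ _))) (vc (np context) v _)
    uH : Unique (oa id Ja)
    uH = u1 id Ja id
    cov : ∀ i -> lookup Ja i ≡ b2 ⊎ Σ (Fin n) \ b -> (b ∈ oa id Ja) × (i ≡ b)
    cov i with lookup Ja i in e
    ... | b2 = i1 U.refl
    ... | b1 = i2 (i , ob id Ja i e , U.refl)
    ot : ∀ {b} -> b ∈ oa id Ja -> ∀ {i κ} -> place i ≡ inBlock b κ -> i ≡ b ⊎ lookup Ja i ≡ b2
    ot m {i} p with lookup Ja i in e
    ... | b2 = i2 U.refl
    ... | b1 = i1 (p5 (U.trans (U.sym (py id nob d₀ i e)) p))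
    fr : ∀ {b} -> Σ (Fin n) (\ i -> (b ≡ i) × (lookup Ja i ≡ b1)) -> lookup Ja b ≡ b1
    fr (i , U.refl , e) = e
    sE : Σ Carrier \ s -> Inv s × ∀ g -> ψ (ι g * ua Ja) K.≈ s K.* Ev g
    sE with s , i , e <- t9 (oa id Ja) Ja uH (\ m -> m) (\ m -> fr (oe id Ja m)) ot cov = s , i , \ g -> K.trans (Ei {g = con s ⊠ g} (trans (a1 (φs (oa id Ja)) g _) (trans (*-congˡ e) (trans (sym (*-assoc _ _ _)) (*-congʳ (cc g _)))))) (Eb (Ac s) g)
    Et : Eva (fac id nob d₀) (∏ \ i -> var i ^ᴾ eb (sw i)) -> Inv (Ev (fac id nob d₀))
    Et (s , i , e) = Ia (K.sym (K.trans (Ea (P.sym (P.*-identityʳ _))) (K.trans (e (con 1#)) (K.trans (K.*-congˡ (K.trans (Ea (P.*-identityʳ _)) Er)) (K.*-identityʳ s))))) i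
    dd : Inv (ψ (ι (fac id nob d₀) * ua Ja))
    dd = Ia (K.sym (p2 (p2 sE) _)) (Ie (p1 (p2 sE)) (Et (uo d₀ sta)))
    ei : ∀ {e} -> Exc d₀ e -> ψ (ι (fac id nob e) * ua Ja) K.≈ 0#
    ei ex with s , _ , h <- sE = K.trans (h _) (K.trans (K.*-congˡ (K.trans (Ea (P.sym (P.*-identityʳ _))) (vc sta ex (con 1#)))) (K.zeroʳ s))
    hc : ∀ J g -> sb Ja ≡ sb J -> Ja ≢ J -> weight id Ja ≤ weight id J -> ψ (ι g * ua J) K.≈ 0#
    hc J g e p l with i , i∉J₀ , ii <- s6 Ja J (e1 e) p = K.trans (cG (trans (a1 (φs (oa id Ja)) g _) (trans (*-congˡ (hd min (oa id Ja) J hk)) (trans (zeroʳ _) (sym (aT (φs (oa id Ja)))))))) uE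
     where
     cG : ∀ {u v} -> ap (φs (oa id Ja)) u ≈Ω ap (φs (oa id Ja)) v -> ψ u K.≈ ψ v
     cG e = Lin.f-cong {K = K} τ (R.act-resp e (St.vac n))
     min : ∀ {i b κ} -> place i ≡ inBlock b κ -> toℕ b ≤ toℕ i
     min {i} = pu id nob d₀ (\ _ _ l -> l) (\ ()) i
     d5 : ∀ cs -> rk cs ≡ List.foldr (\ b s -> toℕ b Q.+ s) 0 cs
     d5 [] = U.refl
     d5 (b ∷ cs) = U.cong (toℕ b Q.+_) (d5 cs)
     hk : Ha min J (oa id Ja)
     hk = i2 (e2 (e1 (U.sym (wf id Ja))) (Q.+-mono-≤ l (e1 (U.sym (d5 (oa id Ja))))) , i , ob id Ja i i∉J₀ , ii)
   module _ (s : Bool) (cs : O -> Carrier) (q k : O) (k+q : k Q.+ q ≡ n) (D : O) where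
    open Fl using (module To)
    open To s cs q using (space)
    open Lin.La K (space 0 D) using (co; +ᴹ-commutativeMonoid)
    Ind : Set
    Ind = Σ (Vec Bool n) (Di 0)
    tag : ∀ J -> Di 0 J -> Ind
    tag J d = J , d
    iy : List Ind
    iy = concatMap (\ J -> map (tag J) (se 0 J D)) (ch n q)
    lK : length iy ≡ N n q k 0 D
    lK = U.trans (lr (\ J -> map (tag J) (se 0 J D)) (ch n q)) (tf (ch n q) \ J m -> U.trans (length-map (tag J) (se 0 J D)) (U.trans (lu 0 J D) (U.trans (tc (ml 0 J) D) (U.cong (\ z -> tu (map just (ins 0 J) List.++ oc 0 z) D) (Q.+-cancelʳ-≡ q _ _ (U.trans (U.cong (em J Q.+_) (U.sym (cm q m))) (U.trans (eg J) (U.sym k+q))))))))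
     where open import Data.Maybe.Base using (just)
    uF : Unique iy
    uF = uz (\ J -> map (tag J) (se 0 J D)) p1 (\ J m -> U.cong p1 (p2 (p2 (∈-map⁻ (tag J) m)))) (\ J -> map⁺ (\ { U.refl -> U.refl }) (u2 0 J D)) (uu n q)
    i0 : ∀ {J d} -> (J , d) ∈ iy -> (sb J ≡ q) × (db d ≤ D)
    i0 m = go (ch n q) (\ m -> cm q m) m
     where
     go : ∀ Js -> (∀ {J} -> J ∈ Js -> sb J ≡ q) -> ∀ {J d} -> (J , d) ∈ concatMap (\ J -> map (tag J) (se 0 J D)) Js -> (sb J ≡ q) × (db d ≤ D)
     go (J ∷ Js) h m with ∈-++⁻ (map (tag J) (se 0 J D)) m
     ... | i2 m' = go Js (\ m -> h (there m)) m'
     ... | i1 m' with d , d∈ , U.refl <- ∈-map⁻ (tag J) m' = h (here U.refl) , sL 0 J D d∈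
    el : Ind -> Ω
    el (J , d) = ι (fac id nob d) * ua J
    eE : ∀ {v} -> v ∈ iy -> Fil D q (el v)
    eE {J , d} m with e , l <- i0 m = Fa (e2 (e1 (e5 _)) l) (Fb (fk id nob d) (U.subst (\ z -> Fil 0 z (ua J)) (U.trans (lc id J) e) (Fc _)))
    fu : Ind -> Ω -> Carrier
    fu (J , d) = At.ψ d
    rf : Ind -> O
    rf (J , d) = Q.suc D Q.* weight id J Q.+ db d
    m2 : ∀ v -> Inv (fu v (el v))
    m2 (J , d) = At.dd d
    m3 : ∀ v w -> v ∈ iy -> w ∈ iy -> v ≢ w -> rf v ≤ rf w -> fu v (el w) K.≈ 0#
    m3 (J , d) (J' , e) m m' v≢w l with sJ , dD <- i0 m | sJ' , eD <- i0 m' = go (Vec.≡-dec Bool._≟_ J J')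
     where
     go : Dec (J ≡ J') -> fu (J , d) (el (J' , e)) K.≈ 0#
     go (yes U.refl) with c6 d e
     ... | i1 ex = At.ei d ex
     ... | i2 (_ , h) = ⊥-elim (v≢w (U.cong (J ,_) (h (Q.+-cancelˡ-≤ (Q.suc D Q.* weight id J) _ _ l))))
     go (no J≢J') with weight id J Q.≤? weight id J'
     ... | yes lw = At.hc d J' _ (U.trans sJ (U.sym sJ')) J≢J' lw
     ... | no ¬lw = ⊥-elim (Q.<⇒≱ sm l)
      where
      sm : rf (J' , e) < rf (J , d)
      sm = e4 (Q.≤-<-trans (Q.+-monoʳ-≤ (Q.suc D Q.* weight id J') eD) (e1 (U.trans (U.sym (e8 (Q.suc D Q.* weight id J') D)) (U.trans (e6 _ (Q.suc D)) (U.sym (Q.*-suc (Q.suc D) (weight id J'))))))) (e2 (Q.*-monoʳ-≤ (Q.suc D) (Q.≰⇒> ¬lw)) (e9 _ _))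
    index : Fin (length iy) -> Ind
    index = List.lookup iy
    open Lk K local nontrivial using (module Tri)
    module T = Tri (\ i j -> fu (index i) (el (index j))) (\ i -> rf (index i)) (\ i -> m2 (index i)) (\ i j i≢j -> m3 (index i) (index j) (∈-lookup i) (∈-lookup j) (\ e -> i≢j (lp uF i j e)))
    rg : ∀ v (u : Σ Ω (Fil D q)) -> Carrier
    rg v (f , _) = fu v f
    ru : ∀ v {u w} -> i9._≈ᴹ_ (space 0 D) u w -> rg v u K.≈ rg v w
    ru (J , d) {f , _} {g , _} h = za (K.trans (K.+-congˡ (K.sym (-1*x≈-x _))) (K.trans (K.sym (K.trans (At.u5 d f (- g)) (K.+-congˡ (At.sr d _ g)))) (At.bd d h)))
     where open import Algebra.Properties.Ring ring using (-1*x≈-x)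
    rt : ∀ v {p} (a : Fin p -> Carrier) w -> rg v (co a w) K.≈ Ri.∑ K (\ j -> a j K.* rg v (w j))
    rt v@(J , d) a w = K.trans (Ho.ha +ᴹ-commutativeMonoid K.+-commutativeMonoid (rg v) (\ {u} {w} -> ru v {u} {w}) (At.uE d) (\ u w -> At.u5 d (p1 u) (p1 w)) _) (Ri.cb K \ j -> At.sr d (a j) (p1 (w j)))
    g4 : Sur (space 0 D) (N n q k 0 D)
    g4 = U.subst (Sur (space 0 D)) lK record { va = \ u i -> rg (index i) u ; vd = \ {u} {w} h i -> ru (index i) {u} {w} h ; vg = \ a w i -> rt (index i) a w ; wi = \ F -> co (T.sol F) vec ; vk = \ F i -> K.trans (rt (index i) (T.sol F) vec) (K.trans (Ri.cb K \ j -> K.*-comm _ _) (T.dx F i)) }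
     where
     vec : Fin (length iy) -> Σ Ω (Fil D q)
     vec i = el (index i) , eE (∈-lookup i)
  -- Any injective sequence of indices is carried to any other by a permutation.
  module _ {n : O} where
   tE : (i j : Fin n) -> transpose i j ⟨$⟩ʳ i ≡ j
   tE i j with i ≟ i
   ... | yes _ = U.refl
   ... | no p = ⊥-elim (p U.refl)
   tF : (i j k : Fin n) -> k ≢ i -> k ≢ j -> transpose i j ⟨$⟩ʳ k ≡ k
   tF i j k p q with k ≟ i
   ... | yes e = ⊥-elim (p e)
   ... | no _ with k ≟ j
   ... | yes e = ⊥-elim (q e)
   ... | no _ = U.refl
   pV : ∀ (w : Permutation′ n) {i j} -> w ⟨$⟩ʳ i ≡ w ⟨$⟩ʳ j -> i ≡ j
   pV w e = U.trans (U.sym (inverseˡ w)) (U.trans (U.cong (w ⟨$⟩ˡ_) e) (inverseˡ w))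
   cJ : (ks ls : List (Fin n)) -> length ks ≡ length ls -> Unique ks -> Unique ls -> Σ (Permutation′ n) \ w -> map (w ⟨$⟩ʳ_) ks ≡ ls
   cJ [] [] e u v = Permutation.id , U.refl
   cJ (k ∷ ks) (l ∷ ls) e (k∉ ∷ u) (l∉ ∷ v) with w , h <- cJ ks ls (Q.suc-injective e) u v = w ∘ₚ transpose (w ⟨$⟩ʳ k) l , U.cong₂ _∷_ (tE (w ⟨$⟩ʳ k) l) (U.trans (fix ks ls h k∉ l∉) h)
    where
    fix : ∀ ks ls -> map (w ⟨$⟩ʳ_) ks ≡ ls -> All.All (k ≢_) ks -> All.All (l ≢_) ls -> map (\ i -> transpose (w ⟨$⟩ʳ k) l ⟨$⟩ʳ (w ⟨$⟩ʳ i)) ks ≡ map (w ⟨$⟩ʳ_) ks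
    fix [] [] _ _ _ = U.refl
    fix (j ∷ ks) (i ∷ ls) h (p All.∷ ps) (q All.∷ qs) with U.refl , t <- ∷-injective h = U.cong₂ _∷_ (tF _ l _ (\ e -> p (U.sym (pV w e))) (\ e -> q (U.sym e))) (fix ks ls t ps qs)
  module Iy where
   open K using (Carrier; 0#; 1#; ring)
   open Kg using (_^_)
   open Su using (actΩ; actΩ-cong; Invariant; constantTerm; SI)
   open Bas
   open Op
   open Ro using (pow; inv; pf; pk; ph; il; iw; 1^; uC)
   open Grp
   open Rep
   open Ave char0
   open Kl using (∑)
   open Wo using (_≈±_; pb; mi; ff; tb; uc; uk)
   open Kj using (Inv; can)
   open import Relation.Binary.Reasoning.Setoid setoid
   data I : Ω -> Set (c ⊔ ℓ) where
    po : ∀ m f -> I (p (Q.suc m) * f)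
    dif : ∀ m f -> I (d m * f)
    none : I 0Ω
    _+_ : ∀ {f g} -> I f -> I g -> I (f + g)
    resp : ∀ {f g} -> f ≈Ω g -> I f -> I g
   If : ∀ {f} -> I f -> ∀ h -> I (f * h)
   If (po m f) h = resp (sym (*-assoc _ _ _)) (po m (f * h))
   If (dif m f) h = resp (sym (*-assoc _ _ _)) (dif m (f * h))
   If none h = resp (sym (zeroˡ h)) none
   If (i + j) h = resp (sym (distribʳ h _ _)) (If i h + If j h)
   If (resp e i) h = resp (*-congʳ e) (If i h)
   Ip : ∀ a {f} -> I f -> I (scalar a * f)
   Ip a i = resp (sym (central a _)) (If i (scalar a))
   dK : ∀ m i -> θ i * d m ≈Ω - (d m * θ i)
   dK m i = begin θ i * d m ≈⟨ ud _ _ ⟩ ∑Ω (\ j -> θ i * (ι (var j ^ᴾ e) * θ j)) ≈⟨ ∑Ω-cong (\ j -> trans (cd (var j ^ᴾ e) _ _) (trans (*-congˡ (θ-θ i j)) (trans (sd _ _ _) (*-congˡ (sym (*-assoc _ _ _)))))) ⟩ ∑Ω (\ j -> - (ι (var j ^ᴾ e) * θ j * θ i)) ≈⟨ sym (ud _ _) ⟩ - ∑Ω (\ j -> ι (var j ^ᴾ e) * θ j * θ i) ≈⟨ *-congˡ (sym (ub _ _)) ⟩ - (d m * θ i) ∎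
    where e = da m
   Ib : ∀ h {f} -> I f -> I (h * f)
   Ib (scalar a) i = Ip a i
   Ib (x k) i = resp (sym (xc k _)) (If i (x k))
   Ib (θ k) (po m f) = resp (sym (cd (pq (Q.suc m)) _ _)) (po m (θ k * f))
   Ib (θ k) (dif m f) = resp (sym (trans (sym (*-assoc _ _ _)) (trans (*-congʳ (dK m k)) (trans (*-assoc _ _ _) (*-congˡ (*-assoc _ _ _)))))) (Ip _ (dif m (θ k * f)))
   Ib (θ k) none = resp (sym (zeroʳ _)) none
   Ib (θ k) (i + j) = resp (sym (distribˡ _ _ _)) (Ib (θ k) i + Ib (θ k) j)
   Ib (θ k) (resp e i) = resp (*-congˡ e) (Ib (θ k) i)
   Ib (g + h) i = resp (sym (distribʳ _ _ _)) (Ib g i + Ib h i)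
   Ib (g * h) i = resp (sym (*-assoc _ _ _)) (Ib g (Ib h i))
   Iu : ∀ {f g} -> f ≈± g -> I g -> I f
   Iu (pb e) i = resp (sym e) i
   Iu (mi e) i = resp (sym e) (Ip _ i)
   Ir : ∀ {m} {f : Fin m -> Ω} -> (∀ i -> I (f i)) -> I (∑Ω f)
   Ir {Q.zero} h = resp (sym (∑Ω-0 _)) none
   Ir {Q.suc m} h = resp (sym (∑Ω-suc _)) (h zero + Ir \ i -> h (suc i))
   reg tri : GM c (c ⊔ ℓ)
   reg = record { aR = record { space = Ma ; act = actΩ ; act-linear = \ g -> isH {V = Ma} {W = Ma} record { fun = actΩ g ; f-cong = actΩ-cong g ; f-+ = \ _ _ -> refl ; f-* = \ _ _ -> refl } } ; aj = ai ; az = am ; act-resp = \ {g} {h} -> al {g} {h} }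
   tri = record { aR = record { space = Ma ; act = \ _ f -> f ; act-linear = \ g -> isH {V = Ma} {W = Ma} identity } ; aj = \ _ _ _ -> refl ; az = \ _ -> refl ; act-resp = \ _ _ -> refl }
    where
    identity : Li Ma Ma
    identity = record { fun = \ f -> f ; f-cong = \ e -> e ; f-+ = \ _ _ -> refl ; f-* = \ _ _ -> refl }
   ave : reg ⟶ tri
   ave = av {Y = reg} {X = tri} record { fun = \ f -> f ; f-cong = \ e -> e ; f-+ = \ _ _ -> refl ; f-* = \ _ _ -> refl }
   open _⟶_ ave using () renaming (⟦_⟧ to Av; ⟦⟧-cong to Av-cong; ⟦⟧-+ to Av-+; ⟦⟧-* to Av-*; ⟦⟧-0 to Av-0; equivariant to Av-act)
   Ap : ∀ {f} -> Invariant f -> Av f ≈Ω f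
   Ap {f} h = aZ {Y = reg} {X = tri} record { fun = \ f -> f ; f-cong = \ e -> e ; f-+ = \ _ _ -> refl ; f-* = \ _ _ -> refl } f f (\ g -> h (g ⁻¹))
   -- Products of generators with a common index, as sequences of letters; true stands for θ.
   Bl : Set
   Bl = Bool × List Bool
   lb : Bool -> Fin n -> Ω
   lb b2 = θ
   lb b1 = x
   lk : List Bool -> Fin n -> Ω
   lk [] k = scalar 1#
   lk (b ∷ bs) k = lb b k * lk bs k
   block : Bl -> Fin n -> Ω
   block (b , bs) k = lb b k * lk bs k
   mer : Bl -> Bl -> Bl
   mer (b , bs) (b' , bs') = b , bs ++ b' ∷ bs'
   bm : Bl -> O
   bm (b , bs) = Q.suc (length bs)
   l5 : ∀ bs cs k -> lk (bs ++ cs) k ≈Ω lk bs k * lk cs k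
   l5 [] cs k = sym (*-identityˡ _)
   l5 (b ∷ bs) cs k = trans (*-congˡ (l5 bs cs k)) (sym (*-assoc _ _ _))
   b7 : ∀ b b' k -> block (mer b b') k ≈Ω block b k * block b' k
   b7 (b , bs) (b' , bs') k = trans (*-congˡ (l5 bs (b' ∷ bs') k)) (sym (*-assoc _ _ _))
   bl : List (Fin n × Bl) -> Ω
   bl [] = scalar 1#
   bl ((k , b) ∷ L) = block b k * bl L
   um : ∀ {f g} h -> f ≈± g -> f * h ≈± g * h
   um h (pb e) = pb (*-congʳ e)
   um h (mi e) = mi (trans (*-congʳ e) (*-assoc _ _ _))
   rN : ∀ {f g h} -> f * (g * h) ≈± (f * g) * h
   rN = pb (sym (*-assoc _ _ _))
   gg : ∀ {f g h} -> f * h ≈± h * f -> g * h ≈± h * g -> (f * g) * h ≈± h * (f * g)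
   gg {f} {g} {h} p q = tb (pb (*-assoc _ _ _)) (tb (uc f q) (tb rN (tb (um g p) (pb (*-assoc _ _ _)))))
   l0 : ∀ b k b' k′ -> lb b k * lb b' k′ ≈± lb b' k′ * lb b k
   l0 b2 k b2 k′ = mi (θ-θ k k′)
   l0 b2 k b1 k′ = pb (sym (x-θ k′ k))
   l0 b1 k b2 k′ = pb (x-θ k k′)
   l0 b1 k b1 k′ = pb (x-x k k′)
   lj : ∀ bs k {h} -> (∀ b -> lb b k * h ≈± h * lb b k) -> lk bs k * h ≈± h * lk bs k
   lj [] k q = pb (central 1# _)
   lj (b ∷ bs) k q = gg (q b) (lj bs k q)
   bC : ∀ b k b' k′ -> block b k * block b' k′ ≈± block b' k′ * block b k
   bC (b , bs) k (b' , bs') k′ = lj (b ∷ bs) k \ c -> ff (lj (b' ∷ bs') k′ \ c' -> l0 c' k′ c k)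
   pB : ∀ {k} L -> k ∈ map p1 L -> Σ Bl \ b -> Σ (List (Fin n × Bl)) \ L' -> (length L ≡ Q.suc (length L')) × (bl L ≈± block b k * bl L')
   pB ((k , b) ∷ L) (here U.refl) = b , L , U.refl , pb refl
   pB ((k′ , b') ∷ L) (there m) with b , L' , l , e <- pB L m = b , (k′ , b') ∷ L' , U.cong Q.suc l , tb (uc _ e) (tb rN (tb (um _ (bC b' k′ b _)) (pb (*-assoc _ _ _))))
   rv : ∀ L -> Unique (map p1 L) ⊎ Σ (List (Fin n × Bl)) \ L' -> (Q.suc (length L') ≡ length L) × (1 ≤ length L') × (bl L ≈± bl L')
   rv [] = i1 []
   rv ((k , b) ∷ L) with _∈?_ _≟_ k (map p1 L) | rv L
   ... | yes m | _ with b' , L' , l , e <- pB L m = i2 ((k , mer b b') ∷ L' , U.cong Q.suc (U.sym l) , s≤s z≤n , tb (uc _ e) (pb (trans (sym (*-assoc _ _ _)) (*-congʳ (sym (b7 b b' k))))))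
   rv ((k , b) ∷ L) | no ¬m | i1 u = i1 (All.¬Any⇒All¬ _ ¬m ∷ u)
   rv ((k , b) ∷ L) | no ¬m | i2 (L' , l , l' , e) = i2 ((k , b) ∷ L' , U.cong Q.suc l , s≤s z≤n , uc _ e)
   bh : Bl -> Ω
   bh b = ∑Ω (block b)
   data S0 (bs : List Bool) : Set (c ⊔ ℓ) where
    ee : (∀ k -> lk bs k ≈Ω ι (var k ^ᴾ length bs)) -> S0 bs
    odd : ∀ e -> Q.suc e ≡ length bs -> (∀ k -> lk bs k ≈Ω ι (var k ^ᴾ e) * θ k) -> S0 bs
    nl : (∀ k -> lk bs k ≈Ω 0Ω) -> S0 bs
   sha : ∀ bs -> S0 bs
   sha [] = ee \ k -> refl
   sha (b1 ∷ bs) with sha bs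
   ... | ee h = ee \ k -> *-congˡ (h k)
   ... | odd e l h = odd (Q.suc e) (U.cong Q.suc l) \ k -> trans (*-congˡ (h k)) (sym (*-assoc _ _ _))
   ... | nl h = nl \ k -> trans (*-congˡ (h k)) (zeroʳ _)
   sha (b2 ∷ bs) with sha bs
   ... | ee h = odd (length bs) U.refl \ k -> trans (*-congˡ (h k)) (sym (cc (var k ^ᴾ length bs) (θ k)))
   ... | odd e l h = nl \ k -> trans (*-congˡ (h k)) (trans (cd (var k ^ᴾ e) _ _) (trans (*-congˡ (uk k)) (zeroʳ _)))
   ... | nl h = nl \ k -> trans (*-congˡ (h k)) (zeroʳ _)
   -- Up to sign-free normalisation, the sum is a power sum, a differential, or zero.
   ge : ∀ b -> r ∣ bm b -> Invariant (bh b) × (∀ f -> I (bh b * f))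
   ge (b , bs) r∣ with sha (b ∷ bs)
   ... | nl h = (\ g -> trans (actΩ-cong g z) (sym z)) , \ f -> resp (sym (trans (*-congʳ z) (zeroˡ f))) none
    where
    z : bh (b , bs) ≈Ω 0Ω
    z = ∑Ω-zero h
   ge (b , bs) (divides (Q.suc m) e) | ee h = (\ g -> trans (actΩ-cong g z) (trans (pS (Q.suc m) g) (sym z))) , \ f -> resp (*-congʳ (sym z)) (po m f)
    where
    z : bh (b , bs) ≈Ω p (Q.suc m)
    z = trans (∑Ω-cong \ k -> trans (h k) (un (P.reflexive (U.cong (var k ^ᴾ_) (U.trans e (Q.*-comm (Q.suc m) r)))))) (sym (uw _))
   ge (b , bs) (divides (Q.suc m) e) | odd e' l h = (\ g -> trans (actΩ-cong g z) (trans (d2 m g) (sym z))) , \ f -> resp (*-congʳ (sym z)) (dif m f)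
    where
    z : bh (b , bs) ≈Ω d m
    z = ∑Ω-cong \ k -> trans (h k) (*-congʳ (un (P.reflexive (U.cong (var k ^ᴾ_) (Q.suc-injective (U.trans l (U.trans e (U.trans (Q.*-comm (Q.suc m) r) (U.sym (sP m))))))))) )
   Aw : ∀ f -> (∀ g -> I (actΩ g f)) -> I (Av f)
   Aw f h = f8 {Y = reg} {X = tri} record { fun = \ f -> f ; f-cong = \ e -> e ; f-+ = \ _ _ -> refl ; f-* = \ _ _ -> refl } I resp none _+_ Ip f (\ g -> h (g ⁻¹))
   Aj : ∀ {f g} -> f ≈± g -> Av f ≈± Av g
   Aj (pb e) = pb (Av-cong e)
   Aj (mi e) = mi (trans (Av-cong e) (Av-* _ _))
   a9 : ∀ g b k -> actΩ g (lb b k) ≈Ω scalar (κ g k) * lb b (p2 g ⟨$⟩ʳ k)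
   a9 g b2 k = refl
   a9 g b1 k = refl
   aC : ∀ g bs k -> actΩ g (lk bs k) ≈Ω scalar (κ g k ^ length bs) * lk bs (p2 g ⟨$⟩ʳ k)
   aC g [] k = sym (*-identityˡ _)
   aC g (b ∷ bs) k = trans (*-cong (a9 g b k) (aC g bs k)) (trans (*-assoc _ _ _) (trans (*-congˡ (sd _ _ _)) (trans (sym (*-assoc _ _ _)) (*-congʳ (sym (scalar-* _ _))))))
   md : Permutation′ n -> List (Fin n × Bl) -> List (Fin n × Bl)
   md w = map \ z -> w ⟨$⟩ʳ p1 z , p2 z
   aB : ∀ g L -> All.All (\ k -> κ g k K.≈ 1#) (map p1 L) -> actΩ g (bl L) ≈Ω bl (md (p2 g) L)
   aB g [] h = refl
   aB g ((k , (b , bs)) ∷ L) (h All.∷ hs) = *-cong (trans (aC g (b ∷ bs) k) (trans (*-congʳ (scalar-≈ one)) (*-identityˡ _))) (aB g L hs)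
    where
    one : κ g k ^ Q.suc (length bs) K.≈ 1#
    one = K.trans (Exp.^-congˡ K.semiring (Q.suc (length bs)) h) (1^ (Q.suc (length bs)))
   rE : ∀ {w : Permutation′ n} L L' -> map (w ⟨$⟩ʳ_) (map p1 L) ≡ map p1 L' -> map p2 L ≡ map p2 L' -> md w L ≡ L'
   rE [] [] _ _ = U.refl
   rE {w} ((_ , b) ∷ L) ((k , _) ∷ L') e e' with U.refl , t <- ∷-injective e | U.refl , t′ <- ∷-injective e' = U.cong ((k , b) ∷_) (rE {w} L L' t t′)
   aK : ∀ {w : Permutation′ n} ks -> All.All (\ k -> κ ((\ _ -> ug) , w) k K.≈ 1#) ks
   aK [] = All.[]
   aK {w} (k ∷ ks) = il All.∷ aK {w} ks
   Ao : ∀ L L' -> map p2 L ≡ map p2 L' -> Unique (map p1 L) -> Unique (map p1 L') -> Av (bl L) ≈Ω Av (bl L')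
   Ao L L' e u u′ = mo (cJ (map p1 L) (map p1 L') (U.trans (length-map p1 L) (U.trans (U.sym (length-map p2 L)) (U.trans (U.cong length e) (U.trans (length-map p2 L') (U.sym (length-map p1 L')))))) u u′)
    where
    mo : Σ (Permutation′ n) (\ w -> map (w ⟨$⟩ʳ_) (map p1 L) ≡ map p1 L') -> Av (bl L) ≈Ω Av (bl L')
    mo (w , h) = trans (sym (Av-act ((\ _ -> ug) , w) (bl L))) (Av-cong (trans (aB ((\ _ -> ug) , w) L (aK {w} (map p1 L))) (ΩR.reflexive (U.cong bl (rE {w} L L' h e)))))
   -- The torus element scaling the variables with index k alone by ζ.
   only : Fin n -> G
   only k = (\ i -> if does (i ≟ k) then ⊖ (1 mod r) else ug) , Permutation.id
   o0 : ∀ k {i} -> k ≢ i -> κ (only k) i K.≈ 1#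
   o0 k {i} p with i ≟ k
   ... | yes e = ⊥-elim (p (U.sym e))
   ... | no _ = il
   o1 : ∀ k -> κ (only k) k K.≈ ζ
   o1 k with k ≟ k
   ... | no p = ⊥-elim (p U.refl)
   ... | yes _ = K.trans (K.sym (iw (p7 (1 mod r)) (pf (⊖ (1 mod r))))) (K.trans (K.reflexive (U.cong (ζ ^_) (tj 1))) (K.trans (uC 1) (K.*-identityʳ ζ)))
    where
    p7 : ∀ c -> pow (⊖ c) K.* pow c K.≈ 1#
    p7 c = K.trans (K.sym (pk (⊖ c) c)) (K.trans (K.reflexive (U.cong pow (ia c))) ph)
   Aq : ∀ k b L -> ¬ r ∣ bm b -> All.All (k ≢_) (map p1 L) -> Av (bl ((k , b) ∷ L)) ≈Ω 0Ω
   Aq k (b , bs) L ¬r∣ h = ca (apart (l % r) (Q.n≢0⇒n>0 (\ e -> ¬r∣ (m%n≡0⇒n∣m l r e))) (m%n<n l r))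
    where
    l = Q.suc (length bs)
    f = bl ((k , (b , bs)) ∷ L)
    f5 : actΩ (only k) f ≈Ω scalar (ζ ^ (l % r)) * f
    f5 = trans (*-cong (trans (aC (only k) (b ∷ bs) k) (*-congʳ (scalar-≈ (K.trans (Exp.^-congˡ K.semiring l (o1 k)) (K.sym (uC l)))))) (trans (aB (only k) L (All.map (o0 k) h)) (ΩR.reflexive (U.cong bl (map-id L))))) (*-assoc _ _ _)
    fix : scalar (ζ ^ (l % r)) * Av f ≈Ω Av f
    fix = trans (sym (Av-* _ f)) (trans (Av-cong (sym f5)) (Av-act (only k) f))
    ca : Inv (ζ ^ (l % r) K.- 1#) -> Av f ≈Ω 0Ω
    ca (u , e) = begin Av f ≈⟨ sym (*-identityˡ _) ⟩ scalar 1# * Av f ≈⟨ *-congʳ (trans (scalar-≈ (K.trans (K.sym e) (K.*-comm _ u))) (scalar-* _ _)) ⟩ scalar u * scalar (ζ ^ (l % r) K.- 1#) * Av f ≈⟨ *-assoc _ _ _ ⟩ scalar u * (scalar (ζ ^ (l % r) K.- 1#) * Av f) ≈⟨ *-congˡ (trans (*-congʳ (scalar-+ _ _)) (distribʳ _ _ _)) ⟩ scalar u * (scalar (ζ ^ (l % r)) * Av f + scalar (K.- 1#) * Av f) ≈⟨ *-congˡ (trans (+-congʳ fix) (minus-self _)) ⟩ scalar u * 0Ω ≈⟨ zeroʳ _ ⟩ 0Ω ∎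
   -- Multiplying by the invariant sum of the first block makes the average over the remaining
   -- indices appear, up to products with fewer blocks.
   Ad : ∀ m L -> length L ≤ m -> 1 ≤ length L -> I (Av (bl L))
   Ad Q.zero L l 1≤ = ⊥-elim (Q.<⇒≱ 1≤ l)
   Ad (Q.suc m) L l 1≤ with rv L
   ... | i2 (L' , l' , 1≤' , e) = Iu (Aj e) (Ad m L' (Q.s≤s⁻¹ (e2 (e1 l') l)) 1≤')
   Ad (Q.suc m) ((k , b) ∷ L) (s≤s l) 1≤ | i1 (k∉ ∷ u) with r ∣? bm b
   ... | no ¬r∣ = resp (sym (Aq k b L ¬r∣ k∉)) none
   ... | yes r∣ = div (cU oc k (o5 (_∈?_ _≟_ k (map p1 L))))
    where
    oc : Fin n -> Bool
    oc j = not (does (_∈?_ _≟_ j (map p1 L)))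
    o5 : (d : Dec (k ∈ map p1 L)) -> not (does d) ≡ b2
    o5 (yes k∈) = ⊥-elim (All.lookup k∉ k∈ U.refl)
    o5 (no _) = U.refl
    A = Av (bl ((k , b) ∷ L))
    f : Fin n -> Ω
    f j = bl ((j , b) ∷ L)
    each : ∀ j (d : Dec (j ∈ map p1 L)) -> I (Av (f j) - scalar (iq (not (does d))) * A)
    each j (no j∉) = resp (sym (trans (+-cong (Ao ((j , b) ∷ L) ((k , b) ∷ L) U.refl (All.¬Any⇒All¬ _ j∉ ∷ u) (k∉ ∷ u)) (*-congˡ (*-identityˡ _))) (minus-self _))) none
    each j (yes j∈) with b' , L' , l' , e <- pB L j∈ = resp (sym (trans (+-congˡ (trans (*-congˡ (zeroˡ _)) (zeroʳ _))) (+-identityʳ _))) (Iu (Aj m8) (Ad m ((j , mer b b') ∷ L') (e2 (e1 (U.sym l')) l) (s≤s z≤n)))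
     where
     m8 : f j ≈± bl ((j , mer b b') ∷ L')
     m8 = tb (uc _ e) (pb (trans (sym (*-assoc _ _ _)) (*-congʳ (sym (b7 b b' j)))))
    wh : I (Av (∑Ω f))
    wh = resp (Av-cong (ub _ _)) (Aw (bh b * bl L) \ g -> resp (*-congʳ (sym (p1 (ge b r∣) g))) (p2 (ge b r∣) (actΩ g (bl L))))
    s = ∑ (\ j -> iq (oc j))
    di : I (Av (∑Ω f) - scalar s * A)
    di = resp (trans (∑Ω-+ _ _) (+-cong (sym Am) (trans (sym (ud _ _)) (*-congˡ (trans (sym (ub _ _)) (*-congʳ (sym dq))))))) (Ir \ j -> each j (_∈?_ _≟_ j (map p1 L)))
     where
     Am : Av (∑Ω f) ≈Ω ∑Ω (\ j -> Av (f j))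
     Am = Ho.ha ΩR.+-commutativeMonoid ΩR.+-commutativeMonoid Av Av-cong Av-0 Av-+ f
     dq : scalar s ≈Ω ∑Ω (\ j -> scalar (iq (oc j)))
     dq = Ho.ha K.+-commutativeMonoid ΩR.+-commutativeMonoid scalar scalar-≈ refl scalar-+ _
    div : Inv s -> I A
    div (v , e) = resp (trans (sym (*-assoc _ _ _)) (trans (*-congʳ (trans (sym (scalar-* _ _)) (scalar-≈ (K.trans (K.*-comm v s) e)))) (*-identityˡ _))) (Ip v (resp rK (wh + Ip (K.- 1#) di)))
     where
     rK : Av (∑Ω f) + - (Av (∑Ω f) - scalar s * A) ≈Ω scalar s * A
     rK = trans (+-congˡ (trans (distribˡ _ _ _) (+-congˡ (-‿involutive _)))) (trans (sym (+-assoc _ _ _)) (trans (+-congʳ (minus-self _)) (+-identityˡ _)))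
   data Au : Ω -> Set (c ⊔ ℓ) where
    product : ∀ a L -> 1 ≤ length L -> Au (scalar a * bl L)
    none : Au 0Ω
    _+_ : ∀ {f g} -> Au f -> Au g -> Au (f + g)
    resp : ∀ {f g} -> f ≈Ω g -> Au f -> Au g
   lh : ∀ b k {h} -> Au h -> Au (lb b k * h)
   lh b k (product a L _) = resp (trans (*-congˡ (*-congʳ (od _))) (sym (sd a _ _))) (product a ((k , (b , [])) ∷ L) (s≤s z≤n))
   lh b k none = resp (sym (zeroʳ _)) none
   lh b k (s + t) = resp (sym (distribˡ _ _ _)) (lh b k s + lh b k t)
   lh b k (resp e s) = resp (*-congˡ e) (lh b k s)
   Aa : ∀ f {h} -> Au h -> Au (f * h)
   Aa (scalar a) (product b L l) = resp (trans (*-congʳ (scalar-* a b)) (*-assoc _ _ _)) (product (a K.* b) L l)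
   Aa (scalar a) none = resp (sym (zeroʳ _)) none
   Aa (scalar a) (s + t) = resp (sym (distribˡ _ _ _)) (Aa (scalar a) s + Aa (scalar a) t)
   Aa (scalar a) (resp e s) = resp (*-congˡ e) (Aa (scalar a) s)
   Aa (x i) s = lh b1 i s
   Aa (θ i) s = lh b2 i s
   Aa (f + g) s = resp (sym (distribʳ _ _ _)) (Aa f s + Aa g s)
   Aa (f * g) s = resp (sym (*-assoc _ _ _)) (Aa f (Aa g s))
   au : ∀ f -> Au (f - scalar (constantTerm f))
   au (scalar a) = resp (sym (minus-self _)) none
   au (x i) = resp (trans (trans (*-identityˡ _) (trans (*-congʳ (od _)) (od _))) (sym (trans (+-congˡ (zeroʳ _)) (+-identityʳ _)))) (product 1# ((i , (b1 , [])) ∷ []) (s≤s z≤n))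
   au (θ i) = resp (trans (trans (*-identityˡ _) (trans (*-congʳ (od _)) (od _))) (sym (trans (+-congˡ (zeroʳ _)) (+-identityʳ _)))) (product 1# ((i , (b2 , [])) ∷ []) (s≤s z≤n))
   au (f + g) = resp (trans (interchange _ _ _ _) (+-congˡ (trans (sym (distribˡ _ _ _)) (*-congˡ (sym (scalar-+ _ _)))))) (au f + au g)
   au (f * g) = resp telescope (Aa f (au g) + Aa (scalar b) (au f))
    where
    a = constantTerm f
    b = constantTerm g
    telescope : f * (g - scalar b) + scalar b * (f - scalar a) ≈Ω f * g - scalar (a K.* b)
    telescope = begin f * (g - scalar b) + scalar b * (f - scalar a) ≈⟨ +-cong (trans (distribˡ _ _ _) (+-congˡ (sd _ _ _))) (trans (distribˡ _ _ _) (+-cong (central b f) (sd _ _ _))) ⟩ (f * g - f * scalar b) + (f * scalar b - scalar b * scalar a) ≈⟨ +-assoc _ _ _ ⟩ f * g + (- (f * scalar b) + (f * scalar b - scalar b * scalar a)) ≈⟨ +-congˡ (trans (sym (+-assoc _ _ _)) (trans (+-congʳ (ΩR.-‿inverseˡ _)) (+-identityˡ _))) ⟩ f * g - scalar b * scalar a ≈⟨ +-congˡ (*-congˡ (trans (sym (scalar-* b a)) (scalar-≈ (K.*-comm b a)))) ⟩ f * g - scalar (a K.* b) ∎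
   Ag : ∀ {f} -> Au f -> I (Av f)
   Ag (product a L l) = resp (sym (Av-* a _)) (Ip a (Ad (length L) L e3 l))
   Ag none = resp (sym Av-0) none
   Ag (s + t) = resp (sym (Av-+ _ _)) (Ag s + Ag t)
   Ag (resp e s) = resp (Av-cong e) (Ag s)
   iL : ∀ {f} -> Invariant f -> constantTerm f K.≈ 0# -> I f
   iL {f} h e = resp (trans (Av-cong (trans (+-congˡ (trans (*-congˡ (scalar-≈ e)) (zeroʳ _))) (+-identityʳ _))) (Ap h)) (Ag (au f))
   Sf : ∀ {f} -> SI f -> I f
   Sf (Superspace.invariant h e) = iL h e
   Sf (s Superspace.+ t) = Sf s + Sf t
   Sf (h Superspace.*ˡ s) = Ib h (Sf s)
   Sf (s Superspace.*ʳ h) = If (Sf s) h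
   Sf (Superspace.resp e s) = resp e (Sf s)
  module Hom where
   open Bas
   open Op
   open Ke
   Seq : i9 K.ring c (c ⊔ ℓ)
   Seq = St.p4 O Ma
   ra : Fin n -> (O -> Ω) -> O -> Ω
   ra i v Q.zero = 0Ω
   ra i v (Q.suc j) = θ i * v j
   gr : Rd Seq
   gr = record { X = \ i -> record { fun = \ v j -> x i * v j ; f-cong = \ e j -> *-congˡ (e j) ; f-+ = \ u v j -> distribˡ _ _ _ ; f-* = \ a v j -> sd a _ _ } ; Θ = \ i -> record { fun = ra i ; f-cong = \ { e Q.zero -> refl ; e (Q.suc j) -> *-congˡ (e j) } ; f-+ = \ { u v Q.zero -> sym (+-identityˡ _) ; u v (Q.suc j) -> distribˡ _ _ _ } ; f-* = \ { a v Q.zero -> sym (zeroʳ _) ; a v (Q.suc j) -> sd a _ _ } } ; X-X = \ i j v m -> cw (x j) (v m) (x-x i j) ; X-Θ = \ { i j v Q.zero -> zeroʳ _ ; i j v (Q.suc m) -> cw (θ j) (v m) (x-θ i j) } ; Θ-Θ = \ { i j v Q.zero -> sym (zeroʳ _) ; i j v (Q.suc Q.zero) -> trans (zeroʳ _) (sym (trans (*-congˡ (zeroʳ _)) (zeroʳ _)))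
         ; i j v (Q.suc (Q.suc m)) -> trans (sym (*-assoc _ _ _)) (trans (*-congʳ (θ-θ i j)) (trans (*-assoc _ _ _) (*-congˡ (*-assoc _ _ _)))) } }
   open Rd gr using (act; op; act-resp)
   spi : O -> Ω -> O -> Ω
   spi Q.zero w Q.zero = w
   spi Q.zero w (Q.suc j) = 0Ω
   spi (Q.suc m) w Q.zero = 0Ω
   spi (Q.suc m) w (Q.suc j) = spi m w j
   bu : ∀ m w -> spi m w m ≡ w
   bu Q.zero w = U.refl
   bu (Q.suc m) w = bu m w
   com : O -> Ω -> Ω
   com q f = act f (spi 0 (scalar 1#)) q
    where open K using (1#)
   c5 : ∀ q {f g} -> f ≈Ω g -> com q f ≈Ω com q g
   c5 q e = act-resp e _ q
   sO : (h : Ω -> Ω) -> h 0Ω ≈Ω 0Ω -> ∀ m w j -> h (spi m w j) ≈Ω spi m (h w) j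
   sO h z Q.zero w Q.zero = refl
   sO h z Q.zero w (Q.suc j) = z
   sO h z (Q.suc m) w Q.zero = z
   sO h z (Q.suc m) w (Q.suc j) = sO h z m w j
   af : ∀ js j -> act (θs js) (spi 0 (scalar K.1#)) j ≈Ω spi (length js) (θs js) j
   af [] j = trans (*-identityˡ _) refl
   af (i ∷ js) Q.zero = refl
   af (i ∷ js) (Q.suc j) = trans (*-congˡ (af js j)) (sO (θ i *_) (zeroʳ _) (length js) (θs js) j)
   ao : ∀ a v j -> act (ι a) v j ≈Ω ι a * v j
   ao (con a) v j = refl
   ao (var i) v j = refl
   ao (a ⊞ b) v j = trans (+-cong (ao a v j) (ao b v j)) (sym (distribʳ _ _ _))
   ao (a ⊠ b) v j = trans (ao a _ j) (trans (*-congˡ (ao b v j)) (sym (*-assoc _ _ _)))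
   ax : ∀ is v j -> act (xs is) v j ≈Ω xs is * v j
   ax [] v j = refl
   ax (i ∷ is) v j = trans (*-congˡ (ax is v j)) (sym (*-assoc _ _ _))
   cv : ∀ {E q f} -> Fil E q f -> com q f ≈Ω f
   cv {q = q} (word a is js (_ , U.refl)) = *-congˡ (trans (ax is _ q) (*-congˡ (trans (af js q) (ΩR.reflexive (bu q (θs js))))))
   cv none = zeroˡ _
   cv (s + t) = +-cong (cv s) (cv t)
   cv (resp e s) = trans (c5 _ (sym e)) (trans (cv s) e)
   ae : ∀ f {v : O -> Ω} -> (∀ j -> Σ O \ E -> Fil E j (v j)) -> ∀ j -> Σ O \ E -> Fil E j (act f v j)
   ae (scalar a) h j with E , s <- h j = E , Sb a s
   ae (x i) h j with E , s <- h j = Q.suc E , Fj i s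
   ae (θ i) h Q.zero = 0 , none
   ae (θ i) h (Q.suc j) with E , s <- h j = E , Fd i s
   ae (f + g) h j with E , s <- ae f h j | E' , t <- ae g h j = E Q.⊔ E' , Fa (Q.m≤m⊔n E E') s + Fa (Q.m≤n⊔m E E') t
   ae (f * g) h j = ae f (ae g h) j
   Fq : ∀ q f -> Σ O \ E -> Fil E q (com q f)
   Fq q f = ae f uo q
    where
    uo : ∀ j -> Σ O \ E -> Fil E j (spi 0 (scalar K.1#) j)
    uo Q.zero = 0 , Fc []
    uo (Q.suc j) = 0 , none
   gf : ∀ q a f -> com q (ι a * f) ≈Ω ι a * com q f
   gf q a f = ao a _ q
   ak : ∀ {m} (f : Fin m -> Ω) v j -> act (∑Ω f) v j ≈Ω ∑Ω (\ i -> act (f i) v j)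
   ak {Q.zero} f v j = trans (act-resp (∑Ω-0 f) v j) (trans (zeroˡ _) (sym (∑Ω-0 _)))
   ak {Q.suc m} f v j = trans (act-resp (∑Ω-suc f) v j) (trans (+-congˡ (ak _ v j)) (sym (∑Ω-suc _)))
   g5 : ∀ q m f -> com (Q.suc q) (d m * f) ≈Ω d m * com q f
   g5 q m f = trans (ak _ _ (Q.suc q)) (trans (∑Ω-cong \ i -> trans (ao (var i ^ᴾ da m) _ (Q.suc q)) (sym (*-assoc _ _ _))) (sym (ub _ _)))
   cK : ∀ m f -> com 0 (d m * f) ≈Ω 0Ω
   cK m f = trans (ak _ _ 0) (∑Ω-zero \ i -> trans (ao (var i ^ᴾ da m) _ 0) (zeroʳ _))
  module Coi (q k : O) (k+q : k Q.+ q ≡ n) where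
   open K using (Carrier; 0#; 1#)
   open Su using (SI; actΩ)
   open Bas
   open Op
   open Fl
   open Hom
   open Iy using (I; Sf)
   open Wo
   open Int Po using (solve; _:=_; _:+_; _:*_; _:-_)
   cs : O -> Carrier
   cs _ = 0#
   open To b2 cs q
   open RingProperties K.ring using () renaming (-0#≈0# to -0≈0)
   Pm : ∀ m f -> P m f ≈Ω p m * f
   Pm m f = trans (+-congˡ (trans (+-identityˡ _) (trans (*-congʳ (scalar-≈ -0≈0)) (zeroˡ _)))) (+-identityʳ _)
   Me : Ω -> Set (c ⊔ ℓ)
   Me f = Σ O \ D -> Sub k D f
   cl : Cl b2 cs q Me
   cl = record { Sc = \ e (D , h) -> D , resp e h ; S-+ = \ (D , h) (E , h') -> D Q.⊔ E , Sj e3 (Q.m≤m⊔n D E) h + Sj e3 (Q.m≤n⊔m D E) h' ; Sv = \ a (D , h) -> D , Sg a h ; S-0 = 0 , none }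
   open Cl cl
   degree : ∀ a -> Σ O \ d -> Pc d a
   degree (con a) = 0 , con a
   degree (var i) = 1 , var i
   degree (a ⊞ b) = let d , s = degree a ; e , t = degree b in d Q.⊔ e , wea (Q.m≤m⊔n d e) s ⊞ wea (Q.m≤n⊔m d e) t
   degree (a ⊠ b) = let d , s = degree a ; e , t = degree b in d Q.+ e , s ⊠ t
   -- The power sums beyond the k-th act as zero: on a θ_J every power of each Xᵢ is annihilated by the
   -- polynomial of degree k vanishing at the X_l with l outside J, so that Newton's recursion applies.
   module _ (J : Vec Bool n) (s3 : sb J ≡ q) where
    T : Pb -> Set (c ⊔ ℓ)
    T a = Me (ι a * ua J)
    Tb : ∀ {a b} -> a ≈ᴾ b -> T a -> T b
    Tb e = Sc (*-congʳ (un e))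
    Tc : ∀ {a b} -> T a -> T b -> T (a ⊞ b)
    Tc h h' = Sc (sym (distribʳ _ _ _)) (S-+ h h')
    Ti : ∀ {a b} -> T a -> T b -> T (a ⊟ b)
    Ti h h' = Tc h (Sc (sym (*-assoc _ _ _)) (Sv _ h'))
    Th : ∀ {m} {f : Fin m -> Pb} -> (∀ i -> T (f i)) -> T (∑ᴾ f)
    Th h = Sc (sym (trans (*-congʳ (uw _)) (ub _ _))) (Sy h)
    Q : List (Fin n) -> O -> Pb
    Q ls e = ∑ᴾ \ i -> var i ^ᴾ (r Q.* e) ⊠ van ls (X i)
    Qa : ∀ l ls e -> Q (l ∷ ls) e ≈ᴾ Q ls (Q.suc e) ⊟ X l ⊠ Q ls e
    Qa l ls e = P.trans (∑ᴾ-cong \ i -> P.trans (ed _ _ _ _) (P.+-congʳ (P.*-congʳ (P.trans (P.sym (^ᴾ-+ (var i) r (r Q.* e))) (P.reflexive (U.cong (var i ^ᴾ_) (U.sym (Q.*-suc r e)))))))) (P.trans (∑ᴾ-+ _ _) (P.+-congˡ (P.trans (P.sym (∑ᴾ-*ˡ _ _)) (P.*-congˡ (P.sym (∑ᴾ-*ˡ _ _))))))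
     where
     ed : ∀ a t u v -> a ⊠ ((t ⊟ u) ⊠ v) ≈ᴾ (t ⊠ a) ⊠ v ⊟ u ⊠ (a ⊠ v)
     ed = solve 4 (\ a t u v -> a :* ((t :- u) :* v) := (t :* a) :* v :- u :* (a :* v)) P.refl
    Qb : ∀ e -> Q [] e ≈ᴾ pq e
    Qb e = ∑ᴾ-cong \ i -> P.*-identityʳ _
    fC : ∀ e a -> T (Q (oa id J) (Q.suc e) ⊠ a)
    fC e a = Tb (P.sym (∑ᴾ-*ʳ a _)) (Th \ i -> each i (lookup J i) U.refl)
     where
     each : ∀ i b -> lookup J i ≡ b -> T ((var i ^ᴾ (r Q.* Q.suc e) ⊠ van (oa id J) (X i)) ⊠ a)
     each i b1 e = Tb (P.sym (P.trans (P.*-congʳ (P.trans (P.*-congˡ (vh (ob id J i e))) (P.zeroʳ _))) (P.zeroˡ _))) (Sc (sym (zeroˡ _)) S-0)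
     each i b2 ii = Tb regroup (cT b2 cs q cl {k} {δ Q.+ (r Q.* length (oa id J) Q.+ da 0)} (\ h -> _ , h) J s3 i (oa id J) ii (\ l -> spl l (lookup J l) U.refl) (p2 (degree w)) e3)
      where
      w = (var i ⊠ var i ^ᴾ (r Q.* e)) ⊠ a
      δ = p1 (degree w)
      spl : ∀ {C : Set (c ⊔ ℓ)} l b -> lookup J l ≡ b -> l ∈ oa id J ⊎ lookup J l ≡ b2 ⊎ C
      spl l b1 e = i1 (ob id J l e)
      spl l b2 e = i2 (i1 e)
      eh : Q.suc (da 0 Q.+ r Q.* e) ≡ r Q.* Q.suc e
      eh = U.trans (U.cong (Q._+ r Q.* e) (U.trans (sP 0) (Q.*-identityʳ r))) (U.sym (Q.*-suc r e))
      regroup : (var i ^ᴾ da 0 ⊠ van (oa id J) (X i)) ⊠ w ≈ᴾ (var i ^ᴾ (r Q.* Q.suc e) ⊠ van (oa id J) (X i)) ⊠ a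
      regroup = P.trans (shu _ _ _ _ _) (P.*-congʳ (P.*-congʳ (P.trans (P.*-congˡ (P.sym (^ᴾ-+ (var i) (da 0) (r Q.* e)))) (P.reflexive (U.cong (var i ^ᴾ_) eh)))))
       where
       shu : ∀ b v t u a -> (b ⊠ v) ⊠ ((t ⊠ u) ⊠ a) ≈ᴾ ((t ⊠ (b ⊠ u)) ⊠ v) ⊠ a
       shu = solve 5 (\ b v t u a -> (b :* v) :* ((t :* u) :* a) := ((t :* (b :* u)) :* v) :* a) P.refl
    l4 : ∀ ls e -> Q.suc e Q.+ length ls ≤ k -> ∀ a -> T (Q ls (Q.suc e) ⊠ a)
    l4 [] e l a = Sc (trans (Pm (Q.suc e) _) (trans (sym (*-assoc _ _ _)) (*-congʳ (*-congʳ (un (P.sym (Qb (Q.suc e)))))))) (_ , img e (e2 (e1 (e6 0 _)) l) (Fm (Q.suc e) (Fb (p2 (degree a)) (U.subst (\ z -> Fil 0 z (ua J)) (U.trans (lc id J) s3) (Fc _)))))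
    l4 (t ∷ ls) e l a = Tb (P.trans (ed _ _ _ _) (P.*-congʳ (P.sym (Qa t ls (Q.suc e))))) (Ti (l4 ls (Q.suc e) (e2 (e1 (U.cong Q.suc (U.sym (e8 e _)))) l) a) (l4 ls e (e2 (Q.+-monoʳ-≤ (Q.suc e) (Q.n≤1+n _)) l) (X t ⊠ a)))
     where
     ed : ∀ u v t a -> u ⊠ a ⊟ v ⊠ (t ⊠ a) ≈ᴾ (u ⊟ t ⊠ v) ⊠ a
     ed = solve 4 (\ u v t a -> u :* a :- v :* (t :* a) := (u :- t :* v) :* a) P.refl
    aM : ∀ ls -> length ls ≤ k -> (∀ e a -> T (Q ls (Q.suc e) ⊠ a)) -> ∀ e a -> T (pq (Q.suc e) ⊠ a)
    aM [] l h e a = Tb (P.*-congʳ (Qb (Q.suc e))) (h e a)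
    aM (t ∷ ls) l h = aM ls (e2 (Q.n≤1+n _) l) sho
     where
     sho : ∀ e a -> T (Q ls (Q.suc e) ⊠ a)
     sho Q.zero a = l4 ls 0 l a
     sho (Q.suc e) a = Tb (P.trans (P.+-congʳ (P.*-congʳ (Qa t ls (Q.suc e)))) (ed _ _ _ _)) (Tc (h e a) (sho e (X t ⊠ a)))
      where
      ed : ∀ u v t a -> (u ⊟ t ⊠ v) ⊠ a ⊞ v ⊠ (t ⊠ a) ≈ᴾ u ⊠ a
      ed = solve 4 (\ u v t a -> (u :- t :* v) :* a :+ v :* (t :* a) := u :* a) P.refl
    hl : ∀ e a -> T (pq (Q.suc e) ⊠ a)
    hl = aM (oa id J) (e1 (Q.+-cancelʳ-≡ q _ _ (U.trans (U.cong (length (oa id J) Q.+_) (U.sym s3)) (U.trans (lt id J) (U.sym k+q))))) fC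
   pv : ∀ m {E f} -> Fil E q f -> Me (p (Q.suc m) * f)
   pv m (word a is js (_ , e)) = Sc (sym (trans (sd a _ _) refl)) (Sv a (from (nor js)))
    where
    from : θs js ≈Ω 0Ω ⊎ (Σ (Vec Bool n) \ J -> (sb J ≡ length js) × (θs js ≈± ua J)) -> Me (p (Q.suc m) * (xs is * θs js))
    from (i1 z) = Sc (sym (trans (*-congˡ (trans (*-congˡ z) (zeroʳ _))) (zeroʳ _))) S-0
    from (i2 (J , e' , z)) = S2 (uc _ (uc (xs is) z)) (Sc (trans (*-assoc _ _ _) (*-congˡ (*-congʳ (sym (xa is))))) (hl J (U.trans e' e) m (xb is)))
   pv m none = Sc (sym (zeroʳ _)) S-0
   pv m (s + t) = Sc (sym (distribˡ _ _ _)) (S-+ (pv m s) (pv m t))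
   pv m (resp e s) = Sc (*-congˡ e) (pv m s)
   Io : ∀ {f} -> I f -> Me (com q f)
   Io (I.po m f) = Sc (sym (gf q (pq (Q.suc m)) f)) (pv m (p2 (Fq q f)))
   Io (I.dif m f) = each q U.refl
    where
    each : ∀ q′ -> q′ ≡ q -> Me (com q′ (d m * f))
    each Q.zero e = Sc (sym (cK m f)) S-0
    each (Q.suc q′) e = Sc (sym (g5 q′ m f)) (_ , rel m e (p2 (Fq q′ f)) e3)
   Io I.none = Sc (sym (zeroˡ _)) S-0
   Io (h I.+ h') = S-+ (Io h) (Io h')
   Io (I.resp e h) = Sc (c5 q e) (Io h)
   S3 : ∀ {E f} -> Fil E q f -> SI f -> Me f
   S3 h s = Sc (cv h) (Io (Sf s))
   open Su using (constantTerm)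
   cP : ∀ i e -> 1 ≤ e -> constantTerm (ι (var i ^ᴾ e)) K.≈ 0#
   cP i (Q.suc e) _ = K.zeroˡ _
   g6 : ∀ m -> constantTerm (p (Q.suc m)) K.≈ 0#
   g6 m = Sn.cg P.+-commutativeMonoid (\ a -> constantTerm (ι a) K.≈ 0#) K.refl (\ e e' -> K.trans (K.+-cong e e') (K.+-identityˡ 0#)) \ i -> cP i _ (Q.>-nonZero⁻¹ _ {{Q.m*n≢0 r (Q.suc m)}})
   gi : ∀ m -> constantTerm (d m) K.≈ 0#
   gi m = Sn.cg ΩR.+-commutativeMonoid (\ f -> constantTerm f K.≈ 0#) K.refl (\ e e' -> K.trans (K.+-cong e e') (K.+-identityˡ 0#)) \ i -> K.zeroʳ _
   Sk : ∀ {j D f} -> Sub j D f -> SI f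
   Sk (rel m e h l) = Superspace._*ʳ_ (Superspace.invariant (d2 m) (gi m)) _
   Sk (img m {v} l h) = Superspace.resp (sym (Pm (Q.suc m) v)) (Superspace._*ʳ_ (Superspace.invariant (pS (Q.suc m)) (g6 m)) v)
   Sk none = Superspace.invariant (\ _ -> refl) K.refl
   Sk (h + h') = Sk h Superspace.+ Sk h'
   Sk (resp e h) = Superspace.resp e (Sk h)
  module Ce (q k : O) (k+q : k Q.+ q ≡ n) where
   open K using (Carrier; 0#; 1#)
   open Su using (SI; SR⟨*,_⟩; ≈⇒≈SR; homogeneous)
   open Bas
   open Op
   open Fl
   open Rep
   open Ca
   open Coi q k k+q using (cs; Sk; S3)
   open To b2 cs q
   open Spa using (eve; vec; fa; fy; ft; ly; sa)
   open Bnd using (N)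
   SR : GM (c ⊔ ℓ) (c ⊔ ℓ)
   SR = record { aR = SR⟨*, q ⟩ ; aj = \ g h (f , _) -> ≈⇒≈SR (ai g h f) ; az = \ (f , _) -> ≈⇒≈SR (am f) ; act-resp = \ {g} {h} e (f , _) -> ≈⇒≈SR (al {g} {h} e f) }
   module _ (bas : ∀ D -> Ba (space k D) (N n q k k D)) (D : O) (D-large : sa b2 cs q k k+q ≤ D) where
    module _ {E : O} (D≤E : D ≤ E) where
     inc : Li (space k D) (space k E)
     inc = record { fun = \ (f , h) -> f , Fa D≤E h ; f-cong = Sj e3 D≤E ; f-+ = \ _ _ -> equal refl ; f-* = \ _ _ -> equal refl }
     b9 : fa b2 cs q k k+q E ≡ fa b2 cs q k k+q D
     b9 = fy b2 cs q k k+q (e2 D-large D≤E) D-large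
     gq : N n q k k E ≡ N n q k k D
     gq = U.trans (U.sym (ly b2 cs q k k+q E)) (U.trans (U.cong length b9) (ly b2 cs q k k+q D))
     mw : ∀ i -> Fil D q (p1 (vec b2 cs q k k+q E i))
     mw i = ft b2 cs q k k+q D (U.subst (p1 (vec b2 cs q k k+q E i) ∈_) b9 (∈-lookup i))
     private
      module A = Lin.La K (space k D)
      module B = Lin.La K (space k E)
     des : ∀ {f} -> Fil E q f -> Σ (Σ Ω (Fil D q)) \ g -> Sub k E (p1 g - f)
     des {f} h = from (eve b2 cs q k k+q E E e3 h)
      where
      from : (Σ (Fil E q f) \ h -> Σ _ \ a -> B._≈ᴹ_ (f , h) (B.co a (vec b2 cs q k k+q E))) -> Σ (Σ Ω (Fil D q)) \ g -> Sub k E (p1 g - f)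
      from (h , a , e) = A.co a w , B.≈ᴹ-trans {fun inc (A.co a w)} {B.co a (vec b2 cs q k k+q E)} {f , h} (B.≈ᴹ-trans {fun inc (A.co a w)} {B.co a (\ i -> fun inc (w i))} {B.co a (vec b2 cs q k k+q E)} (fg inc a w) (B.∑ᴹ-cong \ i -> equal refl)) (B.≈ᴹ-sym {f , h} {B.co a (vec b2 cs q k k+q E)} e)
       where
       w : Fin (length (fa b2 cs q k k+q E)) -> Σ Ω (Fil D q)
       w i = p1 (vec b2 cs q k k+q E i) , mw i
    iK : A k D ⟶ SR
    iK = record { li = record { fun = \ (f , h) -> f , Fi h ; f-cong = Sk ; f-+ = \ _ _ -> ≈⇒≈SR refl ; f-* = \ _ _ -> ≈⇒≈SR refl } ; equivariant = \ _ _ -> ≈⇒≈SR refl }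
    Sz : SR ≃ A k D
    Sz = sV (bij iK (\ (f , h) -> p1 (lift h)) (\ (f , h) -> Sk (p2 (lift h))) ke)
     where
     lift : ∀ {f} (h : HasFermionicDegree q f) -> Σ (Σ Ω (Fil D q)) \ g -> Sub k (D Q.⊔ p1 (fe h)) (p1 g - f)
     lift h = des (Q.m≤m⊔n D _) (Fa (Q.m≤n⊔m D _) (p2 (fe h)))
     ke : ∀ f -> SI (p1 f - 0Ω) -> Sub k D (p1 f - 0Ω)
     ke (f , h) s = vc (S3 (h Sa.+ Sb _ Sa.none) s)
      where
      vc : (Σ O \ E -> Sub k E (f - 0Ω)) -> Sub k D (f - 0Ω)
      vc (E , z) = sur (inc (Q.m≤m⊔n D E)) (bas D) (U.subst (Sur (space k (D Q.⊔ E))) (gq (Q.m≤m⊔n D E)) (b6 (bas (D Q.⊔ E)))) (\ (g , t) -> p1 (des (Q.m≤m⊔n D E) t)) (\ (g , t) -> p2 (des (Q.m≤m⊔n D E) t)) (f , h) (Sj e3 (Q.m≤n⊔m D E) z)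
  module Vo where
   open K using (Carrier; 0#; 1#)
   open Kg using (_^_)
   open Determinant K.ring using (determinant)
   open Mf using (matrix)
   open Su using (actΩ; substitute; module Permute)
   open Bas
   open Op
   open Ro using (pow; inv; pf)
   open Wo
   open Grp using (G)
   open Kl using (∑)
   open Km using () renaming (∑ to ∏; ue to ∏-0; sf to ∏-suc; cb to ∏-cong; uj to ∏-one; uh to ∏-*; pc to ∏-permute)
   open import Relation.Binary.Reasoning.Setoid setoid
   row : ∀ {m} -> (Fin m -> Fin n) -> (Fin m -> Carrier) -> Ω
   row f v = ∑Ω \ j -> scalar (v j) * θ (f j)
   rh : ∀ {p m} -> (Fin m -> Fin n) -> (Fin p -> Fin m -> Carrier) -> Ω
   rh {Q.zero} f M = scalar 1#
   rh {Q.suc p} f M = row f (M zero) * rh f (M ∘ suc)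
   fq : ∀ i j h -> θ i * (θ j * h) ≈Ω - (θ j * (θ i * h))
   fq i j h = trans (sym (*-assoc _ _ _)) (trans (*-congʳ (θ-θ i j)) (trans (*-assoc _ _ _) (*-congˡ (*-assoc _ _ _))))
   r1 : ∀ {m} i (f : Fin m -> Fin n) v h -> θ i * (row f v * h) ≈Ω - (row f v * (θ i * h))
   r1 i f v h = begin θ i * (row f v * h) ≈⟨ trans (*-congˡ (ub _ _)) (ud _ _) ⟩ ∑Ω (\ j -> θ i * (scalar (v j) * θ (f j) * h)) ≈⟨ ∑Ω-cong (\ j -> trans (*-congˡ (*-assoc _ _ _)) (trans (sd _ _ _) (trans (*-congˡ (fq i (f j) h)) (trans (sd _ _ _) (*-congˡ (sym (*-assoc _ _ _))))))) ⟩ ∑Ω (\ j -> - (scalar (v j) * θ (f j) * (θ i * h))) ≈⟨ trans (sym (ud _ _)) (*-congˡ (sym (ub _ _))) ⟩ - (row f v * (θ i * h)) ∎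
   r6 : ∀ {m} (f : Fin (Q.suc m) -> Fin n) v j h -> row f v * (θ (f j) * h) ≈Ω row (f ∘ punchIn j) (v ∘ punchIn j) * (θ (f j) * h)
   r6 f v j h = trans (*-congʳ (∑Ω-remove j _)) (trans (distribʳ _ _ _) (trans (+-congʳ (trans (*-assoc _ _ _) (trans (*-congˡ (trans (sym (*-assoc _ _ _)) (trans (*-congʳ (uk (f j))) (zeroˡ _)))) (zeroʳ _)))) (+-identityˡ _)))
   r5 : ∀ {p m} (f : Fin (Q.suc m) -> Fin n) (M : Fin p -> Fin (Q.suc m) -> Carrier) j -> θ (f j) * rh f M ≈Ω θ (f j) * rh (f ∘ punchIn j) (\ a b -> M a (punchIn j b))
   r5 {Q.zero} f M j = refl
   r5 {Q.suc p} f M j = trans (r1 (f j) f (M zero) _) (trans (*-congˡ (trans (*-congˡ (r5 f (M ∘ suc) j)) (r6 f (M zero) j _))) (sym (r1 (f j) (f ∘ punchIn j) _ _)))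
   pn : ∀ {m} (f : Fin (Q.suc m) -> Fin n) j -> θ (f j) * θs (Data.List.Base.tabulate (f ∘ punchIn j)) ≈Ω scalar ((K.- 1#) ^ toℕ j) * θs (Data.List.Base.tabulate f)
   pn f zero = sym (*-identityˡ _)
   pn {Q.suc m} f (suc j) = trans (fq _ _ _) (trans (*-congˡ (trans (*-congˡ (pn (f ∘ suc) j)) (sd _ _ _))) (trans (sym (*-assoc _ _ _)) (*-congʳ (sym (scalar-* _ _)))))
   la : ∀ {m} (f : Fin m -> Fin n) M -> rh f M ≈Ω scalar (determinant M) * θs (Data.List.Base.tabulate f)
   la {Q.zero} f M = sym (*-identityˡ _)
   la {Q.suc m} f M = begin row f (M zero) * rh f (M ∘ suc) ≈⟨ ub _ _ ⟩ ∑Ω (\ j -> scalar (M zero j) * θ (f j) * rh f (M ∘ suc)) ≈⟨ ∑Ω-cong term ⟩ ∑Ω (\ j -> scalar (en j) * θs (Data.List.Base.tabulate f)) ≈⟨ sym (ub _ _) ⟩ ∑Ω (\ j -> scalar (en j)) * θs (Data.List.Base.tabulate f) ≈⟨ *-congʳ (sym (Ho.ha K.+-commutativeMonoid ΩR.+-commutativeMonoid scalar scalar-≈ refl scalar-+ en)) ⟩ scalar (∑ en) * θs (Data.List.Base.tabulate f) ≈⟨ *-congʳ (scalar-≈ (K.reflexive (Sn.ur K.+-commutativeMonoid en))) ⟩ scalar (determinant M) * θs (Data.List.Base.tabulate f) ∎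
    where
    mq : Fin (Q.suc m) -> Carrier
    mq j = determinant \ a b -> M (suc a) (punchIn j b)
    en : Fin (Q.suc m) -> Carrier
    en j = (K.- 1#) ^ toℕ j K.* M zero j K.* mq j
    term : ∀ j -> scalar (M zero j) * θ (f j) * rh f (M ∘ suc) ≈Ω scalar (en j) * θs (Data.List.Base.tabulate f)
    term j = begin scalar (M zero j) * θ (f j) * rh f (M ∘ suc) ≈⟨ trans (*-assoc _ _ _) (*-congˡ (trans (r5 f (M ∘ suc) j) (*-congˡ (la (f ∘ punchIn j) _)))) ⟩ scalar (M zero j) * (θ (f j) * (scalar (mq j) * θs (Data.List.Base.tabulate (f ∘ punchIn j)))) ≈⟨ *-congˡ (trans (sd _ _ _) (*-congˡ (pn f j))) ⟩ scalar (M zero j) * (scalar (mq j) * (scalar ((K.- 1#) ^ toℕ j) * θs (Data.List.Base.tabulate f))) ≈⟨ trans (*-congˡ (trans (sym (*-assoc _ _ _)) (*-congʳ (sym (scalar-* _ _))))) (trans (sym (*-assoc _ _ _)) (*-congʳ (sym (scalar-* _ _)))) ⟩ scalar (M zero j K.* (mq j K.* (K.- 1#) ^ toℕ j)) * θs (Data.List.Base.tabulate f)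
      ≈⟨ *-congʳ (scalar-≈ (K.trans (K.sym (K.*-assoc _ _ _)) (K.trans (K.*-comm _ _) (K.sym (K.*-assoc _ _ _))))) ⟩
     scalar (en j) * θs (Data.List.Base.tabulate f) ∎
   scalars-out : ∀ a b f g -> (scalar a * f) * (scalar b * g) ≈Ω scalar (a K.* b) * (f * g)
   scalars-out a b f g = trans (*-assoc _ _ _) (trans (*-congˡ (sd _ _ _)) (trans (sym (*-assoc _ _ _)) (*-congʳ (sym (scalar-* _ _)))))
   r4 : ∀ {p m} (f : Fin m -> Fin n) (M : Fin p -> Fin m -> Carrier) (s : Fin p -> Carrier) (h : Fin p -> Fin n) -> (∀ a -> row f (M a) ≈Ω scalar (s a) * θ (h a)) -> rh f M ≈Ω scalar (∏ s) * θs (Data.List.Base.tabulate h)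
   r4 {Q.zero} f M s h e = sym (trans (*-congʳ (scalar-≈ (∏-0 s))) (*-identityˡ _))
   r4 {Q.suc p} f M s h e = trans (*-cong (e zero) (r4 f (M ∘ suc) (s ∘ suc) (h ∘ suc) (e ∘ suc))) (trans (scalars-out _ _ _ _) (*-congʳ (scalar-≈ (K.sym (∏-suc s)))))
   af : ∀ g {m} (f : Fin m -> Fin n) -> actΩ g (θs (Data.List.Base.tabulate f)) ≈Ω scalar (∏ (κ g ∘ f)) * θs (Data.List.Base.tabulate ((p2 g ⟨$⟩ʳ_) ∘ f))
   af g {Q.zero} f = sym (trans (*-congʳ (scalar-≈ (∏-0 (κ g ∘ f)))) (*-identityˡ _))
   af g {Q.suc m} f = trans (*-congˡ (af g (f ∘ suc))) (trans (scalars-out _ _ _ _) (*-congʳ (scalar-≈ (K.sym (∏-suc (κ g ∘ f))))))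
   pe : Permutation′ n -> Ω -> Ω
   pe w = substitute (\ i -> x (w ⟨$⟩ʳ i)) (\ i -> θ (w ⟨$⟩ʳ i))
   pp : ∀ w {m} (f : Fin m -> Fin n) -> pe w (θs (Data.List.Base.tabulate f)) ≡ θs (Data.List.Base.tabulate ((w ⟨$⟩ʳ_) ∘ f))
   pp w {Q.zero} f = U.refl
   pp w {Q.suc m} f = U.cong (θ (w ⟨$⟩ʳ f zero) *_) (pp w (f ∘ suc))
   tabulate-cong : ∀ {m} {f g : Fin m -> Fin n} -> (∀ i -> f i ≡ g i) -> Data.List.Base.tabulate f ≡ Data.List.Base.tabulate g
   tabulate-cong {Q.zero} e = U.refl
   tabulate-cong {Q.suc m} e = U.cong₂ _∷_ (e zero) (tabulate-cong (e ∘ suc))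
   vo : Ω
   vo = θs (Data.List.Base.tabulate id)
   mo : Permutation′ n -> Ω
   mo w = θs (Data.List.Base.tabulate (w ⟨$⟩ʳ_))
   mm : ∀ {m} (f : Fin m -> Fin n) -> mem f fb ≡ Data.List.Base.tabulate f
   mm {Q.zero} f = U.refl
   mm {Q.suc m} f = U.cong (f zero ∷_) (mm (f ∘ suc))
   det : G -> Carrier
   det g = determinant (matrix g)
   dB : ∀ g -> scalar (det g) * mo (p2 g) ≈Ω scalar (∏ \ i -> pow (p1 g i)) * vo
   dB (colour , w) = begin scalar (det (colour , w)) * mo w ≡⟨ U.cong (scalar (det (colour , w)) *_) (U.sym (pp w id)) ⟩ pe w (scalar (det (colour , w)) * vo) ≈⟨ Permute.substitute-cong w (trans (sym (la id (matrix (colour , w)))) (r4 id (matrix (colour , w)) (pow ∘ colour) (w ⟨$⟩ˡ_) en)) ⟩ scalar (∏ (pow ∘ colour)) * pe w (θs (Data.List.Base.tabulate (w ⟨$⟩ˡ_))) ≡⟨ U.cong (scalar (∏ (pow ∘ colour)) *_) (U.trans (pp w _) (U.cong θs (tabulate-cong \ i -> inverseʳ w))) ⟩ scalar (∏ (pow ∘ colour)) * vo ∎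
    where
    en : ∀ a -> row id (matrix (colour , w) a) ≈Ω scalar (pow (colour a)) * θ (w ⟨$⟩ˡ a)
    en a = trans (∑Ω-single _ (w ⟨$⟩ˡ a) \ j p -> trans (*-congʳ (scalar-≈ (K.reflexive (off j p)))) (zeroˡ _)) (*-congʳ (scalar-≈ (K.reflexive (U.cong (\ z -> if z then pow (colour a) else 0#) (dec-true (a ≟ w ⟨$⟩ʳ (w ⟨$⟩ˡ a)) (U.sym (inverseʳ w)))))))
     where
     off : ∀ j -> j ≢ w ⟨$⟩ˡ a -> matrix (colour , w) a j ≡ 0#
     off j p = U.cong (\ z -> if z then pow (colour a) else 0#) (dec-false (a ≟ w ⟨$⟩ʳ j) \ e -> p (U.trans (U.sym (inverseˡ w)) (U.cong (w ⟨$⟩ˡ_) (U.sym e))))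
   m5 : ∀ w -> mo w ≈± vo
   m5 w with nor (Data.List.Base.tabulate (w ⟨$⟩ʳ_))
   ... | i2 (J , s , e) rewrite sM J (U.trans s (length-tabulate (w ⟨$⟩ʳ_))) = U.subst (\ z -> mo w ≈± θs z) (mm id) e
   ... | i1 e = pb (trans e (sym (begin vo ≡⟨ U.cong θs (tabulate-cong \ i -> U.sym (inverseˡ w)) ⟩ θs (Data.List.Base.tabulate \ i -> w ⟨$⟩ˡ (w ⟨$⟩ʳ i)) ≡⟨ U.sym (pp (Data.Fin.Permutation.flip w) (w ⟨$⟩ʳ_)) ⟩ pe (Data.Fin.Permutation.flip w) (mo w) ≈⟨ Permute.substitute-cong (Data.Fin.Permutation.flip w) e ⟩ 0Ω ∎)))
   f3 : ∀ g -> actΩ g vo ≈Ω scalar (det g K.* ∏ \ i -> κ g i K.* κ g i) * vo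
   f3 g = trans (af g id) (sig (m5 (p2 g)))
    where
    k² : Carrier
    k² = ∏ \ i -> κ g i K.* κ g i
    inverse : (∏ \ i -> pow (p1 g i)) K.* ∏ (κ g) K.≈ 1#
    inverse = K.trans (K.*-congˡ (K.sym (∏-permute (inv ∘ p1 g) (p2 g)))) (K.trans (K.sym (∏-* _ _)) (∏-one \ i -> pf (p1 g i)))
    sc : scalar (det g K.* k²) * mo (p2 g) ≈Ω scalar (∏ (κ g)) * vo
    sc = begin scalar (det g K.* k²) * mo (p2 g) ≈⟨ *-congʳ (trans (scalar-≈ (K.*-comm _ _)) (scalar-* _ _)) ⟩ scalar k² * scalar (det g) * mo (p2 g) ≈⟨ trans (*-assoc _ _ _) (*-congˡ (dB g)) ⟩ scalar k² * (scalar (∏ \ i -> pow (p1 g i)) * vo) ≈⟨ trans (sym (*-assoc _ _ _)) (*-congʳ (sym (scalar-* _ _))) ⟩ scalar (k² K.* ∏ \ i -> pow (p1 g i)) * vo ≈⟨ *-congʳ (scalar-≈ (K.trans (K.*-congʳ (∏-* (κ g) (κ g))) (K.trans (K.*-assoc _ _ _) (K.trans (K.*-congˡ (K.trans (K.*-comm _ _) inverse)) (K.*-identityʳ _))))) ⟩ scalar (∏ (κ g)) * vo ∎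
    sig : mo (p2 g) ≈± vo -> scalar (∏ (κ g)) * mo (p2 g) ≈Ω scalar (det g K.* k²) * vo
    sig (pb e) = trans (*-congˡ e) (trans (sym sc) (*-congˡ e))
    sig (mi e) = trans (*-congˡ e) (trans (sd _ _ _) (trans (*-congˡ (sym sc)) (trans (sym (sd _ _ _)) (*-congˡ (trans (*-congˡ e) (-‿involutive vo))))))
  module Coo (k q : O) (k+q : k Q.+ q ≡ n) (y : Fin k -> CommutativeRing.Carrier K) where
   open K using (Carrier; 0#; 1#)
   open Kr using (_^_; ^-distrib-*; ^-homo-*; ^-congˡ; ^-assocʳ)
   open Su using (actΩ; actΩ-cong)
   open Pa using (Place; inZero; inBlock; shift; factor)
   open Bas
   open Op
   open Ro
   open Wo
   open Grp using (G; _⊕_)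
   open Tg
   open Vo
   open Km using () renaming (∑ to ∏; cb to ∏-cong; uh to ∏-*; pc to ∏-permute; uj to ∏-one)
   open Sn P.*-commutativeMonoid using () renaming (∑ to ∏ᴾ; cb to ∏ᴾ-cong; uh to ∏ᴾ-⊠; pc to ∏ᴾ-permute; uj to ∏ᴾ-one; sj to ∏ᴾ-single)
   open Kn using (solve; _:=_; _:*_)
   -- The scalars on the zero block come out inverted, so its colours are reversed.
   fl : Place k -> Place k
   fl (inZero κ) = inZero (opposite κ)
   fl (inBlock b κ) = inBlock b κ
   lI : ∀ {π : Fin n -> Place k} {i b κ} -> fl (π i) ≡ inBlock b κ -> b ∈ allFin k
   lI {b = b} _ = ∈-allFin b
   module At (π : Fin n -> Place k) = Fx (fl ∘ π) y (allFin k) (lI {π})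
   square : Place k -> Carrier
   square (inZero κ) = 1#
   square (inBlock b κ) = pow κ K.* pow κ
   F : (Fin n -> Place k) -> Ω -> Carrier
   F π u = ∏ (square ∘ π) K.* At.ψ π u
   mb : (Fin n -> O) -> Pb
   mb e = ∏ᴾ \ i -> var i ^ᴾ e i
   xf : ∀ is -> Σ (Fin n -> O) \ e -> xb is ≈ᴾ mb e
   xf [] = (\ _ -> 0) , P.sym (∏ᴾ-one \ _ -> P.refl)
   xf (i ∷ is) with e , h <- xf is = (\ j -> one j (does (i ≟ j)) Q.+ e j) , P.trans (P.*-cong (P.sym (P.trans (∏ᴾ-single _ i \ j p -> P.reflexive (U.cong (\ b -> var j ^ᴾ one j b) (dec-false (i ≟ j) \ q -> p (U.sym q)))) (P.trans (P.reflexive (U.cong (\ b -> var i ^ᴾ one i b) (dec-true (i ≟ i) U.refl))) (P.*-identityʳ _)))) h) (P.trans (P.sym (∏ᴾ-⊠ _ _)) (∏ᴾ-cong \ j -> P.sym (^ᴾ-+ (var j) (one j (does (i ≟ j))) (e j))))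
    where
    open import Relation.Nullary.Decidable using (dec-true; dec-false)
    one : Fin n -> Bool -> O
    one j b = if b then 1 else 0
   module _ (g : G) (π π' : Fin n -> Place k) (moves : ∀ i -> π' (p2 g ⟨$⟩ʳ i) ≡ shift (p1 g (p2 g ⟨$⟩ʳ i)) (π i)) where
    private
     module A = At π
     module B = At π'
     w = p2 g
     open St using (loc)
    colour : Fin n -> Fin r
    colour i = p1 g (w ⟨$⟩ʳ i)
    aV : ∀ b -> actΩ g (η (A.φ b)) ≈Ω η (B.φ b)
    aV b = trans (aq g _) (trans (∑Ω-cong \ i -> trans (sym (*-assoc _ _ _)) (*-congʳ (trans (sym (scalar-* _ _)) (scalar-≈ (each i))))) (sym (∑Ω-permute (\ j -> ι (B.φ b j) * θ j) w)))
     where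
     mw : ∀ p d -> me b (fl p) K.* inv d K.≈ me b (fl (shift d p))
     mw (inZero κ) d = K.zeroˡ _
     mw (inBlock b' κ) d with does (b ≟ b')
     ... | b2 = K.sym (iu κ d)
     ... | b1 = K.zeroˡ _
     each : ∀ i -> me b (fl (π i)) K.* κ g i K.≈ me b (fl (π' (w ⟨$⟩ʳ i)))
     each i = K.trans (mw (π i) (colour i)) (K.reflexive (U.cong (me b ∘ fl) (U.sym (moves i))))
    aF : ∀ cs u -> actΩ g (ap (A.φs cs) u) ≈Ω ap (B.φs cs) (actΩ g u)
    aF [] u = refl
    aF (b ∷ cs) u = trans (aF cs _) (ag (B.φs cs) (*-congʳ (aV b)))
    rx : Fin r -> Place k -> Carrier
    rx d (inZero κ) = inv d ^ toℕ (opposite κ)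
    rx d (inBlock b κ) = 1#
    t Z : Carrier
    t = det g K.* ∏ \ i -> κ g i K.* κ g i
    Z = ∏ \ i -> rx (colour i) (π i)
    Tr : Ω -> Set (c ⊔ ℓ)
    Tr v = Σ Pb \ a -> Σ Pb \ a' -> (v ≈Ω ι a * ua fb) × (actΩ g v ≈Ω ι a' * ua fb) × (B.Ev a' K.≈ (t K.* Z) K.* A.Ev a)
    d7 : actΩ g (ua fb) ≈Ω scalar t * ua fb
    d7 = U.subst (\ z -> actΩ g (θs z) ≈Ω scalar t * θs z) (U.sym (mm id)) (f3 g)
    ah : Pb -> Pb
    ah (con a) = con a
    ah (var i) = con (κ g i) ⊠ var (w ⟨$⟩ʳ i)
    ah (a ⊞ b) = ah a ⊞ ah b
    ah (a ⊠ b) = ah a ⊠ ah b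
    aa : ∀ a -> ι (ah a) ≡ actΩ g (ι a)
    aa (con a) = U.refl
    aa (var i) = U.refl
    aa (a ⊞ b) = U.cong₂ _+_ (aa a) (aa b)
    aa (a ⊠ b) = U.cong₂ _*_ (aa a) (aa b)
    d6 : ∀ {a b} -> a ≈ᴾ b -> ah a ≈ᴾ ah b
    d6 {a} {b} (sk e) = sk (trans (ΩR.reflexive (aa a)) (trans (actΩ-cong g e) (ΩR.reflexive (U.sym (aa b)))))
    sca : (Fin n -> O) -> Carrier
    sca e = ∏ \ i -> κ g i ^ e i
    m4 : ∀ e -> ah (mb e) ≈ᴾ con (sca e) ⊠ ∏ᴾ (\ i -> var (w ⟨$⟩ʳ i) ^ᴾ e i)
    m4 e = P.trans (Ho.ha P.*-commutativeMonoid P.*-commutativeMonoid ah d6 P.refl (\ _ _ -> P.refl) _) (P.trans (∏ᴾ-cong \ i -> sk (trans (ΩR.reflexive (aa (var i ^ᴾ e i))) (a3 g i (e i)))) (P.trans (∏ᴾ-⊠ _ _) (P.*-congʳ (P.sym (Ho.ha K.*-commutativeMonoid P.*-commutativeMonoid con (\ e -> sk (scalar-≈ e)) P.refl (\ a b -> sk (scalar-* a b)) _)))))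
    lH : ∀ p d e -> inv d ^ e K.* loc (si y (fl (shift d p))) e K.≈ rx d p K.* loc (si y (fl p)) e
    lH (inZero κ) d e with e Q.≡ᵇ toℕ (opposite κ) in q
    ... | b1 = K.trans (K.zeroʳ _) (K.sym (K.zeroʳ _))
    ... | b2 = K.*-congʳ (K.reflexive (U.cong (inv d ^_) (Q.≡ᵇ⇒≡ e _ (U.subst Data.Bool.Base.T (U.sym q) tt))))
    lH (inBlock b κ) d e = K.trans (K.sym (^-distrib-* _ _ e)) (K.trans (^-congˡ e (K.trans (K.*-congˡ (K.*-congʳ (pk κ d))) (K.trans (rea (inv d) (pow κ) (pow d) (y b)) (K.trans (K.*-congʳ (pf d)) (K.*-identityˡ _))))) (K.sym (K.*-identityˡ _)))
     where
     rea : ∀ i κ d y -> i K.* (κ K.* d K.* y) K.≈ d K.* i K.* (κ K.* y)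
     rea = solve 4 (\ i κ d y -> i :* (κ :* d :* y) := d :* i :* (κ :* y)) K.refl
    Eo : ∀ e -> sca e K.* B.Ev (∏ᴾ \ i -> var (w ⟨$⟩ʳ i) ^ᴾ e i) K.≈ Z K.* A.Ev (mb e)
    Eo e = K.trans (K.*-congˡ (K.trans (B.Ea (P.trans (∏ᴾ-cong \ i -> P.reflexive (U.cong (\ j -> var (w ⟨$⟩ʳ i) ^ᴾ e j) (U.sym (inverseˡ w)))) (P.sym (∏ᴾ-permute (\ j -> var j ^ᴾ e (w ⟨$⟩ˡ j)) w)))) (K.trans (B.Eh (\ j -> e (w ⟨$⟩ˡ j))) (∏-permute (\ j -> loc (B.sw j) (e (w ⟨$⟩ˡ j))) w)))) (K.trans (K.sym (∏-* _ _)) (K.trans (∏-cong \ i -> K.trans (K.*-congˡ (K.reflexive (U.cong₂ (\ p j -> loc (si y (fl p)) (e j)) (moves i) (inverseˡ w)))) (lH (π i) (colour i) (e i))) (K.trans (∏-* _ _) (K.*-congˡ (K.sym (A.Eh e))))))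
    Ec : ∀ {π' : Fin n -> Place k} s a -> At.Ev π' (con s ⊠ a) K.≈ s K.* At.Ev π' a
    Ec {π'} s a = At.Eb π' (At.Ac π' s) a
    tra : ∀ {E v} -> Fil E n v -> Tr v
    tra (Sa.word a is js (l , e)) with s , z <- sA js e | m , h <- xf is = con a ⊠ (con s ⊠ mb m) , con a ⊠ (con s ⊠ (con t ⊠ (con (sca m) ⊠ ∏ᴾ \ i -> var (w ⟨$⟩ʳ i) ^ᴾ m i))) , trans (*-congˡ wg) (sym (*-assoc _ _ _)) , trans (*-congˡ f6) (sym (*-assoc _ _ _)) , va
     where
     wg : xs is * θs js ≈Ω ι (con s ⊠ mb m) * ua fb
     wg = trans (*-cong (trans (xa is) (un h)) z) (trans (sd _ _ _) (sym (*-assoc _ _ _)))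
     f6 : actΩ g (xs is * θs js) ≈Ω ι (con s ⊠ (con t ⊠ (con (sca m) ⊠ ∏ᴾ \ i -> var (w ⟨$⟩ʳ i) ^ᴾ m i))) * ua fb
     f6 = trans (actΩ-cong g wg) (trans (*-assoc _ _ _) (trans (*-congˡ (trans (*-cong (trans (ΩR.reflexive (U.sym (aa (mb m)))) (un (m4 m))) d7) (trans (sd _ _ _) (sym (*-assoc _ _ _))))) (sym (*-assoc _ _ _))))
     va : _ K.≈ _
     va = K.trans (Ec {π'} a _) (K.trans (K.*-congˡ (K.trans (Ec {π'} s _) (K.*-congˡ (K.trans (Ec {π'} t _) (K.*-congˡ (K.trans (Ec {π'} (sca m) _) (Eo m))))))) (K.trans (rea a s t Z (A.Ev (mb m))) (K.*-congˡ (K.sym (K.trans (Ec {π} a _) (K.*-congˡ (Ec {π} s _)))))))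
      where
      rea : ∀ a s t z v -> a K.* (s K.* (t K.* (z K.* v))) K.≈ (t K.* z) K.* (a K.* (s K.* v))
      rea = solve 5 (\ a s t z v -> a :* (s :* (t :* (z :* v))) := (t :* z) :* (a :* (s :* v))) K.refl
    tra Sa.none = con 0# , con 0# , sym (zeroˡ _) , sym (zeroˡ _) , K.trans (vc π') (K.sym (K.trans (K.*-congˡ (vc π)) (K.zeroʳ _)))
     where
     vc : ∀ π -> At.Ev π (con 0#) K.≈ 0#
     vc π = K.trans (At.Ea π (P.sym (P.zeroˡ (con 0#)))) (K.trans (Ec {π} 0# _) (K.zeroˡ _))
    tra (h Sa.+ h') with a , a' , e , f , v <- tra h | b , b' , e' , f′ , v′ <- tra h' = a ⊞ b , a' ⊞ b' , trans (+-cong e e') (sym (distribʳ _ _ _)) , trans (+-cong f f′) (sym (distribʳ _ _ _)) , K.trans (B.Eg a' b') (K.trans (K.+-cong v v′) (K.trans (K.sym (K.distribˡ _ _ _)) (K.*-congˡ (K.sym (A.Eg a b)))))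
    tra (Sa.resp p h) with a , a' , e , f , v <- tra h = a , a' , trans (sym p) e , trans (actΩ-cong g (sym p)) f , v
    bal : ∀ p d -> square (shift d p) K.* (inv d K.* inv d K.* rx d p) K.≈ factor d p K.* square p
    bal (inZero κ) d = K.trans (K.*-identityˡ _) (K.trans (iw {inv d ^ toℕ κ} lL ri) (K.sym (K.*-identityʳ _)))
     where
     eb : toℕ κ Q.+ (2 Q.+ toℕ (opposite κ)) ≡ r Q.* 1
     eb = U.trans (e8 (toℕ κ) _) (U.trans (U.cong Q.suc (U.trans (e8 (toℕ κ) _) (U.trans (U.cong (Q.suc (toℕ κ) Q.+_) (opposite-prop κ)) (Q.m+[n∸m]≡n (toℕ<n κ))))) (U.trans (U.cong (\ z -> Q.suc (z Q.+ (r Q.∸ 1))) (U.sym (Q.*-zeroʳ r))) (sP 0)))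
     lL : inv d ^ toℕ κ K.* (inv d K.* inv d K.* inv d ^ toℕ (opposite κ)) K.≈ 1#
     lL = K.trans (K.*-congˡ (K.*-assoc _ _ _)) (K.trans (K.sym (^-homo-* (inv d) (toℕ κ) _)) (K.trans (K.reflexive (U.cong (inv d ^_) eb)) (i4 d 1)))
     ri : inv d ^ toℕ κ K.* ζ ^ (toℕ κ Q.* toℕ d) K.≈ 1#
     ri = K.trans (K.*-congˡ (K.trans (K.reflexive (U.cong (ζ ^_) (Q.*-comm (toℕ κ) _))) (K.sym (^-assocʳ ζ (toℕ d) (toℕ κ))))) (K.trans (K.sym (^-distrib-* _ _ (toℕ κ))) (K.trans (^-congˡ (toℕ κ) (K.trans (K.*-comm _ _) (pf d))) (1^ (toℕ κ))))
    bal (inBlock b κ) d = K.trans (K.*-congʳ (K.*-cong (pk κ d) (pk κ d))) (K.trans (rea (pow κ) (pow d) (inv d) 1#) (K.*-cong (K.trans (K.*-cong (pf d) (pf d)) (K.*-identityˡ 1#)) (K.*-identityʳ _)))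
     where
     rea : ∀ κ d i o -> κ K.* d K.* (κ K.* d) K.* (i K.* i K.* o) K.≈ d K.* i K.* (d K.* i) K.* (κ K.* κ K.* o)
     rea = solve 4 (\ κ d i o -> κ :* d :* (κ :* d) :* (i :* i :* o) := d :* i :* (d :* i) :* (κ :* κ :* o)) K.refl
    Fs : ∀ {E u} -> Fil E q u -> F π' (actΩ g u) K.≈ (∏ \ i -> factor (colour i) (π i)) K.* det g K.* F π u
    Fs {E} {u} h = from (tra (U.subst (\ z -> Fil E z (ap (A.φs (allFin k)) u)) tot (a7 _ (A.sq (allFin k)) h)))
     where
     tot : length (A.φs (allFin k)) Q.+ q ≡ n
     tot = U.trans (U.cong (Q._+ q) (U.trans (A.lg (allFin k)) (length-tabulate id))) k+q
     W S S' K² : Carrier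
     W = ∏ \ i -> factor (colour i) (π i)
     S = ∏ (square ∘ π)
     S' = ∏ (square ∘ π')
     K² = ∏ \ i -> κ g i K.* κ g i
     pro : S' K.* (K² K.* Z) K.≈ W K.* S
     pro = K.trans (K.*-cong (K.trans (∏-permute (square ∘ π') w) (∏-cong \ i -> K.reflexive (U.cong square (moves i)))) (K.sym (∏-* _ _))) (K.trans (K.sym (∏-* _ _)) (K.trans (∏-cong \ i -> bal (π i) (colour i)) (∏-* _ _)))
     from : Tr (ap (A.φs (allFin k)) u) -> F π' (actΩ g u) K.≈ W K.* det g K.* F π u
     from (a , a' , e , f , v) = K.trans (K.*-congˡ (K.trans (B.Ei {g = a'} (trans (sym (aF (allFin k) u)) f)) (K.trans v (K.*-congˡ (K.sym (A.Ei {g = a} e)))))) (K.trans (rea S' (det g) K² Z (A.ψ u)) (K.trans (K.*-congʳ pro) (rQ W S (det g) (A.ψ u))))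
      where
      rea : ∀ s d k z v -> s K.* (d K.* k K.* z K.* v) K.≈ s K.* (k K.* z) K.* (d K.* v)
      rea = solve 5 (\ s d k z v -> s :* (d :* k :* z :* v) := s :* (k :* z) :* (d :* v)) K.refl
      rQ : ∀ w s d v -> w K.* s K.* (d K.* v) K.≈ w K.* d K.* (s K.* v)
      rQ = solve 4 (\ w s d v -> w :* s :* (d :* v) := w :* d :* (s :* v)) K.refl
  cA : ∀ n q -> n < q -> ch n q ≡ []
  cA Q.zero (Q.suc q) l = U.refl
  cA (Q.suc n) (Q.suc q) (s≤s l) rewrite cA n (Q.suc q) (Q.m<n⇒m<1+n l) | cA n q l = U.refl
  tl : ∀ {A B : Set} (f : B -> O) (g : A -> List B) as -> ta f (concatMap g as) ≡ ta (\ a -> ta f (g a)) as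
  tl f g [] = U.refl
  tl f g (a ∷ as) = U.trans (ts f (g a) _) (U.cong (ta f (g a) Q.+_) (tl f g as))
  tv : ∀ {A : Set} (f : A -> O) v -> (∀ a -> f a ≡ v) -> ∀ as -> ta f as ≡ length as Q.* v
  tv f v e [] = U.refl
  tv f v e (a ∷ as) = U.cong₂ Q._+_ (e a) (tv f v e as)
  module Ar (k : O) where
   open Pa using (Place; inZero; inBlock)
   open Bnd
   open Dig using (em; eg)
   tp : ∀ {A : Set} {m} (f : A -> O) (g : Fin m -> A) (h : Bool -> O) (U : Vec Bool m) -> (∀ b -> f (g b) ≡ h (lookup U b)) -> ta f (Data.List.Base.tabulate g) ≡ sb U Q.* h b2 Q.+ em U Q.* h b1
   tp f g h [] e = U.refl
   tp f g h (b2 ∷ U) e = U.trans (U.cong₂ Q._+_ (e zero) (tp f (g ∘ suc) h U (\ b -> e (suc b)))) (U.sym (e7 (h b2) _ _))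
   tp f g h (b1 ∷ U) e = U.trans (U.cong₂ Q._+_ (e zero) (tp f (g ∘ suc) h U (\ b -> e (suc b)))) (solve 3 (\ x y z -> x :+ (y :+ z) := y :+ (x :+ z)) U.refl (h b1) (sb U Q.* h b2) _)
    where open +-*-Solver
   lm : ∀ j -> length (allFin j) ≡ j
   lm j = length-tabulate {n = j} id
   ka : Maybe (Fin k) -> List (Place k)
   ka nothing = map inZero (allFin (r Q.∸ 1))
   ka (just b) = map (inBlock b) (allFin r)
   pla : List (Place k)
   pla = concatMap ka (nothing ∷ map just (allFin k))
   pm : ∀ p -> p ∈ pla
   pm (inZero κ) = ∈-++⁺ˡ (∈-map⁺ inZero (∈-allFin κ))
   pm (inBlock b κ) = ∈-++⁺ʳ _ (∈-concatMap⁺ ka (Any.map (\ e -> U.subst (\ z -> inBlock b κ ∈ ka z) e (∈-map⁺ (inBlock b) (∈-allFin κ))) (∈-map⁺ just (∈-allFin b))))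
   uG : Unique pla
   uG = uz ka d4 sor uA (ab (allFin k) ∷ map⁺ (\ { U.refl -> U.refl }) (allFin⁺ k))
    where
    d4 : Place k -> Maybe (Fin k)
    d4 (inZero κ) = nothing
    d4 (inBlock b κ) = just b
    sor : ∀ a {p} -> p ∈ ka a -> d4 p ≡ a
    sor nothing m with _ , _ , U.refl <- ∈-map⁻ inZero m = U.refl
    sor (just b) m with _ , _ , U.refl <- ∈-map⁻ (inBlock b) m = U.refl
    uA : ∀ a -> Unique (ka a)
    uA nothing = map⁺ (\ { U.refl -> U.refl }) (allFin⁺ (r Q.∸ 1))
    uA (just b) = map⁺ (\ { U.refl -> U.refl }) (allFin⁺ r)
    ab : ∀ bs -> All.All (nothing ≢_) (map just bs)
    ab [] = All.[]
    ab (b ∷ bs) = (\ ()) All.∷ ab bs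
   st : Place k -> Vec Bool k -> Vec Bool k
   st (inZero κ) U = U
   st (inBlock b κ) U = U [ b ]≔ b1
   -- The words in the places meeting every block marked by U.
   ar : ∀ m -> Vec Bool k -> List (Vec (Place k) m)
   br : ∀ m -> Vec Bool k -> Place k -> List (Vec (Place k) (Q.suc m))
   fin : O -> List (Vec (Place k) 0)
   ar Q.zero U = fin (sb U)
   ar (Q.suc m) U = concatMap (br m U) pla
   br m U p = map (p ∷_) (ar m (st p U))
   fin Q.zero = [] ∷ []
   fin (Q.suc _) = []
   u8 : ∀ m U -> Unique (ar m U)
   u8 Q.zero U with sb U
   ... | Q.zero = All.[] ∷ []
   ... | Q.suc _ = []
   u8 (Q.suc m) U = uz (br m U) Vec.head (\ p m∈ -> hf p (∈-map⁻ (p ∷_) m∈)) (\ p -> map⁺ (\ { U.refl -> U.refl }) (u8 m (st p U))) uG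
    where
    hf : ∀ p {v} -> Σ (Vec (Place k) m) (\ u -> (u ∈ ar m (st p U)) × (v ≡ p ∷ u)) -> Vec.head v ≡ p
    hf p (_ , _ , U.refl) = U.refl
   Hb : ∀ {m} -> Vec Bool k -> Vec (Place k) m -> Set
   Hb {m} U v = ∀ b -> lookup U b ≡ b2 -> Σ (Fin m) \ i -> Σ (Fin r) \ κ -> lookup v i ≡ inBlock b κ
   dz : ∀ p U b -> lookup U b ≡ b2 -> (Σ (Fin r) \ κ -> p ≡ inBlock b κ) ⊎ (lookup (st p U) b ≡ b2)
   dz (inZero κ) U b e = i2 e
   dz (inBlock b' κ) U b e with b ≟ b'
   ... | yes U.refl = i1 (κ , U.refl)
   ... | no b≢b' = i2 (U.trans (lookup∘update′ b≢b' U b1) e)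
   d0 : ∀ p U b -> lookup (st p U) b ≡ b2 -> (lookup U b ≡ b2) × (∀ κ -> p ≢ inBlock b κ)
   d0 (inZero κ) U b e = e , \ _ ()
   d0 (inBlock b' κ) U b e with b ≟ b'
   ... | yes U.refl with () <- U.trans (U.sym e) (lookup∘update b U b1)
   ... | no b≢b' = U.trans (U.sym (lookup∘update′ b≢b' U b1)) e , \ { _ U.refl -> b≢b' U.refl }
   aQ : ∀ m U {v} -> v ∈ ar m U -> Hb U v
   aQ Q.zero U v∈ b e = ⊥-elim (none (sb U) U.refl v∈)
    where
    sT : ∀ {j} (U : Vec Bool j) -> sb U ≡ 0 -> ∀ b -> lookup U b ≢ b2
    sT (b1 ∷ U) s (suc b) e = sT U s b e
    none : ∀ u -> sb U ≡ u -> ∀ {v} -> v ∈ fin u -> ⊥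
    none Q.zero s _ = sT U s b e
   aQ (Q.suc m) U {v} v∈ b e = fou (ori pla v∈)
    where
    ori : ∀ ps {v} -> v ∈ concatMap (br m U) ps -> Σ (Place k) \ p -> Σ (Vec (Place k) m) \ u -> (u ∈ ar m (st p U)) × (v ≡ p ∷ u)
    ori (p ∷ ps) h with ∈-++⁻ (br m U p) h
    ... | i1 h' = p , ∈-map⁻ (p ∷_) h'
    ... | i2 h' = ori ps h'
    fou : (Σ (Place k) \ p -> Σ (Vec (Place k) m) \ u -> (u ∈ ar m (st p U)) × (v ≡ p ∷ u)) -> Σ (Fin (Q.suc m)) \ i -> Σ (Fin r) \ κ -> lookup v i ≡ inBlock b κ
    fou (p , u , u∈ , U.refl) with dz p U b e
    ... | i1 (κ , q) = zero , κ , q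
    ... | i2 e' with i , κ , q <- aQ m (st p U) u∈ b e' = suc i , κ , q
   hg : ∀ m U v -> Hb U v -> v ∈ ar m U
   hg Q.zero U [] h = empty (sb U) U.refl
    where
    ma : ∀ {i j} (U : Vec Bool i) -> sb U ≡ Q.suc j -> Σ (Fin i) \ b -> lookup U b ≡ b2
    ma (b2 ∷ U) s = zero , U.refl
    ma (b1 ∷ U) s with b , e <- ma U s = suc b , e
    empty : ∀ u -> sb U ≡ u -> [] ∈ fin u
    empty Q.zero s = here U.refl
    empty (Q.suc u) s with b , e <- ma U s with () , _ <- h b e
   hg (Q.suc m) U (p ∷ v) h = ∈-concatMap⁺ (br m U) (Any.map (\ e -> U.subst (\ z -> p ∷ v ∈ br m U z) e (∈-map⁺ (p ∷_) (hg m (st p U) v lJ))) (pm p))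
    where
    lJ : Hb (st p U) v
    lJ b e with d0 p U b e
    ... | e' , p≢ with h b e'
    ... | zero , κ , q = ⊥-elim (p≢ κ q)
    ... | suc i , κ , q = i , κ , q
   number : O -> O -> O
   number Q.zero Q.zero = 1
   number Q.zero (Q.suc u) = 0
   number (Q.suc m) u = (r Q.∸ 1) Q.* number m u Q.+ (u Q.* (r Q.* number m (u Q.∸ 1)) Q.+ (k Q.∸ u) Q.* (r Q.* number m u))
   lx : ∀ m U -> length (ar m U) ≡ number m (sb U)
   lx Q.zero U with sb U
   ... | Q.zero = U.refl
   ... | Q.suc _ = U.refl
   lx (Q.suc m) U = U.trans (lr (br m U) pla) (U.trans (td (\ p -> length-map (p ∷_) (ar m (st p U))) pla) (U.trans (tl f ka (nothing ∷ map just (allFin k))) (U.cong₂ Q._+_ zc (U.trans (tk (\ a -> ta f (ka a)) just (allFin k)) (U.trans (tp _ id h U bl) (U.cong (\ z -> sb U Q.* h b2 Q.+ z Q.* h b1) (U.trans (U.sym (Q.m+n∸n≡m (em U) (sb U))) (U.cong (Q._∸ sb U) (eg U)))))))))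
    where
    f : Place k -> O
    f p = length (ar m (st p U))
    h : Bool -> O
    h b2 = r Q.* number m (sb U Q.∸ 1)
    h b1 = r Q.* number m (sb U)
    zc : ta f (ka nothing) ≡ (r Q.∸ 1) Q.* number m (sb U)
    zc = U.trans (tk f inZero (allFin (r Q.∸ 1))) (U.trans (tv _ (number m (sb U)) (\ _ -> lx m U) (allFin (r Q.∸ 1))) (U.cong (Q._* number m (sb U)) (lm (r Q.∸ 1))))
    sG : ∀ {j} (U : Vec Bool j) b -> sb (U [ b ]≔ b1) ≡ (if lookup U b then sb U Q.∸ 1 else sb U)
    sG (b2 ∷ U) zero = U.refl
    sG (b1 ∷ U) zero = U.refl
    sG (b1 ∷ U) (suc b) = sG U b
    sG (b2 ∷ U) (suc b) with lookup U b in e | sG U b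
    ... | b1 | q = U.cong Q.suc q
    ... | b2 | q = U.trans (U.cong Q.suc q) (pos U b e)
     where
     pos : ∀ {j} (U : Vec Bool j) b -> lookup U b ≡ b2 -> Q.suc (sb U Q.∸ 1) ≡ sb U
     pos (b2 ∷ U) b e = U.refl
     pos (b1 ∷ U) (suc b) e = pos U b e
    bl : ∀ b -> ta f (ka (just b)) ≡ h (lookup U b)
    bl b = U.trans (tk f (inBlock b) (allFin r)) (U.trans (tv _ (number m (if lookup U b then sb U Q.∸ 1 else sb U)) (\ _ -> U.trans (lx m (U [ b ]≔ b1)) (U.cong (number m) (sG U b))) (allFin r)) (U.trans (U.cong (Q._* number m (if lookup U b then sb U Q.∸ 1 else sb U)) (lm r)) (g1 (lookup U b))))
     where
     g1 : ∀ t -> r Q.* number m (if t then sb U Q.∸ 1 else sb U) ≡ h t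
     g1 b2 = U.refl
     g1 b1 = U.refl
   int : O -> O -> O -> O
   int m C q = ta (\ J -> Data.Nat.ListAction.product (ins C J)) (ch m q)
   i8 : ∀ m C q -> int (Q.suc m) C (Q.suc q) ≡ int m (Q.suc C) (Q.suc q) Q.+ (r Q.∸ 1 Q.+ r Q.* C) Q.* int m C q
   i8 m C q = U.trans (ts _ (map (b1 ∷_) (ch m (Q.suc q))) _) (U.cong₂ Q._+_ (tk _ (b1 ∷_) (ch m (Q.suc q))) (U.trans (tk _ (b2 ∷_) (ch m q)) (tn (r Q.∸ 1 Q.+ r Q.* C) (\ J -> Data.Nat.ListAction.product (ins C J)) (ch m q))))
   nj : ∀ m u -> m < u -> number m u ≡ 0
   nj Q.zero (Q.suc u) l = U.refl
   nj (Q.suc m) (Q.suc u) (s≤s l) rewrite nj m (Q.suc u) (Q.m<n⇒m<1+n l) | nj m u l = solve 4 (\ a u r b -> a :* con 0 :+ (u :* (r :* con 0) :+ b :* (r :* con 0)) := con 0) U.refl (r Q.∸ 1) (Q.suc u) r (k Q.∸ Q.suc u)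
    where open +-*-Solver
   lM : ∀ {u} -> u < k -> Q.suc (k Q.∸ Q.suc u) ≡ k Q.∸ u
   lM l = U.sym (Q.+-∸-assoc 1 l)
   nc : ∀ m u q -> u Q.+ q ≡ m -> u ≤ k -> number m u ≡ Data.Nat.ListAction.product (ou u) Q.* int m (k Q.∸ u) q
   nc Q.zero Q.zero Q.zero e l = U.refl
   nc (Q.suc m) Q.zero (Q.suc q) e l with U.refl <- Q.suc-injective e rewrite nc m 0 m U.refl z≤n | i8 m k m | cA m (Q.suc m) e3 = solve 4 (\ a k r x -> a :* (x :+ con 0) :+ k :* (r :* (x :+ con 0)) := (a :+ r :* k) :* x :+ con 0) U.refl (r Q.∸ 1) k r (int m k m)
    where open +-*-Solver
   nc (Q.suc m) (Q.suc u) Q.zero e l with U.refl <- U.trans (U.sym (e5 u)) (Q.suc-injective e) rewrite nj u (Q.suc u) e3 | nc u u 0 (e5 u) (e2 (Q.n≤1+n u) l) | tk (\ J -> Data.Nat.ListAction.product (ins (k Q.∸ Q.suc u) J)) (b1 ∷_) (ch u 0) | U.sym (lM l) = solve 6 (\ a u r p i b -> a :* con 0 :+ (u :* (r :* (p :* i)) :+ b :* (r :* con 0)) := r :* u :* p :* i) U.refl (r Q.∸ 1) (Q.suc u) r (Data.Nat.ListAction.product (ou u)) (int u (Q.suc (k Q.∸ Q.suc u)) 0) (k Q.∸ Q.suc u)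
    where open +-*-Solver
   nc (Q.suc m) (Q.suc u) (Q.suc q) e l rewrite nc m u (Q.suc q) (Q.suc-injective e) (e2 (Q.n≤1+n u) l) | nc m (Q.suc u) q (U.trans (U.sym (e8 u q)) (Q.suc-injective e)) l | i8 m (k Q.∸ Q.suc u) q | U.sym (lM l) = solve 7 (\ a u r p i b j -> a :* (r :* u :* p :* j) :+ (u :* (r :* (p :* i)) :+ b :* (r :* (r :* u :* p :* j))) := r :* u :* p :* (i :+ (a :+ r :* b) :* j)) U.refl (r Q.∸ 1) (Q.suc u) r (Data.Nat.ListAction.product (ou u)) (int m (Q.suc (k Q.∸ Q.suc u)) (Q.suc q)) (k Q.∸ Q.suc u) (int m (k Q.∸ Q.suc u) q)
    where open +-*-Solver
   nr : ∀ q D -> k Q.+ q ≡ n -> ta (\ J -> sum (ins 0 J ++ ou k)) (ch n q) ≤ D -> length (ar n fb) ≡ N n q k k D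
   nr q D k+q l = U.trans (lx n fb) (U.trans (U.cong (number n) (s5 k)) (U.trans (nc n k q k+q e3) (U.trans (U.cong (\ z -> Data.Nat.ListAction.product (ou k) Q.* int n z q) (Q.n∸n≡0 k)) (U.sym (Nc n q k l)))))
    where
    s5 : ∀ k -> sb (fb {k}) ≡ k
    s5 Q.zero = U.refl
    s5 (Q.suc k) = U.cong Q.suc (s5 k)
  module Bi (k q : O) (k+q : k Q.+ q ≡ n) where
   open K using (Carrier; 0#; 1#)
   open Kr using (_^_; ^-distrib-*)
   open Pa using (Place; inZero; inBlock)
   open Bas
   open Op
   open Ro
   open Kj
   open S7 using (dk; dl; Ic; ro)
   open Cc using (nat)
   open Wo
   open Tg
   open St using (loc; l3; coefficient)
   open Kn using (solve; _:=_; _:*_; _:-_)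
   open Km using () renaming (∑ to ∏; ue to ∏-0; sf to ∏-suc; uh to ∏-*; rc to ∏-remove)
   open Sn P.*-commutativeMonoid using () renaming (∑ to ∏ᴾ; ue to ∏ᴾ-0; sf to ∏ᴾ-suc)
   y : Fin k -> Carrier
   y b = nat (Q.suc (toℕ b))
   open Coo k q k+q y public using (F; Fs; colour; fl; module At; square; t)
   ty : Fin k -> Fin r -> Fin k -> Fin r -> Bool
   ty b κ b' κ' = does (b ≟ b') ∧ does (κ ≟ κ')
   lC : Bool -> Carrier -> Fin n -> Pb
   lC b2 a i = con 1#
   lC b1 a i = var i ⊟ con a
   lv : Bool -> Carrier -> Carrier -> Carrier
   lv b2 a v = 1#
   lv b1 a v = v K.+ (K.- 1#) K.* a
   -- Lagrange factors: among all places of i, the coefficient or value of test p i is nonzero at p alone.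
   t8 : Place k -> Fin n -> Pb
   t8 (inZero κ) i = var i ^ᴾ toℕ (opposite κ) ⊠ ∏ᴾ (\ b -> X i ⊟ con (y b ^ r))
   t8 (inBlock b κ) i = var i ^ᴾ (r Q.∸ 1) ⊠ ∏ᴾ (\ b' -> ∏ᴾ \ κ' -> lC (ty b κ b' κ') (pow κ' K.* y b') i)
   t4 : Place k -> Carrier -> Carrier
   t4 (inZero κ) v = v ^ toℕ (opposite κ) K.* ∏ (\ b -> v ^ r K.+ (K.- 1#) K.* y b ^ r)
   t4 (inBlock b κ) v = v ^ (r Q.∸ 1) K.* ∏ (\ b' -> ∏ \ κ' -> lv (ty b κ b' κ') (pow κ' K.* y b') v)
   sW : Place k -> Place k -> Carrier
   sW (inZero κ) (inZero κ') = ∏ {k} \ b -> 0# K.+ (K.- 1#) K.* y b ^ r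
   sW (inZero κ) (inBlock b κ') = 0#
   sW (inBlock b κ) p = t4 p (pow κ K.* y b)
   r8 : Place k -> Place k -> O
   r8 (inZero κ) (inZero κ') = toℕ (opposite κ')
   r8 _ _ = 0
   en : Place k -> Place k -> Carrier
   en z p = sW z p K.* loc (si y (fl z)) (r8 z p)
   te : (Fin n -> Place k) -> Pb
   te ρ = ∏ᴾ \ i -> t8 (ρ i) i
   module _ (π : Fin n -> Place k) where
    open At π using (Ev; Ea; Eb; El; Eg; Ac; Ae; Eh)
    record EvA (a : Pb) (s : Carrier) : Set (c ⊔ ℓ) where
     constructor acting
     field eff : ∀ g -> Ev (a ⊠ g) K.≈ s K.* Ev g
    open EvA
    Ed : ∀ s -> EvA (con s) s
    Ed s = acting (Eb (Ac s))
    Em : ∀ {a b s t} -> EvA a s -> EvA b t -> EvA (a ⊞ b) (s K.+ t)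
    Em h h' = acting \ g -> K.trans (Ea (P.distribʳ g _ _)) (K.trans (Eg _ _) (K.trans (K.+-cong (eff h g) (eff h' g)) (K.sym (K.distribʳ _ _ _))))
    Ef : ∀ {a b s t} -> EvA a s -> EvA b t -> EvA (a ⊠ b) (s K.* t)
    Ef h h' = acting \ g -> K.trans (Ea (P.*-assoc _ _ g)) (K.trans (eff h _) (K.trans (K.*-congˡ (eff h' g)) (K.sym (K.*-assoc _ _ _))))
    Ej : ∀ {a s} -> EvA a s -> ∀ t -> EvA (a ⊟ con t) (s K.+ (K.- 1#) K.* t)
    Ej h t = Em h (Ef (Ed (K.- 1#)) (Ed t))
    En : ∀ {a s} -> EvA a s -> ∀ e -> EvA (a ^ᴾ e) (s ^ e)
    En h Q.zero = Ed 1#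
    En h (Q.suc e) = Ef h (En h e)
    Ee : ∀ {m} {a : Fin m -> Pb} {s} -> (∀ j -> EvA (a j) (s j)) -> EvA (∏ᴾ a) (∏ s)
    Ee {Q.zero} h = acting \ g -> K.trans (Ea (P.*-congʳ (∏ᴾ-0 _))) (K.trans (eff (Ed 1#) g) (K.*-congʳ (K.sym (∏-0 _))))
    Ee {Q.suc m} h = acting \ g -> K.trans (Ea (P.*-congʳ (∏ᴾ-suc _))) (K.trans (eff (Ef (h zero) (Ee (h ∘ suc))) g) (K.*-congʳ (K.sym (∏-suc _))))
    record Re (i : Fin n) (a : Pb) (s : Carrier) (e : O) : Set (c ⊔ ℓ) where
     constructor reducing
     field rR : ∀ g -> Ev (a ⊠ g) K.≈ s K.* Ev (var i ^ᴾ e ⊠ g)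
    open Re
    lG : ∀ {i v} -> EvA (var i) v -> ∀ b a -> EvA (lC b a i) (lv b a v)
    lG h b2 a = Ed 1#
    lG h b1 a = Ej h a
    t3 : ∀ i z -> π i ≡ z -> ∀ p -> Re i (t8 p i) (sW z p) (r8 z p)
    t3 i (inBlock b κ) e p = reducing \ g -> K.trans (eff (gy p) g) (K.*-congˡ (Ea (P.sym (P.*-identityˡ g))))
     where
     at : EvA (var i) (pow κ K.* y b)
     at = acting (Eb (Ae {i} (U.cong fl e)))
     gy : ∀ p -> EvA (t8 p i) (t4 p (pow κ K.* y b))
     gy (inZero κ') = Ef (En at (toℕ (opposite κ'))) (Ee \ b' -> Ej (En at r) (y b' ^ r))
     gy (inBlock b' κ') = Ef (En at (r Q.∸ 1)) (Ee \ b″ -> Ee \ κ″ -> lG at (ty b' κ' b″ κ″) (pow κ″ K.* y b″))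
    t3 i (inZero κ) e (inBlock b κ') = reducing \ g -> K.trans (Ea (P.*-assoc _ _ g)) (K.trans (El {i} (U.cong fl e) (toℕ<n (opposite κ)) _) (K.sym (K.zeroˡ _)))
    t3 i (inZero κ) e (inZero κ') = reducing \ g -> K.trans (Ea (P.trans (P.*-congʳ (P.*-comm _ _)) (P.*-assoc _ _ g))) (eff (Ee \ b -> Ej ki (y b ^ r)) _)
     where
     ki : EvA (X i) 0#
     ki = acting \ g -> K.trans (El {i} {e = r} (U.cong fl e) (e4 (toℕ<n (opposite κ)) (Q.m∸n≤m r 1)) g) (K.sym (K.zeroˡ _))
    rr : ∀ {m} (f : Fin m -> Fin n) {a s} {e : Fin m -> O} -> (∀ j -> Re (f j) (a j) (s j) (e j)) -> ∀ g -> Ev (∏ᴾ a ⊠ g) K.≈ ∏ s K.* Ev (∏ᴾ (\ j -> var (f j) ^ᴾ e j) ⊠ g)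
    rr {Q.zero} f h g = K.trans (Ea (P.*-congʳ (P.trans (∏ᴾ-0 _) (P.sym (∏ᴾ-0 _))))) (K.trans (K.sym (K.*-identityˡ _)) (K.*-congʳ (K.sym (∏-0 _))))
    rr {Q.suc m} f {a} {s} {e} h g = K.trans (Ea (P.trans (P.*-congʳ (∏ᴾ-suc a)) (P.*-assoc _ _ g))) (K.trans (rR (h zero) _) (K.trans (K.*-congˡ (K.trans (Ea (exc _ _ g)) (rr (f ∘ suc) {e = e ∘ suc} (h ∘ suc) _))) (K.trans (K.sym (K.*-assoc _ _ _)) (K.*-cong (K.sym (∏-suc s)) (Ea (P.trans (exc _ _ g) (P.trans (P.sym (P.*-assoc _ _ g)) (P.*-congʳ (P.sym (∏ᴾ-suc (\ j -> var (f j) ^ᴾ e j)))))))))))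
     where
     exc : ∀ a b g -> a ⊠ (b ⊠ g) ≈ᴾ b ⊠ (a ⊠ g)
     exc a b g = P.trans (P.sym (P.*-assoc a b g)) (P.trans (P.*-congʳ (P.*-comm a b)) (P.*-assoc b a g))
    Es : ∀ ρ -> Ev (te ρ) K.≈ ∏ \ i -> en (π i) (ρ i)
    Es ρ = K.trans (Ea (P.sym (P.*-identityʳ _))) (K.trans (rr id {e = \ i -> r8 (π i) (ρ i)} (\ i -> t3 i (π i) U.refl (ρ i)) P.1#) (K.trans (K.*-congˡ (K.trans (Ea (P.*-identityʳ _)) (Eh (\ i -> r8 (π i) (ρ i))))) (K.sym (∏-* _ _))))
   yb : ∀ b -> Inv (y b)
   yb b = char0 (toℕ b)
   Iq : ∀ {a} -> Inv a -> ∀ e -> Inv (a ^ e)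
   Iq i Q.zero = Ih
   Iq i (Q.suc e) = Ie i (Iq i e)
   Ig : ∀ {m} {f : Fin m -> Carrier} -> (∀ j -> Inv (f j)) -> Inv (∏ f)
   Ig {Q.zero} h = Ia (K.sym (∏-0 _)) Ih
   Ig {Q.suc m} h = Ia (K.sym (∏-suc _)) (Ie (h zero) (Ig (h ∘ suc)))
   vb : ∀ {m} {f : Fin m -> Carrier} i -> f i K.≈ 0# -> ∏ f K.≈ 0#
   vb {Q.suc m} {f} i e = K.trans (∏-remove i f) (K.trans (K.*-congʳ e) (K.zeroˡ _))
   ul : ∀ a -> (K.- 1#) K.* a K.≈ K.- a
   ul = RingProperties.-1*x≈-x K.ring
   pX : ∀ b κ -> Inv (pow κ K.* y b)
   pX b κ = Ie (Ic (toℕ κ)) (yb b)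
   dE : ∀ b κ b' κ' -> ty b κ b' κ' ≡ b1 -> Inv (pow κ K.* y b K.- pow κ' K.* y b')
   dE b κ b' κ' e with b ≟ b'
   ... | no b≢b' = dk κ κ' _ _ \ q -> b≢b' (toℕ-injective (Q.suc-injective q))
   ... | yes U.refl with κ ≟ κ'
   ... | no us = Ia (solve 3 (\ a b y -> (a :- b) :* y := a :* y :- b :* y) K.refl (pow κ) (pow κ') (y b)) (Ie (dl us) (yb b))
   ey : ∀ p -> Inv (en p p)
   ey (inZero κ) = Ie (Ig {k} \ b -> Ia (K.sym (K.trans (K.+-identityˡ _) (ul _))) (Il (Iq (yb b) r))) (Ia (K.sym (l3 (coefficient (toℕ (opposite κ))))) Ih)
   ey (inBlock b κ) = Ie (Ie (Iq (pX b κ) (r Q.∸ 1)) (Ig \ b' -> Ig \ κ' -> fx b' κ' (ty b κ b' κ') U.refl)) Ih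
    where
    fx : ∀ b' κ' t -> ty b κ b' κ' ≡ t -> Inv (lv t (pow κ' K.* y b') (pow κ K.* y b))
    fx b' κ' b2 e = Ih
    fx b' κ' b1 e = Ia (K.+-congˡ (K.sym (ul _))) (dE b κ b' κ' e)
   my : ∀ {a b} -> a K.≈ b -> a K.+ (K.- 1#) K.* b K.≈ 0#
   my e = K.trans (K.+-cong e (ul _)) (K.-‿inverseʳ _)
   ek : ∀ z p -> z ≢ p -> en z p K.≈ 0#
   ek (inZero κ) (inZero κ') z≢p = K.trans (K.*-congˡ (K.reflexive (U.cong (\ t -> if t then 1# else 0#) (dec-false (toℕ (opposite κ') Q.≟ toℕ (opposite κ)) \ e -> z≢p (U.cong inZero (U.trans (U.sym (opposite-involutive κ)) (U.trans (U.cong opposite (U.sym (toℕ-injective e))) (opposite-involutive κ')))))))) (K.zeroʳ _)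
   ek (inZero κ) (inBlock b κ') z≢p = K.zeroˡ _
   ek (inBlock b κ) (inZero κ') z≢p = K.trans (K.*-congʳ (K.trans (K.*-congˡ (vb b (my (K.trans (^-distrib-* _ _ r) (K.trans (K.*-congʳ (ro κ)) (K.*-identityˡ _)))))) (K.zeroʳ _))) (K.zeroˡ _)
   ek (inBlock b κ) (inBlock b' κ') z≢p = K.trans (K.*-congʳ (K.trans (K.*-congˡ (vb b (vb κ (K.trans (K.reflexive (U.cong (\ t -> lv t (pow κ K.* y b) (pow κ K.* y b)) dF)) (my K.refl))))) (K.zeroʳ _))) (K.zeroˡ _)
    where
    dF : ty b' κ' b κ ≡ b1
    dF with b' ≟ b | κ' ≟ κ
    ... | no _ | _ = U.refl
    ... | yes _ | no _ = U.refl
    ... | yes U.refl | yes U.refl = ⊥-elim (z≢p U.refl)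
   cx : ∀ {w} -> Fil 0 n w -> Σ Carrier \ a -> w ≈Ω scalar a * ua fb
   cx (Sa.word a [] js (_ , e)) with s , z <- sA js e = a K.* s , trans (*-congˡ (trans (*-identityˡ _) z)) (trans (sym (*-assoc _ _ _)) (*-congʳ (sym (scalar-* a s))))
   cx Sa.none = 0# , sym (zeroˡ _)
   cx (h Sa.+ h') with a , e <- cx h | b , e' <- cx h' = a K.+ b , trans (+-cong e e') (trans (sym (distribʳ _ _ _)) (*-congʳ (sym (scalar-+ a b))))
   cx (Sa.resp p h) with a , e <- cx h = a , trans (sym p) e
   -- The complement of the chosen representatives.
   module Ch (π : Fin n -> Place k) (nonempty : ∀ b -> Σ (Fin n) \ i -> Σ (Fin r) \ κ -> π i ≡ inBlock b κ) where
    open At π using (φs; Ev; Eb; Ac; ψ; Ei; sq; lg; module Rf)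
    re : Fin k -> Fin n
    re b = p1 (nonempty b)
    r0 : ∀ b -> fl (π (re b)) ≡ inBlock b (p1 (p2 (nonempty b)))
    r0 b = U.cong fl (p2 (p2 (nonempty b)))
    block : ∀ {b b' κ κ'} -> inBlock {k} b κ ≡ inBlock b' κ' -> b ≡ b'
    block U.refl = U.refl
    injective : ∀ {b b'} -> re b ≡ re b' -> b ≡ b'
    injective {b} {b'} e = block (U.trans (U.sym (p2 (p2 (nonempty b)))) (U.trans (U.cong π e) (p2 (p2 (nonempty b')))))
    rem : List (Fin k) -> Vec Bool n
    rem [] = fb
    rem (b ∷ bs) = rem bs [ re b ]≔ b1
    r2 : ∀ {b bs} -> b ∈ bs -> lookup (rem bs) (re b) ≡ b1
    r2 {bs = _ ∷ bs} (here U.refl) = lookup∘update _ (rem bs) b1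
    r2 {b} {b' ∷ bs} (there m) with re b ≟ re b'
    ... | yes e = U.subst (\ z -> lookup (rem (b' ∷ bs)) z ≡ b1) (U.sym e) (lookup∘update _ (rem bs) b1)
    ... | no p = U.trans (lookup∘update′ p (rem bs) b1) (r2 m)
    cov : ∀ bs i -> lookup (rem bs) i ≡ b2 ⊎ Σ (Fin k) \ b -> (b ∈ bs) × (i ≡ re b)
    cov [] i = i1 (lookup-replicate i b2)
    cov (b ∷ bs) i with i ≟ re b
    ... | yes e = i2 (b , here U.refl , e)
    ... | no p with cov bs i
    ... | i1 e = i1 (U.trans (lookup∘update′ p (rem bs) b1) e)
    ... | i2 (b' , m , e) = i2 (b' , there m , e)
    bp : ∀ {bs} -> Unique bs -> length bs Q.+ sb (rem bs) ≡ n
    bp [] = s5 n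
     where
     s5 : ∀ m -> sb (fb {m}) ≡ m
     s5 Q.zero = U.refl
     s5 (Q.suc m) = U.cong Q.suc (s5 m)
    bp {b ∷ bs} (b∉ ∷ u) = U.trans (U.sym (e8 (length bs) _)) (U.trans (U.cong (length bs Q.+_) (U.trans (U.sym (s7 (J [ i ]≔ b1) i (lookup∘update i J b1))) (U.cong sb res))) (bp u))
     where
     J = rem bs
     i = re b
     ii : lookup J i ≡ b2
     ii with cov bs i
     ... | i1 e = e
     ... | i2 (b' , m , e) = ⊥-elim (All.lookup b∉ m (injective e))
     res : J [ i ]≔ b1 [ i ]≔ b2 ≡ J
     res = U.trans ([]≔-idempotent J i) (U.trans (U.cong (J [ i ]≔_) (U.sym ii)) ([]≔-lookup J i))
    J : Vec Bool n
    J = rem (allFin k)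
    lm : length (allFin k) ≡ k
    lm = length-tabulate {n = k} id
    s3 : sb J ≡ q
    s3 = Q.+-cancelˡ-≡ k _ _ (U.trans (U.cong (Q._+ sb J) (U.sym lm)) (U.trans (bp (allFin⁺ k)) (U.sym k+q)))
    df : Ω
    df = ι (te π) * ua J
    dG : ∀ {d} -> Pc d (te π) -> Fil d q df
    dG {d} p = Fa (e1 (e5 d)) (Fb p (U.subst (\ z -> Fil 0 z (ua J)) (U.trans (lc id J) s3) (Fc _)))
    dg : ∀ ρ a -> ap (At.φs ρ (allFin k)) (ua J) ≈Ω scalar a * ua fb -> At.ψ ρ df K.≈ a K.* ∏ (\ i -> en (ρ i) (π i))
    dg ρ a e = K.trans (At.Ei ρ {g = con a ⊠ te π} (trans (a1 (At.φs ρ (allFin k)) (te π) _) (trans (*-congˡ e) (trans (sd _ _ _) (sym (*-assoc _ _ _)))))) (K.trans (At.Eb ρ (At.Ac ρ a) (te π)) (K.*-congˡ (Es ρ π)))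
    dy : ∀ p -> Inv (square p)
    dy (inZero κ) = Ih
    dy (inBlock b κ) = Ie (Ic (toℕ κ)) (Ic (toℕ κ))
    ot : ∀ {b} -> b ∈ allFin k -> ∀ {i κ} -> fl (π i) ≡ inBlock b κ -> i ≡ re b ⊎ lookup J i ≡ b2
    ot {b} _ {i} e with cov (allFin k) i
    ... | i1 e' = i2 e'
    ... | i2 (b' , _ , U.refl) = i1 (U.cong re (block (U.trans (U.sym (r0 b')) e)))
    dp : Inv (F π df)
    dp with s , i , e <- Rf.t9 re (\ b -> p1 (p2 (nonempty b))) (\ {b} _ -> r0 b) (allFin k) J (allFin⁺ k) (\ m -> m) r2 ot (cov (allFin k)) = Ie (Ig \ j -> dy (π j)) (Ia (K.sym (dg π s e)) (Ie i (Ig \ j -> ey (π j))))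
    dI : ∀ ρ i -> ρ i ≢ π i -> F ρ df K.≈ 0#
    dI ρ i p = K.trans (K.*-congˡ (vc (cx (U.subst (\ z -> Fil 0 z (ap (At.φs ρ (allFin k)) (ua J))) lO (a7 (At.φs ρ (allFin k)) (At.sq ρ (allFin k)) (Fc _)))))) (K.zeroʳ _)
     where
     lO : length (At.φs ρ (allFin k)) Q.+ length (mem id J) ≡ n
     lO = U.trans (U.cong₂ Q._+_ (U.trans (At.lg ρ (allFin k)) lm) (U.trans (lc id J) s3)) k+q
     vc : (Σ Carrier \ a -> ap (At.φs ρ (allFin k)) (ua J) ≈Ω scalar a * ua fb) -> At.ψ ρ df K.≈ 0#
     vc (a , e) = K.trans (dg ρ a e) (K.trans (K.*-congˡ (vb i (ek (ρ i) (π i) p))) (K.zeroʳ _))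
  module Id (k q : O) (k+q : k Q.+ q ≡ n) where
   open K using (Carrier; 0#; 1#)
   open Su using (actΩ)
   open Pa
   open OP
   open Mf using (det)
   open Presentations K.ring hiding (refl; sym; trans)
   open Actions K.ring (Group.G n r)
   open Bas
   open Op
   open Fl
   open Grp using (G; ⊖_; ug; _⁻¹; ij; ia; ie) renaming (_⊕_ to infixl 6 _⊞ᶜ_; ⊕-assoc to ⊞ᶜ-assoc)
   open Rep
   open Kj using (Inv)
   open Ca
   open Bi k q k+q public using (ul; F; Fs; colour; module At; module Ch; t; te; y)
   open Ar k
   open Vo using () renaming (det to determinant)
   open Kl using (∑; cb; sj; δ; s0; dc; ux)
   open Km using () renaming (∑ to ∏; ur to ∏-unfold; pc to ∏-permute; cb to ∏-cong)
   all : List (Vec (Place k) n)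
   all = ar n fb
   M : O
   M = length all
   π : Fin M -> Fin n -> Place k
   π j = lookup (List.lookup all j)
   hit : ∀ j b -> Σ (Fin n) \ i -> Σ (Fin r) \ κ -> π j i ≡ inBlock b κ
   hit j b = aQ n fb (∈-lookup j) b (lookup-replicate b b2)
   partition : Fin M -> OP k
   partition j = record { place = π j ; nonempty = hit j }
   fou : (σ : OP k) -> Data.Vec.Base.tabulate (place σ) ∈ all
   fou σ = hg n fb (Data.Vec.Base.tabulate (place σ)) \ b _ -> let i , κ , e = nonempty σ b in i , κ , U.trans (lookup∘tabulate (place σ) i) e
   index : OP k -> Fin M
   index σ = Any.index (fou σ)
   ic : ∀ σ i -> π (index σ) i ≡ place σ i
   ic σ i = U.trans (U.cong (\ v -> lookup v i) (U.sym (Any.lookup-index (fou σ)))) (lookup∘tabulate (place σ) i)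
   ib : ∀ {i j} -> (∀ m -> π i m ≡ π j m) -> i ≡ j
   ib {i} {j} e = lp (u8 n fb) i j (U.trans (U.sym (tabulate∘lookup (List.lookup all i))) (U.trans (Data.Vec.Properties.tabulate-cong e) (tabulate∘lookup (List.lookup all j))))
   Ta : i9 K.ring _ _
   Ta = Action.space (K[OP k ] ⊗ det)
   module T = La Ta
   -- Functionals on presented modules.
   eva : ∀ {a} {A : Set a} -> (A -> Carrier) -> Combination A -> Carrier
   eva f (gen z₁) = f z₁
   eva f 𝟘 = 0#
   eva f (s ⊕ t) = eva f s K.+ eva f t
   eva f (a • s) = a K.* eva f s
   ea : ∀ {a ρ} {A : Set a} {_~_ : Rel (Combination A) ρ} (f : A -> Carrier) -> (∀ {s t} -> s ~ t -> eva f s K.≈ eva f t) -> ∀ {s t} -> Congruence _~_ s t -> eva f s K.≈ eva f t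
   ea f h (relation p) = h p
   ea f h Congruence.refl = K.refl
   ea f h (Congruence.sym p) = K.sym (ea f h p)
   ea f h (Congruence.trans p q) = K.trans (ea f h p) (ea f h q)
   ea f h (⊕-cong p q) = K.+-cong (ea f h p) (ea f h q)
   ea f h (•-cong e p) = K.*-cong e (ea f h p)
   ea f h (⊕-assoc s t u) = K.+-assoc _ _ _
   ea f h (⊕-comm s t) = K.+-comm _ _
   ea f h (⊕-identityˡ s) = K.+-identityˡ _
   ea f h (•-zeroˡ s) = K.zeroˡ _
   ea f h (•-zeroʳ a) = K.zeroʳ a
   ea f h (•-distribʳ s a b) = K.distribʳ _ a b
   ea f h (•-distribˡ a s t) = K.distribˡ a _ _
   ea f h (•-assoc a b s) = K.*-assoc a b _
   ea f h (•-identityˡ s) = K.*-identityˡ _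
   wei : Fin M -> OP k -> Carrier
   wei j σ = δ (index σ) j
   g2 : Fin M -> Combination (OP k) × Carrier -> Carrier
   g2 j (s , a) = a K.* eva (wei j) s
   cz : Fin M -> Combination (Combination (OP k) × Carrier) -> Carrier
   cz j = eva (g2 j)
   c0 : ∀ j {z₁ y} -> z₁ T.≈ᴹ y -> cz j z₁ K.≈ cz j y
   c0 j = ea (g2 j) respects
    where
    gs : ∀ {s t} -> FreeRelation (OP-setoid k) s t -> eva (wei j) s K.≈ eva (wei j) t
    gs (gen-cong {σ} {τ} p) = K.reflexive (U.cong (\ z -> δ z j) (ib \ i -> U.trans (ic σ i) (U.trans (p i) (U.sym (ic τ i)))))
    swap : ∀ a b c -> a K.* (b K.* c) K.≈ b K.* (a K.* c)
    swap a b c = K.trans (K.sym (K.*-assoc a b c)) (K.trans (K.*-congʳ (K.*-comm a b)) (K.*-assoc b a c))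
    respects : ∀ {s t} -> TensorRelation (free (OP-setoid k)) (Action.space det) s t -> cz j s K.≈ cz j t
    respects (⊗-cong p e) = K.*-cong e (ea (wei j) gs p)
    respects (⊗-+ˡ u u′ v) = K.distribˡ _ _ _
    respects (⊗-+ʳ u v v′) = K.distribʳ _ _ _
    respects (⊗-*ˡ a u v) = swap _ _ _
    respects (⊗-*ʳ a u v) = K.*-assoc _ _ _
   fu : ∀ j -> Li Ta (TensorUnit.leftModule {R = K.ring})
   fu j = record { fun = cz j ; f-cong = c0 j ; f-+ = \ _ _ -> K.refl ; f-* = \ _ _ -> K.refl }
   uo : OP k -> Combination (Combination (OP k) × Carrier)
   uo σ = gen (gen σ , 1#)
   ba : Fin M -> Combination (Combination (OP k) × Carrier)
   ba j = uo (partition j)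
   u3 : ∀ σ -> uo σ T.≈ᴹ ba (index σ)
   u3 σ = relation (⊗-cong (relation (gen-cong \ i -> U.sym (ic σ i))) K.refl)
   Rec : Combination (Combination (OP k) × Carrier) -> Set _
   Rec z₁ = z₁ T.≈ᴹ T.co (\ j -> cz j z₁) ba
   rM : ∀ {z₁ y z} -> z T.≈ᴹ z₁ ⊕ y -> Rec z₁ -> Rec y -> Rec z
   rM {z₁} {y} e h h' = T.≈ᴹ-trans e (T.≈ᴹ-trans (⊕-cong h h') (T.≈ᴹ-trans (T.≈ᴹ-sym (T.cC _ _ ba)) (T.∑ᴹ-cong \ j -> T.*ₗ-congʳ (K.sym (c0 j e)))))
   rq : ∀ {a z₁ z} -> z T.≈ᴹ a • z₁ -> Rec z₁ -> Rec z
   rq {a} e h = T.≈ᴹ-trans e (T.≈ᴹ-trans (T.*ₗ-congˡ h) (T.≈ᴹ-trans (T.≈ᴹ-sym (T.cB a _ ba)) (T.∑ᴹ-cong \ j -> T.*ₗ-congʳ (K.sym (c0 j e)))))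
   rs : ∀ {z} -> z T.≈ᴹ 𝟘 -> Rec z
   rs e = T.≈ᴹ-trans e (T.≈ᴹ-sym (T.∑ᴹ-zero \ j -> T.≈ᴹ-trans (T.*ₗ-congʳ (c0 j e)) (T.*ₗ-zeroˡ _)))
   rj : ∀ s -> Rec (gen (s , 1#))
   rj (gen σ) = T.≈ᴹ-trans (u3 σ) (T.≈ᴹ-trans (T.≈ᴹ-sym (T.c1 (index σ) ba)) (T.∑ᴹ-cong \ j -> T.*ₗ-congʳ (K.trans (d1 j (index σ)) (K.sym (K.*-identityˡ _)))))
    where
    d1 : ∀ i j -> δ i j K.≈ δ j i
    d1 i j with i ≟ j
    ... | yes U.refl = K.reflexive (U.sym (s0 i))
    ... | no p = K.reflexive (U.sym (dc (\ e -> p (U.sym e))))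
   rj 𝟘 = rs (T.≈ᴹ-trans (relation (⊗-cong (Congruence.sym (•-zeroˡ 𝟘)) K.refl)) (T.≈ᴹ-trans (relation (⊗-*ˡ 0# 𝟘 1#)) (T.*ₗ-zeroˡ _)))
   rj (s ⊕ t) = rM (relation (⊗-+ˡ s t 1#)) (rj s) (rj t)
   rj (a • s) = rq (relation (⊗-*ˡ a s 1#)) (rj s)
   rz : ∀ z₁ -> Rec z₁
   rz (gen (s , a)) = rq (T.≈ᴹ-trans (relation (⊗-cong Congruence.refl (K.sym (K.*-identityʳ a)))) (relation (⊗-*ʳ a s 1#))) (rj s)
   rz 𝟘 = rs Congruence.refl
   rz (z₁ ⊕ y) = rM Congruence.refl (rz z₁) (rz y)
   rz (a • z₁) = rq Congruence.refl (rz z₁)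
   iH : ∀ j -> index (partition j) ≡ j
   iH j = ib (ic (partition j))
   lB : ∀ {m l p} {V : i9 K.ring m l} (L : Li V (TensorUnit.leftModule {R = K.ring})) (a : Fin p -> Carrier) v -> fun L (La.co V a v) K.≈ ∑ (\ j -> a j K.* fun L (v j))
   lB {V = V} L a v = K.trans (Ho.ha (i9.+ᴹ-commutativeMonoid V) K.+-commutativeMonoid (fun L) (f-cong L) (f-0 L) (f-+ L) _) (cb \ j -> f-* L (a j) (v j))
   c3 : ∀ (u : Fin M -> Carrier) i -> cz i (T.co u ba) K.≈ u i
   c3 u i = K.trans (lB (fu i) u ba) (K.trans (cb \ j -> K.*-congˡ (K.trans (K.*-identityˡ _) (K.reflexive (U.cong (\ z -> δ z i) (iH j))))) (ux u i))
   gj : Sur Ta M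
   gj = record { va = \ z₁ j -> cz j z₁ ; vd = \ e j -> c0 j e ; vg = \ a w j -> lB (fu j) a w ; wi = \ u -> T.co u ba ; vk = c3 }
   F-+ : ∀ ρ u v -> F ρ (u + v) K.≈ F ρ u K.+ F ρ v
   F-+ ρ u v = K.trans (K.*-congˡ (At.u5 ρ u v)) (K.distribˡ _ _ _)
   F-* : ∀ ρ a u -> F ρ (scalar a * u) K.≈ a K.* F ρ u
   F-* ρ a u = K.trans (K.*-congˡ (At.sr ρ a u)) (K.trans (K.sym (K.*-assoc _ _ _)) (K.trans (K.*-congʳ (K.*-comm _ a)) (K.*-assoc _ _ _)))
   open Tg using (ya)
   cs : O -> Carrier
   cs = ya y (allFin k)
   open To b1 cs q using (space; Sub)
   _≟ₚ_ : (p p′ : Place k) -> Dec (p ≡ p′)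
   inZero κ ≟ₚ inZero κ' = map′ (U.cong inZero) (\ { U.refl -> U.refl }) (κ ≟ κ')
   inZero κ ≟ₚ inBlock b' κ' = no \ ()
   inBlock b κ ≟ₚ inZero κ' = no \ ()
   inBlock b κ ≟ₚ inBlock b' κ' = map′ (\ (e , e') -> U.cong₂ inBlock e e') (\ { U.refl -> U.refl , U.refl }) (b ≟ b' ×-dec κ ≟ κ')
   module Du (j : Fin M) = Ch (π j) (hit j)
   dH : ∀ i j -> j ≢ i -> F (π i) (Du.df j) K.≈ 0#
   dH i j j≢i with m , p <- ¬∀⟶∃¬ n (\ m -> π i m ≡ π j m) (\ m -> π i m ≟ₚ π j m) (\ e -> j≢i (U.sym (ib e))) = Du.dI j (π i) m p
   module _ (D : O) where
    Fo : ∀ j -> Li (space k D) (TensorUnit.leftModule {R = K.ring})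
    Fo j = record { fun = \ u -> F (π j) (p1 u) ; f-cong = \ {u} {v} h -> In.za K (K.trans (K.+-congˡ (K.sym (ul _))) (K.trans (K.+-congˡ (K.sym (F-* (π j) (K.- 1#) (p1 v)))) (K.trans (K.sym (F-+ (π j) (p1 u) _)) (vc h)))) ; f-+ = \ u v -> F-+ (π j) (p1 u) (p1 v) ; f-* = \ a u -> F-* (π j) a (p1 u) }
     where
     vc : ∀ {f} -> Sub k D f -> F (π j) f K.≈ 0#
     vc h = K.trans (K.*-congˡ (At.Sm (π j) q (U.trans (U.cong (Q._+ q) (lm k)) k+q) cs k D (\ _ -> K.refl) h)) (K.zeroʳ _)
    identify : Li (space k D) Ta
    identify = record { fun = \ u -> T.co (\ j -> fun (Fo j) u) ba ; f-cong = \ {u} {v} e -> T.∑ᴹ-cong \ j -> T.*ₗ-congʳ (f-cong (Fo j) {u} {v} e) ; f-+ = \ u v -> T.≈ᴹ-trans (T.∑ᴹ-cong \ j -> T.*ₗ-congʳ (f-+ (Fo j) u v)) (T.cC _ _ ba) ; f-* = \ a u -> T.≈ᴹ-trans (T.∑ᴹ-cong \ j -> T.*ₗ-congʳ (f-* (Fo j) a u)) (T.cB a _ ba) }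
    module _ (large : ∀ j -> Fil D q (Du.df j)) where
     iz : i9.Carrierᴹ Ta -> Σ Ω (Fil D q)
     iz z₁ = La.co (space k D) (\ j -> cz j z₁ K.* p1 (Du.dp j)) (\ j -> Du.df j , large j)
     Fu : ∀ z₁ i -> fun (Fo i) (iz z₁) K.≈ cz i z₁
     Fu z₁ i = K.trans (lB (Fo i) _ (\ j -> Du.df j , large j)) (K.trans (sj _ i \ j p -> K.trans (K.*-congˡ (dH i j p)) (K.zeroʳ _)) (K.trans (K.*-assoc _ _ _) (K.trans (K.*-congˡ (K.trans (K.*-comm _ _) (p2 (Du.dp i)))) (K.*-identityʳ _))))
     i6 : ∀ z₁ -> fun identify (iz z₁) T.≈ᴹ z₁
     i6 z₁ = T.≈ᴹ-trans (T.∑ᴹ-cong \ j -> T.*ₗ-congʳ (Fu z₁ j)) (T.≈ᴹ-sym (rz z₁))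
     iD : Ba (space k D) M -> ∀ u -> fun identify u T.≈ᴹ T.0ᴹ -> i9._≈ᴹ_ (space k D) u (i9.0ᴹ (space k D))
     iD B = sur identify B gj iz i6
   module Te = Action (K[OP k ] ⊗ det)
   md : G -> OP k -> OP k
   md (colour , w) σ = recolour colour (permuteOP w σ)
   d8 : ∀ g -> Li Ta Ta
   d8 g = record { fun = Te.act g ; f-cong = H.⟦⟧-cong ; f-+ = H.+ᴹ-homo ; f-* = H.*ₗ-homo }
    where module H = LeftModuleMorphisms.IsLeftModuleHomomorphism (Te.act-linear g)
   d9 : ∀ g σ -> Te.act g (uo σ) T.≈ᴹ (weight (p1 g) (permuteOP (p2 g) σ) K.* determinant g) • ba (index (md g σ))
   d9 g σ = T.≈ᴹ-trans (relation (⊗-*ˡ _ _ _)) (T.≈ᴹ-trans (T.*ₗ-congˡ (relation (⊗-*ʳ _ _ _))) (T.≈ᴹ-trans (T.≈ᴹ-sym (T.*ₗ-assoc _ _ _)) (T.*ₗ-congˡ (u3 (md g σ)))))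
   sZ : ∀ c d -> c ⊞ᶜ d ≡ ug -> (p : Place k) -> shift d (shift c p) ≡ p
   sZ c d e (inZero κ) = U.refl
   sZ c d e (inBlock b κ) = U.cong (inBlock b) (U.trans (⊞ᶜ-assoc κ c d) (U.trans (U.cong (κ ⊞ᶜ_) e) (ij κ)))
   rei : G -> Permutation′ M
   rei g = permutation (\ i -> index (md g (partition i))) (\ i -> index (md (g ⁻¹) (partition i))) (\ i -> ib \ m -> U.trans (ic (md g (partition (index (md (g ⁻¹) (partition i))))) m) (U.trans (U.cong (shift (p1 g m)) (ic (md (g ⁻¹) (partition i)) (p2 g ⟨$⟩ˡ m))) (U.trans (U.cong (\ z -> shift (p1 g m) (shift (⊖ p1 g z) (π i z))) (inverseʳ (p2 g))) (sZ (⊖ p1 g m) (p1 g m) (ia _) (π i m))))) (\ i -> ib \ m -> U.trans (ic (md (g ⁻¹) (partition (index (md g (partition i))))) m) (U.trans (U.cong (shift (⊖ p1 g (p2 g ⟨$⟩ʳ m))) (U.trans (ic (md g (partition i)) (p2 g ⟨$⟩ʳ m)) (U.cong (\ z -> shift (p1 g (p2 g ⟨$⟩ʳ m)) (π i z)) (inverseˡ (p2 g))))) (sZ (p1 g (p2 g ⟨$⟩ʳ m)) (⊖ p1 g (p2 g ⟨$⟩ʳ m)) (ie _) (π i m))))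
   iC : ∀ D g u -> fun (identify D) (GM.act (To.A b1 cs q k D) g u) T.≈ᴹ Te.act g (fun (identify D) u)
   iC D g (u , h) = T.≈ᴹ-trans (T.∑ᴹ-permute (\ j -> F (π j) (actΩ g u) • ba j) (rei g)) (T.≈ᴹ-trans (T.∑ᴹ-cong \ i -> T.≈ᴹ-trans (T.*ₗ-congʳ (coefficient i)) (T.≈ᴹ-trans (T.*ₗ-assoc _ _ _) (T.*ₗ-congˡ (T.≈ᴹ-sym (d9 g (partition i)))))) (T.≈ᴹ-sym (fg (d8 g) (\ i -> F (π i) u) ba)))
    where
    w = p2 g
    wp : ∀ i -> ∏ (\ m -> factor (p1 g (w ⟨$⟩ʳ m)) (π i m)) K.≈ weight (p1 g) (permuteOP w (partition i))
    wp i = K.trans (∏-cong \ m -> K.reflexive (U.cong (\ z -> factor (p1 g (w ⟨$⟩ʳ m)) (π i z)) (U.sym (inverseˡ w)))) (K.trans (K.sym (∏-permute (\ m -> factor (p1 g m) (π i (w ⟨$⟩ˡ m))) w)) (K.reflexive (∏-unfold _)))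
    coefficient : ∀ i -> F (π (rei g ⟨$⟩ʳ i)) (actΩ g u) K.≈ F (π i) u K.* (weight (p1 g) (permuteOP w (partition i)) K.* determinant g)
    coefficient i = K.trans (Fs g (π i) (π (rei g ⟨$⟩ʳ i)) (\ m -> U.trans (ic (md g (partition i)) (w ⟨$⟩ʳ m)) (U.cong (\ z -> shift (p1 g (w ⟨$⟩ʳ m)) (π i z)) (inverseˡ w))) h) (K.trans (K.*-comm _ _) (K.*-congˡ (K.*-congʳ (wp i))))
   c8 : ∀ {m l} {X : GM m l} D -> (∀ j -> Fil D q (Du.df j)) -> Ba (To.space b1 cs q k D) M -> X ≃ To.A b1 cs q k D -> GM.aR X ≅ (K[OP k ] ⊗ det)
   c8 {X = X} D large B iso = record { to = fun f ; isIsomorphism = record { isLeftModuleMonomorphism = record { isLeftModuleHomomorphism = isH f ; injective = \ {u} {v} e -> X.za (X.≈ᴹ-trans (X.≈ᴹ-sym (bc _)) (X.≈ᴹ-trans (bb.⟦⟧-cong {fo.⟦ u X.− v ⟧} {A.0ᴹ} (iD D large B (fo.⟦ u X.− v ⟧) (T.≈ᴹ-trans (fv f u v) (T.mc e)))) bb.⟦⟧-0)) } ; surjective = \ z₁ -> bb.⟦ iz D large z₁ ⟧ , \ {u} e -> T.≈ᴹ-trans (f-cong f e) (T.≈ᴹ-trans (f-cong (identify D) {fo.⟦ bb.⟦ iz D large z₁ ⟧ ⟧} {iz D large z₁} (fc (iz D large z₁))) (i6 D large z₁)) }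
    ; equivariant = \ g u -> T.≈ᴹ-trans (f-cong (identify D) {fo.⟦ X.act g u ⟧} {A.act g fo.⟦ u ⟧} (fo.equivariant g u)) (iC D g fo.⟦ u ⟧) }
    where
    open _≃_ iso
    module X = Sd X
    module A = Sd (To.A b1 cs q k D)
    module fo = _⟶_ fo
    module bb = _⟶_ bb
    f : Li X.space Ta
    f = cq (identify D) fo.li
  module Fw (k q : O) (k+q : k Q.+ q ≡ n) where
   open Cou
   open Bnd using (N; Na; Nb; ins; ou)
   open Com q k (N n q k) (Na n q k) (Nb n q k)
   open Spa using (sx; sa)
   open S7 using (g4)
   open Ce q k k+q using (Sz)
   module J = Id k q k+q using (M; c8; cs; module Du; te; π)
   open Coi q k k+q using (cs; degree)
   open Rep using (_≃_; tg)
   open Ke using (Ba)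
   open Bas using (Fil; Fa)
   open Fl using (module To)
   spa : ∀ s cs D -> _
   spa s cs D = sx s cs q k k+q D
   b0 : ∀ s cs D -> _
   b0 s cs D = g4 s cs q k k+q D
   t1 : ∀ {A : Set} (f : A -> O) {a as} -> a ∈ as -> f a ≤ ta f as
   t1 f (here U.refl) = e9 _ _
   t1 f {as = b ∷ as} (there m) = e2 (t1 f m) (e0 _ (f b))
   dn : Fin J.M -> O
   dn j = p1 (degree (J.te (J.π j)))
   int : O
   int = ta (\ J -> sum (ins 0 J ++ ou k)) (ch n q)
   -- Large enough for all three: the spanning family, the number of partitions, and the dual elements.
   D : O
   D = sa b2 cs q k k+q Q.+ (int Q.+ ta dn (allFin J.M))
   bas : ∀ s cs j -> j ≤ k -> ∀ D -> Ba (To.space s cs q j D) (N n q k j D)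
   bas s cs = Bb.bas s cs (spa s cs) (b0 s cs)
   isomorphism = J.c8 D (\ j -> Fa (e2 (t1 dn (∈-allFin j)) (e2 (e0 _ int) (e0 _ (sa b2 cs q k k+q)))) (J.Du.dG j (p2 (degree (J.te (J.π j)))))) (U.subst (Ba (To.space b1 J.cs q k D)) (U.sym (Ar.nr k q D k+q (e2 (e9 _ _) (e0 _ (sa b2 cs q k k+q))))) (bas b1 J.cs k e3 D)) (tg (Sz (bas b2 cs k e3) D (e9 _ _)) (c2 b2 b1 cs J.cs (spa b2 cs) (b0 b2 cs) (spa b1 J.cs) (b0 b1 J.cs) k e3 D))
 module _ {c ℓ₁ ℓ₂} (K : HeytingField c ℓ₁ ℓ₂) where
  open HeytingField K
  private
   R = commutativeRing K
   module R = CommutativeRing R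
  open In R using (Inv; Ia)
  open RingProperties R.ring using (-0#≈0#)
  m1 : ∀ x -> x - 0# ≈ x
  m1 x = R.trans (R.+-congˡ -0#≈0#) (R.+-identityʳ x)
  Ii : ∀ {x y} -> x # y -> Inv (x - y)
  Ii p with u , _ , e <- #⇒invertible p = u , e
  Im : ∀ {x y} -> Inv (x - y) -> x # y
  Im (u , e) = invertible⇒# (u , R.trans (R.*-comm _ _) e , e)
  Ik : ∀ {x} -> x # 0# -> Inv x
  Ik p = Ia (m1 _) (Ii p)
  Iv : ∀ {a b} -> Inv (a + b) -> Inv a ⊎ Inv b
  Iv {a} {b} i with #-cotrans (Im (Ia (R.sym (m1 _)) i)) b
  ... | i1 p = i1 (Ia (R.trans (R.+-assoc a b _) (R.trans (R.+-congˡ (R.-‿inverseʳ b)) (R.+-identityʳ a))) (Ii p))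
  ... | i2 p = i2 (Ik p)
  Iw : ∀ {a} {A : Set a} -> Inv 0# -> A
  Iw i = ⊥-elim (#-irrefl R.refl (Im (Ia (R.sym (m1 0#)) i)))
 module Con {c ℓ₁ ℓ₂} (K : HeytingField c ℓ₁ ℓ₂) (characteristic : CharacteristicZero K) (n r k : O) .{{_ : NonZero r}} (k≤n : k ≤ n) (ζ : HeytingField.Carrier K) (root : IsPrimitiveRoot K r ζ) where
  private
   R = commutativeRing K
   module R = CommutativeRing R
  open In R using (Inv)
  open IsPrimitiveRoot root
  char0 : ∀ m -> Inv (RawMonoidDefinitions._×_ R.+-rawMonoid (Q.suc m) R.1#)
  char0 m = Ik K (characteristic m)
  apart : ∀ j -> 0 < j -> j < r -> Inv (Exp._^_ R.semiring ζ j R.- R.1#)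
  apart j l l' = Ii K (ζ^j#1 j l l')
  q : O
  q = n ∸ k
  k+q : k Q.+ q ≡ n
  k+q = Q.m+[n∸m]≡n k≤n
  hp : Se
  hp = record { c = c ; ℓ = ℓ₁ ; K = R ; local = Iv K ; nontrivial = Iw K ; char0 = char0 ; n = n ; r = r ; r-positive = Q.>-nonZero (Q.>-nonZero⁻¹ r) ; ζ = ζ ; rw = ζ^r≈1 ; apart = apart }
  isomorphism = Ps.Fw.isomorphism hp k q k+q

theorem4p24 :
    {c ℓ₁ ℓ₂ : Level} (K : HeytingField c ℓ₁ ℓ₂) → CharacteristicZero K →
    (n r k : ℕ) .{{_ : NonZero n}} .{{_ : NonZero r}} → k ≤ n →
    (ζ : HeytingField.Carrier K) → IsPrimitiveRoot K r ζ →
    let R = commutativeRing K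
        open Monomial R n r ζ
        open Superspace R n r ζ using (SR⟨*,_⟩)
        open OrderedSetPartitions R n r ζ using (K[OP_])
        open Actions (CommutativeRing.ring R) Monomial
    in SR⟨*, n ∸ k ⟩ ≅ (K[OP k ] ⊗ det)
theorem4p24 K characteristic n r k k≤n ζ root = Con.isomorphism K characteristic n r k k≤n ζ root
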